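{- Let $n\ge6$ be finite. Then the following hold: (1) The set of isomorphism types of finite algebras in $S\mathfrak{Nr}_3\mathsf{CA}_n$ having only infinite $n$-flat representations is not recursively enumerable. (2) The equational theory of $S\mathfrak{Nr}_3\mathsf{CA}_n$ is undecidable. (3) The equational theory of $S\mathfrak{Nr}_3(\mathsf{CA}_n\cap\mathsf{Fin})$ is undecidable, where $\mathsf{Fin}$ denotes the class of finite algebras. (4) The variety $S\mathfrak{Nr}_3\mathsf{CA}_n$ is not finitely axiomatizable even in $m$th order logic (for any finite $m$). (5) There exists a finite algebra in $S\mathfrak{Nr}_3\mathsf{CA}_n$ that does not have a finite $n$-dimensional hyperbasis.
   Context: $\mathsf{CA}_n$ is the class of cylindric algebras of dimension $n$. For $\mathfrak B\in\mathsf{CA}_n$, $\mathfrak{Nr}_3\mathfrak B$ has universe $\{b:c_ib=b\text{ for }3\le i<n\}$ and the operations with indices $<3$; $S$ is closure under isomorphic copies of subalgebras. Flat representations. Let $m=3$ and $\mathfrak A\in\mathsf{CA}_m$. A relativized representation of $\mathfrak A$ is a set $M$ with $V\subseteq{}^mM$, $M=\bigcup_{s\in V}\mathrm{rng}(s)$, and an injective homomorphism $f:\mathfrak A\to\wp(V)$ (Boolean operations relative to $V$, $c_iX=\{s\in V:\exists t\in X,\ t_j=s_j\ \forall j\ne i\}$, $d_{ij}=\{s\in V:s_i=s_j\}$); $M\models a(\bar s)$ means $\bar s\in f(a)$. A clique is $C\subseteq M$ with ${}^mC\subseteq V$; $C^n(M)$ is the set of $n$-tuples of $M$ whose range is a clique.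 $M$ is $n$-square if whenever $\bar x\in C^n(M)$, $a\in A$, $i<m$, $l:m\to n$, $k\in n\setminus\{l(j):j\ne i\}$ and $M\models c_ia(x_{l(0)},\dots,x_{l(m-1)})$, there is $\bar y\in C^n(M)$ agreeing with $\bar x$ off $k$ such that $M\models a(y_{l'(0)},\dots,y_{l'(m-1)})$, where $l'$ is $l$ changed so that $l'(i)=k$. $M$ is $n$-flat if it is $n$-square and for every first order formula $\phi$ with variables $x_0,\dots,x_{n-1}$ in the language with an $m$-ary relation symbol for each $a\in A$, all $\bar a\in C^n(M)$ and $i,j<n$, $M\models_C\exists x_i\exists x_j\phi(\bar a)$ iff $M\models_C\exists x_j\exists x_i\phi(\bar a)$, where $\models_C$ is clique-guarded satisfaction: defined for $\bar a\in C^n(M)$, as usual for atomic formulas and Boolean connectives, with $M\models_C\exists x_i\phi(\bar a)$ iff $M\models_C\phi(\bar b)$ for some $\bar b\in C^n(M)$ agreeing with $\bar a$ off $i$. Hyperbases. Let $\mathfrak A\in\mathsf{CA}_m$ be atomic and $\Lambda$ a nonempty set. An $n$-dimensional $\Lambda$-hypernetwork is a map $N:{}^{\le n}n\to\Lambda\cup\mathrm{At}\mathfrak A$ with $N(\bar x)\in\mathrm{At}\mathfrak A$ if $|\bar x|=m$, $N(\bar x)\in\Lambda$ otherwise, such that for $\delta\in{}^mn$, $i,j<m$, $d<n$: $N(\delta[i\to\delta_j])\le d_{ij}$, $N(\delta[i\to d])\le c_iN(\delta)$ (where $\delta[i\to d]$ is $\delta$ with $i$th entry replaced by $d$), and if $|\bar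 x|=|\bar y|$ and for every $i<|\bar x|$ there is $\bar z$ with $N(x_i,y_i,\bar z)\le d_{01}$, then $N(\bar x)=N(\bar y)$. For $S\subseteq n$, $M\equiv_SN$ means $M$ and $N$ agree on ${}^{\le n}(n\setminus S)$. An $n$-dimensional hyperbasis for $\mathfrak A$ is a set $H$ of $n$-dimensional $\Lambda$-hypernetworks (for some $\Lambda$) such that: every atom $a$ is $N(0,\dots,m-1)$ for some $N\in H$; whenever $N\in H$, $\bar x\in{}^mn$, $i<m$, $a$ is an atom with $N(\bar x)\le c_ia$ and $z\in n\setminus\{x_j:j\ne i\}$, there is $M\in H$ with $M\equiv_{\{z\}}N$ and $M(\bar x[i\to z])=a$; and whenever $M,N\in H$, $x,y<n$, $M\equiv_{\{x,y\}}N$, there is $L\in H$ with $M\equiv_{\{x\}}L\equiv_{\{y\}}N$. It is finite if $H$ is a finite set. -}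

module Defs where

open import Level using (Level; 0ℓ; _⊔_) renaming (suc to lsuc)
open import Data.Bool using (Bool; true)
open import Data.Empty using (⊥-elim)
open import Data.Fin using (Fin; zero; suc; toℕ; inject≤)
import Data.Fin.Properties as Fin
open import Data.List using (List; []; _∷_)
open import Data.List.Membership.Propositional using (_∈_)
open import Data.List.Relation.Unary.All using (All; []; _∷_)
import Data.List.Relation.Unary.All as All
open import Data.List.Relation.Unary.Any using (Any)
open import Data.Nat as ℕ using (ℕ; zero; suc; _+_; _≤_; _<_)
import Data.Nat.Properties as ℕ
open import Data.Product using (Σ; Σ-syntax; ∃; ∃-syntax; _×_; _,_; proj₁; proj₂)
open import Data.Product.Relation.Binary.Pointwise.NonDependent using (_×ₛ_)
open import Data.Sum using (inj₁; inj₂; [_,_]′)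
import Data.Sum as Sum
open import Data.Unit using (tt) renaming (⊤ to Unit)
open import Data.Vec using (Vec; []; _∷_; lookup; map; tabulate; concat; toList; _[_]≔_)
import Data.Vec.Membership.Propositional as Vec
import Data.Vec.Relation.Unary.All as Vec
open import Function using (_∘_)
open import Function.Bundles using (Func; _⟨$⟩_; Inverse; _⇔_)
open import Function.Relation.Binary.Setoid.Equality using (_⇨_)
open import Relation.Binary.Bundles using (Setoid)
open import Relation.Binary.Structures using (IsEquivalence)
open import Relation.Binary.PropositionalEquality as ≡ using (_≡_; _≢_)
import Relation.Binary.Reasoning.Setoid as SetoidReasoning
open import Relation.Nullary using (¬_)
open import Relation.Unary using (Pred; _⊆_; _≐_; _∪_; _∩_; ∁; ∅; ｛_｝) renaming (_∈_ to _∈ᵤ_; _∉_ to _∉ᵤ_)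
open import Algebra.Lattice.Bundles using (BooleanAlgebra)
open import Algebra.Lattice.Structures using (IsBooleanAlgebra)
import Algebra.Lattice.Properties.BooleanAlgebra as BAProperties

Finite : {c ℓ : Level} → Setoid c ℓ → Set (c ⊔ ℓ)
Finite S = ∃[ k ] Inverse S (≡.setoid (Fin k))

-- Only the similarity type of n-dimensional cylindric algebras.
record Alg (n : ℕ) (c ℓ : Level) : Set (lsuc (c ⊔ ℓ)) where
  infix  4 _≈_ _⊑_
  infixr 7 _∧_
  infixr 6 _∨_
  infix  8 ∼_
  field
    Carrier       : Set c
    _≈_           : Carrier → Carrier → Set ℓ
    isEquivalence : IsEquivalence _≈_
    _∨_ _∧_       : Carrier → Carrier → Carrier
    ∼_            : Carrier → Carrier
    ⊤ ⊥           : Carrier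
    cyl           : Fin n → Carrier → Carrier
    diag          : Fin n → Fin n → Carrier
    ∨-cong        : ∀ {x x′ y y′} → x ≈ x′ → y ≈ y′ → x ∨ y ≈ x′ ∨ y′
    ∧-cong        : ∀ {x x′ y y′} → x ≈ x′ → y ≈ y′ → x ∧ y ≈ x′ ∧ y′
    ∼-cong        : ∀ {x x′} → x ≈ x′ → ∼ x ≈ ∼ x′
    cyl-cong      : ∀ i {x x′} → x ≈ x′ → cyl i x ≈ cyl i x′

  setoid : Setoid c ℓ
  setoid = record { isEquivalence = isEquivalence }

  open IsEquivalence isEquivalence public

  _⊑_ : Carrier → Carrier → Set ℓ
  x ⊑ y = x ∧ y ≈ x

  record IsAtom (a : Carrier) : Set (c ⊔ ℓ) where
    field
      nonzero : ¬ (a ≈ ⊥)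
      minimal : ∀ x → x ⊑ a → ¬ (x ≈ ⊥) → x ≈ a

FiniteAlg : {n : ℕ} {c ℓ : Level} → Alg n c ℓ → Set (c ⊔ ℓ)
FiniteAlg A = Finite (Alg.setoid A)

record IsCA {n : ℕ} {c ℓ : Level} (A : Alg n c ℓ) : Set (c ⊔ ℓ) where
  open Alg A
  field
    isBooleanAlgebra : IsBooleanAlgebra _≈_ _∨_ _∧_ ∼_ ⊤ ⊥
    cyl-⊥    : ∀ i → cyl i ⊥ ≈ ⊥
    cyl-⊑    : ∀ i x → x ⊑ cyl i x
    cyl-∧    : ∀ i x y → cyl i (x ∧ cyl i y) ≈ cyl i x ∧ cyl i y
    cyl-comm : ∀ i j x → cyl i (cyl j x) ≈ cyl j (cyl i x)
    diag-⊤   : ∀ i → diag i i ≈ ⊤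
    diag-cyl : ∀ i j k → k ≢ i → k ≢ j → diag i j ≈ cyl k (diag i k ∧ diag k j)
    diag-sub : ∀ i j x → i ≢ j → cyl i (diag i j ∧ x) ∧ cyl i (diag i j ∧ ∼ x) ≈ ⊥

record CA (n : ℕ) (c ℓ : Level) : Set (lsuc (c ⊔ ℓ)) where
  field
    alg  : Alg n c ℓ
    isCA : IsCA alg

record Embedding {n : ℕ} {a ℓa b ℓb : Level} (A : Alg n a ℓa) (B : Alg n b ℓb)
                 : Set (a ⊔ ℓa ⊔ b ⊔ ℓb) where
  private
    module A = Alg A
    module B = Alg B
  field
    to        : A.Carrier → B.Carrier
    cong      : ∀ {x y} → x A.≈ y → to x B.≈ to y
    injective : ∀ {x y} → to x B.≈ to y → x A.≈ y
    ∨-homo    : ∀ x y → to (x A.∨ y) B.≈ (to x B.∨ to y)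
    ∧-homo    : ∀ x y → to (x A.∧ y) B.≈ (to x B.∧ to y)
    ∼-homo    : ∀ x → to (A.∼ x) B.≈ (B.∼ to x)
    ⊤-homo    : to A.⊤ B.≈ B.⊤
    ⊥-homo    : to A.⊥ B.≈ B.⊥
    cyl-homo  : ∀ i x → to (A.cyl i x) B.≈ B.cyl i (to x)
    diag-homo : ∀ i j → to (A.diag i j) B.≈ B.diag i j

_≅_ : {n : ℕ} {a ℓa b ℓb : Level} → Alg n a ℓa → Alg n b ℓb → Set (a ⊔ ℓa ⊔ b ⊔ ℓb)
A ≅ B = Σ[ e ∈ Embedding A B ] ∀ y → ∃[ x ] Alg._≈_ B (Embedding.to e x) y

module _ {m n : ℕ} {c ℓ : Level} .(m≤n : m ≤ n) (B : CA n c ℓ) where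
  open CA B
  open Alg alg
  open IsCA isCA
  private
    booleanAlgebra : BooleanAlgebra c ℓ
    booleanAlgebra = record { isBooleanAlgebra = isBooleanAlgebra }
    open BAProperties booleanAlgebra
      using (∧-identityˡ; ∧-zeroʳ; ∧-zeroˡ; deMorgan₂; ¬-involutive; ∨-identityʳ)
    module BA = BooleanAlgebra booleanAlgebra
    open SetoidReasoning setoid

  Neat : Carrier → Set ℓ
  Neat b = ∀ (i : Fin n) → m ≤ toℕ i → cyl i b ≈ b

  private
    cyl-⊤ : ∀ i → cyl i ⊤ ≈ ⊤
    cyl-⊤ i = trans (sym (∧-identityˡ _)) (cyl-⊑ i ⊤)

    cyl-idem : ∀ i x → cyl i (cyl i x) ≈ cyl i x
    cyl-idem i x = begin
      cyl i (cyl i x)        ≈⟨ cyl-cong i (∧-identityˡ _) ⟨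
      cyl i (⊤ ∧ cyl i x)    ≈⟨ cyl-∧ i ⊤ x ⟩
      cyl i ⊤ ∧ cyl i x      ≈⟨ ∧-cong (cyl-⊤ i) refl ⟩
      ⊤ ∧ cyl i x            ≈⟨ ∧-identityˡ _ ⟩
      cyl i x                ∎

    fix-∧ : ∀ i {x y} → cyl i x ≈ x → cyl i y ≈ y → cyl i (x ∧ y) ≈ x ∧ y
    fix-∧ i {x} {y} p q = begin
      cyl i (x ∧ y)          ≈⟨ cyl-cong i (∧-cong refl q) ⟨
      cyl i (x ∧ cyl i y)    ≈⟨ cyl-∧ i x y ⟩
      cyl i x ∧ cyl i y      ≈⟨ ∧-cong p q ⟩
      x ∧ y                  ∎

    fix-∼ : ∀ i {x} → cyl i x ≈ x → cyl i (∼ x) ≈ ∼ x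
    fix-∼ i {x} p = begin
      cyl i (∼ x)                              ≈⟨ BA.trans (BA.∧-comm _ _) (∧-identityˡ _) ⟨
      cyl i (∼ x) ∧ ⊤                          ≈⟨ ∧-cong refl (BA.∨-complementʳ x) ⟨
      cyl i (∼ x) ∧ (x ∨ ∼ x)                  ≈⟨ BA.∧-distribˡ-∨ _ _ _ ⟩
      (cyl i (∼ x) ∧ x) ∨ (cyl i (∼ x) ∧ ∼ x)  ≈⟨ ∨-cong disjoint (trans (BA.∧-comm _ _) (cyl-⊑ i (∼ x))) ⟩
      ⊥ ∨ ∼ x                                  ≈⟨ trans (BA.∨-comm _ _) (∨-identityʳ _) ⟩
      ∼ x                                      ∎
      where
      disjoint : cyl i (∼ x) ∧ x ≈ ⊥
      disjoint = begin
        cyl i (∼ x) ∧ x        ≈⟨ ∧-cong refl p ⟨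
        cyl i (∼ x) ∧ cyl i x  ≈⟨ cyl-∧ i (∼ x) x ⟨
        cyl i (∼ x ∧ cyl i x)  ≈⟨ cyl-cong i (∧-cong refl p) ⟩
        cyl i (∼ x ∧ x)        ≈⟨ cyl-cong i (BA.∧-complementˡ x) ⟩
        cyl i ⊥                ≈⟨ cyl-⊥ i ⟩
        ⊥                      ∎

    fix-∨ : ∀ i {x y} → cyl i x ≈ x → cyl i y ≈ y → cyl i (x ∨ y) ≈ x ∨ y
    fix-∨ i {x} {y} p q = begin
      cyl i (x ∨ y)            ≈⟨ cyl-cong i eq ⟩
      cyl i (∼ (∼ x ∧ ∼ y))    ≈⟨ fix-∼ i (fix-∧ i (fix-∼ i p) (fix-∼ i q)) ⟩
      ∼ (∼ x ∧ ∼ y)            ≈⟨ eq ⟨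
      x ∨ y                    ∎
      where
      eq : x ∨ y ≈ ∼ (∼ x ∧ ∼ y)
      eq = trans (sym (¬-involutive _)) (∼-cong (deMorgan₂ x y))

    fix-diag : ∀ k i j → k ≢ i → k ≢ j → cyl k (diag i j) ≈ diag i j
    fix-diag k i j p q = begin
      cyl k (diag i j)                      ≈⟨ cyl-cong k (diag-cyl i j k p q) ⟩
      cyl k (cyl k (diag i k ∧ diag k j))   ≈⟨ cyl-idem k _ ⟩
      cyl k (diag i k ∧ diag k j)           ≈⟨ diag-cyl i j k p q ⟨
      diag i j                              ∎

    outside : ∀ (k : Fin n) (i : Fin m) → m ≤ toℕ k → k ≢ inject≤ i m≤n
    outside k i m≤k ≡.refl =
      ℕ.<⇒≱ (Fin.toℕ<n i) (≡.subst (m ≤_) (Fin.toℕ-inject≤ i m≤n) m≤k)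

  Nr : Alg m (c ⊔ ℓ) ℓ
  Nr = record
    { Carrier       = Σ Carrier Neat
    ; _≈_           = λ x y → proj₁ x ≈ proj₁ y
    ; isEquivalence = record { refl = refl ; sym = sym ; trans = trans }
    ; _∨_           = λ (x , p) (y , q) → x ∨ y , λ i h → fix-∨ i (p i h) (q i h)
    ; _∧_           = λ (x , p) (y , q) → x ∧ y , λ i h → fix-∧ i (p i h) (q i h)
    ; ∼_            = λ (x , p) → ∼ x , λ i h → fix-∼ i (p i h)
    ; ⊤             = ⊤ , λ i _ → cyl-⊤ i
    ; ⊥             = ⊥ , λ i _ → cyl-⊥ i
    ; cyl           = λ j (x , p) → cyl (inject≤ j m≤n) x ,
                        λ i h → trans (cyl-comm i _ x) (cyl-cong _ (p i h))
    ; diag          = λ j k → diag (inject≤ j m≤n) (inject≤ k m≤n) ,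
                        λ i h → fix-diag i _ _ (outside i j h) (outside i k h)
    ; ∨-cong        = ∨-cong
    ; ∧-cong        = ∧-cong
    ; ∼-cong        = ∼-cong
    ; cyl-cong      = λ i → cyl-cong (inject≤ i m≤n)
    }

-- Being isomorphic to a subalgebra is admitting an embedding.
SNr : {m n : ℕ} → .(m ≤ n) → Pred (CA n 0ℓ 0ℓ) (lsuc 0ℓ) → Pred (Alg m 0ℓ 0ℓ) (lsuc 0ℓ)
SNr m≤n K A = ∃[ B ] (K B × Embedding A (Nr m≤n B))

AllCA : (n : ℕ) → Pred (CA n 0ℓ 0ℓ) (lsuc 0ℓ)
AllCA n B = Level.Lift (lsuc 0ℓ) Unit

FiniteCA : (n : ℕ) → Pred (CA n 0ℓ 0ℓ) (lsuc 0ℓ)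
FiniteCA n B = Level.Lift (lsuc 0ℓ) (FiniteAlg (CA.alg B))

-- Tuples are vectors rather than functions so that, without function
-- extensionality, a set of tuples cannot separate pointwise equal ones.
module _ {M : Set} {m : ℕ} (V : Pred (Vec M m) 0ℓ) where

  private
    _≡[_]_ : Vec M m → Fin m → Vec M m → Set
    s ≡[ i ] t = ∀ j → j ≢ i → lookup t j ≡ lookup s j

  ℘ : Alg m (lsuc 0ℓ) 0ℓ
  ℘ = record
    { Carrier       = Σ[ X ∈ Pred (Vec M m) 0ℓ ] (X ⊆ V)
    ; _≈_           = λ X Y → proj₁ X ≐ proj₁ Y
    ; isEquivalence = record
        { refl  = (λ x → x) , (λ x → x)
        ; sym   = λ (p , q) → q , p
        ; trans = λ (p , q) (p′ , q′) → (λ x → p′ (p x)) , (λ x → q (q′ x)) }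
    ; _∨_           = λ (X , p) (Y , q) → (X ∪ Y) , [ p , q ]′
    ; _∧_           = λ (X , p) (Y , q) → (X ∩ Y) , (λ (x , _) → p x)
    ; ∼_            = λ (X , _) → (V ∩ ∁ X) , proj₁
    ; ⊤             = V , (λ v → v)
    ; ⊥             = ∅ , ⊥-elim
    ; cyl           = λ i (X , _) → (λ s → V s × ∃[ t ] (X t × s ≡[ i ] t)) , proj₁
    ; diag          = λ i j → (λ s → V s × lookup s i ≡ lookup s j) , proj₁
    ; ∨-cong        = λ (p , q) (p′ , q′) → Sum.map p p′ , Sum.map q q′
    ; ∧-cong        = λ (p , q) (p′ , q′) →
                        (λ (x , y) → p x , p′ y) , (λ (x , y) → q x , q′ y)
    ; ∼-cong        = λ (p , q) → (λ (v , x) → v , x ∘ q) , (λ (v , x) → v , x ∘ p)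
    ; cyl-cong      = λ i (p , q) → (λ (v , t , x , e) → v , t , p x , e) ,
                                    (λ (v , t , x , e) → v , t , q x , e)
    }

record RelRep {m : ℕ} (A : Alg m 0ℓ 0ℓ) : Set₁ where
  field
    M     : Set
    V     : Pred (Vec M m) 0ℓ
    cover : ∀ x → ∃[ s ] (V s × x Vec.∈ s)
    rep   : Embedding A (℘ V)

  infix 4 _⊨_
  _⊨_ : Vec M m → Alg.Carrier A → Set
  s ⊨ a = proj₁ (Embedding.to rep a) s

  Clique : Pred M 0ℓ → Set
  Clique C = ∀ (s : Vec M m) → Vec.All C s → V s

  CliqueTuple : {n : ℕ} → Pred (Vec M n) 0ℓ
  CliqueTuple x = Clique (Vec._∈ x)

  AgreeOff : {n : ℕ} → Fin n → Vec M n → Vec M n → Set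
  AgreeOff k x y = ∀ j → j ≢ k → lookup y j ≡ lookup x j

  Square : ℕ → Set
  Square n =
    ∀ (x : Vec M n) → CliqueTuple x →
    ∀ (a : Alg.Carrier A) (i : Fin m) (l : Vec (Fin n) m) (k : Fin n) →
    (∀ j → j ≢ i → k ≢ lookup l j) →
    map (lookup x) l ⊨ Alg.cyl A i a →
    ∃[ y ] (CliqueTuple y × AgreeOff k x y × map (lookup y) (l [ i ]≔ k) ⊨ a)

-- First order formulas with variables x₀,…,xₙ₋₁ over an m-ary relation
-- symbol for each element of C.
data FO (C : Set) (m n : ℕ) : Set where
  rel  : C → Vec (Fin n) m → FO C m n
  eq   : Fin n → Fin n → FO C m n
  neg  : FO C m n → FO C m n
  conj : FO C m n → FO C m n → FO C m n
  ex   : Fin n → FO C m n → FO C m n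

module _ {m : ℕ} {A : Alg m 0ℓ 0ℓ} (R : RelRep A) where
  open RelRep R

  -- Clique-guarded satisfaction; meaningful at clique tuples.
  CliqueSat : {n : ℕ} → FO (Alg.Carrier A) m n → Vec M n → Set
  CliqueSat (rel a l)  x = map (lookup x) l ⊨ a
  CliqueSat (eq i j)   x = lookup x i ≡ lookup x j
  CliqueSat (neg φ)    x = ¬ CliqueSat φ x
  CliqueSat (conj φ ψ) x = CliqueSat φ x × CliqueSat ψ x
  CliqueSat (ex i φ)   x = ∃[ y ] (CliqueTuple y × AgreeOff i x y × CliqueSat φ y)

  Flat : ℕ → Set
  Flat n = Square n ×
    (∀ (φ : FO (Alg.Carrier A) m n) (x : Vec M n) → CliqueTuple x → ∀ i j →
       CliqueSat (ex i (ex j φ)) x ⇔ CliqueSat (ex j (ex i φ)) x)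

OnlyInfiniteFlatReps : ℕ → {m : ℕ} → Alg m 0ℓ 0ℓ → Set₁
OnlyInfiniteFlatReps n A =
  ∀ (R : RelRep A) → Flat R n → ¬ Finite (≡.setoid (RelRep.M R))

-- The dimension is m = 2 + k, so that the tuples (xᵢ, yᵢ, z̄) below have
-- length m for z̄ of length k.
module _ {k : ℕ} (A : Alg (2 + k) 0ℓ 0ℓ) (n : ℕ) where
  open Alg A
  private
    m = 2 + k

  -- A map on tuples of length ≤ n with values in At 𝔄 at length m and in Λ
  -- at every other length, given as its two restrictions.
  record Hypernetwork (Λ : Set) : Set where
    field
      atom   : Vec (Fin n) m → Carrier
      isAtom : ∀ x → IsAtom (atom x)
      label  : ∀ {h} → .(h ≤ n) → .(h ≢ m) → Vec (Fin n) h → Λ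

    Identified : ∀ {h} → Vec (Fin n) h → Vec (Fin n) h → Set
    Identified x y =
      ∀ i → ∃[ z ] (atom (lookup x i ∷ lookup y i ∷ z) ⊑ diag zero (suc zero))

    field
      atom-diag  : ∀ δ i j → atom (δ [ i ]≔ lookup δ j) ⊑ diag i j
      atom-cyl   : ∀ δ i d → atom (δ [ i ]≔ d) ⊑ cyl i (atom δ)
      atom-resp  : ∀ x y → Identified x y → atom x ≈ atom y
      label-resp : ∀ {h} .(p : h ≤ n) .(q : h ≢ m) (x y : Vec (Fin n) h) →
                   Identified x y → label p q x ≡ label p q y

  module _ {Λ : Set} where

    Agree : Pred (Fin n) 0ℓ → Hypernetwork Λ → Hypernetwork Λ → Set
    Agree S M N =
      (∀ x → Vec.All (_∉ᵤ S) x → M.atom x ≈ N.atom x) ×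
      (∀ {h} .(p : h ≤ n) .(q : h ≢ m) (x : Vec (Fin n) h) → Vec.All (_∉ᵤ S) x →
         M.label p q x ≡ N.label p q x)
      where
      module M = Hypernetwork M
      module N = Hypernetwork N

    record IsHyperbasis .(m≤n : m ≤ n) (H : Pred (Hypernetwork Λ) 0ℓ) : Set where
      open Hypernetwork
      field
        atoms     : ∀ a → IsAtom a →
                    ∃[ N ] (H N × atom N (tabulate (λ i → inject≤ i m≤n)) ≈ a)
        cylinders : ∀ N → H N → ∀ (x : Vec (Fin n) m) i a → IsAtom a →
                    atom N x ⊑ cyl i a →
                    ∀ z → (∀ j → j ≢ i → z ≢ lookup x j) →
                    ∃[ M ] (H M × Agree ｛ z ｝ M N × atom M (x [ i ]≔ z) ≈ a)
        amalgam   : ∀ M N → H M → H N → ∀ x y → Agree (｛ x ｝ ∪ ｛ y ｝) M N →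
                    ∃[ L ] (H L × Agree ｛ x ｝ M L × Agree ｛ y ｝ L N)

    -- Hypernetworks are counted up to extensional equality of maps.
    FiniteSet : Pred (Hypernetwork Λ) 0ℓ → Set
    FiniteSet H = Σ[ Ns ∈ List (Hypernetwork Λ) ] (∀ N → H N → Any (Agree ∅ N) Ns)

  HasFiniteHyperbasis : .(m ≤ n) → Set₁
  HasFiniteHyperbasis m≤n =
    Σ[ Λ ∈ Set ] Σ[ H ∈ Pred (Hypernetwork Λ) 0ℓ ] (Λ × IsHyperbasis m≤n H × FiniteSet H)

data PR : ℕ → Set where
  zer  : PR 0
  succ : PR 1
  proj : ∀ {k} → Fin k → PR k
  comp : ∀ {j k} → PR j → Vec (PR k) j → PR k
  prec : ∀ {k} → PR k → PR (2 + k) → PR (1 + k)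
  mu   : ∀ {k} → PR (1 + k) → PR k

mutual
  data _[_]⇓_ : ∀ {k} → PR k → Vec ℕ k → ℕ → Set where
    zer⇓   : zer [ [] ]⇓ 0
    succ⇓  : ∀ {x} → succ [ x ∷ [] ]⇓ suc x
    proj⇓  : ∀ {k} {i : Fin k} {xs} → proj i [ xs ]⇓ lookup xs i
    comp⇓  : ∀ {j k} {f : PR j} {gs : Vec (PR k) j} {xs ys y} →
             gs [ xs ]⇓* ys → f [ ys ]⇓ y → comp f gs [ xs ]⇓ y
    prec0⇓ : ∀ {k} {f : PR k} {g xs y} → f [ xs ]⇓ y → prec f g [ 0 ∷ xs ]⇓ y
    precs⇓ : ∀ {k} {f : PR k} {g xs x r y} →
             prec f g [ x ∷ xs ]⇓ r → g [ x ∷ r ∷ xs ]⇓ y → prec f g [ suc x ∷ xs ]⇓ y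
    mu⇓    : ∀ {k} {f : PR (1 + k)} {xs y} →
             f [ y ∷ xs ]⇓ 0 → (∀ z → z < y → ∃[ v ] (f [ z ∷ xs ]⇓ suc v)) →
             mu f [ xs ]⇓ y

  data _[_]⇓*_ {k : ℕ} : ∀ {j} → Vec (PR k) j → Vec ℕ k → Vec ℕ j → Set where
    []  : ∀ {xs} → [] [ xs ]⇓* []
    _∷_ : ∀ {j} {g : PR k} {gs : Vec (PR k) j} {xs y ys} →
          g [ xs ]⇓ y → gs [ xs ]⇓* ys → (g ∷ gs) [ xs ]⇓* (y ∷ ys)

Halts : PR 1 → ℕ → Set
Halts f x = ∃[ y ] (f [ x ∷ [] ]⇓ y)

triangle : ℕ → ℕ
triangle zero    = 0
triangle (suc k) = suc k + triangle k

⟪_,_⟫ : ℕ → ℕ → ℕ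
⟪ x , y ⟫ = triangle (x + y) + y

codeList : List ℕ → ℕ
codeList []       = 0
codeList (x ∷ xs) = suc ⟪ x , codeList xs ⟫

-- Decidability and enumerability of sets of codable objects; nothing is
-- required of the program on numbers that are not codes.
DecidableBy : {X : Set} {ℓ : Level} → (X → ℕ) → Pred X ℓ → Set ℓ
DecidableBy code P =
  ∃[ f ] (∀ x → (P x → f [ code x ∷ [] ]⇓ 1) × (¬ P x → f [ code x ∷ [] ]⇓ 0))

data Term (n : ℕ) (X : Set) : Set where
  var       : X → Term n X
  _∨_ _∧_   : Term n X → Term n X → Term n X
  ∼_        : Term n X → Term n X
  ⊤ ⊥       : Term n X
  cyl       : Fin n → Term n X → Term n X
  diag      : Fin n → Fin n → Term n X

module _ {n : ℕ} {c ℓ : Level} (A : Alg n c ℓ) where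
  private
    module A = Alg A

  eval : {X : Set} → (X → A.Carrier) → Term n X → A.Carrier
  eval ρ (var x)    = ρ x
  eval ρ (s ∨ t)    = eval ρ s A.∨ eval ρ t
  eval ρ (s ∧ t)    = eval ρ s A.∧ eval ρ t
  eval ρ (∼ t)      = A.∼ eval ρ t
  eval ρ ⊤          = A.⊤
  eval ρ ⊥          = A.⊥
  eval ρ (cyl i t)  = A.cyl i (eval ρ t)
  eval ρ (diag i j) = A.diag i j

Equation : ℕ → Set
Equation n = Term n ℕ × Term n ℕ

EqTheory : {n : ℕ} → Pred (Alg n 0ℓ 0ℓ) (lsuc 0ℓ) → Pred (Equation n) (lsuc 0ℓ)
EqTheory K (s , t) = ∀ A → K A → ∀ ρ → Alg._≈_ A (eval A ρ s) (eval A ρ t)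

codeTerm : {n : ℕ} → Term n ℕ → ℕ
codeTerm (var x)    = ⟪ 0 , x ⟫
codeTerm (s ∨ t)    = ⟪ 1 , ⟪ codeTerm s , codeTerm t ⟫ ⟫
codeTerm (s ∧ t)    = ⟪ 2 , ⟪ codeTerm s , codeTerm t ⟫ ⟫
codeTerm (∼ t)      = ⟪ 3 , codeTerm t ⟫
codeTerm ⊤          = ⟪ 4 , 0 ⟫
codeTerm ⊥          = ⟪ 5 , 0 ⟫
codeTerm (cyl i t)  = ⟪ 6 , ⟪ toℕ i , codeTerm t ⟫ ⟫
codeTerm (diag i j) = ⟪ 7 , ⟪ toℕ i , toℕ j ⟫ ⟫

codeEquation : {n : ℕ} → Equation n → ℕ
codeEquation (s , t) = ⟪ codeTerm s , codeTerm t ⟫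

DecidableEqTheory : {n : ℕ} → Pred (Alg n 0ℓ 0ℓ) (lsuc 0ℓ) → Set₁
DecidableEqTheory K = DecidableBy codeEquation (EqTheory K)

record Table (n : ℕ) : Set where
  field
    size           : ℕ
    joinT meetT    : Vec (Vec (Fin size) size) size
    complT         : Vec (Fin size) size
    topT botT      : Fin size
    cylT           : Vec (Vec (Fin size) size) n
    diagT          : Vec (Vec (Fin size) n) n

  code : ℕ
  code = codeList (size ∷ codes (concat joinT) ∷ codes (concat meetT) ∷ codes complT ∷
                   toℕ topT ∷ toℕ botT ∷ codes (concat cylT) ∷ codes (concat diagT) ∷ [])
    where
    codes : ∀ {h} → Vec (Fin size) h → ℕ
    codes xs = codeList (toList (map toℕ xs))

  alg : Alg n 0ℓ 0ℓ
  alg = record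
    { Carrier       = Fin size
    ; _≈_           = _≡_
    ; isEquivalence = ≡.isEquivalence
    ; _∨_           = λ x y → lookup (lookup joinT x) y
    ; _∧_           = λ x y → lookup (lookup meetT x) y
    ; ∼_            = lookup complT
    ; ⊤             = topT
    ; ⊥             = botT
    ; cyl           = λ i → lookup (lookup cylT i)
    ; diag          = λ i j → lookup (lookup diagT i) j
    ; ∨-cong        = ≡.cong₂ _
    ; ∧-cong        = ≡.cong₂ _
    ; ∼-cong        = ≡.cong _
    ; cyl-cong      = λ i → ≡.cong _
    }

-- The isomorphism types of the algebras in K are those of the algebras in
-- some recursively enumerable set of tables.  Recursively enumerable sets
-- are taken as domains of partial recursive functions.
REIsoTypes : {n : ℕ} → Pred (Alg n 0ℓ 0ℓ) (lsuc 0ℓ) → Set₁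
REIsoTypes K = Σ[ f ∈ PR 1 ]
  (∀ T → Halts f (Table.code T) → K (Table.alg T)) ×
  (∀ A → K A → ∃[ T ] (Halts f (Table.code T) × A ≅ Table.alg T))

-- rel ts is the type of relations between objects of the types ts.
data Ty : Set where
  ind : Ty
  rel : List Ty → Ty

mutual
  -- Individuals have order 1, relations between individuals order 2, etc.
  order : Ty → ℕ
  order ind      = 1
  order (rel ts) = suc (maxOrder ts)

  maxOrder : List Ty → ℕ
  maxOrder []       = 1
  maxOrder (t ∷ ts) = order t ℕ.⊔ maxOrder ts

data Arg (n : ℕ) (Γ : List Ty) : Ty → Set where
  ind : Term n (ind ∈ Γ) → Arg n Γ ind
  rel : ∀ {ts} → rel ts ∈ Γ → Arg n Γ (rel ts)

-- All quantified variables have types of order at most r; ∀ and the other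
-- connectives are recovered classically.
data HO (n r : ℕ) (Γ : List Ty) : Set where
  eq   : Term n (ind ∈ Γ) → Term n (ind ∈ Γ) → HO n r Γ
  app  : ∀ {ts} → rel ts ∈ Γ → All (Arg n Γ) ts → HO n r Γ
  neg  : HO n r Γ → HO n r Γ
  conj : HO n r Γ → HO n r Γ → HO n r Γ
  ex   : (t : Ty) → order t ≤ r → HO n r (t ∷ Γ) → HO n r Γ

Sentence : ℕ → ℕ → Set
Sentence n r = HO n r []

module _ {n : ℕ} (A : Alg n 0ℓ 0ℓ) where
  private
    module A = Alg A

  mutual
    -- Relations are characteristic functions that respect the equality of
    -- their arguments; by excluded middle these are all the relations.
    Dom : Ty → Setoid 0ℓ 0ℓ
    Dom ind      = A.setoid
    Dom (rel ts) = Doms ts ⇨ ≡.setoid Bool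

    Doms : List Ty → Setoid 0ℓ 0ℓ
    Doms []       = ≡.setoid Unit
    Doms (t ∷ ts) = Dom t ×ₛ Doms ts

  Env : List Ty → Set
  Env = All (λ t → Setoid.Carrier (Dom t))

  evalArg : ∀ {Γ t} → Env Γ → Arg n Γ t → Setoid.Carrier (Dom t)
  evalArg ρ (ind s) = eval A (All.lookup ρ) s
  evalArg ρ (rel x) = All.lookup ρ x

  evalArgs : ∀ {Γ ts} → Env Γ → All (Arg n Γ) ts → Setoid.Carrier (Doms ts)
  evalArgs ρ []       = tt
  evalArgs ρ (a ∷ as) = evalArg ρ a , evalArgs ρ as

  Sat : ∀ {r Γ} → Env Γ → HO n r Γ → Set
  Sat ρ (eq s t)   = eval A (All.lookup ρ) s A.≈ eval A (All.lookup ρ) t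
  Sat ρ (app x as) = All.lookup ρ x ⟨$⟩ evalArgs ρ as ≡ true
  Sat ρ (neg φ)    = ¬ Sat ρ φ
  Sat ρ (conj φ ψ) = Sat ρ φ × Sat ρ ψ
  Sat ρ (ex t _ φ) = Σ[ d ∈ Setoid.Carrier (Dom t) ] Sat (d ∷ ρ) φ

FinitelyAxiomatizable : {n : ℕ} → ℕ → Pred (Alg n 0ℓ 0ℓ) (lsuc 0ℓ) → Set₁
FinitelyAxiomatizable {n} r K =
  Σ[ Φ ∈ List (Sentence n r) ] (∀ A → K A ⇔ All (Sat A []) Φ)

module Submission where

-- A finite algebra is attached to a program, that is to a counter machine, so
-- that the behaviour of the program decides which representations the algebra
-- has. The theorem then follows by letting programs work on their own codes.
--
-- From programs to algebras. A computation is a tiling of the quarter plane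
-- whose rows are the configurations of the machine. An atom of the algebra is
-- a consistent triple of labels of the edges of a triangle; the vertices are
-- worlds and points. A label of two points says, for instance, that
-- the second is the successor of the first, comes later in its chain, or is in
-- another chain and carries the tile t with it. Two chains of points, seen from a common world,
-- span the quarter plane. The label of a world and a point is a colour; colour
-- zero, called green, means that the world contains the point, and every other
-- colour restricts the labels between the point and the points of the world.
--
-- No representation. The labels are relations that satisfy finitely many laws
-- (System). Six coordinates suffice to follow the two chains step by step in a
-- cylindric algebra: the world, the two origins and the two current points
-- leave one coordinate for the next point. So every place of the plane carries
-- a tile (Extraction, Occurrence), and the laws force this tile to be the one
-- of the computation (Determined). Hence there is no system of relations for a
-- rejecting program. For a program that never stops, a finite algebra has no
-- system either: two columns would carry the same tiles, whereas a register
-- that counts the steps tells the columns apart.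
--
-- Representation. If the program does not reject, the plane is tiled, and an
-- infinite structure is built in steps, each answering one demand for a
-- triangle over an edge (Model, Limit). The set algebra on all sequences of its
-- elements is of every finite dimension and has the algebra of the program as
-- a subalgebra of the neat reduct (Represent). So the algebra belongs to
-- the class unless the program rejects. If the program never stops, then a
-- finite flat representation is excluded, because the formulas modulo
-- equivalence on its clique tuples form a finite cylindric algebra
-- (FlatAlgebra), and a finite hyperbasis is excluded by its finite complex
-- algebra (HyperAlgebra).
--
-- Equations. That no triple of relations satisfies the laws is an equation
-- (LawTerms). It holds for a rejecting program, and it fails in a finite set
-- algebra for an accepting one, whose tiling becomes constant (Closing).
--
-- Diagonalization. For every primitive recursive function there is a program
-- that knows its own number and searches for a positive value of the function
-- there: it accepts or rejects by the value found, and does not stop if there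
-- is none (searcher). The construction of the table and of the equation from
-- the program is primitive recursive, and so are evaluation of a recursive
-- function up to a bound and truth of higher order sentences in a finite
-- algebra. A program that searches for its own algebra in an enumeration, and
-- rejects when it finds it, refutes enumerability; one that does the opposite
-- of what a decision procedure, or a list of axioms, says about its equation or
-- its algebra refutes decidability and axiomatizability. The search for a
-- positive value of the zero function never stops, and gives the last claim.
open import Defs
open import Level using (0ℓ; lift) renaming (suc to lsuc; _⊔_ to _⊔ℓ_)
open import Axiom.ExcludedMiddle using (ExcludedMiddle)
open import Data.Bool using (Bool; true; false; not; if_then_else_; T) renaming (_∧_ to _&&_; _∨_ to _||_)
import Data.Bool.Properties as Bool
open import Data.Empty renaming (⊥ to Empty; ⊥-elim to efq)
open import Data.Unit using (tt) renaming (⊤ to Unit)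
open import Data.Nat using (ℕ; zero; suc; _+_; _*_; _∸_; _^_; _≤_; _<_; _/_; _%_) renaming (z≤n to zl; s≤s to sl; _≡ᵇ_ to _==_; _<ᵇ_ to _<<_)
import Data.Nat as ℕ
import Data.Nat.Properties as ℕ
import Data.Nat.DivMod as ℕ
open import Data.Nat.Solver using (module +-*-Solver)
open import Data.Integer using (ℤ; +_; -[1+_])
import Data.Integer as ℤ
import Data.Integer.Properties as ℤ
open import Data.Fin using (Fin; zero; suc; fromℕ<; inject≤) renaming (toℕ to ix)
import Data.Fin as Fin
import Data.Fin.Properties as Fin
open import Data.Product using (Σ; Σ-syntax; ∃-syntax; _×_; _,_) renaming (proj₁ to fst; proj₂ to snd)
open import Data.Sum using (_⊎_; [_,_]′) renaming (inj₁ to inl; inj₂ to inr)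
open import Data.Maybe using (Maybe; just; nothing)
open import Data.List using (List; []; _∷_; _++_)
import Data.List as List
import Data.List.Properties as List
open import Data.List.Membership.Propositional using (_∈_)
import Data.List.Membership.Propositional.Properties as ∈
open import Data.List.Relation.Unary.All using (All; []; _∷_)
import Data.List.Relation.Unary.All as All
open import Data.List.Relation.Unary.Any using (Any; here; there)
import Data.List.Relation.Unary.Any as Any
import Data.List.Relation.Unary.Any.Properties as AnyP
open import Data.Vec using (Vec; []; _∷_; tabulate; concat; toList; _[_]≔_) renaming (lookup to look)
import Data.Vec as Vec
import Data.Vec.Properties as Vec
import Data.Vec.Membership.Propositional as VecM
import Data.Vec.Membership.Propositional.Properties as VecMP
import Data.Vec.Relation.Unary.All as VecAll
import Data.Vec.Relation.Unary.Any as VecAny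
import Data.Vec.Relation.Unary.Any.Properties as VecAnyP
import Data.Vec.Relation.Unary.All.Properties as VecAllP
open import Function using (_∘_; id; case_of_)
open import Function.Bundles using (Inverse; Equivalence; Func; _⟨$⟩_)
import Relation.Binary
open import Relation.Binary.Bundles using (Setoid)
open import Relation.Binary.PropositionalEquality using (refl; sym; trans; cong; subst; subst₂) renaming (_≡_ to _~_; _≢_ to _#_; cong₂ to cong2)
import Relation.Binary.PropositionalEquality as ≡
open import Relation.Nullary using (¬_; Dec; yes; no; does)
open import Relation.Unary using (Pred)
open import Algebra.Lattice.Bundles using (BooleanAlgebra)
open import Algebra.Lattice.Structures using (IsBooleanAlgebra)
import Algebra.Lattice.Properties.BooleanAlgebra as BAProperties
open import Data.Nat.Properties using (m≤m+n; ≤-trans; *-comm; *-identityʳ; *-monoʳ-≤; *-monoˡ-≤; +-assoc; +-cancelʳ-≡; +-comm; +-identityʳ; +-mono-<-≤; +-mono-≤; +-monoʳ-<; +-monoʳ-≤; +-monoˡ-<; +-monoˡ-≤; +-suc; <-cmp; <-irrefl; <-≤-connex; <-≤-trans; <ᵇ⇒<; <⇒≤; ^-monoʳ-≤; m+n∸m≡n; m<n⇒0<n∸m; m<n⇒m<1+n; m^n>0; m∸n+n≡m; m≤m⊔n; m≤n+m; m≤n⇒m<n∨m≡n; m≤n⇒m≤1+n; m≤n⊔m; n<1+n; n<1⇒n≡0; n∸n≡0; n≤1+n; pred[m∸n]≡m∸[1+n]; pred[n]≤n; ≡ᵇ⇒≡; ≤-antisym; ≤-irrelevant; ≤-pred;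 ≤-refl; ≤-reflexive)
open import Data.Nat.DivMod using (+-distrib-/; [m+kn]%n≡m%n; m%n<n; m*n%n≡0; m*n/n≡m; m<n*o⇒m/o<n; m<n⇒m%n≡m; m<n⇒m/n≡0; m≡m%n+[m/n]*n)
open import Data.Fin.Patterns using (1F; 2F)
open import Agda.Primitive using (Setω)

EM : Setω
EM = ∀ ℓ → ExcludedMiddle ℓ

infix 4 _!
_! : Bool → Set
b ! = b ~ true

infixr 5 _&_
_&_ : ∀ {a} {A : Set a} {x y z : A} → x ~ y → y ~ z → x ~ z
_&_ = trans

-- Labels of pairs of points.
data PL : Set where
 idn o w nx nx˘ ft ft˘ : PL
 tl tl˘ : ℕ -> PL

conv : PL -> PL
conv idn = idn
conv o = o
conv w = w
conv nx = nx˘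
conv nx˘ = nx
conv ft = ft˘
conv ft˘ = ft
conv (tl t) = tl˘ t
conv (tl˘ t) = tl t

elimPL : ∀ {P : PL -> Set}-> P idn -> P o -> P w -> P nx -> P nx˘ -> P ft -> P ft˘ ->(∀ t -> P (tl t))->(∀ t -> P (tl˘ t))-> ∀ ℓ -> P ℓ
elimPL a b c d e f g h k idn = a
elimPL a b c d e f g h k o = b
elimPL a b c d e f g h k w = c
elimPL a b c d e f g h k nx = d
elimPL a b c d e f g h k nx˘ = e
elimPL a b c d e f g h k ft = f
elimPL a b c d e f g h k ft˘ = g
elimPL a b c d e f g h k (tl t) = h t
elimPL a b c d e f g h k (tl˘ t) = k t

cc : ∀ ℓ -> conv (conv ℓ)~ ℓ
cc = elimPL refl refl refl refl refl refl refl (\_ -> refl) \_ -> refl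

record Tiles : Set where
 field
  N : ℕ
  hor ver : ℕ -> ℕ -> Bool
  bad : ℕ -> Bool
  start : ℕ
 isft : PL -> Bool
 isft ft = true
 isft w = true
 isft _ = false
 verOk horOk runOk : ℕ -> PL -> Bool
 verOk t (tl u) = ver t u
 verOk t w = true
 verOk t _ = false
 horOk t (tl˘ u) = hor t u
 horOk t w = true
 horOk t _ = false
 runOk t (tl u) = not ((t == start) && bad u)
 runOk t _ = true
 afterNx afterFt : PL -> PL -> Bool
 afterNx nx γ = isft γ
 afterNx ft γ = isft γ
 afterNx (tl t) γ = verOk t γ && runOk t γ
 afterNx (tl˘ t) γ = horOk t γ
 afterNx _ _ = true
 afterFt (tl t) γ = runOk t γ
 afterFt _ _ = true
 ru : PL -> PL -> PL -> Bool
 ru α nx γ = afterNx α γ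
 ru α ft γ = afterFt α γ
 ru _ _ _ = true
 VPL : PL -> Set
 VPL (tl t) = t < N
 VPL (tl˘ t) = t < N
 VPL _ = Unit
 record Plane (t0 : ℕ) : Set where
  field
   cell : ℕ -> ℕ -> ℕ
   cell0 : cell 0 0 ~ t0
   cell< : ∀ a b -> cell a b < N
   cellH : ∀ a b -> hor (cell a b)(cell (suc a) b) !
   cellV : ∀ a b -> ver (cell a b)(cell a (suc b)) !
   cellR : ∀ a b b' -> cell a b ~ start -> b < b' -> bad (cell a b')~ false

Planes : Tiles -> Set
Planes TS = ∀ t -> t < Tiles.N TS -> Tiles.Plane TS t

conv-valid : (TS : Tiles)-> ∀ ℓ -> Tiles.VPL TS ℓ -> Tiles.VPL TS (conv ℓ)
conv-valid TS = elimPL id id id id id id id (\_ -> id) \_ -> id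

module RuLemmas (TS : Tiles) where
 open Tiles TS
 data Succ : PL -> Set where
  nx : Succ nx
  ft : Succ ft
 succ? : ∀ β -> Succ β ⊎ (∀ α γ -> ru α β γ !)
 succ? nx = inl nx
 succ? ft = inl ft
 succ? idn = inr \_ _ -> refl
 succ? o = inr \_ _ -> refl
 succ? w = inr \_ _ -> refl
 succ? nx˘ = inr \_ _ -> refl
 succ? ft˘ = inr \_ _ -> refl
 succ? (tl _) = inr \_ _ -> refl
 succ? (tl˘ _) = inr \_ _ -> refl
 ru-first : ∀ α γ -> afterNx α γ ! -> afterFt α γ ! -> ∀ β -> ru α β γ !
 ru-first α γ a b β with succ? β
 ... | inl nx = a
 ... | inl ft = b
 ... | inr h = h α γ
 ru-w3 : ∀ α β -> ru α β w !
 ru-w3 α = ru-first α w (elimPL {\α -> afterNx α w !} refl refl refl refl refl refl refl (\_ -> refl)(\_ -> refl) α)(elimPL {\α -> afterFt α w !} refl refl refl refl refl refl refl (\_ -> refl)(\_ -> refl) α)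
 ru-w1 : ∀ β γ -> ru w β γ !
 ru-w1 β γ = ru-first w γ refl refl β
 ru-o1 : ∀ β γ -> ru o β γ !
 ru-o1 β γ = ru-first o γ refl refl β
 ru-id1 : ∀ β γ -> ru idn β γ !
 ru-id1 β γ = ru-first idn γ refl refl β
 ru-conv : ∀ α γ -> ru α (conv α) γ !
 ru-conv α γ = elimPL {\α -> ru α (conv α) γ !} refl refl refl refl refl refl refl (\_ -> refl)(\_ -> refl) α
 ru-conv' : ∀ α γ -> ru (conv α) α γ !
 ru-conv' α γ = subst (\x -> ru (conv α) x γ !)(cc α)(ru-conv (conv α) γ)

module World0 (em : EM)(TS : Tiles)
 (plane : Planes TS) where
 open Tiles TS
 open RuLemmas TS
 data Chain : Set where
  base : ℕ -> Chain
  att : Chain -> Bool ->(t : ℕ)-> t < N -> ℤ -> Chain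
 root : Chain -> ℕ
 root (base k) = k
 root (att i _ _ _ _) = root i
 depth : Chain -> ℕ
 depth (base k) = 0
 depth (att i _ _ _ _) = suc (depth i)
 Pos : Set
 Pos = Chain × ℤ
 _≟_ : (i j : Chain)-> Dec (i ~ j)
 i ≟ j = em 0ℓ
 kl : ℤ -> PL
 kl (+ 0) = idn
 kl (+ 1) = nx
 kl (+ (suc (suc _))) = ft
 kl -[1+ 0 ] = nx˘
 kl -[1+ suc _ ] = ft˘
 cellAt : (t : ℕ)-> t < N -> ℤ -> ℤ -> PL
 cellAt t h (+ a)(+ b) = tl (Plane.cell (plane t h) a b)
 cellAt t h _ _ = o
 side : Bool ->(t : ℕ)-> t < N -> ℤ -> ℤ -> PL
 side true t h a b = cellAt t h a b
 side false t h a b = conv (cellAt t h b a)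
 up : Chain -> ℤ -> Chain -> ℤ -> PL
 up i a (base _) b = o
 up i a (att j d t h s) b with i ≟ j
 ... | yes _ = side d t h (a ℤ.- s) b
 ... | no _ = o
 mix : PL -> PL -> PL
 mix o y = y
 mix x _ = x
 across : Chain -> ℤ -> Chain -> ℤ -> PL
 across i a j b = mix (up i a j b)(conv (up j b i a))
 labW : Pos -> Pos -> PL
 labW (i , a)(j , b) with i ≟ j
 ... | yes _ = kl (b ℤ.- a)
 ... | no _ = across i a j b
 data Cross : PL -> Set where
  o : Cross o
  tl : ∀ {t}-> t < N -> Cross (tl t)
  tl˘ : ∀ {t}-> t < N -> Cross (tl˘ t)
 cross-conv : ∀ {ℓ}-> Cross ℓ -> Cross (conv ℓ)
 cross-conv o = o
 cross-conv (tl h) = tl˘ h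
 cross-conv (tl˘ h) = tl h
 cross-cell : ∀ t h a b -> Cross (cellAt t h a b)
 cross-cell t h (+ a)(+ b) = tl (Plane.cell< (plane t h) a b)
 cross-cell t h (+ a) -[1+ _ ] = o
 cross-cell t h -[1+ _ ] _ = o
 cross-side : ∀ d t h a b -> Cross (side d t h a b)
 cross-side true t h a b = cross-cell t h a b
 cross-side false t h a b = cross-conv (cross-cell t h b a)
 cross-up : ∀ i a j b -> Cross (up i a j b)
 cross-up i a (base x) b = o
 cross-up i a (att j d t h s) b with i ≟ j
 ... | yes _ = cross-side d t h _ b
 ... | no _ = o
 cross-mix : ∀ {x y}-> Cross x -> Cross y -> Cross (mix x y)
 cross-mix o c = c
 cross-mix (tl h) c = tl h
 cross-mix (tl˘ h) c = tl˘ h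
 cross-across : ∀ i a j b -> Cross (across i a j b)
 cross-across i a j b = cross-mix (cross-up i a j b)(cross-conv (cross-up j b i a))
 up-depth : ∀ i a j b -> up i a j b ~ o ⊎ depth j ~ suc (depth i)
 up-depth i a (base x) b = inl refl
 up-depth i a (att j d t h s) b with i ≟ j
 ... | yes refl = inr refl
 ... | no _ = inl refl
 up-excl : ∀ i a j b -> up i a j b ~ o ⊎ up j b i a ~ o
 up-excl i a j b with up-depth i a j b | up-depth j b i a
 ... | inl e | _ = inl e
 ... | inr _ | inl e = inr e
 ... | inr e | inr e' = efq (<-irrefl (e' & cong suc e)(m<n⇒m<1+n ≤-refl))
 mix-o : ∀ x -> mix x o ~ x
 mix-o = elimPL refl refl refl refl refl refl refl (\_ -> refl) \_ -> refl
 across-conv : ∀ i a j b -> across j b i a ~ conv (across i a j b)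
 across-conv i a j b with up i a j b | up j b i a | up-excl i a j b
 ... | .o | y | inl refl = mix-o y & sym (cc y)
 ... | x | .o | inr refl = cong conv (sym (mix-o x))
 kl-neg : ∀ x -> kl (ℤ.- x)~ conv (kl x)
 kl-neg (+ 0) = refl
 kl-neg (+ 1) = refl
 kl-neg (+ suc (suc n)) = refl
 kl-neg -[1+ 0 ] = refl
 kl-neg -[1+ suc n ] = refl
 flip- : ∀ a b -> a ℤ.- b ~ ℤ.- (b ℤ.- a)
 flip- a b = sym (ℤ.neg-distrib-+ b (ℤ.- a)& cong (\x -> ℤ.- b ℤ.+ x)(ℤ.neg-involutive a)& ℤ.+-comm (ℤ.- b) a)
 labW-conv : ∀ u v -> labW v u ~ conv (labW u v)
 labW-conv (i , a)(j , b) with i ≟ j | j ≟ i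
 ... | yes _ | yes _ = cong kl (flip- a b)& kl-neg (b ℤ.- a)
 ... | yes refl | no ne = efq (ne refl)
 ... | no ne | yes refl = efq (ne refl)
 ... | no _ | no _ = across-conv i a j b
 data InW : PL -> Set where
  idn : InW idn
  nx : InW nx
  nx˘ : InW nx˘
  ft : InW ft
  ft˘ : InW ft˘
  cr : ∀ {ℓ}-> Cross ℓ -> InW ℓ
 kl-in : ∀ x -> InW (kl x)
 kl-in (+ 0) = idn
 kl-in (+ 1) = nx
 kl-in (+ suc (suc _)) = ft
 kl-in -[1+ 0 ] = nx˘
 kl-in -[1+ suc _ ] = ft˘
 labW-in : ∀ u v -> InW (labW u v)
 labW-in (i , a)(j , b) with i ≟ j
 ... | yes _ = kl-in (b ℤ.- a)
 ... | no _ = cr (cross-across i a j b)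
 labW#w : ∀ u v -> labW u v # w
 labW#w u v e with labW u v | labW-in u v
 labW#w u v () | .idn | idn
 labW#w u v () | .o | cr o
 labW-valid : ∀ u v -> VPL (labW u v)
 labW-valid u v with labW u v | labW-in u v
 ... | .idn | idn = tt
 ... | .nx | nx = tt
 ... | .nx˘ | nx˘ = tt
 ... | .ft | ft = tt
 ... | .ft˘ | ft˘ = tt
 ... | .o | cr o = tt
 ... | .(tl _) | cr (tl h) = h
 ... | .(tl˘ _) | cr (tl˘ h) = h
 labW-refl : ∀ u -> labW u u ~ idn
 labW-refl (i , a) with i ≟ i
 ... | yes _ = cong kl (ℤ.+-inverseʳ a)
 ... | no ne = efq (ne refl)
 kl-idn : ∀ x -> kl x ~ idn -> x ~ + 0
 kl-idn (+ 0) e = refl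
 kl-idn (+ 1)()
 kl-idn (+ suc (suc _))()
 kl-idn -[1+ 0 ] ()
 kl-idn -[1+ suc _ ] ()
 labW-idn : ∀ u v -> labW u v ~ idn -> u ~ v
 labW-idn (i , a)(j , b) e with i ≟ j
 ... | yes refl = cong (i ,_)(sym (ℤ.i-j≡0⇒i≡j b a (kl-idn _ e)))
 ... | no _ with across i a j b | cross-across i a j b
 labW-idn (i , a)(j , b)() | no _ | .o | o
 kl-nx : ∀ x -> kl x ~ nx -> x ~ + 1
 kl-nx (+ 1) e = refl
 kl-nx (+ 0)()
 kl-nx (+ suc (suc _))()
 kl-nx -[1+ 0 ] ()
 kl-nx -[1+ suc _ ] ()
 kl-ft : ∀ x -> kl x ~ ft -> ∃[ n ] x ~ + suc (suc n)
 kl-ft (+ suc (suc n)) e = n , refl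
 kl-ft (+ 1)()
 kl-ft (+ 0)()
 kl-ft -[1+ 0 ] ()
 kl-ft -[1+ suc _ ] ()
 ru-kl-nx : ∀ x -> ru (kl x) nx (kl (+ 1 ℤ.+ x)) !
 ru-kl-nx (+ 0) = refl
 ru-kl-nx (+ 1) = refl
 ru-kl-nx (+ suc (suc n)) = refl
 ru-kl-nx -[1+ 0 ] = refl
 ru-kl-nx -[1+ suc n ] = refl
 ru-kl-ft : ∀ x γ -> ru (kl x) ft γ !
 ru-kl-ft (+ 0) γ = refl
 ru-kl-ft (+ 1) γ = refl
 ru-kl-ft (+ suc (suc n)) γ = refl
 ru-kl-ft -[1+ 0 ] γ = refl
 ru-kl-ft -[1+ suc n ] γ = refl
 data Fwd : PL -> ℕ -> Set where
  nx : Fwd nx 0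
  ft : ∀ {n}-> Fwd ft n
 run-tl : ∀ t u ->(t ~ start -> bad u ~ false)-> runOk t (tl u) !
 run-tl t u h with t == start in eq
 ... | false = refl
 ... | true = cong not (h (≡ᵇ⇒≡ t start (subst T (sym eq) tt)))
 Moves : PL -> PL -> PL -> Set
 Moves α β γ = α ~ o ⊎ (ru α β γ ! × γ # o × α # o)
 mv1 : ∀ t h x y {β n}-> Fwd β n -> Moves (cellAt t h x y) β (cellAt t h x (y ℤ.+ + suc n))
 mv1 t h -[1+ x ] y f = inl refl
 mv1 t h (+ x) -[1+ y ] f = inl refl
 mv1 t h (+ x)(+ y) nx rewrite +-comm y 1
  | Plane.cellV (plane t h) x y
  | run-tl (Plane.cell (plane t h) x y)(Plane.cell (plane t h) x (suc y))(\e -> Plane.cellR (plane t h) x y (suc y) e ≤-refl) = inr (refl , (\()), \())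
 mv1 t h (+ x)(+ y)(ft {n}) = inr (run-tl (Plane.cell (plane t h) x y) _ (\e -> Plane.cellR (plane t h) x y _ e (ℕ.m<m+n y (sl zl))), (\()), \())
 mv2 : ∀ t h x y {β n}-> Fwd β n -> Moves (conv (cellAt t h y x)) β (conv (cellAt t h (y ℤ.+ + suc n) x))
 mv2 t h x -[1+ y ] f = inl refl
 mv2 t h -[1+ x ] (+ y) f = inl refl
 mv2 t h (+ x)(+ y) nx rewrite +-comm y 1 = inr (Plane.cellH (plane t h) y x , (\()), \())
 mv2 t h (+ x)(+ y) ft = inr (refl , (\()), \())
 mv-side : ∀ d t h a b {β n}-> Fwd β n -> Moves (side d t h a b) β (side d t h a (b ℤ.+ + suc n))
 mv-side true t h a b = mv1 t h a b
 mv-side false t h a b = mv2 t h a b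
 mv-side˘ : ∀ d t h a b {β n}-> Fwd β n -> Moves (conv (side d t h b a)) β (conv (side d t h (b ℤ.+ + suc n) a))
 mv-side˘ true t h a b f = mv2 t h a b f
 mv-side˘ false t h a b {β}{n} f rewrite cc (cellAt t h a b) | cc (cellAt t h a (b ℤ.+ + suc n)) = mv1 t h a b f
 mv-up : ∀ i a j b {β n}-> Fwd β n -> Moves (up i a j b) β (up i a j (b ℤ.+ + suc n))
 mv-up i a (base x) b f = inl refl
 mv-up i a (att j d t h s) b f with i ≟ j
 ... | yes _ = mv-side d t h _ b f
 ... | no _ = inl refl
 shift- : ∀ b s n ->(b ℤ.+ + n) ℤ.- s ~ (b ℤ.- s) ℤ.+ + n
 shift- b s n = ℤ.+-assoc b (+ n)(ℤ.- s)& cong (\x -> b ℤ.+ x)(ℤ.+-comm (+ n)(ℤ.- s))& sym (ℤ.+-assoc b (ℤ.- s)(+ n))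
 mv-up˘ : ∀ i a j b {β n}-> Fwd β n -> Moves (conv (up j b i a)) β (conv (up j (b ℤ.+ + suc n) i a))
 mv-up˘ (base x) a j b f = inl refl
 mv-up˘ (att i d t h s) a j b {n = n} f with j ≟ i
 ... | yes _ rewrite shift- b s (suc n) = mv-side˘ d t h a (b ℤ.- s) f
 ... | no _ = inl refl
 mix-#o : ∀ x y -> x # o -> mix x y ~ x
 mix-#o x y ne = elimPL {\x -> x # o -> mix x y ~ x}(\_ -> refl)(\n -> efq (n refl))(\_ -> refl)(\_ -> refl)(\_ -> refl)(\_ -> refl)(\_ -> refl)(\_ _ -> refl)(\_ _ -> refl) x ne
 ru-across : ∀ i a j b {β n}-> Fwd β n -> ru (across i a j b) β (across i a j (b ℤ.+ + suc n)) !
 ru-across i a j b {β}{n} f with up i a j b | mv-up i a j b f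
 ... | .o | inl refl = second
  where
  second : ru (conv (up j b i a)) β (across i a j (b ℤ.+ + suc n)) !
  second with conv (up j b i a) | mv-up˘ i a j b f
  ... | .o | inl refl = ru-o1 β _
  ... | α | inr (e , ne , _) with up-excl i a j (b ℤ.+ + suc n)
  ... | inl z rewrite z = e
  ... | inr z = efq (ne (cong conv z))
 ... | α | inr (e , ne , ne') rewrite mix-#o α (conv (up j b i a)) ne'
  | mix-#o (up i a j (b ℤ.+ + suc n))(conv (up j (b ℤ.+ + suc n) i a)) ne = e
 cancel : ∀ b c x -> c ℤ.- b ~ x -> c ~ b ℤ.+ x
 cancel b c x e = sym (ℤ.+-identityʳ c)& cong (\y -> c ℤ.+ y)(sym (ℤ.+-inverseˡ b))& sym (ℤ.+-assoc c (ℤ.- b) b)& cong (\y -> y ℤ.+ b) e & ℤ.+-comm x b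
 ru-fwd : ∀ i a j b {β n}-> Fwd β n -> ru (labW (i , a)(j , b)) β (labW (i , a)(j , b ℤ.+ + suc n)) !
 ru-fwd i a j b {β}{n} f with i ≟ j
 ... | no _ = ru-across i a j b f
 ru-fwd i a j b {n = n} nx | yes _ = cong (\x -> ru (kl (b ℤ.- a)) nx (kl x))(shift- b a 1 & ℤ.+-comm (b ℤ.- a)(+ 1))& ru-kl-nx (b ℤ.- a)
 ru-fwd i a j b {n = n} ft | yes _ = ru-kl-ft (b ℤ.- a) _
 ru-W : ∀ u v x -> ru (labW u v)(labW v x)(labW u x) !
 ru-W u v x with succ? (labW v x)
 ... | inr h = h (labW u v)(labW u x)
 ru-W (i , a)(j , b)(j' , c) | inl s with j ≟ j'
 ... | no _ with across j b j' c | cross-across j b j' c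
 ru-W (i , a)(j , b)(j' , c) | inl () | no _ | .o | o
 ru-W (i , a)(j , b)(j' , c) | inl () | no _ | .(tl _) | tl x
 ru-W (i , a)(j , b)(j' , c) | inl () | no _ | .(tl˘ _) | tl˘ x
 ru-W (i , a)(j , b)(.j , c) | inl s | yes refl with kl (c ℤ.- b) in eq
 ru-W (i , a)(j , b)(.j , c) | inl nx | yes refl | .nx rewrite cancel b c (+ 1)(kl-nx _ eq) = ru-fwd i a j b nx
 ru-W (i , a)(j , b)(.j , c) | inl ft | yes refl | .ft with kl-ft _ eq
 ... | n , e rewrite cancel b c (+ suc (suc n)) e = ru-fwd i a j b ft
 -- every label is seen from every position
 data Real : PL -> Set where
  nx : Real nx
  nx˘ : Real nx˘
  ft : Real ft
  ft˘ : Real ft˘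
  tl : ∀ {t}-> t < N -> Real (tl t)
  tl˘ : ∀ {t}-> t < N -> Real (tl˘ t)
 kl-at : ∀ i a x -> labW (i , a)(i , a ℤ.+ x)~ kl x
 kl-at i a x with i ≟ i
 ... | no ne = efq (ne refl)
 ... | yes _ = cong kl (cong (\y -> y ℤ.- a)(ℤ.+-comm a x)& ℤ.+-assoc x a (ℤ.- a)& cong (\y -> x ℤ.+ y)(ℤ.+-inverseʳ a)& ℤ.+-identityʳ x)
 acyc : ∀ {i d t h s}-> i # att i d t h s
 acyc e = <-irrefl (cong depth e) ≤-refl
 att-at : ∀ i a d t h -> labW (i , a)(att i d t h a , + 0)~ side d t h (+ 0)(+ 0)
 att-at i a d t h with i ≟ att i d t h a
 ... | yes e = efq (acyc e)
 ... | no _ with i ≟ i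
 ... | no ne = efq (ne refl)
 ... | yes _ rewrite ℤ.+-inverseʳ a with d
 ... | true = refl
 ... | false = refl
 sees : ∀ u ℓ -> Real ℓ -> ∃[ v ] (labW u v ~ ℓ × root (fst v)~ root (fst u))
 sees (i , a) .nx nx = (i , a ℤ.+ + 1), kl-at i a _ , refl
 sees (i , a) .nx˘ nx˘ = (i , a ℤ.+ -[1+ 0 ]), kl-at i a _ , refl
 sees (i , a) .ft ft = (i , a ℤ.+ + 2), kl-at i a _ , refl
 sees (i , a) .ft˘ ft˘ = (i , a ℤ.+ -[1+ 1 ]), kl-at i a _ , refl
 sees (i , a) .(tl t)(tl {t} h) = (att i true t h a , + 0), trans (att-at i a true t h)(cong tl (Plane.cell0 (plane t h))), refl
 sees (i , a) .(tl˘ t)(tl˘ {t} h) = (att i false t h a , + 0), trans (att-at i a false t h)(cong tl˘ (Plane.cell0 (plane t h))), refl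
 up-root : ∀ i a j b -> root i # root j -> up i a j b ~ o
 up-root i a (base x) b ne = refl
 up-root i a (att j d t h s) b ne with i ≟ j
 ... | yes refl = efq (ne refl)
 ... | no _ = refl
 far : ∀ u v -> root (fst u)# root (fst v)-> labW u v ~ o
 far (i , a)(j , b) ne with i ≟ j
 ... | yes refl = efq (ne refl)
 ... | no _ rewrite up-root i a j b ne | up-root j b i a (ne ∘ sym) = refl
 sees-o : ∀ u -> ∃[ v ] labW u v ~ o
 sees-o u = (base (suc (root (fst u))), + 0), far u _ (\e -> <-irrefl e ≤-refl)

module World (em : EM)(TS : Tiles)
 (plane : Planes TS) where
 open Tiles TS
 private module W = World0 em TS plane
 open W public using (Chain; base; att; root; Pos; Real; nx; nx˘; ft; ft˘; tl; tl˘)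
 abstract
  labW : Pos -> Pos -> PL
  labW = W.labW
  labW-conv : ∀ u v -> labW v u ~ conv (labW u v)
  labW-conv = W.labW-conv
  labW#w : ∀ u v -> labW u v # w
  labW#w = W.labW#w
  labW-valid : ∀ u v -> VPL (labW u v)
  labW-valid = W.labW-valid
  labW-refl : ∀ u -> labW u u ~ idn
  labW-refl = W.labW-refl
  labW-idn : ∀ u v -> labW u v ~ idn -> u ~ v
  labW-idn = W.labW-idn
  ru-W : ∀ u v x -> ru (labW u v)(labW v x)(labW u x) !
  ru-W = W.ru-W
  sees : ∀ u ℓ -> Real ℓ -> ∃[ v ] (labW u v ~ ℓ × root (fst v)~ root (fst u))
  sees = W.sees
  far : ∀ u v -> root (fst u)# root (fst v)-> labW u v ~ o
  far = W.far
  sees-o : ∀ u -> ∃[ v ] labW u v ~ o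
  sees-o = W.sees-o

record Masks (TS : Tiles) : Set1 where
 open Tiles TS
 field
  K : ℕ
  mem : ℕ -> PL -> Bool
  mem-o : ∀ R -> mem R o !
  mem-w : ∀ R -> mem R w !
  maskOf : (PL -> Set)-> ℕ
  mask< : ∀ P -> maskOf P < K
  mask⇒ : ∀ P ℓ -> VPL ℓ -> ℓ # o -> ℓ # w -> mem (maskOf P) ℓ ! -> P ℓ
  mask⇐ : ∀ P ℓ -> VPL ℓ -> ℓ # idn -> P ℓ -> mem (maskOf P) ℓ !

-- Labels of pairs of elements, elements being worlds or points.
data Lab : Set where
 pp : PL -> Lab
 zp pz : ℕ -> Lab
 zz : Bool -> Lab

module Labels (TS : Tiles)(K : ℕ)(mem : ℕ -> PL -> Bool) where
 open Tiles TS
 record Zok (κ κ' : ℕ)(ℓ : PL) : Set where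
  constructor zok
  field
   gg : κ ~ 0 -> κ' ~ 0 -> ℓ # w
   ng : ∀ R -> κ ~ suc R -> κ' ~ 0 -> mem R ℓ !
   gn : ∀ R -> κ ~ 0 -> κ' ~ suc R -> mem R (conv ℓ) !
   ii : ℓ ~ idn -> κ ~ κ'
 record RU (α β γ : PL) : Set where
  constructor mk
  field un : ru α β γ !
 record Pok (α β γ : PL) : Set where
  constructor pok
  field
   r1 : RU α β γ
   r2 : RU γ (conv β) α
   r3 : RU (conv α) γ β
   r4 : RU β (conv γ)(conv α)
   r5 : RU (conv γ) α (conv β)
   r6 : RU (conv β)(conv α)(conv γ)
   i1 : α ~ idn -> β ~ γ
   i2 : β ~ idn -> α ~ γ
   i3 : γ ~ idn -> β ~ conv α
 Cons : Lab -> Lab -> Lab -> Set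
 Cons (pp α)(pp β)(pp γ) = Pok α β γ
 Cons (pp ℓ)(pz κ')(pz κ) = Zok κ κ' ℓ
 Cons (zp κ)(pp ℓ)(zp κ') = Zok κ κ' ℓ
 Cons (pz κ)(zp κ')(pp ℓ) = Zok κ κ' ℓ
 Cons (zz e)(zp κ)(zp κ') = e ! -> κ ~ κ'
 Cons (zp κ)(pz κ')(zz e) = e ! -> κ ~ κ'
 Cons (pz κ)(zz e)(pz κ') = e ! -> κ ~ κ'
 Cons (zz a)(zz b)(zz c) = (a ! -> b ~ c)× (b ! -> a ~ c)× (c ! -> a ~ b)
 Cons _ _ _ = Empty
 Valid : Lab -> Set
 Valid (pp ℓ) = VPL ℓ
 Valid (zp κ) = κ ≤ K
 Valid (pz κ) = κ ≤ K
 Valid (zz b) = Unit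
 isId : Lab -> Bool
 isId (pp idn) = true
 isId (zz b) = b
 isId _ = false

record Structure (TS : Tiles)(MS : Masks TS) : Set1 where
 open Labels TS (Masks.K MS)(Masks.mem MS)
 field
  M : Set
  lab : M -> M -> Lab
  cons : ∀ a b c -> Cons (lab a b)(lab b c)(lab a c)
  valid : ∀ a b -> Valid (lab a b)
  id⇒ : ∀ a b -> isId (lab a b) ! -> a ~ b
  id⇐ : ∀ a -> isId (lab a a) !
  meets : ∀ a b β γ -> Valid β -> Valid γ -> Cons (lab a b) β γ -> ∃[ c ] (lab b c ~ β × lab a c ~ γ)
  point : M

module Model (em : EM)(TS : Tiles)
 (plane : Planes TS)(MS : Masks TS) where
 open Tiles TS
 open RuLemmas TS
 open World em TS plane
 open Masks MS
 open Labels TS K mem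
 real : ∀ ℓ -> VPL ℓ -> ℓ # idn -> ℓ # o -> ℓ # w -> Real ℓ
 real idn v a b c = efq (a refl)
 real o v a b c = efq (b refl)
 real w v a b c = efq (c refl)
 real nx v a b c = nx
 real nx˘ v a b c = nx˘
 real ft v a b c = ft
 real ft˘ v a b c = ft˘
 real (tl x) v a b c = tl v
 real (tl˘ x) v a b c = tl˘ v
 Real-#o : ∀ {ℓ}-> Real ℓ -> ℓ # o
 Real-#o () refl
 Real-#w : ∀ {ℓ}-> Real ℓ -> ℓ # w
 Real-#w () refl
 Real-#idn : ∀ {ℓ}-> Real ℓ -> ℓ # idn
 Real-#idn () refl
 Real-val : ∀ {ℓ}-> Real ℓ -> VPL ℓ
 Real-val nx = tt
 Real-val nx˘ = tt
 Real-val ft = tt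
 Real-val ft˘ = tt
 Real-val (tl h) = h
 Real-val (tl˘ h) = h
 data View : PL -> Set where
  idn : View idn
  o : View o
  w : View w
  re : ∀ {ℓ}-> Real ℓ -> View ℓ
 view : ∀ ℓ -> VPL ℓ -> View ℓ
 view idn v = idn
 view o v = o
 view w v = w
 view nx v = re nx
 view nx˘ v = re nx˘
 view ft v = re ft
 view ft˘ v = re ft˘
 view (tl x) v = re (tl v)
 view (tl˘ x) v = re (tl˘ v)
 record Net (zn pn : ℕ) : Set where
  field
   pl : Fin pn -> Fin pn -> PL
   col : Fin zn -> Fin pn -> ℕ
   pos : Fin zn -> Fin pn -> Pos
   plid : ∀ p -> pl p p ~ idn
   plne : ∀ p q -> pl p q ~ idn -> p ~ q
   plcv : ∀ p q -> pl q p ~ conv (pl p q)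
   plok : ∀ p q r -> ru (pl p q)(pl q r)(pl p r) !
   plva : ∀ p q -> VPL (pl p q)
   grn : ∀ z p q -> col z p ~ 0 -> col z q ~ 0 -> pl p q ~ labW (pos z p)(pos z q)
   rng : ∀ z p q {R}-> col z p ~ suc R -> col z q ~ 0 -> mem R (pl p q) !
   bnd : ∀ z p {R}-> col z p ~ suc R -> R < K
  Rea : Fin zn -> Fin pn -> Set
  Rea z p = ∀ R -> col z p ~ suc R -> ∀ ℓ -> Real ℓ -> mem R ℓ ! -> ∃[ q ] (col z q ~ 0 × pl p q ~ ℓ)
 open Net
 record Tri (a b c : PL) : Set where
  constructor tri
  field
   t1 : ru a b c !
   t2 : ru (conv a) c b !
   t3 : ru b (conv c)(conv a) !
 tri-w1 : ∀ b c -> Tri w b c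
 tri-w1 b c = tri (ru-w1 b c)(ru-w1 c b)(ru-w3 b (conv c))
 tri-w2 : ∀ a c -> Tri a w c
 tri-w2 a c = tri refl (ru-w3 (conv a) c)(ru-w1 (conv c)(conv a))
 tri-w3 : ∀ a b -> Tri a b w
 tri-w3 a b = tri (ru-w3 a b) refl refl
 tri-oo : ∀ b -> Tri o b o
 tri-oo b = tri (ru-o1 b o)(ru-o1 o b) refl
 tri-id : ∀ a -> Tri a idn a
 tri-id a = tri refl (ru-conv' a idn)(ru-id1 (conv a)(conv a))
 tri-W : ∀ x y z -> Tri (labW x y)(labW y z)(labW x z)
 tri-W x y z = tri (ru-W x y z)
  (cong (\ℓ -> ru ℓ (labW x z)(labW y z))(sym (labW-conv x y))& ru-W y x z)
  (cong2 (\ℓ m -> ru (labW y z) ℓ m)(sym (labW-conv x z))(sym (labW-conv x y))& ru-W y z x)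
 record NewP {zn pn}(N : Net zn pn) : Set where
  field
   lam : Fin pn -> PL
   κ : Fin zn -> ℕ
   u : Fin zn -> Pos
   tris : ∀ s s' -> Tri (lam s)(pl N s s')(lam s')
   ne : ∀ s -> lam s # idn
   val : ∀ s -> VPL (lam s)
   g1 : ∀ z s -> κ z ~ 0 -> col N z s ~ 0 -> lam s ~ labW (u z)(pos N z s)
   g2 : ∀ z s {R}-> κ z ~ 0 -> col N z s ~ suc R -> mem R (conv (lam s)) !
   g3 : ∀ z s {R}-> κ z ~ suc R -> col N z s ~ 0 -> mem R (lam s) !
   g4 : ∀ z {R}-> κ z ~ suc R -> R < K
 module _ {zn pn}(N : Net zn pn)(D : NewP N) where
  open NewP D
  private
   pl' : Fin (suc pn)-> Fin (suc pn)-> PL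
   pl' zero zero = idn
   pl' zero (suc s) = lam s
   pl' (suc s) zero = conv (lam s)
   pl' (suc s)(suc t) = pl N s t
   col' : Fin zn -> Fin (suc pn)-> ℕ
   col' z zero = κ z
   col' z (suc s) = col N z s
   pos' : Fin zn -> Fin (suc pn)-> Pos
   pos' z zero = u z
   pos' z (suc s) = pos N z s
  conv-idn : ∀ {ℓ}-> conv ℓ ~ idn -> ℓ ~ idn
  conv-idn {idn} e = refl
  addP : Net zn (suc pn)
  addP .pl = pl'
  addP .col = col'
  addP .pos = pos'
  addP .plid zero = refl
  addP .plid (suc p) = plid N p
  addP .plne zero zero e = refl
  addP .plne zero (suc q) e = efq (ne q e)
  addP .plne (suc p) zero e = efq (ne p (conv-idn e))
  addP .plne (suc p)(suc q) e = cong suc (plne N p q e)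
  addP .plcv zero zero = refl
  addP .plcv zero (suc q) = refl
  addP .plcv (suc p) zero = sym (cc (lam p))
  addP .plcv (suc p)(suc q) = plcv N p q
  addP .plok zero zero r = ru-id1 (pl' zero r)(pl' zero r)
  addP .plok zero (suc q) zero = ru-conv (lam q) idn
  addP .plok zero (suc q)(suc r) = Tri.t1 (tris q r)
  addP .plok (suc p) zero zero = refl
  addP .plok (suc p) zero (suc r) = Tri.t2 (tris p r)
  addP .plok (suc p)(suc q) zero = Tri.t3 (tris p q)
  addP .plok (suc p)(suc q)(suc r) = plok N p q r
  addP .plva zero zero = tt
  addP .plva zero (suc q) = val q
  addP .plva (suc p) zero = conv-valid TS _ (val p)
  addP .plva (suc p)(suc q) = plva N p q
  addP .grn z zero zero a b = sym (labW-refl (u z))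
  addP .grn z zero (suc q) a b = g1 z q a b
  addP .grn z (suc p) zero a b = cong conv (g1 z p b a)& sym (labW-conv (u z)(pos N z p))
  addP .grn z (suc p)(suc q) a b = grn N z p q a b
  addP .rng z zero zero a b with trans (sym a) b
  ... | ()
  addP .rng z zero (suc q) a b = g3 z q a b
  addP .rng z (suc p) zero a b = g2 z p b a
  addP .rng z (suc p)(suc q) a b = rng N z p q a b
  addP .bnd z zero a = g4 z a
  addP .bnd z (suc p) a = bnd N z p a
 record NewZ {zn pn}(N : Net zn pn) : Set where
  field
   κ : Fin pn -> ℕ
   u : Fin pn -> Pos
   h1 : ∀ p q -> κ p ~ 0 -> κ q ~ 0 -> pl N p q ~ labW (u p)(u q)
   h2 : ∀ p q {R}-> κ p ~ suc R -> κ q ~ 0 -> mem R (pl N p q) !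
   h3 : ∀ p {R}-> κ p ~ suc R -> R < K
 module _ {zn pn}(N : Net zn pn)(D : NewZ N) where
  open NewZ D
  addZ : Net (suc zn) pn
  addZ .pl = pl N
  addZ .col zero = κ
  addZ .col (suc z) = col N z
  addZ .pos zero = u
  addZ .pos (suc z) = pos N z
  addZ .plid = plid N
  addZ .plne = plne N
  addZ .plcv = plcv N
  addZ .plok = plok N
  addZ .plva = plva N
  addZ .grn zero = h1
  addZ .grn (suc z) = grn N z
  addZ .rng zero = h2
  addZ .rng (suc z) = rng N z
  addZ .bnd zero = h3
  addZ .bnd (suc z) = bnd N z
 data _◁_ : ∀ {zn pn zn' pn'}-> Net zn pn -> Net zn' pn' -> Set where
  done : ∀ {zn pn}{N : Net zn pn}-> N ◁ N
  aP : ∀ {zn pn zn' pn'}{N : Net zn pn}{N' : Net zn' pn'}-> N ◁ N' ->(D : NewP N')-> N ◁ addP N' D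
  aZ : ∀ {zn pn zn' pn'}{N : Net zn pn}{N' : Net zn' pn'}-> N ◁ N' ->(D : NewZ N')-> N ◁ addZ N' D
 liftZ : ∀ {zn pn zn' pn'}{N : Net zn pn}{N' : Net zn' pn'}-> N ◁ N' -> Fin zn -> Fin zn'
 liftZ done z = z
 liftZ (aP e D) z = liftZ e z
 liftZ (aZ e D) z = suc (liftZ e z)
 liftP : ∀ {zn pn zn' pn'}{N : Net zn pn}{N' : Net zn' pn'}-> N ◁ N' -> Fin pn -> Fin pn'
 liftP done p = p
 liftP (aP e D) p = suc (liftP e p)
 liftP (aZ e D) p = liftP e p
 ◁-pl : ∀ {zn pn zn' pn'}{N : Net zn pn}{N' : Net zn' pn'}(e : N ◁ N') p q -> pl N' (liftP e p)(liftP e q)~ pl N p q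
 ◁-pl done p q = refl
 ◁-pl (aP e D) p q = ◁-pl e p q
 ◁-pl (aZ e D) p q = ◁-pl e p q
 ◁-col : ∀ {zn pn zn' pn'}{N : Net zn pn}{N' : Net zn' pn'}(e : N ◁ N') z p -> col N' (liftZ e z)(liftP e p)~ col N z p
 ◁-col done z p = refl
 ◁-col (aP e D) z p = ◁-col e z p
 ◁-col (aZ e D) z p = ◁-col e z p
 ◁-trans : ∀ {a b c d e f}{N : Net a b}{N' : Net c d}{N'' : Net e f}-> N ◁ N' -> N' ◁ N'' -> N ◁ N''
 ◁-trans e done = e
 ◁-trans e (aP f D) = aP (◁-trans e f) D
 ◁-trans e (aZ f D) = aZ (◁-trans e f) D
 liftP-trans : ∀ {a b c d e f}{N : Net a b}{N' : Net c d}{N'' : Net e f}(x : N ◁ N')(y : N' ◁ N'') p ->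
  liftP (◁-trans x y) p ~ liftP y (liftP x p)
 liftP-trans x done p = refl
 liftP-trans x (aP y D) p = cong suc (liftP-trans x y p)
 liftP-trans x (aZ y D) p = liftP-trans x y p
 liftZ-trans : ∀ {a b c d e f}{N : Net a b}{N' : Net c d}{N'' : Net e f}(x : N ◁ N')(y : N' ◁ N'') p ->
  liftZ (◁-trans x y) p ~ liftZ y (liftZ x p)
 liftZ-trans x done p = refl
 liftZ-trans x (aP y D) p = liftZ-trans x y p
 liftZ-trans x (aZ y D) p = cong suc (liftZ-trans x y p)
 bound : ∀ {n}(f : Fin n -> ℕ)-> ∃[ k ] (∀ i -> f i < k)
 bound {zero} f = 0 , \()
 bound {suc n} f with bound (f ∘ suc)
 ... | k , h = suc (f zero) ℕ.⊔ k , \ { zero -> m≤m⊔n (suc (f zero)) k; (suc i)-> ≤-trans (h i)(m≤n⊔m (suc (f zero)) k) }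
 fresh : ∀ {zn pn}(N : Net zn pn) z -> ∃[ k ] (∀ s -> root (fst (pos N z s))< k)
 fresh N z = bound (\s -> root (fst (pos N z s)))
 far-o : ∀ {k i}(a b : ℤ)-> root i < k -> labW (base k , a)(i , b)~ o
 far-o a b h = far _ _ (\e -> <-irrefl (sym e) h)
 links : ∀ {zn pn}(N : Net zn pn)->(Fin pn -> PL)-> Fin zn -> PL -> Set
 links N lam z ℓ = ∃[ s ] (col N z s ~ 0 × lam s ~ ℓ)
 dcol : ∀ {zn pn}(N : Net zn pn)->(Fin pn -> PL)-> Fin zn -> ℕ
 dcol N lam z = suc (maskOf (links N lam z))
 in-mask : ∀ P ℓ -> VPL ℓ -> ℓ # idn -> P ℓ -> mem (maskOf P) ℓ !
 in-mask = mask⇐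
 out-mask : ∀ P ℓ -> Real ℓ -> mem (maskOf P) ℓ ! -> P ℓ
 out-mask P ℓ r m = mask⇒ P ℓ (Real-val r)(Real-#o r)(Real-#w r) m
 suc-inj : ∀ {a b : ℕ}-> suc a ~ suc b -> a ~ b
 suc-inj refl = refl
 0#suc : ∀ {A : Set}{x n : ℕ}-> x ~ 0 -> x ~ suc n -> A
 0#suc refl ()
 -- a new point that is green in no world, or whose colours are prescribed in a set of worlds
 record NewP' {zn pn}(N : Net zn pn) : Set where
  field
   lam : Fin pn -> PL
   tris : ∀ s s' -> Tri (lam s)(pl N s s')(lam s')
   ne : ∀ s -> lam s # idn
   val : ∀ s -> VPL (lam s)
   κ : Fin zn -> Maybe ℕ
   u : Pos
   g1 : ∀ z s -> κ z ~ just 0 -> col N z s ~ 0 -> lam s ~ labW u (pos N z s)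
   g2 : ∀ z s {R}-> κ z ~ just 0 -> col N z s ~ suc R -> mem R (conv (lam s)) !
   g3 : ∀ z s {R}-> κ z ~ just (suc R)-> col N z s ~ 0 -> mem R (lam s) !
   g4 : ∀ z {R}-> κ z ~ just (suc R)-> R < K
  fill : Maybe ℕ -> Fin zn -> ℕ
  fill (just c) z = c
  fill nothing z = dcol N lam z
  full : NewP N
  full .NewP.lam = lam
  full .NewP.κ z = fill (κ z) z
  full .NewP.u z = u
  full .NewP.tris = tris
  full .NewP.ne = ne
  full .NewP.val = val
  full .NewP.g1 z s e with κ z in eq
  full .NewP.g1 z s refl | just .0 = g1 z s eq
  full .NewP.g2 z s e with κ z in eq
  full .NewP.g2 z s refl | just .0 = g2 z s eq
  full .NewP.g3 z s e with κ z in eq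
  full .NewP.g3 z s refl | just .(suc _) = g3 z s eq
  full .NewP.g3 z s refl | nothing = \g -> in-mask _ (lam s)(val s)(ne s)(s , g , refl)
  full .NewP.g4 z e with κ z in eq
  full .NewP.g4 z refl | just .(suc _) = g4 z eq
  full .NewP.g4 z refl | nothing = mask< _
  result : Net zn (suc pn)
  result = addP N full
  rea-new : ∀ z -> κ z ~ nothing -> Rea result z zero
  rea-new z e R c ℓ r m with κ z
  rea-new z refl R refl ℓ r m | nothing with out-mask (links N lam z) ℓ r m
  ... | s , g , e = suc s , g , e
  rea-green : ∀ z -> κ z ~ just 0 -> Rea result z zero
  rea-green z e R c with κ z
  rea-green z refl R () | just .0
  rea-old : ∀ z p -> Rea N z p -> Rea result z (suc p)
  rea-old z p h R c ℓ r m with h R c ℓ r m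
  ... | q , g , e = suc q , g , e
 -- a new point whose colour is prescribed in one world
 record At1 {zn pn}(N : Net zn pn)(z : Fin zn)(k : ℕ) : Set where
  field
   lam : Fin pn -> PL
   tris : ∀ s s' -> Tri (lam s)(pl N s s')(lam s')
   ne : ∀ s -> lam s # idn
   val : ∀ s -> VPL (lam s)
   u : Pos
   g1 : ∀ s -> k ~ 0 -> col N z s ~ 0 -> lam s ~ labW u (pos N z s)
   g2 : ∀ s {R}-> k ~ 0 -> col N z s ~ suc R -> mem R (conv (lam s)) !
   g3 : ∀ s {R}-> k ~ suc R -> col N z s ~ 0 -> mem R (lam s) !
   g4 : ∀ {R}-> k ~ suc R -> R < K
  at : ∀ {z'}-> Dec (z' ~ z)-> Maybe ℕ
  at (yes _) = just k
  at (no _) = nothing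
  is : ∀ {z' n}(d : Dec (z' ~ z))-> at d ~ just n -> z' ~ z × k ~ n
  is (yes e) refl = e , refl
  new : NewP' N
  new = record { lam = lam; tris = tris; ne = ne; val = val; u = u; κ = \z' -> at (z' Fin.≟ z)
   ; g1 = \z' s e -> case is (z' Fin.≟ z) e of \ { (refl , q)-> g1 s q }; g2 = \z' s e -> case is (z' Fin.≟ z) e of \ { (refl , q)-> g2 s q }
   ; g3 = \z' s e -> case is (z' Fin.≟ z) e of \ { (refl , q)-> g3 s q }; g4 = \z' e -> g4 (snd (is (z' Fin.≟ z) e)) }
  open NewP' new public using (result; full; rea-old)
  κz : NewP'.κ new z ~ just k
  κz with z Fin.≟ z
  ... | yes _ = refl
  ... | no n = efq (n refl)
  κ≠ : ∀ z' -> z' # z -> NewP'.κ new z' ~ nothing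
  κ≠ z' n with z' Fin.≟ z
  ... | yes e = efq (n e)
  ... | no _ = refl
  colz : col result z zero ~ k
  colz = cong (\x -> NewP'.fill new x z) κz
  new-or : ∀ z' -> Rea result z' zero ⊎ z' ~ z
  new-or z' = go (z' Fin.≟ z)
   where
   go : Dec (z' ~ z)-> Rea result z' zero ⊎ z' ~ z
   go (yes e) = inr e
   go (no n) = inl (NewP'.rea-new new z' (κ≠ z' n))
  new-green : k ~ 0 -> ∀ z' -> Rea result z' zero
  new-green q z' = [ id , (\ { refl -> NewP'.rea-green new z (κz & cong just q) }) ]′ (new-or z')
 Good : ∀ {zn pn}-> Net zn pn -> Set
 Good N = ∀ z p -> Rea N z p
 record Ext {zn pn}(N : Net zn pn)(C : ∀ {zn' pn'}(N' : Net zn' pn')-> N ◁ N' -> Set) : Set where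
  constructor mkExt
  field
   {zn' pn'} : ℕ
   N' : Net zn' pn'
   ext : N ◁ N'
   good : Good N'
   goal : C N' ext
 module Pick {pn}(p q : Fin pn)(a b : PL) where
  pick : Fin pn -> PL
  pick s with s Fin.≟ p | s Fin.≟ q
  ... | yes _ | _ = a
  ... | no _ | yes _ = b
  ... | no _ | no _ = w
  data Pk (s : Fin pn) : PL -> Set where
   isp : s ~ p -> Pk s a
   isq : s ~ q -> Pk s b
   oth : Pk s w
  pk : ∀ s -> Pk s (pick s)
  pk s with s Fin.≟ p | s Fin.≟ q
  ... | yes e | _ = isp e
  ... | no _ | yes e = isq e
  ... | no _ | no _ = oth
  pick-p : pick p ~ a
  pick-p with p Fin.≟ p
  ... | yes _ = refl
  ... | no ne = efq (ne refl)
  pick-q : (p ~ q -> a ~ b)-> pick q ~ b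
  pick-q h with q Fin.≟ p | q Fin.≟ q
  ... | yes e | _ = h (sym e)
  ... | no _ | yes _ = refl
  ... | no _ | no ne = efq (ne refl)
 module D1 {zn pn}(N : Net zn pn)(gN : Good N)(p q : Fin pn)(a b : PL)
  (t1 : Tri a (pl N p q) b)(t2 : Tri b (pl N q p) a)
  (na : a # idn)(nb : b # idn)(va : VPL a)(vb : VPL b)(ab : p ~ q -> a ~ b) where
  open Pick p q a b
  D : NewP' N
  D .NewP'.lam = pick
  D .NewP'.tris s s' with pick s | pk s | pick s' | pk s'
  ... | .w | oth | β | _ = tri-w1 _ _
  ... | α | _ | .w | oth = tri-w3 _ _
  ... | .a | isp refl | .a | isp refl rewrite plid N p = tri-id a
  ... | .a | isp refl | .b | isq refl = t1
  ... | .b | isq refl | .a | isp refl = t2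
  ... | .b | isq refl | .b | isq refl rewrite plid N q = tri-id b
  D .NewP'.ne s with pick s | pk s
  ... | .w | oth = \()
  ... | .a | isp _ = na
  ... | .b | isq _ = nb
  D .NewP'.val s with pick s | pk s
  ... | .w | oth = tt
  ... | .a | isp _ = va
  ... | .b | isq _ = vb
  D .NewP'.κ z = nothing
  D .NewP'.u = base 0 , + 0
  D .NewP'.g1 z s ()
  D .NewP'.g2 z s ()
  D .NewP'.g3 z s ()
  D .NewP'.g4 z ()
  Goal : ∀ {zn' pn'}(N' : Net zn' pn')-> N ◁ N' -> Set
  Goal N' e = ∃[ r ] (pl N' r (liftP e p)~ a × pl N' r (liftP e q)~ b)
  demand : Ext N Goal
  demand = mkExt (NewP'.result D)(aP done (NewP'.full D))
   (\ { z zero -> NewP'.rea-new D z refl; z (suc x)-> NewP'.rea-old D z x (gN z x) })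
   (zero , pick-p , pick-q ab)
 realList : ∃[ L ] (∀ ℓ -> Real ℓ -> ℓ ∈ L)
 realList = (nx ∷ nx˘ ∷ ft ∷ ft˘ ∷ List.map tl (List.upTo N) ++ List.map tl˘ (List.upTo N)), \
  { .nx nx -> here refl; .nx˘ nx˘ -> there (here refl); .ft ft -> there (there (here refl)); .ft˘ ft˘ -> there (there (there (here refl)))
  ; .(tl _)(tl h)-> there (there (there (there (∈.∈-++⁺ˡ (∈.∈-map⁺ tl (∈.∈-upTo⁺ h))))))
  ; .(tl˘ _)(tl˘ h)-> there (there (there (there (∈.∈-++⁺ʳ (List.map tl (List.upTo N))(∈.∈-map⁺ tl˘ (∈.∈-upTo⁺ h)))))) }
 data _◁P_ : ∀ {zn pn pn'}-> Net zn pn -> Net zn pn' -> Set where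
  done : ∀ {zn pn}{N : Net zn pn}-> N ◁P N
  aP : ∀ {zn pn pn'}{N : Net zn pn}{N' : Net zn pn'}-> N ◁P N' ->(D : NewP N')-> N ◁P addP N' D
 up◁ : ∀ {zn pn pn'}{N : Net zn pn}{N' : Net zn pn'}-> N ◁P N' -> N ◁ N'
 up◁ done = done
 up◁ (aP e D) = aP (up◁ e) D
 lift◁ : ∀ {zn pn pn'}{N : Net zn pn}{N' : Net zn pn'}-> N ◁P N' -> Fin pn -> Fin pn'
 lift◁ done p = p
 lift◁ (aP e D) p = suc (lift◁ e p)
 tr◁ : ∀ {zn a b c}{N : Net zn a}{N' : Net zn b}{N'' : Net zn c}-> N ◁P N' -> N' ◁P N'' -> N ◁P N''
 tr◁ e done = e
 tr◁ e (aP f D) = aP (tr◁ e f) D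
 -- a new green point at a free position, with a given label to the point p if that is not green
 module Green {zn pn}(N : Net zn pn)(z : Fin zn)(p : Fin pn)(v : Pos)(lp : PL)(nlp : lp # idn)(vlp : VPL lp)
  (mlp : ∀ R -> col N z p ~ suc R -> mem R (conv lp) !)
  (tlp : ∀ s R -> col N z s ~ 0 -> col N z p ~ suc R -> Tri lp (pl N p s)(labW v (pos N z s))× Tri (labW v (pos N z s))(pl N s p) lp)
  (free : ∀ s -> col N z s ~ 0 -> pos N z s # v) where
  data L (s : Fin pn) : PL -> Set where
   green : col N z s ~ 0 -> L s (labW v (pos N z s))
   isp : ∀ {R}-> s ~ p -> col N z s ~ suc R -> L s lp
   oth : L s w
  lab : Fin pn -> ℕ -> Bool -> PL
  lab s zero _ = labW v (pos N z s)
  lab s (suc _) true = lp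
  lab s (suc _) false = w
  lm : Fin pn -> PL
  lm s = lab s (col N z s)(does (s Fin.≟ p))
  lv : ∀ s -> L s (lm s)
  lv s with col N z s in ce | s Fin.≟ p
  ... | zero | _ = green ce
  ... | suc _ | yes e = isp e ce
  ... | suc _ | no _ = oth
  lm-green : ∀ s -> col N z s ~ 0 -> lm s ~ labW v (pos N z s)
  lm-green s g = cong (\n -> lab s n (does (s Fin.≟ p))) g
  lm-p : ∀ {R}-> col N z p ~ suc R -> lm p ~ lp
  lm-p c = trans (cong (\n -> lab p n (does (p Fin.≟ p))) c)(aux (p Fin.≟ p))
   where
   aux : ∀ {n}(d : Dec (p ~ p))-> lab p (suc n)(does d)~ lp
   aux (yes _) = refl
   aux (no ne) = efq (ne refl)
  lm-oth : ∀ s {R}-> s # p -> col N z s ~ suc R -> lm s ~ w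
  lm-oth s ne c = trans (cong (\n -> lab s n (does (s Fin.≟ p))) c)(aux (s Fin.≟ p))
   where
   aux : ∀ {n}(d : Dec (s ~ p))-> lab s (suc n)(does d)~ w
   aux (yes e) = efq (ne e)
   aux (no _) = refl
  D : At1 N z 0
  D .At1.lam = lm
  D .At1.tris s s' with lm s | lv s | lm s' | lv s'
  ... | .w | oth | β | _ = tri-w1 _ _
  ... | α | _ | .w | oth = tri-w3 _ _
  ... | ._ | green g | ._ | green g' rewrite grn N z s s' g g' = tri-W v (pos N z s)(pos N z s')
  ... | ._ | isp refl c | ._ | isp refl c' rewrite plid N s = tri-id lp
  ... | ._ | green g | ._ | isp refl c = snd (tlp s _ g c)
  ... | ._ | isp refl c | ._ | green g = fst (tlp s' _ g c)
  D .At1.ne s with lm s | lv s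
  ... | ._ | green g = \e -> free s g (sym (labW-idn v _ e))
  ... | ._ | isp _ _ = nlp
  ... | ._ | oth = \()
  D .At1.val s with lm s | lv s
  ... | ._ | green g = labW-valid _ _
  ... | ._ | isp _ _ = vlp
  ... | ._ | oth = tt
  D .At1.u = v
  D .At1.g1 s _ = lm-green s
  D .At1.g2 s {R} _ g with lm s | lv s
  ... | ._ | green g' = 0#suc g' g
  ... | ._ | isp refl _ = mlp R g
  ... | ._ | oth = mem-w R
  D .At1.g3 s ()
  D .At1.g4 ()
  open At1 D public using (result; full; rea-old; colz; κ≠; new-green)
  good : Good N -> Good result
  good g z' zero = new-green refl z'
  good g z' (suc s) = rea-old z' s (g z' s)
 -- a pending point: its links to greens follow the clone position c
 InF : Pos -> Pos -> Set
 InF c v = ∃[ ℓ ] Σ[ r ∈ Real ℓ ] v ~ fst (sees c ℓ r)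
 InF-root : ∀ {c v}-> InF c v -> root (fst v)~ root (fst c)
 InF-root {c}(ℓ , r , refl) = snd (snd (sees c ℓ r))
 record Pend {zn pn}(N : Net zn pn)(z : Fin zn)(p : Fin pn)(c : Pos)(R : ℕ) : Set where
  field
   colp : col N z p ~ suc R
   onF : ∀ s -> col N z s ~ 0 -> InF c (pos N z s)-> mem R (labW c (pos N z s)) ! -> pl N p s ~ labW c (pos N z s)
   offF : ∀ s -> col N z s ~ 0 -> pl N p s ~ w ⊎ pl N p s ~ labW c (pos N z s)
 module Step {zn pn}(N : Net zn pn)(z : Fin zn)(p : Fin pn)(c : Pos)(R : ℕ)(P : Pend N z p c R)
  (ℓ : PL)(r : Real ℓ)(m : mem R ℓ !) where
  open Pend P
  v : Pos
  v = fst (sees c ℓ r)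
  cv : labW c v ~ ℓ
  cv = fst (snd (sees c ℓ r))
  module New (free : ∀ s -> col N z s ~ 0 -> pos N z s # v) where
   vc : conv (labW v c)~ ℓ
   vc = sym (labW-conv v c)& cv
   p-s : ∀ s R -> col N z s ~ 0 -> col N z p ~ suc R -> Tri (labW v c)(pl N p s)(labW v (pos N z s))× Tri (labW v (pos N z s))(pl N s p)(labW v c)
   p-s s _ g _ with offF s g
   ... | inl e rewrite plcv N p s | e = tri-w2 _ _ , tri-w2 _ _
   ... | inr e rewrite plcv N p s | e | sym (labW-conv c (pos N z s)) = tri-W v c (pos N z s), tri-W v (pos N z s) c
   open Green N z p v (labW v c)(\e -> Real-#idn r (sym vc & cong conv e))(labW-valid v c)
    (\R' g -> trans (cong2 mem (suc-inj (sym g & colp)) vc) m) p-s free public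
    renaming (result to N'')
   p-new : pl N'' (suc p) zero ~ ℓ
   p-new = cong conv (lm-p colp)& vc
   oth-new : ∀ s {R'}-> s # p -> col N z s ~ suc R' -> pl N'' (suc s) zero ~ w
   oth-new s ne g = cong conv (lm-oth s ne g)
   pend'' : Pend N'' z (suc p) c R
   pend'' = record
    { colp = colp
    ; onF = \ { zero _ _ _ -> trans p-new (sym cv); (suc s) g f m -> onF s g f m }
    ; offF = \ { zero _ -> inr (p-new & sym cv); (suc s) g -> offF s g } }
   others'' : ∀ z' p' c' R' -> Pend N z' p' c' R' ->(z' # z ⊎ (p' # p × root (fst c')# root (fst c)))->
    Pend N'' z' (suc p') c' R'
   others'' z' p' c' R' P' h = aux (z' Fin.≟ z) h
    where
    aux : Dec (z' ~ z)->(z' # z ⊎ (p' # p × root (fst c')# root (fst c)))-> Pend N'' z' (suc p') c' R'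
    aux (yes refl)(inl ne) = efq (ne refl)
    aux (no ne) _ = record
     { colp = Pend.colp P'
     ; onF = \ { zero g -> efq (absurd g); (suc s) g -> Pend.onF P' s g }
     ; offF = \ { zero g -> efq (absurd g); (suc s) g -> Pend.offF P' s g } }
     where
     absurd : col N'' z' zero # 0
     absurd g with trans (sym g)(cong (\k -> NewP'.fill (At1.new D) k z')(κ≠ z' ne))
     ... | ()
    aux (yes refl)(inr (np , nr)) = record
     { colp = Pend.colp P'
     ; onF = \ { zero g f m -> efq (nr (sym (InF-root f)& snd (snd (sees c ℓ r)))); (suc s) g -> Pend.onF P' s g }
     ; offF = \ { zero g -> inl (oth-new p' np (Pend.colp P')); (suc s) g -> Pend.offF P' s g } }
 record Res {zn pn}(N : Net zn pn)(z : Fin zn)(p : Fin pn)(c : Pos)(R : ℕ)(L : List PL) : Set where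
  field
   {pn'} : ℕ
   N' : Net zn pn'
   e : N ◁P N'
   pend : Pend N' z (lift◁ e p) c R
   got : ∀ ℓ -> ℓ ∈ L -> Real ℓ -> mem R ℓ ! -> ∃[ q ] (col N' z q ~ 0 × pl N' (lift◁ e p) q ~ ℓ)
   others : ∀ z' p' c' R' -> Pend N z' p' c' R' ->(z' # z ⊎ (p' # p × root (fst c')# root (fst c)))->
    Pend N' z' (lift◁ e p') c' R'
   keep : ∀ z' p' -> Rea N z' p' -> Rea N' z' (lift◁ e p')
   new : ∀ z' p'' ->(∃[ p' ] p'' ~ lift◁ e p')⊎ Rea N' z' p''
 lift-inj : ∀ {zn pn pn'}{N : Net zn pn}{N' : Net zn pn'}(e : N ◁P N'){p q}-> lift◁ e p ~ lift◁ e q -> p ~ q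
 lift-inj done refl = refl
 lift-inj (aP e D) pq = lift-inj e (Fin.suc-injective pq)
 realizeL : ∀ {zn pn}(N : Net zn pn) z p c R -> Pend N z p c R -> ∀ L -> Res N z p c R L
 realizeL N z p c R P [] = record
  { N' = N; e = done; pend = P; got = \ℓ (); others = \_ _ _ _ P' _ -> P'; keep = \_ _ h -> h; new = \_ p'' -> inl (p'' , refl) }
 realizeL {zn} N z p c R P (ℓ ∷ L) with realizeL N z p c R P L
 ... | r0 = go (em 0ℓ)
  where
  open Res r0
  stay : (Real ℓ -> mem R ℓ ! -> ∃[ q ] (col N' z q ~ 0 × pl N' (lift◁ e p) q ~ ℓ))-> Res N z p c R (ℓ ∷ L)
  stay h = record { N' = N'; e = e; pend = pend; others = others; keep = keep; new = new
   ; got = \ { ._ (here refl) r m -> h r m; ℓ' (there i) r m -> got ℓ' i r m } }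
  module _ (r : Real ℓ)(m : mem R ℓ !) where
   open Step N' z (lift◁ e p) c R pend ℓ r m
   grow : (∀ s -> col N' z s ~ 0 -> pos N' z s # v)-> Res N z p c R (ℓ ∷ L)
   grow free = record
    { N' = N''; e = aP e full; pend = pend''
    ; got = \ { ._ (here refl) r m -> zero , colz , p-new
     ; ℓ' (there i) r m -> let q , g , qe = got ℓ' i r m in suc q , g , qe }
    ; others = \z' p' c' R' P' h -> others'' z' (lift◁ e p') c' R' (others z' p' c' R' P' h)
     (case h of \ { (inl a)-> inl a; (inr (a , b))-> inr ((\pe -> a (lift-inj e pe)), b) })
    ; keep = \z' p' h -> rea-old z' (lift◁ e p')(keep z' p' h)
    ; new = \ { z' zero -> inr (new-green refl z')
     ; z' (suc p'')-> [ (\(p' , pe)-> inl (p' , cong suc pe)), (\h -> inr (rea-old z' p'' h)) ]′ (new z' p'') } }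
    where open New free
   occupied : (∃[ s ] (col N' z s ~ 0 × pos N' z s ~ v))-> Res N z p c R (ℓ ∷ L)
   occupied (s , g , se) = stay \_ _ -> s , g , trans (Pend.onF pend s g (ℓ , r , se)(cong (mem R)(cong (labW c) se & cv)& m))(cong (labW c) se & cv)
   decide : Dec (∃[ s ] (col N' z s ~ 0 × pos N' z s ~ v))-> Res N z p c R (ℓ ∷ L)
   decide (yes h) = occupied h
   decide (no h) = grow \s g se -> h (s , g , se)
  go : Dec (Real ℓ × mem R ℓ !)-> Res N z p c R (ℓ ∷ L)
  go (yes (r , m)) = decide r m (em 0ℓ)
  go (no h) = stay \r m -> efq (h (r , m))
 -- all pending pairs of a set can be realized one after the other
 record Done {zn pn}(N : Net zn pn)(z : Fin zn)(p : Fin pn) : Set where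
  field
   {pn'} : ℕ
   N' : Net zn pn'
   e : N ◁P N'
   rea : Rea N' z (lift◁ e p)
   keep : ∀ z' p' -> Rea N z' p' -> Rea N' z' (lift◁ e p')
   new : ∀ z' p'' ->(∃[ p' ] p'' ~ lift◁ e p')⊎ Rea N' z' p''
 realize : ∀ {zn pn}(N : Net zn pn) z p c R -> Pend N z p c R ->
  Σ[ D ∈ Done N z p ] (∀ z' p' c' R' -> Pend N z' p' c' R' ->(z' # z ⊎ (p' # p × root (fst c')# root (fst c)))->
   Pend (Done.N' D) z' (lift◁ (Done.e D) p') c' R')
 realize N z p c R P = record
  { N' = N'; e = e; keep = keep; new = new
  ; rea = \R' c ℓ r m -> got ℓ (snd realList ℓ r) r (subst (\x -> mem x ℓ !)(suc-inj (sym c & Pend.colp pend)) m) }, others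
  where open Res (realizeL N z p c R P (fst realList))
 record Fin' {zn pn}(N : Net zn pn) : Set where
  field
   {pn'} : ℕ
   N' : Net zn pn'
   e : N ◁P N'
   good : Good N'
 finish1 : ∀ {zn pn}(N : Net zn pn) z p c R -> Pend N z p c R ->(∀ z' p' -> Rea N z' p' ⊎ (z' ~ z × p' ~ p))-> Fin' N
 finish1 N z p c R P h with realize N z p c R P
 ... | D , _ = record { N' = Done.N' D; e = Done.e D; good = \z' p'' -> aux z' p'' (Done.new D z' p'') }
  where
  aux : ∀ z' p'' ->(∃[ p' ] p'' ~ lift◁ (Done.e D) p')⊎ Rea (Done.N' D) z' p'' -> Rea (Done.N' D) z' p''
  aux z' p'' (inr r) = r
  aux z' ._ (inl (p' , refl)) with h z' p'
  ... | inl r = Done.keep D z' p' r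
  ... | inr (refl , refl) = Done.rea D
 finish2 : ∀ {zn pn}(N : Net zn pn) z p c R z1 p1 c1 R1 -> Pend N z p c R -> Pend N z1 p1 c1 R1 ->
  (z1 # z ⊎ (p1 # p × root (fst c1)# root (fst c)))->
  (∀ z' p' -> Rea N z' p' ⊎ ((z' ~ z × p' ~ p)⊎ (z' ~ z1 × p' ~ p1)))-> Fin' N
 finish2 N z p c R z1 p1 c1 R1 P P1 dj h with realize N z p c R P
 ... | D , oth with finish1 (Done.N' D) z1 (lift◁ (Done.e D) p1) c1 R1 (oth z1 p1 c1 R1 P1 dj)(\z' p'' -> aux z' p'' (Done.new D z' p''))
  where
  aux : ∀ z' p'' ->(∃[ p' ] p'' ~ lift◁ (Done.e D) p')⊎ Rea (Done.N' D) z' p'' ->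
   Rea (Done.N' D) z' p'' ⊎ (z' ~ z1 × p'' ~ lift◁ (Done.e D) p1)
  aux z' p'' (inr r) = inl r
  aux z' ._ (inl (p' , refl)) with h z' p'
  ... | inl r = inl (Done.keep D z' p' r)
  ... | inr (inl (refl , refl)) = inl (Done.rea D)
  ... | inr (inr (refl , refl)) = inr (refl , refl)
 ... | F = record { N' = Fin'.N' F; e = tr◁ (Done.e D)(Fin'.e F); good = Fin'.good F }
 trivial : ∀ {zn pn}(N : Net zn pn)-> Good N -> Fin' N
 trivial N g = record { N' = N; e = done; good = g }
 -- what a demand asks for
 GZP : ∀ {zn pn}(z : Fin zn)(p : Fin pn)-> ℕ -> PL -> {N : Net zn pn}-> ∀ {zn' pn'}(N' : Net zn' pn')-> N ◁ N' -> Set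
 GZP z p κ a N' e = ∃[ r ] (col N' (liftZ e z) r ~ κ × pl N' r (liftP e p)~ a)
 GZZ : ∀ {zn pn}(z z1 : Fin zn)-> ℕ -> ℕ -> {N : Net zn pn}-> ∀ {zn' pn'}(N' : Net zn' pn')-> N ◁ N' -> Set
 GZZ z z1 κ κ1 N' e = ∃[ r ] (col N' (liftZ e z) r ~ κ × col N' (liftZ e z1) r ~ κ1)
 GPP : ∀ {zn pn}(p q : Fin pn)-> ℕ -> ℕ -> {N : Net zn pn}-> ∀ {zn' pn'}(N' : Net zn' pn')-> N ◁ N' -> Set
 GPP p q κ κ1 N' e = ∃[ z ] (col N' z (liftP e p)~ κ × col N' z (liftP e q)~ κ1 × (∀ z0 -> liftZ e z0 # z))
 liftZ-inj : ∀ {zn pn zn' pn'}{N : Net zn pn}{N' : Net zn' pn'}(e : N ◁ N'){z z'}-> liftZ e z ~ liftZ e z' -> z ~ z'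
 liftZ-inj done h = h
 liftZ-inj (aP e D) h = liftZ-inj e h
 liftZ-inj (aZ e D) h = liftZ-inj e (Fin.suc-injective h)
 carryZP : ∀ {a b c d m n}{N : Net a b}{N1 : Net c d}{N2 : Net m n}{z p κ ℓ}(x : N ◁ N1)(y : N1 ◁ N2)->
  GZP z p κ ℓ N1 x -> GZP z p κ ℓ N2 (◁-trans x y)
 carryZP {z = z}{p} x y (r , h , k) rewrite liftZ-trans x y z | liftP-trans x y p =
  liftP y r , trans (◁-col y _ _) h , trans (◁-pl y _ _) k
 carryZZ : ∀ {a b c d m n}{N : Net a b}{N1 : Net c d}{N2 : Net m n}{z z1 κ κ1}(x : N ◁ N1)(y : N1 ◁ N2)->
  GZZ z z1 κ κ1 N1 x -> GZZ z z1 κ κ1 N2 (◁-trans x y)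
 carryZZ {z = z}{z1} x y (r , h , k) rewrite liftZ-trans x y z | liftZ-trans x y z1 =
  liftP y r , trans (◁-col y _ _) h , trans (◁-col y _ _) k
 carryPP : ∀ {a b c d m n}{N : Net a b}{N1 : Net c d}{N2 : Net m n}{p q κ κ1}(x : N ◁ N1)(y : N1 ◁ N2)->
  GPP p q κ κ1 N1 x -> GPP p q κ κ1 N2 (◁-trans x y)
 carryPP {p = p}{q} x y (z , h , k , f) rewrite liftP-trans x y p | liftP-trans x y q =
  liftZ y z , trans (◁-col y _ _) h , trans (◁-col y _ _) k , \z0 e -> f z0 (liftZ-inj y (sym (liftZ-trans x y z0)& e))
 view≠ : ∀ a -> VPL a -> a # idn -> a # w ->(a ~ o)⊎ Real a
 view≠ a v ni nw with view a v
 ... | idn = efq (ni refl)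
 ... | o = inl refl
 ... | w = efq (nw refl)
 ... | re r = inr r
 Real-conv : ∀ {a}-> Real a -> Real (conv a)
 Real-conv nx = nx˘
 Real-conv nx˘ = nx
 Real-conv ft = ft˘
 Real-conv ft˘ = ft
 Real-conv (tl h) = tl˘ h
 Real-conv (tl˘ h) = tl h
 -- a position seen from u with a given in-world label
 seen : ∀ u a -> VPL a -> a # idn -> a # w -> ∃[ v ] labW v u ~ a
 seen u a va ni nw with view≠ a va ni nw
 ... | inl refl = let v , e = sees-o u in v , trans (labW-conv u v)(cong conv e)
 ... | inr r = let v , e , _ = sees u (conv a)(Real-conv r) in v , trans (labW-conv u v)(cong conv e & cc a)
 module D3 {zn pn}(N : Net zn pn)(gN : Good N)(z : Fin zn)(p : Fin pn)(κ' : ℕ)(a : PL)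
  (na : a # idn)(va : VPL a)
  (h0 : col N z p ~ 0 -> κ' ~ 0 -> a # w)
  (h1 : ∀ R -> col N z p ~ 0 -> κ' ~ suc R -> mem R a !)
  (h2 : ∀ R -> col N z p ~ suc R -> κ' ~ 0 -> mem R (conv a) !)
  (h3 : ∀ R -> κ' ~ suc R -> R < K) where
  Goal : ∀ {zn' pn'}(N' : Net zn' pn')-> N ◁ N' -> Set
  Goal = GZP z p κ' a
  kf : ℕ
  kf = fst (fresh N z)
  vf : Pos
  vf = base kf , + 0
  vf-far : ∀ s -> labW vf (pos N z s)~ o
  vf-far s = far-o _ _ (snd (fresh N z) s)
  vf-root : ∀ s -> root (fst (pos N z s))# root (fst vf)
  vf-root s e = <-irrefl e (snd (fresh N z) s)
  caseA : col N z p ~ 0 -> κ' ~ 0 -> Ext N Goal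
  caseA c k with seen (pos N z p) a va na (h0 c k)
  ... | v , e with em 0ℓ {∃[ s ] (col N z s ~ 0 × pos N z s ~ v)}
  ... | yes (s , g , refl) = mkExt N done gN (s , trans g (sym k), trans (grn N z s p g c) e)
  ... | no f = mkExt result (aP done full)(good gN)(zero , trans colz (sym k), trans (lm-green p c) e)
   where
   t : ∀ s R -> col N z s ~ 0 -> col N z p ~ suc R -> Tri w (pl N p s)(labW v (pos N z s))× Tri (labW v (pos N z s))(pl N s p) w
   t s R _ q = 0#suc c q
   open Green N z p v w (\()) tt (\R _ -> mem-w R) t (\s g se -> f (s , g , se))
  caseC : ∀ R -> col N z p ~ suc R -> κ' ~ 0 -> Ext N Goal
  caseC R c k with em 0ℓ {a ~ o ⊎ a ~ w}
  ... | yes h = mkExt result (aP done full)(good gN)(zero , trans colz (sym k), lm-p c)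
   where
   t : a ~ o ⊎ a ~ w -> ∀ s R -> col N z s ~ 0 -> col N z p ~ suc R -> Tri a (pl N p s)(labW vf (pos N z s))× Tri (labW vf (pos N z s))(pl N s p) a
   t (inl refl) s _ _ _ rewrite vf-far s = tri-oo _ , tri-oo _
   t (inr refl) s _ _ _ = tri-w1 _ _ , tri-w3 _ _
   open Green N z p vf a na va (\R q -> h2 R q k)(t h)(\s g se -> vf-root s (cong (root ∘ fst) se))
  ... | no h with gN z p R c (conv a)(Real-conv (real a va na (h ∘ inl)(h ∘ inr)))(h2 R c k)
  ... | q , g , e = mkExt N done gN (q , trans g (sym k), trans (plcv N p q)(cong conv e & cc a))
  module Clone (R : ℕ)(k : κ' ~ suc R)(c : Pos)
   (hc : (col N z p ~ 0 × a ~ labW c (pos N z p))⊎ ((∀ s -> ¬ InF c (pos N z s))× (∀ s -> labW c (pos N z s)~ o)× (col N z p ~ 0 -> a ~ w))) where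
   Fs : Fin pn -> Set
   Fs s = col N z s ~ 0 × InF c (pos N z s)× mem R (labW c (pos N z s)) !
   data L (s : Fin pn) : PL -> Set where
    isp : s ~ p -> L s a
    inF : Fs s -> L s (labW c (pos N z s))
    oth : L s w
   lm : Fin pn -> PL
   lm s with s Fin.≟ p | em 0ℓ {Fs s}
   ... | yes _ | _ = a
   ... | no _ | yes _ = labW c (pos N z s)
   ... | no _ | no _ = w
   lv : ∀ s -> L s (lm s)
   lv s with s Fin.≟ p | em 0ℓ {Fs s}
   ... | yes e | _ = isp e
   ... | no _ | yes f = inF f
   ... | no _ | no _ = oth
   lm-p : lm p ~ a
   lm-p with p Fin.≟ p | em 0ℓ {Fs p}
   ... | yes _ | _ = refl
   ... | no ne | _ = efq (ne refl)
   lm-F : ∀ s -> Fs s -> lm s ~ labW c (pos N z s)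
   lm-F s f with s Fin.≟ p | em 0ℓ {Fs s}
   ... | no _ | yes _ = refl
   ... | no _ | no nf = efq (nf f)
   ... | yes refl | _ = [ snd , (\(nf , _)-> efq (nf s (fst (snd f)))) ]′ hc
   pF : ∀ s -> Fs s -> Tri a (pl N p s)(labW c (pos N z s))× Tri (labW c (pos N z s))(pl N s p) a
   pF s (g , f , _) = [ (\(gp , e)-> subst₂ (\x y -> Tri a x (labW c (pos N z s))× Tri (labW c (pos N z s)) y a)
    (sym (grn N z p s gp g))(sym (grn N z s p g gp))
    (subst (\x -> Tri x (labW (pos N z p)(pos N z s))(labW c (pos N z s))× Tri (labW c (pos N z s))(labW (pos N z s)(pos N z p)) x)(sym e)
     (tri-W c (pos N z p)(pos N z s), tri-W c (pos N z s)(pos N z p))))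
    , (\(nf , _)-> efq (nf s f)) ]′ hc
   D : At1 N z (suc R)
   D .At1.lam = lm
   D .At1.tris s s' with lm s | lv s | lm s' | lv s'
   ... | .w | oth | β | _ = tri-w1 _ _
   ... | α | _ | .w | oth = tri-w3 _ _
   ... | ._ | inF (g , _) | ._ | inF (g' , _) rewrite grn N z s s' g g' = tri-W c (pos N z s)(pos N z s')
   ... | ._ | isp refl | ._ | isp refl rewrite plid N s = tri-id _
   ... | ._ | inF f | ._ | isp refl = snd (pF s f)
   ... | ._ | isp refl | ._ | inF f = fst (pF s' f)
   D .At1.ne s with lm s | lv s
   ... | ._ | inF (_ , (ℓ , r , f), _) = \e -> Real-#idn r (sym (fst (snd (sees c ℓ r)))& cong (labW c)(sym f)& e)
   ... | ._ | isp e = na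
   ... | ._ | oth = \()
   D .At1.val s with lm s | lv s
   ... | ._ | inF _ = labW-valid _ _
   ... | ._ | isp e = va
   ... | ._ | oth = tt
   D .At1.u = vf
   D .At1.g1 s ()
   D .At1.g2 s ()
   D .At1.g3 s refl g with lm s | lv s
   ... | ._ | inF (_ , _ , m) = m
   ... | ._ | isp refl = h1 R g k
   ... | ._ | oth = mem-w R
   D .At1.g4 refl = h3 R k
   open At1 D renaming (result to N1)
   off : ∀ s -> col N z s ~ 0 -> lm s ~ w ⊎ lm s ~ labW c (pos N z s)
   off s g with lm s | lv s
   ... | ._ | inF _ = inr refl
   ... | ._ | oth = inl refl
   ... | ._ | isp refl = [ (\(_ , e)-> inr e), (\(_ , _ , e)-> inl (e g)) ]′ hc
   P : Pend N1 z zero c R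
   P .Pend.colp = colz
   P .Pend.onF zero g f m = 0#suc g colz
   P .Pend.onF (suc s) g f m = lm-F s (g , f , m)
   P .Pend.offF zero g = 0#suc g colz
   P .Pend.offF (suc s) g = off s g
   rest : ∀ z' p' -> Rea N1 z' p' ⊎ (z' ~ z × p' ~ zero)
   rest z' (suc p') = inl (rea-old z' p' (gN z' p'))
   rest z' zero = [ inl , (\e -> inr (e , refl)) ]′ (new-or z')
   ext : Ext N Goal
   ext with finish1 N1 z zero c R P rest
   ... | F = mkExt (Fin'.N' F)(◁-trans (aP done full)(up◁ (Fin'.e F)))(Fin'.good F)
    (carryZP {z = z}{p = p}{κ = κ'}{ℓ = a}(aP done full)(up◁ (Fin'.e F))(zero , trans colz (sym k), lm-p))
  InF-far : ∀ s -> ¬ InF vf (pos N z s)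
  InF-far s f = vf-root s (InF-root f)
  caseB : ∀ R -> κ' ~ suc R -> Ext N Goal
  caseB R k with em 0ℓ {col N z p ~ 0 × a # w}
  ... | yes (c , nw) = let v , e = seen (pos N z p) a va na nw in Clone.ext R k v (inl (c , sym e))
  ... | no h = Clone.ext R k vf (inr (InF-far , vf-far , \c -> aw c))
   where
   aw : col N z p ~ 0 -> a ~ w
   aw c with em 0ℓ {a ~ w}
   ... | yes e = e
   ... | no ne = efq (h (c , ne))
  demand : Ext N Goal
  demand = aux κ' (col N z p) refl refl
   where
   aux : ∀ k n -> κ' ~ k -> col N z p ~ n -> Ext N Goal
   aux (suc R) _ k c = caseB R k
   aux zero zero k c = caseA c k
   aux zero (suc R) k c = caseC R c k
 module D5 {zn pn}(N : Net zn pn)(gN : Good N)(z z1 : Fin zn)(z# : z # z1)(κ κ1 : ℕ)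
  (b : ∀ R -> κ ~ suc R -> R < K)(b1 : ∀ R -> κ1 ~ suc R -> R < K) where
  kk : ∃[ k ] ∀ s -> root (fst (pos N z s))< k × root (fst (pos N z1 s))< k
  kk = let k , h = fresh N z; k1 , h1 = fresh N z1 in
   k ℕ.⊔ k1 , \s -> ≤-trans (h s)(m≤m⊔n k k1), ≤-trans (h1 s)(m≤n⊔m k k1)
  c : Pos
  c = base (fst kk), + 0
  Gs : Fin pn -> Set
  Gs s = (κ ~ 0 × col N z s ~ 0)⊎ (κ1 ~ 0 × col N z1 s ~ 0)
  lab : ∀ {s}-> Dec (Gs s)-> PL
  lab (yes _) = o
  lab (no _) = w
  lm : Fin pn -> PL
  lm s = lab (em 0ℓ {Gs s})
  data L : PL -> Set where
   o : L o
   w : L w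
  lv : ∀ s -> L (lm s)
  lv s with em 0ℓ {Gs s}
  ... | yes _ = o
  ... | no _ = w
  lm-G : ∀ s -> Gs s -> lm s ~ o
  lm-G s g with em 0ℓ {Gs s}
  ... | yes _ = refl
  ... | no ng = efq (ng g)
  cz : ∀ s -> labW c (pos N z s)~ o
  cz s = far-o _ _ (fst (snd kk s))
  cz1 : ∀ s -> labW c (pos N z1 s)~ o
  cz1 s = far-o _ _ (snd (snd kk s))
  kap : ∀ {z'}-> Dec (z' ~ z)-> Dec (z' ~ z1)-> Maybe ℕ
  kap (yes _) _ = just κ
  kap (no _)(yes _) = just κ1
  kap (no _)(no _) = nothing
  data Kv (z' : Fin zn) : Maybe ℕ -> Set where
   isz : z' ~ z -> Kv z' (just κ)
   isz1 : z' ~ z1 -> Kv z' (just κ1)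
   oth : z' # z -> z' # z1 -> Kv z' nothing
  kv : ∀ {z'}(d : Dec (z' ~ z))(d1 : Dec (z' ~ z1))-> Kv z' (kap d d1)
  kv (yes e) _ = isz e
  kv (no _)(yes e) = isz1 e
  kv (no a)(no b) = oth a b
  D : NewP' N
  D .NewP'.lam = lm
  D .NewP'.tris s s' with lm s | lv s | lm s' | lv s'
  ... | .w | w | β | _ = tri-w1 _ _
  ... | α | _ | .w | w = tri-w3 _ _
  ... | .o | o | .o | o = tri-oo (pl N s s')
  D .NewP'.ne s with lm s | lv s
  ... | ._ | o = \()
  ... | ._ | w = \()
  D .NewP'.val s with lm s | lv s
  ... | ._ | o = tt
  ... | ._ | w = tt
  D .NewP'.κ z' = kap (z' Fin.≟ z)(z' Fin.≟ z1)
  D .NewP'.u = c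
  D .NewP'.g1 z' s e g with kap (z' Fin.≟ z)(z' Fin.≟ z1) | kv (z' Fin.≟ z)(z' Fin.≟ z1)
  D .NewP'.g1 z' s refl g | ._ | isz refl = lm-G s (inl (refl , g))& sym (cz s)
  D .NewP'.g1 z' s refl g | ._ | isz1 refl = lm-G s (inr (refl , g))& sym (cz1 s)
  D .NewP'.g2 z' s {R} e g with lm s | lv s
  ... | ._ | o = mem-o R
  ... | ._ | w = mem-w R
  D .NewP'.g3 z' s {R} e g with lm s | lv s
  ... | ._ | o = mem-o R
  ... | ._ | w = mem-w R
  D .NewP'.g4 z' {R} e with kap (z' Fin.≟ z)(z' Fin.≟ z1) | kv (z' Fin.≟ z)(z' Fin.≟ z1)
  D .NewP'.g4 z' refl | ._ | isz refl = b _ refl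
  D .NewP'.g4 z' refl | ._ | isz1 refl = b1 _ refl
  N1 = NewP'.result D
  kz : NewP'.κ D z ~ just κ
  kz with kap (z Fin.≟ z)(z Fin.≟ z1) | kv (z Fin.≟ z)(z Fin.≟ z1)
  ... | ._ | isz _ = refl
  ... | ._ | isz1 e = efq (z# e)
  ... | ._ | oth n _ = efq (n refl)
  kz1 : NewP'.κ D z1 ~ just κ1
  kz1 with kap (z1 Fin.≟ z)(z1 Fin.≟ z1) | kv (z1 Fin.≟ z)(z1 Fin.≟ z1)
  ... | ._ | isz e = efq (z# (sym e))
  ... | ._ | isz1 e = refl
  ... | ._ | oth _ n = efq (n refl)
  cl : col N1 z zero ~ κ
  cl = cong (\x -> NewP'.fill D x z) kz
  cl1 : col N1 z1 zero ~ κ1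
  cl1 = cong (\x -> NewP'.fill D x z1) kz1
  pend : ∀ z' R ->(∀ s -> labW c (pos N z' s)~ o)->(∀ s -> root (fst (pos N z' s))< fst kk)-> col N1 z' zero ~ suc R -> Pend N1 z' zero c R
  pend z' R fo fr e = record
   { colp = e
   ; onF = \ { zero g f m -> 0#suc g e; (suc s) g f m -> efq (<-irrefl (InF-root f)(fr s)) }
   ; offF = \ { zero g -> 0#suc g e
    ; (suc s) g -> off s } }
   where
   off : ∀ s -> lm s ~ w ⊎ lm s ~ labW c (pos N z' s)
   off s with lm s | lv s
   ... | ._ | o = inr (sym (fo s))
   ... | ._ | w = inl refl
  rest : ∀ z' p' -> Rea N1 z' p' ⊎ ((z' ~ z × p' ~ zero)⊎ (z' ~ z1 × p' ~ zero))
  rest z' (suc p') = inl (NewP'.rea-old D z' p' (gN z' p'))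
  rest z' zero = aux (z' Fin.≟ z)(z' Fin.≟ z1)
   where
   aux : Dec (z' ~ z)-> Dec (z' ~ z1)-> Rea N1 z' zero ⊎ ((z' ~ z × zero ~ zero)⊎ (z' ~ z1 × zero ~ zero))
   aux (yes e) _ = inr (inl (e , refl))
   aux (no _)(yes e) = inr (inr (e , refl))
   aux (no n)(no n1) = inl (NewP'.rea-new D z' kn)
    where
    kn : NewP'.κ D z' ~ nothing
    kn with kap (z' Fin.≟ z)(z' Fin.≟ z1) | kv (z' Fin.≟ z)(z' Fin.≟ z1)
    ... | ._ | isz e = efq (n e)
    ... | ._ | isz1 e = efq (n1 e)
    ... | ._ | oth _ _ = refl
  fin : ∀ k k1 -> κ ~ k -> κ1 ~ k1 -> Fin' N1
  fin zero zero e e1 = trivial N1 \z' p' -> [ id , [ (\ { (refl , refl)-> NewP'.rea-green D z (kz & cong just e) })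
   , (\ { (refl , refl)-> NewP'.rea-green D z1 (kz1 & cong just e1) }) ]′ ]′ (rest z' p')
  fin (suc R) zero e e1 = finish1 N1 z zero c R (pend z R cz (\s -> fst (snd kk s))(cl & e)) \z' p' ->
   [ inl , [ inr , (\ { (refl , refl)-> inl (NewP'.rea-green D z1 (kz1 & cong just e1)) }) ]′ ]′ (rest z' p')
  fin zero (suc R) e e1 = finish1 N1 z1 zero c R (pend z1 R cz1 (\s -> snd (snd kk s))(cl1 & e1)) \z' p' ->
   [ inl , [ (\ { (refl , refl)-> inl (NewP'.rea-green D z (kz & cong just e)) }), inr ]′ ]′ (rest z' p')
  fin (suc R)(suc R1) e e1 = finish2 N1 z zero c R z1 zero c R1
   (pend z R cz (\s -> fst (snd kk s))(cl & e))(pend z1 R1 cz1 (\s -> snd (snd kk s))(cl1 & e1))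
   (inl (\x -> z# (sym x))) rest
  demand : Ext N (GZZ z z1 κ κ1)
  demand = mkExt (Fin'.N' F)(◁-trans (aP done (NewP'.full D))(up◁ (Fin'.e F)))(Fin'.good F)
   (carryZZ {z = z}{z1 = z1}{κ = κ}{κ1 = κ1}(aP done (NewP'.full D))(up◁ (Fin'.e F))(zero , cl , cl1))
   where F = fin κ κ1 refl refl
 module D2 {zn pn}(N : Net zn pn)(gN : Good N)(p q : Fin pn)(p#q : p # q)(κ κ1 : ℕ)
  (b : ∀ R -> κ ~ suc R -> R < K)(b1 : ∀ R -> κ1 ~ suc R -> R < K)
  (cp cq : Pos)
  (hgg : κ ~ 0 -> κ1 ~ 0 -> pl N p q ~ labW cp cq)
  (hgn : (κ ~ 0 × ∃[ R ] κ1 ~ suc R)⊎ ((∃[ R ] κ ~ suc R)× κ1 ~ 0)->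
   (pl N p q ~ labW cp cq)⊎ (pl N p q ~ w × root (fst cp)# root (fst cq)))
  (hnn : ∀ {R R1}-> κ ~ suc R -> κ1 ~ suc R1 -> root (fst cp)# root (fst cq))
  (m : ∀ R -> κ ~ suc R -> κ1 ~ 0 -> mem R (pl N p q) !)
  (m1 : ∀ R -> κ ~ 0 -> κ1 ~ suc R -> mem R (conv (pl N p q)) !) where
  data W3 (s : Fin pn) : Set where
   isp : s ~ p -> W3 s
   isq : s ~ q -> W3 s
   oth : s # p -> s # q -> W3 s
  w3 : ∀ s -> W3 s
  w3 s with s Fin.≟ p | s Fin.≟ q
  ... | yes e | _ = isp e
  ... | no _ | yes e = isq e
  ... | no a | no c = oth a c
  Gr : Fin pn -> Set
  Gr t = (t ~ p × κ ~ 0)⊎ (t ~ q × κ1 ~ 0)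
  Lk : Fin pn -> PL -> Set
  Lk s ℓ = ∃[ t ] (Gr t × pl N s t ~ ℓ)
  kp : ∀ s -> W3 s -> ℕ
  kp s (isp _) = κ
  kp s (isq _) = κ1
  kp s (oth _ _) = suc (maskOf (Lk s))
  ps : ∀ {s}-> W3 s -> Pos
  ps (isp _) = cp
  ps (isq _) = cq
  ps (oth _ _) = cp
  gr : ∀ s (x : W3 s)-> kp s x ~ 0 -> Gr s
  gr s (isp e) k = inl (e , k)
  gr s (isq e) k = inr (e , k)
  D : NewZ N
  D .NewZ.κ s = kp s (w3 s)
  D .NewZ.u s = ps (w3 s)
  D .NewZ.h1 s t e e1 = go (w3 s)(w3 t) e e1
   where
   go : (x : W3 s)(y : W3 t)-> kp s x ~ 0 -> kp t y ~ 0 -> pl N s t ~ labW (ps x)(ps y)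
   go (isp refl)(isp refl) e e1 = plid N p & sym (labW-refl cp)
   go (isp refl)(isq refl) e e1 = hgg e e1
   go (isq refl)(isp refl) e e1 = plcv N p q & cong conv (hgg e1 e)& sym (labW-conv cp cq)
   go (isq refl)(isq refl) e e1 = plid N q & sym (labW-refl cq)
  D .NewZ.h2 s t {R} e e1 = go (w3 s)(w3 t) e e1
   where
   go : (x : W3 s)(y : W3 t)-> kp s x ~ suc R -> kp t y ~ 0 -> mem R (pl N s t) !
   go (isp refl)(isp refl) e e1 = 0#suc e1 e
   go (isp refl)(isq refl) e e1 = m R e e1
   go (isq refl)(isp refl) e e1 = cong (mem R)(plcv N p q)& m1 R e1 e
   go (isq refl)(isq refl) e e1 = 0#suc e1 e
   go (oth a c) y refl e1 = mask⇐ (Lk s)(pl N s t)(plva N s t)(\i -> ni y e1 (plne N s t i))(t , gr t y e1 , refl)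
    where
    ni : (y : W3 t)-> kp t y ~ 0 -> s # t
    ni (isp refl) e = a
    ni (isq refl) e = c
  D .NewZ.h3 s {R} e = go (w3 s) e
   where
   go : (x : W3 s)-> kp s x ~ suc R -> R < K
   go (isp refl) e = b R e
   go (isq refl) e = b1 R e
   go (oth a c) refl = mask< (Lk s)
  N1 : Net (suc zn) pn
  N1 = addZ N D
  colp : col N1 zero p ~ κ
  colp = go (w3 p)
   where
   go : ∀ x -> kp p x ~ κ
   go (isp _) = refl
   go (isq e) = efq (p#q e)
   go (oth n _) = efq (n refl)
  colq : col N1 zero q ~ κ1
  colq = go (w3 q)
   where
   go : ∀ x -> kp q x ~ κ1
   go (isp e) = efq (p#q (sym e))
   go (isq e) = refl
   go (oth _ n) = efq (n refl)
  posp : pos N1 zero p ~ cp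
  posp = go (w3 p)
   where
   go : ∀ (x : W3 p)-> ps x ~ cp
   go (isp _) = refl
   go (isq e) = efq (p#q e)
   go (oth n _) = efq (n refl)
  posq : pos N1 zero q ~ cq
  posq = go (w3 q)
   where
   go : ∀ (x : W3 q)-> ps x ~ cq
   go (isp e) = efq (p#q (sym e))
   go (isq e) = refl
   go (oth _ n) = efq (n refl)
  grn-new : ∀ s -> col N1 zero s ~ 0 -> Gr s
  grn-new s e = gr s (w3 s) e
  green-p : κ ~ 0 -> col N1 zero p ~ 0
  green-p e = colp & e
  green-q : κ1 ~ 0 -> col N1 zero q ~ 0
  green-q e = colq & e
  pend-q : ∀ R -> κ1 ~ suc R -> Pend N1 zero q cq R
  pend-q R e = record { colp = colq & e; onF = \s g f m -> on s (grn-new s g) f; offF = \s g -> off s (grn-new s g) }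
   where
   key : κ ~ 0 ->(pl N q p ~ labW cq cp)⊎ (pl N q p ~ w × root (fst cp)# root (fst cq))
   key k = [ (\x -> inl (plcv N p q & cong conv x & sym (labW-conv cp cq)))
    , (\(x , r)-> inr (trans (plcv N p q)(cong conv x), r)) ]′ (hgn (inl (k , R , e)))
   on : ∀ s -> Gr s -> InF cq (pos N1 zero s)-> pl N q s ~ labW cq (pos N1 zero s)
   on s (inl (refl , k)) f = [ (\x -> trans x (cong (labW cq)(sym posp)))
    , (\(_ , r)-> efq (r (cong (root ∘ fst)(sym posp)& InF-root f))) ]′ (key k)
   on s (inr (refl , k)) f = 0#suc k e
   off : ∀ s -> Gr s -> pl N q s ~ w ⊎ pl N q s ~ labW cq (pos N1 zero s)
   off s (inl (refl , k)) = [ (\x -> inr (x & cong (labW cq)(sym posp))), (\(x , _)-> inl x) ]′ (key k)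
   off s (inr (refl , k)) = 0#suc k e
  pend-p : ∀ R -> κ ~ suc R -> Pend N1 zero p cp R
  pend-p R e = record { colp = colp & e; onF = \s g f m -> on s (grn-new s g) f; offF = \s g -> off s (grn-new s g) }
   where
   on : ∀ s -> Gr s -> InF cp (pos N1 zero s)-> pl N p s ~ labW cp (pos N1 zero s)
   on s (inr (refl , k)) f = [ (\x -> trans x (cong (labW cp)(sym posq)))
    , (\(_ , r)-> efq (r (sym (cong (root ∘ fst)(sym posq)& InF-root f)))) ]′ (hgn (inr ((R , e), k)))
   on s (inl (refl , k)) f = 0#suc k e
   off : ∀ s -> Gr s -> pl N p s ~ w ⊎ pl N p s ~ labW cp (pos N1 zero s)
   off s (inr (refl , k)) = [ (\x -> inr (x & cong (labW cp)(sym posq))), (\(x , _)-> inl x) ]′ (hgn (inr ((R , e), k)))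
   off s (inl (refl , k)) = 0#suc k e
  rest : ∀ z' s -> Rea N1 z' s ⊎ ((z' ~ zero × s ~ p)⊎ (z' ~ zero × s ~ q))
  rest (suc z') s = inl (gN z' s)
  rest zero s = go (w3 s) refl
   where
   go : (x : W3 s)-> kp s (w3 s)~ kp s x -> Rea N1 zero s ⊎ ((zero ~ zero × s ~ p)⊎ (zero ~ zero × s ~ q))
   go (isp e) _ = inr (inl (refl , e))
   go (isq e) _ = inr (inr (refl , e))
   go (oth a c) we = inl r
    where
    r : Rea N1 zero s
    r R e ℓ rl mm with mask⇒ (Lk s) ℓ (Real-val rl)(Real-#o rl)(Real-#w rl)(subst (\x -> mem x ℓ !)(suc-inj (sym e & we)) mm)
    ... | t , inl (refl , k), pe = t , green-p k , pe
    ... | t , inr (refl , k), pe = t , green-q k , pe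
  no-rea : ∀ s -> col N1 zero s ~ 0 -> Rea N1 zero s
  no-rea s e R e1 = 0#suc e e1
  fin : ∀ k k1 -> κ ~ k -> κ1 ~ k1 -> Fin' N1
  fin zero zero e e1 = trivial N1 \z' s -> [ id , [ (\ { (refl , refl)-> no-rea p (green-p e) }), (\ { (refl , refl)-> no-rea q (green-q e1) }) ]′ ]′ (rest z' s)
  fin (suc R) zero e e1 = finish1 N1 zero p cp R (pend-p R e) \z' s ->
   [ inl , [ inr , (\ { (refl , refl)-> inl (no-rea q (green-q e1)) }) ]′ ]′ (rest z' s)
  fin zero (suc R) e e1 = finish1 N1 zero q cq R (pend-q R e1) \z' s ->
   [ inl , [ (\ { (refl , refl)-> inl (no-rea p (green-p e)) }), inr ]′ ]′ (rest z' s)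
  fin (suc R)(suc R1) e e1 = finish2 N1 zero p cp R zero q cq R1 (pend-p R e)(pend-q R1 e1)
   (inr ((\x -> p#q (sym x)), (\x -> hnn e e1 (sym x)))) rest
  demand : Ext N (GPP p q κ κ1)
  demand = mkExt (Fin'.N' F)(◁-trans (aZ done D)(up◁ (Fin'.e F)))(Fin'.good F)
   (carryPP {p = p}{q = q}{κ = κ}{κ1 = κ1}(aZ done D)(up◁ (Fin'.e F))(zero , colp , colq , \z0 ()))
   where F = fin κ κ1 refl refl
 module D2' {zn pn}(N : Net zn pn)(gN : Good N)(p q : Fin pn)(p#q : p # q)(κ κ1 : ℕ)
  (b : ∀ R -> κ ~ suc R -> R < K)(b1 : ∀ R -> κ1 ~ suc R -> R < K)
  (gg : κ ~ 0 -> κ1 ~ 0 -> pl N p q # w)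
  (m : ∀ R -> κ ~ suc R -> κ1 ~ 0 -> mem R (pl N p q) !)
  (m1 : ∀ R -> κ ~ 0 -> κ1 ~ suc R -> mem R (conv (pl N p q)) !) where
  demand : Ext N (GPP p q κ κ1)
  demand with em 0ℓ {pl N p q ~ w} | em 0ℓ {κ ~ 0 ⊎ κ1 ~ 0}
  ... | yes e | _ = D2.demand N gN p q p#q κ κ1 b b1 (base 0 , + 0)(base 1 , + 0)(\a c -> efq (gg a c e))(\_ -> inr (e , \()))(\_ _ ()) m m1
  ... | no _ | no n = D2.demand N gN p q p#q κ κ1 b b1 (base 0 , + 0)(base 1 , + 0)(\a c -> efq (n (inl a)))
   (\ { (inl (a , _))-> efq (n (inl a)); (inr (_ , a))-> efq (n (inr a)) })(\_ _ ()) m m1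
  ... | no ne | yes n with seen (base 0 , + 0)(pl N p q)(plva N p q)(\i -> p#q (plne N p q i)) ne
  ... | v , e = D2.demand N gN p q p#q κ κ1 b b1 v (base 0 , + 0)(\_ _ -> sym e)(\_ -> inl (sym e))
   (\a c -> efq ([ (\x -> 0#suc x a), (\x -> 0#suc x c) ]′ n)) m m1
 module Iso {zn pn}(N : Net zn pn)(gN : Good N) where
  D : NewP' N
  D .NewP'.lam _ = w
  D .NewP'.tris s s' = tri-w1 _ _
  D .NewP'.ne s ()
  D .NewP'.val s = tt
  D .NewP'.κ z = nothing
  D .NewP'.u = base 0 , + 0
  D .NewP'.g1 z s ()
  D .NewP'.g2 z s ()
  D .NewP'.g3 z s ()
  D .NewP'.g4 z ()
  N1 : Net zn (suc pn)
  N1 = NewP'.result D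
  good : Good N1
  good z zero = NewP'.rea-new D z refl
  good z (suc p) = NewP'.rea-old D z p (gN z p)
  step : N ◁ N1
  step = aP done (NewP'.full D)
  colour : ∀ z -> ∃[ R ] (col N1 z zero ~ suc R × R < K)
  colour z = _ , refl , mask< _
 backZZ : ∀ {a b c d m n}{N : Net a b}{N1 : Net c d}{N2 : Net m n}{z κ}(x : N ◁ N1)(y : N1 ◁ N2)->
  ∃[ r ] col N2 (liftZ y (liftZ x z)) r ~ κ -> GZZ z z κ κ N2 (◁-trans x y)
 backZZ {z = z} x y (r , h) rewrite liftZ-trans x y z = r , h , h
 backPP : ∀ {a b c d m n}{N : Net a b}{N1 : Net c d}{N2 : Net m n}{p κ}(x : N ◁ N1)(y : N1 ◁ N2)->
  ∃[ z ] (col N2 z (liftP y (liftP x p))~ κ × (∀ z0 -> liftZ y z0 # z))-> GPP p p κ κ N2 (◁-trans x y)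
 backPP {p = p} x y (z , h , f) rewrite liftP-trans x y p = z , h , h , \z0 e -> f (liftZ x z0)(sym (liftZ-trans x y z0)& e)
 demandZ : ∀ {zn pn}(N : Net zn pn)(gN : Good N)(z : Fin zn)(κ : ℕ)->(∀ R -> κ ~ suc R -> R < K)-> Ext N (GZZ z z κ κ)
 demandZ N gN z κ b = mkExt (Ext.N' F)(◁-trans step (Ext.ext F))(Ext.good F)
  (backZZ {z = z}{κ = κ} step (Ext.ext F)(let r , e , _ = Ext.goal F in r , e))
  where
  open Iso N gN
  F = D3.demand N1 good z zero κ w (\()) tt (\c -> 0#suc c (fst (snd (colour z))))(\R c -> 0#suc c (fst (snd (colour z))))(\R _ _ -> mem-w R) b
 demandP : ∀ {zn pn}(N : Net zn pn)(gN : Good N)(p : Fin pn)(κ : ℕ)->(∀ R -> κ ~ suc R -> R < K)-> Ext N (GPP p p κ κ)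
 demandP N gN p κ b = mkExt (Ext.N' F)(◁-trans step (Ext.ext F))(Ext.good F)
  (backPP {p = p}{κ = κ} step (Ext.ext F)(let r , e , _ , f = Ext.goal F in r , e , f))
  where
  open Iso N gN
  R0 = maskOf (\_ -> Empty)
  F = D2'.demand N1 good (suc p) zero (\()) κ (suc R0) b (\ { R refl -> mask< _ })(\_ ())(\R _ ())(\R _ _ -> mem-w R)
 module IsoZ {zn pn}(N : Net zn pn)(gN : Good N) where
  D : NewZ N
  D .NewZ.κ _ = suc (maskOf (\_ -> Empty))
  D .NewZ.u _ = base 0 , + 0
  D .NewZ.h1 p q ()
  D .NewZ.h2 p q _ ()
  D .NewZ.h3 p refl = mask< _
  N1 : Net (suc zn) pn
  N1 = addZ N D
  step : N ◁ N1
  step = aZ done D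
  good : Good N1
  good (suc z) p = gN z p
  good zero p R refl ℓ r m = efq (mask⇒ (\_ -> Empty) ℓ (Real-val r)(Real-#o r)(Real-#w r) m)
 demand∅ : ∀ {zn pn}(N : Net zn pn)(gN : Good N)-> Ext N (\ {zn'} N' e -> ∃[ z ] (∀ z0 -> liftZ e z0 # z))
 demand∅ N gN = mkExt N1 step good (zero , \z0 ())
  where open IsoZ N gN
 Pt : ∀ {zn pn}-> Net zn pn -> Set
 Pt {zn}{pn} N = Fin zn ⊎ Fin pn
 labN : ∀ {zn pn}(N : Net zn pn)-> Pt N -> Pt N -> Lab
 labN N (inl z)(inl z') = zz (does (z Fin.≟ z'))
 labN N (inl z)(inr p) = zp (col N z p)
 labN N (inr p)(inl z) = pz (col N z p)
 labN N (inr p)(inr q) = pp (pl N p q)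
 liftX : ∀ {zn pn zn' pn'}{N : Net zn pn}{N' : Net zn' pn'}-> N ◁ N' -> Pt N -> Pt N'
 liftX e (inl z) = inl (liftZ e z)
 liftX e (inr p) = inr (liftP e p)
 does-≡ : ∀ {A B : Set}(a : Dec A)(b : Dec B)->(A -> B)->(B -> A)-> does a ~ does b
 does-≡ (yes _)(yes _) f g = refl
 does-≡ (no _)(no _) f g = refl
 does-≡ (yes a)(no n) f g = efq (n (f a))
 does-≡ (no n)(yes b) f g = efq (n (g b))
 does⇒ : ∀ {A : Set}(a : Dec A)-> does a ! -> A
 does⇒ (yes a) _ = a
 ◁-lab : ∀ {zn pn zn' pn'}{N : Net zn pn}{N' : Net zn' pn'}(e : N ◁ N') x y -> labN N' (liftX e x)(liftX e y)~ labN N x y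
 ◁-lab e (inl z)(inl z') = cong zz (does-≡ (liftZ e z Fin.≟ liftZ e z')(z Fin.≟ z')(liftZ-inj e)(cong (liftZ e)))
 ◁-lab e (inl z)(inr p) = cong zp (◁-col e z p)
 ◁-lab e (inr p)(inl z) = cong pz (◁-col e z p)
 ◁-lab e (inr p)(inr q) = cong pp (◁-pl e p q)
 liftX-trans : ∀ {a b c d e f}{N : Net a b}{N' : Net c d}{N'' : Net e f}(x : N ◁ N')(y : N' ◁ N'') p ->
  liftX (◁-trans x y) p ~ liftX y (liftX x p)
 liftX-trans x y (inl z) = cong inl (liftZ-trans x y z)
 liftX-trans x y (inr p) = cong inr (liftP-trans x y p)
 zokN : ∀ {zn pn}(N : Net zn pn) z p q -> Zok (col N z p)(col N z q)(pl N p q)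
 zokN N z p q = zok (\a b e -> labW#w _ _ (sym (grn N z p q a b)& e))
  (\R a b -> rng N z p q a b)
  (\R a b -> trans (cong (mem R)(sym (plcv N p q)))(rng N z q p b a))
  (\i -> cong (col N z)(plne N p q i))
 ru∘ : ∀ {a b c a' b' c'}-> a ~ a' -> b ~ b' -> c ~ c' -> RU a b c -> RU a' b' c'
 ru∘ refl refl refl h = h
 pokN : ∀ {zn pn}(N : Net zn pn) p q r -> Pok (pl N p q)(pl N q r)(pl N p r)
 pokN N p q r = record
  { r1 = mk (plok N p q r)
  ; r2 = ru∘ refl (plcv N q r) refl (mk (plok N p r q))
  ; r3 = ru∘ (plcv N p q) refl refl (mk (plok N q p r))
  ; r4 = ru∘ refl (plcv N p r)(plcv N p q)(mk (plok N q r p))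
  ; r5 = ru∘ (plcv N p r) refl (plcv N q r)(mk (plok N r p q))
  ; r6 = ru∘ (plcv N q r)(plcv N p q)(plcv N p r)(mk (plok N r q p))
  ; i1 = \i -> cong (\x -> pl N x r)(sym (plne N p q i))
  ; i2 = \i -> cong (pl N p)(plne N q r i)
  ; i3 = \i -> trans (cong (pl N q)(sym (plne N p r i)))(plcv N p q) }
 bool-eq : ∀ {zn}(a b c : Fin zn)-> does (a Fin.≟ b) ! -> does (b Fin.≟ c)~ does (a Fin.≟ c)
 bool-eq a b c h = cong (\x -> does (x Fin.≟ c))(sym (does⇒ (a Fin.≟ b) h))
 does-sym : ∀ {n}(a b : Fin n)-> does (a Fin.≟ b)~ does (b Fin.≟ a)
 does-sym a b = does-≡ (a Fin.≟ b)(b Fin.≟ a) sym sym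
 net-cons : ∀ {zn pn}(N : Net zn pn) a b c -> Cons (labN N a b)(labN N b c)(labN N a c)
 net-cons N (inr a)(inr b)(inr c) = pokN N a b c
 net-cons N (inr a)(inr b)(inl c) = zokN N c a b
 net-cons N (inl a)(inr b)(inr c) = zokN N a b c
 net-cons N (inr a)(inl b)(inr c) = zokN N b a c
 net-cons N (inl a)(inl b)(inr c) h = cong (\x -> col N x c)(sym (does⇒ (a Fin.≟ b) h))
 net-cons N (inl a)(inr b)(inl c) h = cong (\x -> col N x b)(does⇒ (a Fin.≟ c) h)
 net-cons N (inr a)(inl b)(inl c) h = cong (\x -> col N x a)(does⇒ (b Fin.≟ c) h)
 net-cons N (inl a)(inl b)(inl c) = bool-eq a b c
  , (\h -> cong (\x -> does (a Fin.≟ x))(does⇒ (b Fin.≟ c) h))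
  , (\h -> trans (does-sym a b)(cong (\x -> does (b Fin.≟ x))(does⇒ (a Fin.≟ c) h)))
 net-valid : ∀ {zn pn}(N : Net zn pn) a b -> Valid (labN N a b)
 net-valid N (inl a)(inl b) = tt
 net-valid N (inl a)(inr b) with col N a b in e
 ... | zero = zl
 ... | suc R = bnd N a b e
 net-valid N (inr b)(inl a) with col N a b in e
 ... | zero = zl
 ... | suc R = bnd N a b e
 net-valid N (inr a)(inr b) = plva N a b
 Goal : ∀ {zn pn}{N : Net zn pn}(x y : Pt N)(β γ : Lab)-> ∀ {zn' pn'}(N' : Net zn' pn')-> N ◁ N' -> Set
 Goal x y β γ N' e = ∃[ c ] (labN N' (liftX e y) c ~ β × labN N' (liftX e x) c ~ γ)
 Res' : ∀ {zn pn}(N : Net zn pn)(x y : Pt N)(β γ : Lab)-> Set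
 Res' N x y β γ = Ext N (Goal x y β γ)
 mapE : ∀ {zn pn}{N : Net zn pn}{C C' : ∀ {zn' pn'}(N' : Net zn' pn')-> N ◁ N' -> Set}->
  (∀ {zn' pn'}(N' : Net zn' pn')(e : N ◁ N')-> C N' e -> C' N' e)-> Ext N C -> Ext N C'
 mapE f X = mkExt (Ext.N' X)(Ext.ext X)(Ext.good X)(f (Ext.N' X)(Ext.ext X)(Ext.goal X))
 stop : ∀ {zn pn}{N : Net zn pn}(g : Good N){x y : Pt N}{β γ : Lab} c -> labN N y c ~ β -> labN N x c ~ γ -> Res' N x y β γ
 stop {N = N} g {x}{y} c e f = mkExt N done g (c , trans (cong (\u -> labN N u c)(lift-done y)) e , trans (cong (\u -> labN N u c)(lift-done x)) f)
  where
  lift-done : ∀ x -> liftX (done {N = N}) x ~ x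
  lift-done (inl _) = refl
  lift-done (inr _) = refl
 ≤K : ∀ {κ}-> κ ≤ K -> ∀ R -> κ ~ suc R -> R < K
 ≤K h R refl = h
 dPPP : ∀ {zn pn}(N : Net zn pn)-> Good N -> ∀ p q β γ -> VPL β -> VPL γ -> Pok (pl N p q) β γ -> Res' N (inr p)(inr q)(pp β)(pp γ)
 dPPP N g p q β γ vβ vγ h with em 0ℓ {β ~ idn} | em 0ℓ {γ ~ idn}
 ... | yes refl | _ = stop g (inr q)(cong pp (plid N q))(cong pp (Pok.i2 h refl))
 ... | no _ | yes refl = stop g (inr p)(cong pp (plcv N p q & sym (Pok.i3 h refl)))(cong pp (plid N p))
 ... | no nβ | no nγ = mapE (\N' e (r , a , b)-> inr r , cong pp (flip N' _ _ b), cong pp (flip N' _ _ a))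
  (D1.demand N g p q (conv γ)(conv β)
   (tri (un (Pok.r5 h))(un (ru∘ (sym (cc γ)) refl refl (Pok.r2 h)))(un (ru∘ refl (sym (cc β))(sym (cc γ))(Pok.r1 h))))
   (tri (un (ru∘ refl (sym (plcv N p q)) refl (Pok.r6 h)))(un (ru∘ (sym (cc β)) refl (sym (plcv N p q))(Pok.r4 h)))
    (un (ru∘ (sym (plcv N p q))(sym (cc γ))(sym (cc β))(Pok.r3 h))))
   (\e -> nγ (conv-idn' e))(\e -> nβ (conv-idn' e))(conv-valid TS γ vγ)(conv-valid TS β vβ)
   (\ { refl -> cong conv (sym (Pok.i1 h (plid N p))) }))
  where
  open RU
  conv-idn' : ∀ {ℓ}-> conv ℓ ~ idn -> ℓ ~ idn
  conv-idn' {idn} e = refl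
  flip : ∀ {zn pn}(N : Net zn pn) r p {ℓ}-> pl N r p ~ conv ℓ -> pl N p r ~ ℓ
  flip N r p e = plcv N r p & cong conv e & cc _
 dPPZ : ∀ {zn pn}(N : Net zn pn)-> Good N -> ∀ p q κ' κ -> κ' ≤ K -> κ ≤ K -> Zok κ κ' (pl N p q)-> Res' N (inr p)(inr q)(pz κ')(pz κ)
 dPPZ N g p q κ' κ v' v h with em 0ℓ {p ~ q}
 ... | yes refl with Zok.ii h (plid N p)
 ... | refl = mapE (\N' e (z , a , b , _)-> inl z , cong pz b , cong pz a)(demandP N g p κ (≤K v))
 dPPZ N g p q κ' κ v' v h | no ne =
  mapE (\N' e (z , a , b , _)-> inl z , cong pz b , cong pz a)
   (D2'.demand N g p q ne κ κ' (≤K v)(≤K v')(Zok.gg h)(Zok.ng h)(Zok.gn h))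
 dZP : ∀ {zn pn}(N : Net zn pn)-> Good N -> ∀ z p κ' ℓ -> κ' ≤ K -> VPL ℓ -> Zok (col N z p) κ' ℓ ->
  Ext N (\N' e -> ∃[ r ] (col N' (liftZ e z) r ~ κ' × pl N' (liftP e p) r ~ ℓ))
 dZP N g z p κ' ℓ vκ vℓ h with em 0ℓ {ℓ ~ idn}
 ... | yes refl = mkExt N done g (p , Zok.ii h refl , plid N p)
 ... | no ne = mapE (\N' e (r , a , b)-> r , a , trans (plcv N' r _)(cong conv b & cc ℓ))
  (D3.demand N g z p κ' (conv ℓ)(\e -> ne (sym (cc ℓ)& cong conv e))(conv-valid TS ℓ vℓ)
   (\a b e -> Zok.gg h a b (sym (cc ℓ)& cong conv e))
   (\R a b -> Zok.gn h R a b)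
   (\R a b -> trans (cong (mem R)(cc ℓ))(Zok.ng h R a b))
   (≤K vκ))
 does-true : ∀ {n}{z : Fin n}(d : Dec (z ~ z))-> does d !
 does-true (yes _) = refl
 does-true (no n) = efq (n refl)
 does-false : ∀ {n}{x y : Fin n}(d : Dec (x ~ y))-> x # y -> does d ~ false
 does-false (yes e) n = efq (n e)
 does-false (no _) n = refl
 dZP->Z : ∀ {zn pn}(N : Net zn pn)-> Good N -> ∀ z p κ b -> κ ≤ K ->(b ! -> col N z p ~ κ)->
  Ext N (\N' e -> ∃[ c ] (col N' c (liftP e p)~ κ × does (liftZ e z Fin.≟ c)~ b))
 dZP->Z N g z p κ true v h = mkExt N done g (z , h refl , does-true (z Fin.≟ z))
 dZP->Z N g z p κ false v h = mapE (\N' e (c , a , _ , f)-> c , a , does-false (liftZ e z Fin.≟ c)(f z))(demandP N g p κ (≤K v))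
 demand : ∀ {zn pn}(N : Net zn pn)-> Good N -> ∀ x y β γ -> Valid β -> Valid γ -> Cons (labN N x y) β γ -> Res' N x y β γ
 demand N g (inr p)(inr q)(pp β)(pp γ) vβ vγ h = dPPP N g p q β γ vβ vγ h
 demand N g (inr p)(inr q)(pz κ')(pz κ) vβ vγ h = dPPZ N g p q κ' κ vβ vγ h
 demand N g (inl z)(inr p)(pp ℓ)(zp κ') vβ vγ h =
  mapE (\N' e (r , a , b)-> inr r , cong pp b , cong zp a)(dZP N g z p κ' ℓ vγ vβ h)
 demand N g (inr p)(inl z)(zp κ')(pp ℓ) vβ vγ h =
  mapE (\N' e (r , a , b)-> inr r , cong zp a , cong pp b)(dZP N g z p κ' ℓ vβ vγ h)
 demand N g (inl z)(inr p)(pz κ)(zz b) vβ vγ h =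
  mapE (\N' e (c , a , d)-> inl c , cong pz a , cong zz d)(dZP->Z N g z p κ b vβ h)
 demand N g (inr p)(inl z)(zz b)(pz κ) vβ vγ h =
  mapE (\N' e (c , a , d)-> inl c , cong zz d , cong pz a)(dZP->Z N g z p κ b vγ h)
 demand N g (inl z)(inl z')(zp κ)(zp κ') vβ vγ h with z Fin.≟ z'
 ... | yes refl with h refl
 ... | refl = mapE (\N' e (r , a , b)-> inr r , cong zp a , cong zp b)(demandZ N g z κ (≤K vβ))
 demand N g (inl z)(inl z')(zp κ)(zp κ') vβ vγ h | no ne =
  mapE (\N' e (r , a , b)-> inr r , cong zp b , cong zp a)(D5.demand N g z z' ne κ' κ (≤K vγ)(≤K vβ))
 demand N g (inl z)(inl z')(zz true)(zz b) vβ vγ h = stop g (inl z')(cong zz (does-true (z' Fin.≟ z')))(cong zz (fst (snd h) refl))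
 demand N g (inl z)(inl z')(zz false)(zz true) vβ vγ h = stop g (inl z)(cong zz (does-sym z' z & snd (snd h) refl))(cong zz (does-true (z Fin.≟ z)))
 demand N g (inl z)(inl z')(zz false)(zz false) vβ vγ h =
  mapE (\N' e (c , f)-> inl c , cong zz (does-false (liftZ e z' Fin.≟ c)(f z')), cong zz (does-false (liftZ e z Fin.≟ c)(f z)))(demand∅ N g)
 plList : List PL
 plList = idn ∷ o ∷ w ∷ fst realList
 ∈plList : ∀ ℓ -> VPL ℓ -> ℓ ∈ plList
 ∈plList ℓ v with view ℓ v
 ... | idn = here refl
 ... | o = there (here refl)
 ... | w = there (there (here refl))
 ... | re r = there (there (there (snd realList ℓ r)))
 labList : List Lab
 labList = List.map pp plList ++ (List.map zp (List.upTo (suc K)) ++ (List.map pz (List.upTo (suc K)) ++ (zz true ∷ zz false ∷ [])))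
 ∈labList : ∀ β -> Valid β -> β ∈ labList
 ∈labList (pp ℓ) v = ∈.∈-++⁺ˡ (∈.∈-map⁺ pp (∈plList ℓ v))
 ∈labList (zp κ) v = ∈.∈-++⁺ʳ (List.map pp plList)(∈.∈-++⁺ˡ (∈.∈-map⁺ zp (∈.∈-upTo⁺ (sl v))))
 ∈labList (pz κ) v = ∈.∈-++⁺ʳ (List.map pp plList)(∈.∈-++⁺ʳ (List.map zp (List.upTo (suc K)))(∈.∈-++⁺ˡ (∈.∈-map⁺ pz (∈.∈-upTo⁺ (sl v)))))
 ∈labList (zz b) v = ∈.∈-++⁺ʳ (List.map pp plList)(∈.∈-++⁺ʳ (List.map zp (List.upTo (suc K)))(∈.∈-++⁺ʳ (List.map pz (List.upTo (suc K)))(zb b)))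
  where
  zb : ∀ b -> zz b ∈ (zz true ∷ zz false ∷ [])
  zb true = here refl
  zb false = there (here refl)
 Dem : ∀ {zn pn}-> Net zn pn -> Set
 Dem N = (Pt N × Pt N)× (Lab × Lab)
 Met : ∀ {zn pn}{N : Net zn pn}-> Dem N -> ∀ {zn' pn'}(N' : Net zn' pn')-> N ◁ N' -> Set
 Met {N = N}((x , y), (β , γ)) N' e = Valid β -> Valid γ -> Cons (labN N x y) β γ -> Goal x y β γ N' e
 persist : ∀ {a b c d m n}{N : Net a b}{N1 : Net c d}{N2 : Net m n}{x y β γ}(e : N ◁ N1)(f : N1 ◁ N2)->
  Goal x y β γ N1 e -> Goal x y β γ N2 (◁-trans e f)
 persist {x = x}{y} e f (c , h , k) rewrite liftX-trans e f x | liftX-trans e f y =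
  liftX f c , trans (◁-lab f _ _) h , trans (◁-lab f _ _) k
 meetAll : ∀ {zn pn}(N : Net zn pn)-> Good N ->(L : List (Dem N))-> Ext N (\N' e -> ∀ d -> d ∈ L -> Met d N' e)
 meetAll N g [] = mkExt N done g (\d ())
 meetAll N g (d@((x , y), (β , γ)) ∷ L) with meetAll N g L
 ... | mkExt N1 e1 g1 h1 with em 0ℓ {Valid β × Valid γ × Cons (labN N x y) β γ}
 ... | no n = mkExt N1 e1 g1 \ { ._ (here refl) a b c -> efq (n (a , b , c)); d' (there i)-> h1 d' i }
 ... | yes (a , b , c) with demand N1 g1 (liftX e1 x)(liftX e1 y) β γ a b (subst (\ℓ -> Cons ℓ β γ)(sym (◁-lab e1 x y)) c)
 ... | mkExt N2 e2 g2 (r , h , k) = mkExt N2 (◁-trans e1 e2) g2 \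
  { ._ (here refl) _ _ _ -> r , trans (cong (\u -> labN N2 u r)(liftX-trans e1 e2 y)) h
   , trans (cong (\u -> labN N2 u r)(liftX-trans e1 e2 x)) k
  ; d' (there i) a b c -> persist e1 e2 (h1 d' i a b c) }
 pts : ∀ {zn pn}(N : Net zn pn)-> List (Pt N)
 pts {zn}{pn} N = List.map inl (List.allFin zn) ++ List.map inr (List.allFin pn)
 ∈pts : ∀ {zn pn}(N : Net zn pn) x -> x ∈ pts N
 ∈pts N (inl z) = ∈.∈-++⁺ˡ (∈.∈-map⁺ inl (∈.∈-allFin z))
 ∈pts {zn} N (inr p) = ∈.∈-++⁺ʳ (List.map inl (List.allFin zn))(∈.∈-map⁺ inr (∈.∈-allFin p))
 dems : ∀ {zn pn}(N : Net zn pn)-> List (Dem N)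
 dems N = List.cartesianProduct (List.cartesianProduct (pts N)(pts N))(List.cartesianProduct labList labList)
 record Stage : Set where
  constructor stage
  field
   {zn pn} : ℕ
   net : Net zn pn
   good : Good net
 open Stage
 ∈dems : ∀ {zn pn}(N : Net zn pn) x y β γ -> Valid β -> Valid γ ->((x , y), (β , γ)) ∈ dems N
 ∈dems N x y β γ a b = ∈.∈-cartesianProduct⁺ {xs = List.cartesianProduct (pts N)(pts N)}{ys = List.cartesianProduct labList labList}
  (∈.∈-cartesianProduct⁺ (∈pts N x)(∈pts N y))(∈.∈-cartesianProduct⁺ (∈labList β a)(∈labList γ b))
 size : ∀ {a b c d}{N : Net a b}{N' : Net c d}-> N ◁ N' -> a ≤ c × b ≤ d
 size done = ≤-refl , ≤-refl
 size (aP e D) = let i , j = size e in i , m≤n⇒m≤1+n j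
 size (aZ e D) = let i , j = size e in m≤n⇒m≤1+n i , j
 record Next (S : Stage) : Set where
  field
   to : Stage
   e : net S ◁ net to
   zn< : zn S < zn to
   pn< : pn S < pn to
   met : ∀ x y β γ -> Met ((x , y), (β , γ))(net to) e
 module _ {zn pn}(N : Net zn pn)(g : Good N)(X : Ext N (\N' e -> ∀ d -> d ∈ dems N -> Met d N' e)) where
  private
   N2 = IsoZ.N1 (Ext.N' X)(Ext.good X)
   g2 = IsoZ.good (Ext.N' X)(Ext.good X)
   more : Ext.N' X ◁ Iso.N1 N2 g2
   more = ◁-trans (IsoZ.step (Ext.N' X)(Ext.good X))(Iso.step N2 g2)
  next' : Next (stage N g)
  next' = record
   { to = stage (Iso.N1 N2 g2)(Iso.good N2 g2); e = ◁-trans (Ext.ext X) more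
   ; zn< = sl (fst (size (Ext.ext X))); pn< = sl (snd (size (Ext.ext X)))
   ; met = \x y β γ a b c -> persist (Ext.ext X) more (Ext.goal X ((x , y), (β , γ))(∈dems N x y β γ a b) a b c) }
 abstract
  next : ∀ S -> Next S
  next (stage N g) = next' N g (meetAll N g (dems N))
 idx : ∀ {n}-> Fin n -> ℕ
 idx {suc n} zero = n
 idx (suc i) = idx i
 idx< : ∀ {n}(i : Fin n)-> idx i < n
 idx< {suc n} zero = ≤-refl
 idx< (suc i) = m<n⇒m<1+n (idx< i)
 idx-inj : ∀ {n}(i j : Fin n)-> idx i ~ idx j -> i ~ j
 idx-inj zero zero h = refl
 idx-inj zero (suc j) h = efq (<-irrefl (sym h)(idx< j))
 idx-inj (suc i) zero h = efq (<-irrefl h (idx< i))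
 idx-inj (suc i)(suc j) h = cong suc (idx-inj i j h)
 at : ∀ n x -> x < n -> ∃[ i ] idx {n} i ~ x
 at (suc n) x h with x ℕ.≟ n
 ... | yes e = zero , sym e
 ... | no ne = let i , e = at n x (ℕ.≤∧≢⇒< (≤-pred h) ne) in suc i , e
 seq : ℕ -> Stage
 seq zero = stage {0}{0}(record { pl = \(); col = \(); pos = \(); plid = \(); plne = \(); plcv = \(); plok = \(); plva = \(); grn = \(); rng = \(); bnd = \() })(\()) 
 seq (suc i) = Next.to (next (seq i))
 grow : ∀ i -> i ≤ zn (seq i)× i ≤ pn (seq i)
 grow zero = zl , zl
 grow (suc i) = let a , b = grow i in ≤-trans (sl a)(Next.zn< (next (seq i))), ≤-trans (sl b)(Next.pn< (next (seq i)))
 emb : ∀ d i -> net (seq i) ◁ net (seq (d + i))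
 emb zero i = done
 emb (suc d) i = ◁-trans (emb d i)(Next.e (next (seq (d + i))))
 Carrier : Set
 Carrier = ℕ ⊎ ℕ
 name : ∀ {i}-> Pt (net (seq i))-> Carrier
 name (inl z) = inl (idx z)
 name (inr p) = inr (idx p)
 name-inj : ∀ {i}(x y : Pt (net (seq i)))-> name {i} x ~ name {i} y -> x ~ y
 name-inj (inl x)(inl y) h = cong inl (idx-inj x y (inj1-inj h))
  where inj1-inj : ∀ {a b : ℕ}-> inl {B = ℕ} a ~ inl b -> a ~ b
        inj1-inj refl = refl
 name-inj (inr x)(inr y) h = cong inr (idx-inj x y (inj2-inj h))
  where inj2-inj : ∀ {a b : ℕ}-> inr {A = ℕ} a ~ inr b -> a ~ b
        inj2-inj refl = refl
 idx-liftP : ∀ {a b c d}{N : Net a b}{N' : Net c d}(e : N ◁ N') p -> idx (liftP e p)~ idx p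
 idx-liftP done p = refl
 idx-liftP (aP e D) p = idx-liftP e p
 idx-liftP (aZ e D) p = idx-liftP e p
 idx-liftZ : ∀ {a b c d}{N : Net a b}{N' : Net c d}(e : N ◁ N') p -> idx (liftZ e p)~ idx p
 idx-liftZ done p = refl
 idx-liftZ (aP e D) p = idx-liftZ e p
 idx-liftZ (aZ e D) p = idx-liftZ e p
 name-lift : ∀ {i j}(e : net (seq i) ◁ net (seq j)) x -> name {j}(liftX e x)~ name {i} x
 name-lift e (inl z) = cong inl (idx-liftZ e z)
 name-lift e (inr p) = cong inr (idx-liftP e p)
 lvl : Carrier -> ℕ
 lvl (inl n) = suc n
 lvl (inr n) = suc n
 loc : ∀ i c -> lvl c ≤ i -> ∃[ x ] name {i} x ~ c
 loc i (inl n) h = let z , e = at (zn (seq i)) n (≤-trans h (fst (grow i))) in inl z , cong inl e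
 loc i (inr n) h = let z , e = at (pn (seq i)) n (≤-trans h (snd (grow i))) in inr z , cong inr e
 st : Carrier -> Carrier -> ℕ
 st a b = lvl a ℕ.⊔ lvl b
 labM : Carrier -> Carrier -> Lab
 labM a b = labN (net (seq (st a b)))(fst (loc (st a b) a (m≤m⊔n _ _)))(fst (loc (st a b) b (m≤n⊔m (lvl a) _)))
 same : ∀ i j (x y : Pt (net (seq i)))(x' y' : Pt (net (seq j)))-> name {i} x ~ name {j} x' -> name {i} y ~ name {j} y' ->
  labN (net (seq i)) x y ~ labN (net (seq j)) x' y'
 same i j x y x' y' h k = trans (sym (◁-lab (emb j i) x y))(go (+-comm j i)& ◁-lab (emb i j) x' y')
  where
  go : j + i ~ i + j -> labN (net (seq (j + i)))(liftX (emb j i) x)(liftX (emb j i) y)~ labN (net (seq (i + j)))(liftX (emb i j) x')(liftX (emb i j) y')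
  go q = go' (j + i)(i + j) q (liftX (emb j i) x)(liftX (emb j i) y)(liftX (emb i j) x')(liftX (emb i j) y')
   (name-lift {i}{j + i}(emb j i) x & h & sym (name-lift {j}{i + j}(emb i j) x'))
   (name-lift {i}{j + i}(emb j i) y & k & sym (name-lift {j}{i + j}(emb i j) y'))
   where
   go' : ∀ m n -> m ~ n ->(x y : Pt (net (seq m)))(x' y' : Pt (net (seq n)))-> name {m} x ~ name {n} x' -> name {m} y ~ name {n} y' ->
    labN (net (seq m)) x y ~ labN (net (seq n)) x' y'
   go' m .m refl x y x' y' h k = cong2 (labN (net (seq m)))(name-inj {m} x x' h)(name-inj {m} y y' k)
 labM-at : ∀ i (x y : Pt (net (seq i)))-> labM (name {i} x)(name {i} y)~ labN (net (seq i)) x y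
 labM-at i x y = same (st (name {i} x)(name {i} y)) i _ _ x y
  (snd (loc _ (name {i} x)(m≤m⊔n _ _)))(snd (loc _ (name {i} y)(m≤n⊔m (lvl (name {i} x)) _)))
 stage3 : (P : Carrier -> Carrier -> Carrier -> Set)->(∀ i (x y z : Pt (net (seq i)))-> P (name {i} x)(name {i} y)(name {i} z))-> ∀ a b c -> P a b c
 stage3 P h a b c = subst₂ (\u v -> P u v c)(snd x)(snd y)(subst (P _ _)(snd z)(h i (fst x)(fst y)(fst z)))
  where
  i = lvl a ℕ.⊔ (lvl b ℕ.⊔ lvl c)
  x = loc i a (m≤m⊔n (lvl a) _)
  y = loc i b (≤-trans (m≤m⊔n (lvl b)(lvl c))(m≤n⊔m (lvl a) _))
  z = loc i c (≤-trans (m≤n⊔m (lvl b)(lvl c))(m≤n⊔m (lvl a) _))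
 isId-net : ∀ {a b}(N : Net a b) x y -> isId (labN N x y) ! -> x ~ y
 isId-net N (inl x)(inl y) h = cong inl (does⇒ (x Fin.≟ y) h)
 isId-net N (inr x)(inr y) h = cong inr (Net.plne N x y (go _ h))
  where
  go : ∀ ℓ -> isId (pp ℓ) ! -> ℓ ~ idn
  go idn h = refl
 isId-refl : ∀ {a b}(N : Net a b) x -> isId (labN N x x) !
 isId-refl N (inl x) = does-true (x Fin.≟ x)
 isId-refl N (inr x) = cong (\ℓ -> isId (pp ℓ))(Net.plid N x)
 structure : Structure TS MS
 structure .Structure.M = Carrier
 structure .Structure.lab = labM
 structure .Structure.cons = stage3 (\a b c -> Cons (labM a b)(labM b c)(labM a c)) \i x y z -> go i x y z
  where
  go : ∀ i (x y z : Pt (net (seq i)))-> Cons (labM (name {i} x)(name {i} y))(labM (name {i} y)(name {i} z))(labM (name {i} x)(name {i} z))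
  go i x y z rewrite labM-at i x y | labM-at i y z | labM-at i x z = net-cons (net (seq i)) x y z
 structure .Structure.valid a b = stage3 (\a b _ -> Valid (labM a b))(\i x y _ -> subst Valid (sym (labM-at i x y))(net-valid (net (seq i)) x y)) a b b
 structure .Structure.id⇒ a b = stage3 (\a b _ -> isId (labM a b) ! -> a ~ b)
  (\i x y _ h -> cong (name {i})(isId-net (net (seq i)) x y (cong isId (sym (labM-at i x y))& h))) a b b
 structure .Structure.id⇐ a = stage3 (\a _ _ -> isId (labM a a) !)(\i x _ _ -> trans (cong isId (labM-at i x x))(isId-refl (net (seq i)) x)) a a a
 structure .Structure.meets a b β γ vβ vγ = stage3 (\a b _ -> Cons (labM a b) β γ -> ∃[ c ] (labM b c ~ β × labM a c ~ γ)) go a b b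
  where
  go : ∀ i (x y _ : Pt (net (seq i)))-> Cons (labM (name {i} x)(name {i} y)) β γ -> ∃[ c ] (labM (name {i} y) c ~ β × labM (name {i} x) c ~ γ)
  go i x y _ h with Next.met (next (seq i)) x y β γ vβ vγ (subst (\ℓ -> Cons ℓ β γ)(labM-at i x y) h)
  ... | c , p , q = name {suc i} c , trans (same _ (suc i) _ _ (liftX e y) c
   (snd (loc _ (name {i} y)(m≤m⊔n _ _))& sym (name-lift {i}{suc i} e y))
   (snd (loc _ (name {suc i} c)(m≤n⊔m (lvl (name {i} y)) _)))) p
   , trans (same _ (suc i) _ _ (liftX e x) c
    (snd (loc _ (name {i} x)(m≤m⊔n _ _))& sym (name-lift {i}{suc i} e x))
    (snd (loc _ (name {suc i} c)(m≤n⊔m (lvl (name {i} x)) _)))) q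
   where e = Next.e (next (seq i))
 structure .Structure.point = inl 0

-- Digits of numbers.
shr : ℕ -> ℕ -> ℕ -> ℕ
shr b zero x = x
shr b (suc j) x = shr b j x / suc b

dig : ℕ -> ℕ -> ℕ -> ℕ
dig b j x = shr b j x % suc b

shr-suc : ∀ b j x -> shr b (suc j) x ~ shr b j (x / suc b)
shr-suc b zero x = refl
shr-suc b (suc j) x = cong (_/ suc b)(shr-suc b j x)

dig-suc : ∀ b j x -> dig b (suc j) x ~ dig b j (x / suc b)
dig-suc b j x = cong (_% suc b)(shr-suc b j x)

-- the number with the given first n digits
fd : ℕ -> ℕ ->(ℕ -> ℕ)-> ℕ
fd b zero f = 0
fd b (suc n) f = f 0 + fd b n (f ∘ suc) * suc b

dig< : ∀ b j x -> dig b j x < suc b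
dig< b j x = m%n<n (shr b j x)(suc b)

mod-dm : ∀ b a q -> a < suc b ->(a + q * suc b) % suc b ~ a
mod-dm b a q h = [m+kn]%n≡m%n a q (suc b)& m<n⇒m%n≡m h

div-dm : ∀ b a q -> a < suc b ->(a + q * suc b) / suc b ~ q
div-dm b a q h = trans (+-distrib-/ a (q * suc b)(subst (_< suc b)(sym eq') h))
 (cong2 _+_ (m<n⇒m/n≡0 h)(m*n/n≡m q (suc b))& refl)
 where
 eq' : a % suc b + q * suc b % suc b ~ a
 eq' = cong2 _+_ (m<n⇒m%n≡m h)(m*n%n≡0 q (suc b))& +-identityʳ a

dig-fd : ∀ b n f j ->(∀ i -> f i < suc b)-> j < n -> dig b j (fd b n f)~ f j
dig-fd b (suc n) f zero h j< = mod-dm b (f 0)(fd b n (f ∘ suc))(h 0)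
dig-fd b (suc n) f (suc j) h (sl j<) = dig-suc b j _ & cong (dig b j)(div-dm b (f 0)(fd b n (f ∘ suc))(h 0))& dig-fd b n (f ∘ suc) j (h ∘ suc) j<

fd-< : ∀ b n f ->(∀ i -> f i < suc b)-> fd b n f < suc b ^ n
fd-< b zero f h = sl zl
fd-< b (suc n) f h = begin-strict
 f 0 + fd b n (f ∘ suc) * suc b <⟨ +-monoˡ-< _ (h 0) ⟩
 suc b + fd b n (f ∘ suc) * suc b ≤⟨ *-monoˡ-≤ (suc b)(fd-< b n (f ∘ suc)(h ∘ suc)) ⟩
 suc b ^ n * suc b ≡⟨ *-comm (suc b ^ n)(suc b) ⟩
 suc b * suc b ^ n ∎
 where open ℕ.≤-Reasoning

fd-cong : ∀ b n f g ->(∀ i -> i < n -> f i ~ g i)-> fd b n f ~ fd b n g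
fd-cong b zero f g h = refl
fd-cong b (suc n) f g h = cong2 (\x y -> x + y * suc b)(h 0 (sl zl))(fd-cong b n (f ∘ suc)(g ∘ suc)(\i i< -> h (suc i)(sl i<)))

fd-dig : ∀ b n x -> x < suc b ^ n -> fd b n (\j -> dig b j x)~ x
fd-dig b zero x h = sym (n<1⇒n≡0 h)
fd-dig b (suc n) x h = trans (cong (\y -> x % suc b + y * suc b) rest)(sym (m≡m%n+[m/n]*n x (suc b)))
 where
 h' : x / suc b < suc b ^ n
 h' = m<n*o⇒m/o<n (subst (x <_)(*-comm (suc b)(suc b ^ n)) h)
 rest : fd b n (\j -> dig b (suc j) x)~ x / suc b
 rest = fd-cong b n _ _ (\i _ -> dig-suc b i x)& fd-dig b n (x / suc b) h'

dig-ext : ∀ b n x y -> x < suc b ^ n -> y < suc b ^ n ->(∀ j -> j < n -> dig b j x ~ dig b j y)-> x ~ y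
dig-ext b n x y hx hy h = sym (fd-dig b n x hx)& fd-cong b n _ _ h & fd-dig b n y hy

b2n : Bool -> ℕ
b2n true = 1
b2n false = 0

b2n< : ∀ b -> b2n b < 2
b2n< true = sl (sl zl)
b2n< false = sl zl

bit : ℕ -> ℕ -> Bool
bit x j = dig 1 j x == 1

bits : ℕ ->(ℕ -> Bool)-> ℕ
bits n f = fd 1 n (b2n ∘ f)

bit-bits : ∀ n f j -> j < n -> bit (bits n f) j ~ f j
bit-bits n f j h rewrite dig-fd 1 n (b2n ∘ f) j (b2n< ∘ f) h with f j
... | true = refl
... | false = refl

bits< : ∀ n f -> bits n f < 2 ^ n
bits< n f = fd-< 1 n (b2n ∘ f)(b2n< ∘ f)

bit-ext : ∀ n x y -> x < 2 ^ n -> y < 2 ^ n ->(∀ j -> j < n -> bit x j ~ bit y j)-> x ~ y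
bit-ext n x y hx hy h = dig-ext 1 n x y hx hy \j j< -> two (dig 1 j x)(dig 1 j y)(dig< 1 j x)(dig< 1 j y)(h j j<)
 where
 two : ∀ a b -> a < 2 -> b < 2 ->(a == 1)~ (b == 1)-> a ~ b
 two 0 0 _ _ _ = refl
 two 1 1 _ _ _ = refl
 two (suc (suc a)) b (sl (sl ())) _ _
 two a (suc (suc b)) _ (sl (sl ())) _

-- Boolean reflection
infixr 5 _⇛_
_⇛_ : Bool -> Bool -> Bool
a ⇛ b = not a || b

&- : ∀ {a b}-> a && b ! -> a ! × b !
&- {true}{true} h = refl , refl

&+ : ∀ {a b}-> a ! -> b ! -> a && b !
&+ refl refl = refl

⇛- : ∀ {a b}-> a ⇛ b ! -> a ! -> b !
⇛- {true} h refl = h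

⇛+ : ∀ {a b}->(a ! -> b !)-> a ⇛ b !
⇛+ {true} h = h refl
⇛+ {false} h = refl

not- : ∀ {a}-> not a ! -> a # true
not- {false} h ()

not+ : ∀ {a}-> a # true -> not a !
not+ {true} h = efq (h refl)
not+ {false} h = refl

==- : ∀ {a b}->(a == b) ! -> a ~ b
==- {a}{b} h = ≡ᵇ⇒≡ a b (subst T (sym h) tt)

==-refl : ∀ a ->(a == a) !
==-refl zero = refl
==-refl (suc a) = ==-refl a

==+ : ∀ {a b}-> a ~ b ->(a == b) !
==+ {a} refl = ==-refl a

<<- : ∀ {a b}->(a << b) ! -> a < b
<<- {a}{b} h = <ᵇ⇒< a b (subst T (sym h) tt)

<<+ : ∀ {a b}-> a < b ->(a << b) !
<<+ {zero}{suc b} h = refl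
<<+ {suc a}{suc b}(sl h) = <<+ h

-- Labels as pairs of numbers: a kind and a value.
kdP vlP : PL -> ℕ
kdP (tl _) = 1
kdP (tl˘ _) = 2
kdP _ = 0
vlP idn = 0
vlP o = 1
vlP w = 2
vlP nx = 3
vlP nx˘ = 4
vlP ft = 5
vlP ft˘ = 6
vlP (tl t) = t
vlP (tl˘ t) = t

kdL vlL : Lab -> ℕ
kdL (pp ℓ) = kdP ℓ
kdL (zp κ) = 3
kdL (pz κ) = 4
kdL (zz b) = 5
vlL (pp ℓ) = vlP ℓ
vlL (zp κ) = κ
vlL (pz κ) = κ
vlL (zz b) = b2n b

cvk : ℕ -> ℕ
cvk k = if k == 1 then 2 else (if k == 2 then 1 else k)

cvv : ℕ -> ℕ -> ℕ
cvv k v = if k == 0 then (if v == 3 then 4 else (if v == 4 then 3 else (if v == 5 then 6 else (if v == 6 then 5 else v)))) else v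

cvk-conv : ∀ ℓ -> kdP (conv ℓ)~ cvk (kdP ℓ)
cvk-conv = elimPL refl refl refl refl refl refl refl (\_ -> refl) \_ -> refl

cvv-conv : ∀ ℓ -> vlP (conv ℓ)~ cvv (kdP ℓ)(vlP ℓ)
cvv-conv = elimPL refl refl refl refl refl refl refl (\_ -> refl) \_ -> refl

unPL : ℕ -> ℕ -> PL
unPL 1 v = tl v
unPL 2 v = tl˘ v
unPL _ 0 = idn
unPL _ 1 = o
unPL _ 2 = w
unPL _ 3 = nx
unPL _ 4 = nx˘
unPL _ 5 = ft
unPL _ _ = ft˘

unPL-PL : ∀ ℓ -> unPL (kdP ℓ)(vlP ℓ)~ ℓ
unPL-PL = elimPL refl refl refl refl refl refl refl (\_ -> refl) \_ -> refl

feat-inj : ∀ ℓ m -> kdP ℓ ~ kdP m -> vlP ℓ ~ vlP m -> ℓ ~ m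
feat-inj ℓ m h k = sym (unPL-PL ℓ)& cong2 unPL h k & unPL-PL m

-- Rules on kinds and values.
module Numeric (TS : Tiles) where
 open Tiles TS
 isW isN isF isI : ℕ -> ℕ -> Bool
 isW k v = (k == 0) && (v == 2)
 isN k v = (k == 0) && (v == 3)
 isF k v = (k == 0) && (v == 5)
 isI k v = (k == 0) && (v == 0)
 ruN : ℕ -> ℕ -> ℕ -> ℕ -> ℕ -> ℕ -> Bool
 ruN k1 v1 k2 v2 k3 v3 =
  ((isN k2 v2 && (isN k1 v1 || isF k1 v1)) ⇛ (isW k3 v3 || isF k3 v3)) &&
  (((isN k2 v2 && (k1 == 1)) ⇛ (isW k3 v3 || ((k3 == 1) && ver v1 v3))) &&
  (((isN k2 v2 && (k1 == 2)) ⇛ (isW k3 v3 || ((k3 == 2) && hor v1 v3))) &&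
   (((isN k2 v2 || isF k2 v2) && ((k1 == 1) && (k3 == 1))) ⇛ not ((v1 == start) && bad v3))))
 ruP : PL -> PL -> PL -> Bool
 ruP α β γ = ruN (kdP α)(vlP α)(kdP β)(vlP β)(kdP γ)(vlP γ)
 &&-true : ∀ a -> a && true ~ a
 &&-true true = refl
 &&-true false = refl
 ruP≡ru : ∀ α β γ -> ruP α β γ ~ ru α β γ
 ruP≡ru α β γ = elimPL {\β -> ∀ α -> ruP α β γ ~ ru α β γ} triv triv triv (\α -> nxt α γ) triv (\α -> far α γ) triv (\_ -> triv)(\_ -> triv) β α
  where
  triv : ∀ {A : Set}{x : A}{B : Set}-> B -> x ~ x
  triv _ = refl
  nxt : ∀ α γ -> ruP α nx γ ~ ru α nx γ
  nxt = elimPL triv triv triv (elimPL refl refl refl refl refl refl refl (\_ -> refl) \_ -> refl) triv (elimPL refl refl refl refl refl refl refl (\_ -> refl) \_ -> refl) triv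
   (\_ -> elimPL refl refl refl refl refl refl refl (\_ -> refl) \_ -> refl)
   (\v -> elimPL refl refl refl refl refl refl refl (\_ -> refl) \u -> &&-true (hor v u))
  far : ∀ α γ -> ruP α ft γ ~ ru α ft γ
  far = elimPL triv triv triv triv triv triv triv (\_ -> elimPL refl refl refl refl refl refl refl (\_ -> refl) \_ -> refl)(\_ -> triv)

module Codes (em : EM)(TS : Tiles) where
 open Tiles TS
 open Numeric TS
 nbits K : ℕ
 nbits = 4 + 2 * N
 K = 2 ^ nbits
 slot : ℕ -> ℕ -> ℕ
 slot k v = if k == 1 then 4 + 2 * v else (if k == 2 then 5 + 2 * v else v ∸ 3)
 memN : ℕ -> ℕ -> ℕ -> Bool
 memN R k v = if (k == 0) && (v << 3) then not (v == 0) else bit R (slot k v)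
 mem : ℕ -> PL -> Bool
 mem R ℓ = memN R (kdP ℓ)(vlP ℓ)
 inc : PL -> PL
 inc (tl t) = tl (suc t)
 inc (tl˘ t) = tl˘ (suc t)
 inc ℓ = ℓ
 tile : ℕ -> PL
 tile 0 = tl 0
 tile 1 = tl˘ 0
 tile (suc (suc j)) = inc (tile j)
 unslot : ℕ -> PL
 unslot 0 = nx
 unslot 1 = nx˘
 unslot 2 = ft
 unslot 3 = ft˘
 unslot (suc (suc (suc (suc j)))) = tile j
 2*suc : ∀ v -> 2 * suc v ~ suc (suc (2 * v))
 2*suc v = cong suc (+-suc v (v + 0))
 tile-tl : ∀ v -> tile (2 * v)~ tl v
 tile-tl zero = refl
 tile-tl (suc v) = cong tile (2*suc v)& cong inc (tile-tl v)
 tile-tl˘ : ∀ v -> tile (1 + 2 * v)~ tl˘ v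
 tile-tl˘ zero = refl
 tile-tl˘ (suc v) = cong (tile ∘ suc)(2*suc v)& cong inc (tile-tl˘ v)
 slotP : PL -> ℕ
 slotP ℓ = slot (kdP ℓ)(vlP ℓ)
 data Proper : PL -> Set where
  pr : ∀ {ℓ}-> unslot (slotP ℓ)~ ℓ -> slotP ℓ < nbits ->(∀ R -> mem R ℓ ~ bit R (slotP ℓ))-> Proper ℓ
 2*< : ∀ {v n}-> v < n -> suc (2 * v)< 2 * n
 2*< {v}{n} h = subst (_≤ 2 * n)(2*suc v)(*-monoʳ-≤ 2 h)
 proper : ∀ ℓ -> VPL ℓ -> ℓ # idn -> ℓ # o -> ℓ # w -> Proper ℓ
 proper idn v a b c = efq (a refl)
 proper o v a b c = efq (b refl)
 proper w v a b c = efq (c refl)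
 proper nx v a b c = pr refl (sl zl)(\R -> refl)
 proper nx˘ v a b c = pr refl (sl (sl zl))(\R -> refl)
 proper ft v a b c = pr refl (sl (sl (sl zl)))(\R -> refl)
 proper ft˘ v a b c = pr refl (sl (sl (sl (sl zl))))(\R -> refl)
 proper (tl x) v a b c = pr (tile-tl x)(+-monoʳ-< 4 (≤-trans (sl (n≤1+n _))(2*< v)))(\R -> refl)
 proper (tl˘ x) v a b c = pr (tile-tl˘ x)(+-monoʳ-< 4 (2*< v))(\R -> refl)
 truth : Set -> Bool
 truth P = does (em 0ℓ {P})
 truth- : ∀ {P}-> truth P ! -> P
 truth- {P} h with em 0ℓ {P}
 ... | yes p = p
 truth+ : ∀ {P}-> P -> truth P !
 truth+ {P} p with em 0ℓ {P}
 ... | yes _ = refl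
 ... | no n = efq (n p)
 slots : (PL -> Set)-> ℕ -> Bool
 slots P j = truth (P (unslot j))
 masks : Masks TS
 masks .Masks.K = K
 masks .Masks.mem = mem
 masks .Masks.mem-o R = refl
 masks .Masks.mem-w R = refl
 masks .Masks.maskOf P = bits nbits (slots P)
 masks .Masks.mask< P = bits< nbits (slots P)
 masks .Masks.mask⇒ P ℓ v n1 nw h with em 0ℓ {ℓ ~ idn}
 masks .Masks.mask⇒ P .idn v n1 nw () | yes refl
 ... | no ni with proper ℓ v ni n1 nw
 ... | pr e s m = subst P e (truth- (sym (bit-bits nbits (slots P)(slotP ℓ) s)& sym (m (bits nbits (slots P)))& h))
 masks .Masks.mask⇐ P ℓ v ni p with em 0ℓ {ℓ ~ o} | em 0ℓ {ℓ ~ w}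
 ... | yes refl | _ = refl
 ... | no _ | yes refl = refl
 ... | no n1 | no nw with proper ℓ v ni n1 nw
 ... | pr e s m = m (bits nbits (slots P))& bit-bits nbits (slots P)(slotP ℓ) s & truth+ (subst P (sym e) p)
 open Labels TS K mem
 zok1 zok2 zok3 zok4 zokF : ℕ -> ℕ -> ℕ -> ℕ -> Bool
 zok1 κ κ' k v = ((κ == 0) && (κ' == 0)) ⇛ not (isW k v)
 zok2 κ κ' k v = (not (κ == 0) && (κ' == 0)) ⇛ memN (κ ∸ 1) k v
 zok3 κ κ' k v = ((κ == 0) && not (κ' == 0)) ⇛ memN (κ' ∸ 1)(cvk k)(cvv k v)
 zok4 κ κ' k v = isI k v ⇛ (κ == κ')
 zokF κ κ' k v = zok1 κ κ' k v && (zok2 κ κ' k v && (zok3 κ κ' k v && zok4 κ κ' k v))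
 idF : ℕ -> ℕ -> ℕ -> ℕ -> ℕ -> ℕ -> Bool
 idF k1 v1 k2 v2 k3 v3 = isI k1 v1 ⇛ ((k2 == k3) && (v2 == v3))
 pokF : ℕ -> ℕ -> ℕ -> ℕ -> ℕ -> ℕ -> Bool
 pokF k1 v1 k2 v2 k3 v3 =
  ruN k1 v1 k2 v2 k3 v3 &&
  (ruN k3 v3 (cvk k2)(cvv k2 v2) k1 v1 &&
  (ruN (cvk k1)(cvv k1 v1) k3 v3 k2 v2 &&
  (ruN k2 v2 (cvk k3)(cvv k3 v3)(cvk k1)(cvv k1 v1) &&
  (ruN (cvk k3)(cvv k3 v3) k1 v1 (cvk k2)(cvv k2 v2) &&
  (ruN (cvk k2)(cvv k2 v2)(cvk k1)(cvv k1 v1)(cvk k3)(cvv k3 v3) &&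
  (idF k1 v1 k2 v2 k3 v3 && (idF k2 v2 k1 v1 k3 v3 && idF k3 v3 k2 v2 (cvk k1)(cvv k1 v1))))))))
 zzF : ℕ -> ℕ -> ℕ -> Bool
 zzF a b c = ((a == 1) ⇛ (b == c)) && (((b == 1) ⇛ (a == c)) && ((c == 1) ⇛ (a == b)))
 cat : ℕ -> ℕ
 cat k = if k << 3 then 0 else k
 -- the selector is the sequence of categories, in base 6
 consF : ℕ -> ℕ -> ℕ -> ℕ -> ℕ -> ℕ -> ℕ -> Bool
 consF sel k1 v1 k2 v2 k3 v3 =
  if sel == 0 then pokF k1 v1 k2 v2 k3 v3 else
  (if sel == 28 then zokF v3 v2 k1 v1 else
  (if sel == 111 then zokF v1 v3 k2 v2 else
  (if sel == 162 then zokF v1 v2 k3 v3 else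
  (if sel == 201 then ((v1 == 1) ⇛ (v2 == v3)) else
  (if sel == 137 then ((v3 == 1) ⇛ (v1 == v2)) else
  (if sel == 178 then ((v2 == 1) ⇛ (v1 == v3)) else
  (if sel == 215 then zzF v1 v2 v3 else false)))))))
 catL : Lab -> ℕ
 catL (pp _) = 0
 catL (zp _) = 3
 catL (pz _) = 4
 catL (zz _) = 5
 consL : Lab -> Lab -> Lab -> Bool
 consL α β γ = consF (catL α * 36 + catL β * 6 + catL γ)(kdL α)(vlL α)(kdL β)(vlL β)(kdL γ)(vlL γ)
 isI-idn : ∀ ℓ -> isI (kdP ℓ)(vlP ℓ) ! -> ℓ ~ idn
 isI-idn ℓ h = let a , b = &- h in feat-inj ℓ idn (==- a)(==- b)
 isW-w : ∀ ℓ -> isW (kdP ℓ)(vlP ℓ) ! -> ℓ ~ w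
 isW-w ℓ h = let a , b = &- h in feat-inj ℓ w (==- a)(==- b)
 module _ (κ κ' : ℕ)(ℓ : PL) where
  private
   k = kdP ℓ
   v = vlP ℓ
  zok- : zokF κ κ' k v ! -> Zok κ κ' ℓ
  zok- h with &- {zok1 κ κ' k v}{zok2 κ κ' k v && (zok3 κ κ' k v && zok4 κ κ' k v)} h
  ... | h1 , h' with &- {zok2 κ κ' k v}{zok3 κ κ' k v && zok4 κ κ' k v} h'
  ... | h2 , h'' with &- {zok3 κ κ' k v}{zok4 κ κ' k v} h''
  ... | h3 , h4 = zok
   (\a b e -> not- (⇛- {(κ == 0) && (κ' == 0)}{not (isW k v)} h1 (&+ (==+ a)(==+ b)))(cong (\x -> isW (kdP x)(vlP x)) e))
   (\R a b -> subst (\x -> memN (x ∸ 1) k v !) a (⇛- {not (κ == 0) && (κ' == 0)}{memN (κ ∸ 1) k v} h2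
    (&+ {not (κ == 0)}(cong (\x -> not (x == 0)) a)(==+ b))))
   (\R a b -> trans (cong2 (memN R)(cvk-conv ℓ)(cvv-conv ℓ))
    (subst (\x -> memN (x ∸ 1)(cvk k)(cvv k v) !) b (⇛- {(κ == 0) && not (κ' == 0)}{memN (κ' ∸ 1)(cvk k)(cvv k v)} h3
     (&+ {κ == 0}(==+ a)(cong (\x -> not (x == 0)) b)))))
   (\e -> ==- (⇛- {isI k v}{κ == κ'} h4 (cong (\x -> isI (kdP x)(vlP x)) e)))
  zok+ : Zok κ κ' ℓ -> zokF κ κ' k v !
  zok+ h = &+ {zok1 κ κ' k v}(⇛+ {(κ == 0) && (κ' == 0)} \e -> not+ \i ->
   let a , b = &- {κ == 0}{κ' == 0} e in Zok.gg h (==- a)(==- b)(isW-w ℓ i))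
   (&+ {zok2 κ κ' k v}(⇛+ {not (κ == 0) && (κ' == 0)} \e -> ng κ h (&- {not (κ == 0)}{κ' == 0} e))
   (&+ {zok3 κ κ' k v}(⇛+ {(κ == 0) && not (κ' == 0)} \e -> gn κ' h (&- {κ == 0}{not (κ' == 0)} e))
    (⇛+ {isI k v} \e -> ==+ (Zok.ii h (isI-idn ℓ e)))))
   where
   ng : ∀ κ -> Zok κ κ' ℓ -> not (κ == 0) ! × (κ' == 0) ! -> memN (κ ∸ 1) k v !
   ng (suc R) h (_ , e) = Zok.ng h R refl (==- e)
   gn : ∀ κ' -> Zok κ κ' ℓ ->(κ == 0) ! × not (κ' == 0) ! -> memN (κ' ∸ 1)(cvk k)(cvv k v) !
   gn (suc R) h (e , _) = sym (cong2 (memN R)(cvk-conv ℓ)(cvv-conv ℓ))& Zok.gn h R (==- e) refl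
 id- : ∀ α β γ -> idF (kdP α)(vlP α)(kdP β)(vlP β)(kdP γ)(vlP γ) ! -> α ~ idn -> β ~ γ
 id- α β γ h refl = let a , b = &- h in feat-inj β γ (==- a)(==- b)
 id+ : ∀ α β γ ->(α ~ idn -> β ~ γ)-> idF (kdP α)(vlP α)(kdP β)(vlP β)(kdP γ)(vlP γ) !
 id+ α β γ h = ⇛+ \e -> &+ (==+ (cong kdP (h (isI-idn α e))))(==+ (cong vlP (h (isI-idn α e))))
 pok- : ∀ α β γ -> pokF (kdP α)(vlP α)(kdP β)(vlP β)(kdP γ)(vlP γ) ! -> Pok α β γ
 pok- α β γ h rewrite sym (cvk-conv α) | sym (cvv-conv α) | sym (cvk-conv β) | sym (cvv-conv β) | sym (cvk-conv γ) | sym (cvv-conv γ)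
  | ruP≡ru α β γ | ruP≡ru γ (conv β) α | ruP≡ru (conv α) γ β | ruP≡ru β (conv γ)(conv α) | ruP≡ru (conv γ) α (conv β)
  | ruP≡ru (conv β)(conv α)(conv γ) with &- h
 ... | h1 , h with &- h
 ... | h2 , h with &- h
 ... | h3 , h with &- h
 ... | h4 , h with &- h
 ... | h5 , h with &- h
 ... | h6 , h with &- h
 ... | i1 , h with &- h
 ... | i2 , i3 = record { r1 = mk h1; r2 = mk h2; r3 = mk h3; r4 = mk h4; r5 = mk h5; r6 = mk h6
  ; i1 = id- α β γ i1; i2 = id- β α γ i2; i3 = id- γ β (conv α) i3 }
 pok+ : ∀ α β γ -> Pok α β γ -> pokF (kdP α)(vlP α)(kdP β)(vlP β)(kdP γ)(vlP γ) !
 pok+ α β γ h rewrite sym (cvk-conv α) | sym (cvv-conv α) | sym (cvk-conv β) | sym (cvv-conv β) | sym (cvk-conv γ) | sym (cvv-conv γ)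
  | ruP≡ru α β γ | ruP≡ru γ (conv β) α | ruP≡ru (conv α) γ β | ruP≡ru β (conv γ)(conv α) | ruP≡ru (conv γ) α (conv β)
  | ruP≡ru (conv β)(conv α)(conv γ) =
  &+ (un r1)(&+ (un r2)(&+ (un r3)(&+ (un r4)(&+ (un r5)(&+ (un r6)
   (&+ (id+ α β γ i1)(&+ (id+ β α γ i2)(id+ γ β (conv α) i3))))))))
  where open Pok h
        open RU
 b2n-inj : ∀ a b -> b2n a ~ b2n b -> a ~ b
 b2n-inj true true h = refl
 b2n-inj false false h = refl
 b2n-true : ∀ a ->(b2n a == 1) ! -> a !
 b2n-true true h = refl
 eqz- : ∀ b {x y}->((b2n b == 1) ⇛ (x == y)) ! -> b ! -> x ~ y
 eqz- true h refl = ==- h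
 eqz+ : ∀ b {x y}->(b ! -> x ~ y)->((b2n b == 1) ⇛ (x == y)) !
 eqz+ b h = ⇛+ \e -> ==+ (h (b2n-true b e))
 zzz- : ∀ a b c -> zzF (b2n a)(b2n b)(b2n c) ! ->(a ! -> b ~ c)× (b ! -> a ~ c)× (c ! -> a ~ b)
 zzz- a b c h = let h1 , h' = &- h; h2 , h3 = &- h' in
  (\e -> b2n-inj b c (eqz- a h1 e)), (\e -> b2n-inj a c (eqz- b h2 e)), (\e -> b2n-inj a b (eqz- c h3 e))
 zzz+ : ∀ a b c ->(a ! -> b ~ c)× (b ! -> a ~ c)× (c ! -> a ~ b)-> zzF (b2n a)(b2n b)(b2n c) !
 zzz+ a b c (h1 , h2 , h3) = &+ (eqz+ a (cong b2n ∘ h1))(&+ (eqz+ b (cong b2n ∘ h2))(eqz+ c (cong b2n ∘ h3)))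
 cons- : ∀ α β γ -> consL α β γ ! -> Cons α β γ
 cons- (pp a)(pp b)(pp c) h = pok- a b c h
 cons- (pp a)(pz b)(pz c) h = zok- c b a h
 cons- (zp a)(pp b)(zp c) h = zok- a c b h
 cons- (zp a)(pz b)(zz c) h = eqz- c h
 cons- (pz a)(zp b)(pp c) h = zok- a b c h
 cons- (pz a)(zz b)(pz c) h = eqz- b h
 cons- (zz a)(zp b)(zp c) h = eqz- a h
 cons- (zz a)(zz b)(zz c) h = zzz- a b c h
 cons- (pp _)(pp _)(zp _)()
 cons- (pp _)(pp _)(zz _)()
 cons- (zp _)(pp _)(pp _)()
 cons- (zp _)(pp _)(pz _)()
 cons- (pz _)(pp _)(zp _)()
 cons- (pz _)(pp _)(zz _)()
 cons- (zz _)(pp _)(pp _)()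
 cons- (zz _)(pp _)(pz _)()
 cons+ : ∀ α β γ -> Cons α β γ -> consL α β γ !
 cons+ (pp a)(pp b)(pp c) h = pok+ a b c h
 cons+ (pp a)(pz b)(pz c) h = zok+ c b a h
 cons+ (zp a)(pp b)(zp c) h = zok+ a c b h
 cons+ (zp a)(pz b)(zz c) h = eqz+ c h
 cons+ (pz a)(zp b)(pp c) h = zok+ a b c h
 cons+ (pz a)(zz b)(pz c) h = eqz+ b h
 cons+ (zz a)(zp b)(zp c) h = eqz+ a h
 cons+ (zz a)(zz b)(zz c) h = zzz+ a b c h

-- Bounded search, and the enumeration of the numbers below a bound with a decidable property.
anyN : ℕ ->(ℕ -> Bool)-> Bool
anyN zero Q = false
anyN (suc n) Q = Q n || anyN n Q

anyN+ : ∀ n Q i -> i < n -> Q i ! -> anyN n Q !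
anyN+ (suc n) Q i h q with i ℕ.≟ n
... | yes refl rewrite q = refl
... | no ne with Q n
... | true = refl
... | false = anyN+ n Q i (ℕ.≤∧≢⇒< (≤-pred h) ne) q

anyN- : ∀ n Q -> anyN n Q ! -> ∃[ i ] (i < n × Q i !)
anyN- (suc n) Q h with Q n in e
... | true = n , ≤-refl , e
... | false = let i , i< , q = anyN- n Q h in i , m<n⇒m<1+n i< , q

cnt : (ℕ -> Bool)-> ℕ -> ℕ
cnt P zero = 0
cnt P (suc i) = cnt P i + b2n (P i)

findN : (ℕ -> Bool)-> ℕ -> ℕ
findN Q zero = 0
findN Q (suc n) = if Q n then n else findN Q n

nth : (ℕ -> Bool)-> ℕ -> ℕ -> ℕ
nth P M j = findN (\i -> P i && (cnt P i == j)) M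

findN-sat : ∀ Q n i -> i < n -> Q i ! -> Q (findN Q n) ! × findN Q n < n
findN-sat Q (suc n) i h q with Q n in e
... | true = e , ≤-refl
... | false with i ℕ.≟ n
... | yes refl = case trans (sym q) e of \()
... | no ne = let a , b = findN-sat Q n i (ℕ.≤∧≢⇒< (≤-pred h) ne) q in a , m<n⇒m<1+n b

cnt-mono : ∀ P {i j}-> i ≤ j -> cnt P i ≤ cnt P j
cnt-mono P {j = zero} zl = zl
cnt-mono P {i}{suc j} h with i ℕ.≟ suc j
... | yes refl = ≤-refl
... | no ne = ≤-trans (cnt-mono P {i}{j}(≤-pred (ℕ.≤∧≢⇒< h ne)))(m≤m+n _ _)

cnt-< : ∀ P {i j}-> i < j -> P i ! -> cnt P i < cnt P j
cnt-< P {i} h p = ≤-trans (≤-reflexive (+-comm 1 (cnt P i)& cong (\b -> cnt P i + b2n b)(sym p)))(cnt-mono P h)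

cnt-inj : ∀ P {i j}-> P i ! -> P j ! -> cnt P i ~ cnt P j -> i ~ j
cnt-inj P {i}{j} p q h with <-cmp i j
... | Relation.Binary.tri< l _ _ = efq (<-irrefl h (cnt-< P l p))
... | Relation.Binary.tri≈ _ e _ = e
... | Relation.Binary.tri> _ _ g = efq (<-irrefl (sym h)(cnt-< P g q))

cnt-onto : ∀ P M j -> j < cnt P M -> ∃[ i ] (i < M × P i ! × cnt P i ~ j)
cnt-onto P (suc M) j h with P M in p | j ℕ.≟ cnt P M
... | true | yes refl = M , ≤-refl , p , refl
... | true | no ne = let i , a , b , c = cnt-onto P M j (ℕ.≤∧≢⇒< (≤-pred (subst (j <_)(+-comm (cnt P M) 1) h)) ne) in i , m<n⇒m<1+n a , b , c
... | false | _ = let i , a , b , c = cnt-onto P M j (subst (j <_)(+-identityʳ _) h) in i , m<n⇒m<1+n a , b , c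

module Enum (P : ℕ -> Bool)(M : ℕ) where
 total : ℕ
 total = cnt P M
 nth-spec : ∀ j -> j < total -> nth P M j < M × P (nth P M j) ! × cnt P (nth P M j)~ j
 nth-spec j h with cnt-onto P M j h
 ... | i , i< , p , c with findN-sat (\i -> P i && (cnt P i == j)) M i i< (&+ p (==+ c))
 ... | q , l = let a , b = &- {P (nth P M j)} q in l , a , ==- b
 nth-cnt : ∀ i -> i < M -> P i ! -> cnt P i < total × nth P M (cnt P i)~ i
 nth-cnt i h p = l , cnt-inj P (fst (snd (nth-spec _ l))) p (snd (snd (nth-spec _ l)))
  where l = cnt-< P h p

-- Tables from operations on numbers.
record Ops : Set where
 field
  sz : ℕ -- one less than the number of elements
  join meet : ℕ -> ℕ -> ℕ
  comp' : ℕ -> ℕ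
  top bot : ℕ
  cyl' : ℕ -> ℕ -> ℕ
  diag' : ℕ -> ℕ -> ℕ
 fin : ℕ -> Fin (suc sz)
 fin x = fromℕ< (m%n<n x (suc sz))
 toℕ-fin : ∀ x -> ix (fin x)~ x % suc sz
 toℕ-fin x = Fin.toℕ-fromℕ< (m%n<n x (suc sz))
 toℕ-fin' : ∀ x -> x < suc sz -> ix (fin x)~ x
 toℕ-fin' x h = toℕ-fin x & m<n⇒m%n≡m h
 table : Table 3
 table = record
  { size = suc sz
  ; joinT = tabulate \x -> tabulate \y -> fin (join (ix x)(ix y))
  ; meetT = tabulate \x -> tabulate \y -> fin (meet (ix x)(ix y))
  ; complT = tabulate \x -> fin (comp' (ix x))
  ; topT = fin top
  ; botT = fin bot
  ; cylT = tabulate \i -> tabulate \x -> fin (cyl' (ix i)(ix x))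
  ; diagT = tabulate \i -> tabulate \j -> fin (diag' (ix i)(ix j)) }
 private module A = Alg (Table.alg table)
 tab1 : ∀ {n m}(f : Fin n -> Fin m) x -> look (tabulate f) x ~ f x
 tab1 f x = Vec.lookup∘tabulate f x
 tab2 : ∀ {n m k}(f : Fin n -> Fin m -> Fin k) x y -> look (look (tabulate \x -> tabulate (f x)) x) y ~ f x y
 tab2 f x y = cong (\v -> look v y)(Vec.lookup∘tabulate (\x -> tabulate (f x)) x)& Vec.lookup∘tabulate (f x) y
 join≡ : ∀ x y -> ix (x A.∨ y)~ join (ix x)(ix y) % suc sz
 join≡ x y = cong ix (tab2 (\x y -> fin (join (ix x)(ix y))) x y)& toℕ-fin (join (ix x)(ix y))
 meet≡ : ∀ x y -> ix (x A.∧ y)~ meet (ix x)(ix y) % suc sz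
 meet≡ x y = cong ix (tab2 (\x y -> fin (meet (ix x)(ix y))) x y)& toℕ-fin (meet (ix x)(ix y))
 comp≡ : ∀ x -> ix (A.∼ x)~ comp' (ix x) % suc sz
 comp≡ x = cong ix (tab1 (\x -> fin (comp' (ix x))) x)& toℕ-fin (comp' (ix x))
 cyl≡ : ∀ i x -> ix (A.cyl i x)~ cyl' (ix i)(ix x) % suc sz
 cyl≡ i x = cong ix (tab2 (\i x -> fin (cyl' (ix i)(ix x))) i x)& toℕ-fin (cyl' (ix i)(ix x))
 diag≡ : ∀ i j -> ix (A.diag i j)~ diag' (ix i)(ix j) % suc sz
 diag≡ i j = cong ix (tab2 (\i j -> fin (diag' (ix i)(ix j))) i j)& toℕ-fin (diag' (ix i)(ix j))

-- The algebra of sets of consistent triples of labels.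
module Triples (em : EM)(TS : Tiles) where
 open Tiles TS
 open Numeric TS
 open Codes em TS
 open Labels TS K mem
 abstract
  base-1 : ℕ
  base-1 = 5 + K * 6
  base-1≡ : base-1 ~ 5 + K * 6
  base-1≡ = refl
 kd vl : ℕ -> ℕ
 kd l = l % 6
 vl l = l / 6
 encL : Lab -> ℕ
 encL β = kdL β + vlL β * 6
 kdP<6 : ∀ ℓ -> kdP ℓ < 3
 kdP<6 = elimPL (sl zl)(sl zl)(sl zl)(sl zl)(sl zl)(sl zl)(sl zl)(\_ -> sl (sl zl)) \_ -> sl (sl (sl zl))
 kdL<6 : ∀ β -> kdL β < 6
 kdL<6 (pp ℓ) = ≤-trans (kdP<6 ℓ)(sl (sl (sl zl)))
 kdL<6 (zp _) = sl (sl (sl (sl zl)))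
 kdL<6 (pz _) = sl (sl (sl (sl (sl zl))))
 kdL<6 (zz _) = sl (sl (sl (sl (sl (sl zl)))))
 kd-enc : ∀ β -> kd (encL β)~ kdL β
 kd-enc β = mod-dm 5 (kdL β)(vlL β)(kdL<6 β)
 vl-enc : ∀ β -> vl (encL β)~ vlL β
 vl-enc β = div-dm 5 (kdL β)(vlL β)(kdL<6 β)
 validF : ℕ -> ℕ -> Bool
 validF k v = if k == 0 then v << 7 else (if k << 3 then v << N else (if k << 5 then v << suc K else v << 2))
 decL : ℕ -> ℕ -> Lab
 decL 3 v = zp v
 decL 4 v = pz v
 decL 5 0 = zz false
 decL 5 _ = zz true
 decL k v = pp (unPL k v)
 decL-enc : ∀ β -> decL (kdL β)(vlL β)~ β
 decL-enc (pp ℓ) = elimPL {\ℓ -> decL (kdP ℓ)(vlP ℓ)~ pp ℓ} refl refl refl refl refl refl refl (\_ -> refl)(\_ -> refl) ℓ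
 decL-enc (zp x) = refl
 decL-enc (pz x) = refl
 decL-enc (zz true) = refl
 decL-enc (zz false) = refl
 enc-inj : ∀ β γ -> encL β ~ encL γ -> β ~ γ
 enc-inj β γ h = sym (decL-enc β)& cong2 decL (sym (kd-enc β)& cong kd h & kd-enc γ)
  (sym (vl-enc β)& cong vl h & vl-enc γ)& decL-enc γ
 seven : ∀ v -> v < 7 -> ∃[ β ] (0 ~ kdL β × v ~ vlL β × Valid β)
 seven 0 h = pp idn , refl , refl , tt
 seven 1 h = pp o , refl , refl , tt
 seven 2 h = pp w , refl , refl , tt
 seven 3 h = pp nx , refl , refl , tt
 seven 4 h = pp nx˘ , refl , refl , tt
 seven 5 h = pp ft , refl , refl , tt
 seven 6 h = pp ft˘ , refl , refl , tt
 seven (suc (suc (suc (suc (suc (suc (suc v)))))))(sl (sl (sl (sl (sl (sl (sl ())))))))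
 valid-code : ∀ k v -> k < 6 -> validF k v ! -> ∃[ β ] (k ~ kdL β × v ~ vlL β × Valid β)
 valid-code 0 v _ h = seven v (<<- h)
 valid-code 1 v _ h = pp (tl v), refl , refl , <<- h
 valid-code 2 v _ h = pp (tl˘ v), refl , refl , <<- h
 valid-code 3 v _ h = zp v , refl , refl , ≤-pred (<<- h)
 valid-code 4 v _ h = pz v , refl , refl , ≤-pred (<<- h)
 valid-code 5 0 _ h = zz false , refl , refl , tt
 valid-code 5 1 _ h = zz true , refl , refl , tt
 valid-code 5 (suc (suc v)) _ ()
 valid-code (suc (suc (suc (suc (suc (suc k)))))) v (sl (sl (sl (sl (sl (sl ())))))) h
 code-valid : ∀ β -> Valid β -> validF (kdL β)(vlL β) !
 code-valid (pp ℓ) h = elimPL {\ℓ -> VPL ℓ -> validF (kdP ℓ)(vlP ℓ) !}(\_ -> refl)(\_ -> refl)(\_ -> refl)(\_ -> refl)(\_ -> refl)(\_ -> refl)(\_ -> refl)(\_ -> <<+)(\_ -> <<+) ℓ h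
 code-valid (zp x) h = <<+ (sl h)
 code-valid (pz x) h = <<+ (sl h)
 code-valid (zz true) h = refl
 code-valid (zz false) h = refl
 sel : ℕ -> ℕ -> ℕ -> ℕ
 sel k1 k2 k3 = cat k1 * 36 + cat k2 * 6 + cat k3
 okLab : ℕ -> Bool
 okLab l = validF (kd l)(vl l)
 okTriple : ℕ -> ℕ -> ℕ -> Bool
 okTriple a b c = (okLab a && (okLab b && okLab c)) &&
  consF (sel (kd a)(kd b)(kd c))(kd a)(vl a)(kd b)(vl b)(kd c)(vl c)
 cat-kd : ∀ β -> cat (kdL β)~ catL β
 cat-kd (pp ℓ) with kdP ℓ << 3 | <<+ (kdP<6 ℓ)
 ... | .true | refl = refl
 cat-kd (zp _) = refl
 cat-kd (pz _) = refl
 cat-kd (zz _) = refl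
 okTriple≡ : ∀ α β γ -> Valid α -> Valid β -> Valid γ -> okTriple (encL α)(encL β)(encL γ)~ consL α β γ
 okTriple≡ α β γ va vb vc rewrite kd-enc α | kd-enc β | kd-enc γ | vl-enc α | vl-enc β | vl-enc γ
  | code-valid α va | code-valid β vb | code-valid γ vc | cat-kd α | cat-kd β | cat-kd γ = refl
 okLab-dec : ∀ l -> okLab l ! -> ∃[ β ] (l ~ encL β × Valid β)
 okLab-dec l h with valid-code (kd l)(vl l)(m%n<n l 6) h
 ... | β , e , f , v = β , trans (m≡m%n+[m/n]*n l 6)(cong2 (\x y -> x + y * 6) e f), v
 N≤K : N ≤ K
 N≤K = ≤-trans (m≤m+n N (N + 0))(≤-trans (m≤n+m (2 * N) 4)(n≤2^n (4 + 2 * N)))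
  where
  n≤2^n : ∀ n -> n ≤ 2 ^ n
  n≤2^n zero = zl
  n≤2^n (suc n) = subst (suc n ≤_)(cong (\y -> 2 ^ n + y)(sym (+-identityʳ (2 ^ n))))(+-mono-≤ (m^n>0 2 n)(n≤2^n n))
 6≤K : 6 ≤ K
 6≤K = ≤-trans (m≤m+n 6 10)(^-monoʳ-≤ 2 {4}{nbits}(m≤m+n 4 (2 * N)))
 vl≤K : ∀ β -> Valid β -> vlL β ≤ K
 vl≤K (pp idn) v = zl
 vl≤K (pp o) v = ≤-trans (m≤m+n 1 5) 6≤K
 vl≤K (pp w) v = ≤-trans (m≤m+n 2 4) 6≤K
 vl≤K (pp nx) v = ≤-trans (m≤m+n 3 3) 6≤K
 vl≤K (pp nx˘) v = ≤-trans (m≤m+n 4 2) 6≤K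
 vl≤K (pp ft) v = ≤-trans (m≤m+n 5 1) 6≤K
 vl≤K (pp ft˘) v = 6≤K
 vl≤K (pp (tl x)) v = ≤-trans (<⇒≤ v) N≤K
 vl≤K (pp (tl˘ x)) v = ≤-trans (<⇒≤ v) N≤K
 vl≤K (zp x) v = v
 vl≤K (pz x) v = v
 vl≤K (zz true) v = ≤-trans (m≤m+n 1 5) 6≤K
 vl≤K (zz false) v = zl
 enc< : ∀ β -> Valid β -> encL β < suc base-1
 enc< β v = subst (\x -> encL β < suc x)(sym base-1≡)(+-mono-<-≤ (kdL<6 β)(*-monoˡ-≤ 6 (vl≤K β v)))
 ℓ01 ℓ12 ℓ02 : ℕ -> ℕ
 ℓ01 c = dig base-1 0 c
 ℓ12 c = dig base-1 1 c
 ℓ02 c = dig base-1 2 c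
 okAtom : ℕ -> Bool
 okAtom c = okTriple (ℓ01 c)(ℓ12 c)(ℓ02 c)
 bound : ℕ
 bound = suc base-1 ^ 3
 abstract
  total : ℕ
  total = cnt okAtom bound
  total≡ : total ~ cnt okAtom bound
  total≡ = refl
  atm : ℕ -> ℕ
  atm j = nth okAtom bound j
  atomNo≡ : ∀ j -> atm j ~ nth okAtom bound j
  atomNo≡ j = refl
  nth-spec : ∀ j -> j < total -> atm j < bound × okAtom (atm j) ! × cnt okAtom (atm j)~ j
  nth-spec = Enum.nth-spec okAtom bound
  nth-cnt : ∀ i -> i < bound -> okAtom i ! -> cnt okAtom i < total × atm (cnt okAtom i)~ i
  nth-cnt = Enum.nth-cnt okAtom bound
 three : ℕ -> ℕ -> ℕ -> ℕ -> ℕ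
 three a b c 0 = a
 three a b c 1 = b
 three a b c (suc (suc _)) = c
 code3 : ℕ -> ℕ -> ℕ -> ℕ
 code3 a b c = fd base-1 3 (three a b c)
 edge : ℕ -> ℕ -> ℕ
 edge i c = if i == 0 then ℓ12 c else (if i == 1 then ℓ02 c else ℓ01 c)
 idLab : ℕ -> Bool
 idLab l = isI (kd l)(vl l) || ((kd l == 5) && (vl l == 1))
 onDiag : ℕ -> ℕ -> ℕ -> Bool
 onDiag i j c = if i == j then true else idLab (if (i + j) == 1 then ℓ01 c else (if (i + j) == 2 then ℓ02 c else ℓ12 c))
 joinN meetN cylN : ℕ -> ℕ -> ℕ
 compN : ℕ -> ℕ
 joinN x y = bits total (\j -> bit x j || bit y j)
 meetN x y = bits total (\j -> bit x j && bit y j)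
 compN x = bits total (\j -> not (bit x j))
 cylN i x = bits total (\j -> anyN total (\j' -> bit x j' && (edge i (atm j) == edge i (atm j'))))
 topN botN : ℕ
 topN = bits total (\j -> true)
 botN = bits total (\j -> false)
 diagN : ℕ -> ℕ -> ℕ
 diagN i j = bits total (\k -> onDiag i j (atm k))
 ops : Ops
 ops = record { sz = 2 ^ total ∸ 1; join = joinN; meet = meetN; comp' = compN; top = topN; bot = botN; cyl' = cylN; diag' = diagN }
 tableA : Table 3
 tableA = Ops.table ops
 algA : Alg 3 0ℓ 0ℓ
 algA = Table.alg tableA
 private module A = Alg algA
 size≡ : suc (2 ^ total ∸ 1)~ 2 ^ total
 size≡ = +-comm 1 (2 ^ total ∸ 1)& m∸n+n≡m (m^n>0 2 total)
 has : A.Carrier -> ℕ -> Bool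
 has x j = bit (ix x) j
 red : ∀ f -> bits total f % suc (2 ^ total ∸ 1)~ bits total f
 red f = m<n⇒m%n≡m (subst (bits total f <_)(sym size≡)(bits< total f))
 has-join : ∀ x y j -> j < total -> has (x A.∨ y) j ~ has x j || has y j
 has-join x y j h = cong (\z -> bit z j)(Ops.join≡ ops x y & red _)& bit-bits total (\j -> has x j || has y j) j h
 has-meet : ∀ x y j -> j < total -> has (x A.∧ y) j ~ has x j && has y j
 has-meet x y j h = cong (\z -> bit z j)(Ops.meet≡ ops x y & red _)& bit-bits total (\j -> has x j && has y j) j h
 has-comp : ∀ x j -> j < total -> has (A.∼ x) j ~ not (has x j)
 has-comp x j h = cong (\z -> bit z j)(Ops.comp≡ ops x & red _)& bit-bits total (\j -> not (has x j)) j h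
 has-top : ∀ j -> j < total -> has A.⊤ j !
 has-top j h = cong (\z -> bit z j)(Ops.toℕ-fin ops topN & red _)& bit-bits total (\j -> true) j h
 has-bot : ∀ j -> j < total -> has A.⊥ j ~ false
 has-bot j h = cong (\z -> bit z j)(Ops.toℕ-fin ops botN & red _)& bit-bits total (\j -> false) j h
 has-cyl : ∀ i x j -> j < total -> has (A.cyl i x) j ~ anyN total (\j' -> has x j' && (edge (ix i)(atm j) == edge (ix i)(atm j')))
 has-cyl i x j h = cong (\z -> bit z j)(Ops.cyl≡ ops i x & red _)& bit-bits total (\j -> anyN total (\j' -> has x j' && (edge (ix i)(atm j) == edge (ix i)(atm j')))) j h
 has-diag : ∀ i k j -> j < total -> has (A.diag i k) j ~ onDiag (ix i)(ix k)(atm j)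
 has-diag i k j h = cong (\z -> bit z j)(Ops.diag≡ ops i k & red _)& bit-bits total (\j -> onDiag (ix i)(ix k)(atm j)) j h
 has-ext : ∀ x y ->(∀ j -> j < total -> has x j ~ has y j)-> x ~ y
 has-ext x y h = Fin.toℕ-injective (bit-ext total (ix x)(ix y)(lt x)(lt y) h)
  where
  lt : ∀ x -> ix x < 2 ^ total
  lt x = subst (ix x <_) size≡ (Fin.toℕ<n x)
 -- the element with prescribed atoms
 elt : (ℕ -> Bool)-> A.Carrier
 elt f = Ops.fin ops (bits total f)
 has-elt : ∀ f j -> j < total -> has (elt f) j ~ f j
 has-elt f j h = cong (\z -> bit z j)(Ops.toℕ-fin ops (bits total f)& red f)& bit-bits total f j h
 record Atom (j : ℕ) : Set where
  field
   α β γ : Lab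
   e1 : ℓ01 (atm j)~ encL α
   e2 : ℓ12 (atm j)~ encL β
   e3 : ℓ02 (atm j)~ encL γ
   v1 : Valid α
   v2 : Valid β
   v3 : Valid γ
   cons : Cons α β γ
 labels : ∀ a b c -> okTriple a b c ! -> Σ[ α ∈ Lab ] Σ[ β ∈ Lab ] Σ[ γ ∈ Lab ]
  (a ~ encL α × b ~ encL β × c ~ encL γ × Valid α × Valid β × Valid γ × Cons α β γ)
 labels a b c p with &- {okLab a && (okLab b && okLab c)} p
 ... | q , r with &- {okLab a} q
 ... | q1 , q' with &- {okLab b} q'
 ... | q2 , q3 with okLab-dec a q1 | okLab-dec b q2 | okLab-dec c q3
 ... | α , refl , v1 | β , refl , v2 | γ , refl , v3 = α , β , γ , refl , refl , refl , v1 , v2 , v3 , cons- α β γ (sym (okTriple≡ α β γ v1 v2 v3)& p)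
 atom' : ∀ j -> j < total -> Atom j
 atom' j h = let α , β , γ , e1 , e2 , e3 , v1 , v2 , v3 , k = labels _ _ _ (fst (snd (nth-spec j h))) in
  record { α = α; β = β; γ = γ; e1 = e1; e2 = e2; e3 = e3; v1 = v1; v2 = v2; v3 = v3; cons = k }
 abstract
  atom : ∀ j -> j < total -> Atom j
  atom = atom'
 numb : Lab -> Lab -> Lab -> ℕ
 numb α β γ = cnt okAtom (code3 (encL α)(encL β)(encL γ))
 module _ (α β γ : Lab)(va : Valid α)(vb : Valid β)(vc : Valid γ)(h : Cons α β γ) where
  private
   c = code3 (encL α)(encL β)(encL γ)
   lt : ∀ i -> three (encL α)(encL β)(encL γ) i < suc base-1
   lt 0 = enc< α va
   lt 1 = enc< β vb
   lt (suc (suc i)) = enc< γ vc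
   d0 : ℓ01 c ~ encL α
   d0 = dig-fd base-1 3 _ 0 lt (sl zl)
   d1 : ℓ12 c ~ encL β
   d1 = dig-fd base-1 3 _ 1 lt (sl (sl zl))
   d2 : ℓ02 c ~ encL γ
   d2 = dig-fd base-1 3 _ 2 lt (sl (sl (sl zl)))
   ok : okAtom c !
   ok = subst₂ (\x y -> okTriple x y (ℓ02 c) !)(sym d0)(sym d1)(subst (\z -> okTriple (encL α)(encL β) z !)(sym d2)
    (okTriple≡ α β γ va vb vc & cons+ α β γ h))
   spec = nth-cnt c (fd-< base-1 3 _ lt) ok
  numb< : numb α β γ < total
  numb< = fst spec
  numb-ℓ01 : ℓ01 (atm (numb α β γ))~ encL α
  numb-ℓ01 = cong ℓ01 (snd spec)& d0
  numb-ℓ12 : ℓ12 (atm (numb α β γ))~ encL β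
  numb-ℓ12 = cong ℓ12 (snd spec)& d1
  numb-ℓ02 : ℓ02 (atm (numb α β γ))~ encL γ
  numb-ℓ02 = cong ℓ02 (snd spec)& d2
 idLab-enc : ∀ β -> idLab (encL β)~ isId β
 idLab-enc β rewrite kd-enc β | vl-enc β = go β
  where
  go : ∀ β ->(isI (kdL β)(vlL β) || ((kdL β == 5) && (vlL β == 1)))~ isId β
  go (pp ℓ) = elimPL {\ℓ ->(isI (kdP ℓ)(vlP ℓ) || ((kdP ℓ == 5) && (vlP ℓ == 1)))~ isId (pp ℓ)} refl refl refl refl refl refl refl (\_ -> refl)(\_ -> refl) ℓ
  go (zp x) = refl
  go (pz x) = refl
  go (zz true) = refl
  go (zz false) = refl
 -- an atom is determined by its labels
 atom-ext : ∀ j j' -> j < total -> j' < total -> ℓ01 (atm j)~ ℓ01 (atm j')-> ℓ12 (atm j)~ ℓ12 (atm j')-> ℓ02 (atm j)~ ℓ02 (atm j')-> j ~ j'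
 atom-ext j j' h h' a b c = let l , _ , e = nth-spec j h; l' , _ , e' = nth-spec j' h' in
  trans (sym e)(cong (cnt okAtom)(dig-ext base-1 3 _ _ l l' \ { 0 _ -> a; 1 _ -> b; 2 _ -> c; (suc (suc (suc i)))(sl (sl (sl ()))) })& e')

module Classical (em : EM) where
 abstract
  tr : Set -> Bool
  tr P = does (em 0ℓ {P})
  tr- : ∀ {P}-> tr P ! -> P
  tr- {P} h with em 0ℓ {P}
  ... | yes p = p
  tr+ : ∀ {P}-> P -> tr P !
  tr+ {P} p with em 0ℓ {P}
  ... | yes _ = refl
  ... | no n = efq (n p)
 bext : ∀ {a b : Bool}->(a ! -> b !)->(b ! -> a !)-> a ~ b
 bext {true} f g = sym (f refl)
 bext {false}{true} f g = g refl
 bext {false}{false} f g = refl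
 tr-cong : ∀ {P Q : Set}->(P -> Q)->(Q -> P)-> tr P ~ tr Q
 tr-cong f g = bext (\h -> tr+ (f (tr- h)))(\h -> tr+ (g (tr- h)))

-- Algebras of sets given by characteristic functions.
module Pointwise {C X : Set}(v : C -> X -> Bool)(_∪_ _∩_ : C -> C -> C)(−_ : C -> C)(𝟏 𝟎 : C)
 (v∪ : ∀ a b x -> v (a ∪ b) x ~ v a x || v b x)(v∩ : ∀ a b x -> v (a ∩ b) x ~ v a x && v b x)(v− : ∀ a x -> v (− a) x ~ not (v a x))
 (v𝟏 : ∀ x -> v 𝟏 x !)(v𝟎 : ∀ x -> v 𝟎 x ~ false) where
 _≋_ : C -> C -> Set
 a ≋ b = ∀ x -> v a x ~ v b x
 boolean : IsBooleanAlgebra _≋_ _∪_ _∩_ −_ 𝟏 𝟎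
 boolean = isBooleanAlgebraʳ record
  { isDistributiveLattice = isDistributiveLatticeʳʲᵐ record
   { isLattice = record
    { isEquivalence = record { refl = \x -> refl; sym = \h x -> sym (h x); trans = \h k x -> trans (h x)(k x) }
    ; ∨-comm = \a b x -> trans (v∪ a b x)(Bool.∨-comm (v a x)(v b x)& sym (v∪ b a x))
    ; ∨-assoc = ∨-assoc'
    ; ∨-cong = \ {a}{a'}{b}{b'} h k x -> trans (v∪ a b x)(cong2 _||_ (h x)(k x)& sym (v∪ a' b' x))
    ; ∧-comm = \a b x -> trans (v∩ a b x)(Bool.∧-comm (v a x)(v b x)& sym (v∩ b a x))
    ; ∧-assoc = ∧-assoc'
    ; ∧-cong = \ {a}{a'}{b}{b'} h k x -> trans (v∩ a b x)(cong2 _&&_ (h x)(k x)& sym (v∩ a' b' x))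
    ; absorptive = absorb1 , absorb2 }
   ; ∨-distribʳ-∧ = dist }
  ; ∨-complementʳ = \a x -> trans (v∪ a (− a) x)(cong (v a x ||_)(v− a x)& snd Bool.∨-inverse (v a x)& sym (v𝟏 x))
  ; ∧-complementʳ = \a x -> trans (v∩ a (− a) x)(cong (v a x &&_)(v− a x)& snd Bool.∧-inverse (v a x)& sym (v𝟎 x))
  ; ¬-cong = \ {a}{b} h x -> trans (v− a x)(cong not (h x)& sym (v− b x)) }
  where
  open import Algebra.Lattice.Structures.Biased _≋_
  ∨-assoc' : ∀ a b c ->((a ∪ b) ∪ c) ≋ (a ∪ (b ∪ c))
  ∨-assoc' a b c x rewrite v∪ (a ∪ b) c x | v∪ a b x | v∪ a (b ∪ c) x | v∪ b c x = Bool.∨-assoc (v a x)(v b x)(v c x)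
  ∧-assoc' : ∀ a b c ->((a ∩ b)∩ c) ≋ (a ∩ (b ∩ c))
  ∧-assoc' a b c x rewrite v∩ (a ∩ b) c x | v∩ a b x | v∩ a (b ∩ c) x | v∩ b c x = Bool.∧-assoc (v a x)(v b x)(v c x)
  absorb1 : ∀ a b ->(a ∪ (a ∩ b)) ≋ a
  absorb1 a b x rewrite v∪ a (a ∩ b) x | v∩ a b x = fst Bool.∨-∧-absorptive (v a x)(v b x)
  absorb2 : ∀ a b ->(a ∩ (a ∪ b)) ≋ a
  absorb2 a b x rewrite v∩ a (a ∪ b) x | v∪ a b x = snd Bool.∨-∧-absorptive (v a x)(v b x)
  dist : ∀ a b c ->((b ∩ c) ∪ a) ≋ ((b ∪ a)∩ (c ∪ a))
  dist a b c x rewrite v∪ (b ∩ c) a x | v∩ b c x | v∩ (b ∪ a)(c ∪ a) x | v∪ b a x | v∪ c a x = snd Bool.∨-distrib-∧ (v a x)(v b x)(v c x)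

-- Cylindric atom structures.
record Frame (n : ℕ) : Set1 where
 infix 4 _∼_
 field
  Pt : Set
  _∼_ : Pt -> Pt -> Set
  E : Fin n -> Pt -> Pt -> Set
  D : Fin n -> Fin n -> Pt -> Set
  ∼-E : ∀ i {p q}-> p ∼ q -> E i p q
  ∼-D : ∀ i j {p q}-> p ∼ q -> D i j p -> D i j q
  ∼-sym : ∀ {p q}-> p ∼ q -> q ∼ p
  E-refl : ∀ i p -> E i p p
  E-sym : ∀ i {p q}-> E i p q -> E i q p
  E-trans : ∀ i {p q r}-> E i p q -> E i q r -> E i p r
  E-comm : ∀ i j {p q r}-> E i p q -> E j q r -> ∃[ s ] (E j p s × E i s r)
  D-refl : ∀ i p -> D i i p
  D-cyl⇒ : ∀ i j k -> k # i -> k # j -> ∀ p -> D i j p -> ∃[ q ] (E k p q × D i k q × D k j q)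
  D-cyl⇐ : ∀ i j k -> k # i -> k # j -> ∀ p q -> E k p q -> D i k q -> D k j q -> D i j p
  D-sub : ∀ i j -> i # j -> ∀ {p q}-> E i p q -> D i j p -> D i j q -> p ∼ q

module ComplexAlgebra (em : EM){n : ℕ}(F : Frame n) where
 open Frame F
 open Classical em
 Elt : Set
 Elt = Σ[ X ∈ (Pt -> Bool) ] (∀ {p q}-> p ∼ q -> X p ~ X q)
 Cyl : Fin n ->(Pt -> Bool)-> Pt -> Set
 Cyl i X p = ∃[ q ] (E i p q × X q !)
 cm : Alg n 0ℓ 0ℓ
 cm = record
  { Carrier = Elt
  ; _≈_ = \(X , _)(Y , _)-> ∀ p -> X p ~ Y p
  ; isEquivalence = record { refl = \p -> refl; sym = \h p -> sym (h p); trans = \h k p -> trans (h p)(k p) }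
  ; _∨_ = \(X , f)(Y , g)->(\p -> X p || Y p), \e -> cong2 _||_ (f e)(g e)
  ; _∧_ = \(X , f)(Y , g)->(\p -> X p && Y p), \e -> cong2 _&&_ (f e)(g e)
  ; ∼_ = \(X , f)->(\p -> not (X p)), \e -> cong not (f e)
  ; ⊤ = (\_ -> true), \_ -> refl
  ; ⊥ = (\_ -> false), \_ -> refl
  ; cyl = \i (X , f)->(\p -> tr (Cyl i X p)), \e -> tr-cong (\(r , a , b)-> r , E-trans i (∼-E i (∼-sym e)) a , b)(\(r , a , b)-> r , E-trans i (∼-E i e) a , b)
  ; diag = \i j ->(\p -> tr (D i j p)), \e -> tr-cong (∼-D i j e)(∼-D i j (∼-sym e))
  ; ∨-cong = \h k p -> cong2 _||_ (h p)(k p)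
  ; ∧-cong = \h k p -> cong2 _&&_ (h p)(k p)
  ; ∼-cong = \h p -> cong not (h p)
  ; cyl-cong = \i h p -> tr-cong (\(r , a , b)-> r , a , trans (sym (h r)) b)(\(r , a , b)-> r , a , trans (h r) b)
  }
 cmCA : CA n 0ℓ 0ℓ
 cmCA = record
  { alg = cm
  ; isCA = record
   { isBooleanAlgebra = Pointwise.boolean {Elt}{Pt} fst (Alg._∨_ cm)(Alg._∧_ cm)(Alg.∼_ cm)(Alg.⊤ cm)(Alg.⊥ cm)(\_ _ _ -> refl)(\_ _ _ -> refl)(\_ _ -> refl)(\_ -> refl)(\_ -> refl)
   ; cyl-⊥ = \i p -> bext (\h -> case snd (snd (tr- h)) of \())(\())
   ; cyl-⊑ = \i (X , _) p -> bext (\h -> fst (&- {X p}{tr (Cyl i X p)} h))(\h -> cong2 _&&_ h (tr+ (p , E-refl i p , h)))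
   ; cyl-∧ = \i (X , _)(Y , _) p -> bext
    (\h -> let q , e , k = tr- h; a , b = &- {X q}{tr (Cyl i Y q)} k; r , e' , c = tr- b in
     cong2 _&&_ (tr+ (q , e , a))(tr+ (r , E-trans i e e' , c)))
    (\h -> let a , b = &- {tr (Cyl i X p)}{tr (Cyl i Y p)} h; q , e , k = tr- a; r , e' , c = tr- b in
     tr+ (q , e , cong2 _&&_ k (tr+ (r , E-trans i (E-sym i e) e' , c))))
   ; cyl-comm = \i j (X , _) p -> bext (swap i j X p)(swap j i X p)
   ; diag-⊤ = \i p -> tr+ (D-refl i p)
   ; diag-cyl = \i j k ki kj p -> bext
    (\h -> let q , e , a , b = D-cyl⇒ i j k ki kj p (tr- h) in tr+ (q , e , cong2 _&&_ (tr+ a)(tr+ b)))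
    (\h -> let q , e , c = tr- h; a , b = &- {tr (D i k q)}{tr (D k j q)} c in tr+ (D-cyl⇐ i j k ki kj p q e (tr- a)(tr- b)))
   ; diag-sub = \i j (X , f) ij p -> bext
    (\h -> let a , b = &- {tr (Cyl i (\q -> tr (D i j q) && X q) p)}{tr (Cyl i (\q -> tr (D i j q) && not (X q)) p)} h
               q , e , c = tr- a; r , e' , d = tr- b
               c1 , c2 = &- {tr (D i j q)}{X q} c; d1 , d2 = &- {tr (D i j r)}{not (X r)} d
               s = D-sub i j ij (E-trans i (E-sym i e) e')(tr- c1)(tr- d1) in
     case trans (sym d2)(cong not (sym (f s)& c2)) of \())
    (\()) } }
  where
  swap : ∀ i j X p -> tr (Cyl i (\q -> tr (Cyl j X q)) p) ! -> tr (Cyl j (\q -> tr (Cyl i X q)) p) !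
  swap i j X p h = let q , e , k = tr- h; r , e' , x = tr- k; s , a , b = E-comm i j e e' in tr+ (s , a , tr+ (r , b , x))

-- The frame of all sequences of elements of a set.
module Tuples (M : Set)(_≟_ : (a b : M)-> Dec (a ~ b))(n : ℕ) where
 _≈[_]_ : Vec M n -> Fin n -> Vec M n -> Set
 s ≈[ i ] t = ∀ j -> j # i -> look s j ~ look t j
 upd : ∀ (s : Vec M n) i a j -> j # i -> look (s [ i ]≔ a) j ~ look s j
 upd s i a j ne = Vec.lookup∘updateAt′ j i ne s
 upd-at : ∀ (s : Vec M n) i a -> look (s [ i ]≔ a) i ~ a
 upd-at s i a = Vec.lookup∘updateAt i s
 vec-ext : ∀ {m}(s t : Vec M m)->(∀ j -> look s j ~ look t j)-> s ~ t
 vec-ext s t h = sym (Vec.tabulate∘lookup s)& Vec.tabulate-cong h & Vec.tabulate∘lookup t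
 frame : Frame n
 frame = record
  { Pt = Vec M n; _∼_ = _~_; E = \i s t -> s ≈[ i ] t; D = \i j s -> look s i ~ look s j
  ; ∼-E = \ { i refl j _ -> refl }; ∼-D = \ { i j refl h -> h }; ∼-sym = sym
  ; E-refl = \i p j _ -> refl; E-sym = \i h j ne -> sym (h j ne); E-trans = \i h k j ne -> trans (h j ne)(k j ne)
  ; E-comm = comm
  ; D-refl = \i p -> refl
  ; D-cyl⇒ = \i j k ki kj p h -> p [ k ]≔ look p i , (\l ne -> sym (upd p k _ l ne))
   , trans (upd p k _ i (ki ∘ sym))(sym (upd-at p k _)), trans (upd-at p k _)(h & sym (upd p k _ j (kj ∘ sym)))
  ; D-cyl⇐ = \i j k ki kj p q e a b -> trans (e i (ki ∘ sym))(a & b & sym (e j (kj ∘ sym)))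
  ; D-sub = \i j ij {p}{q} e a b -> vec-ext p q \l -> sub i j ij {p}{q} e a b l (l Fin.≟ i) }
  where
  sub : ∀ i j -> i # j -> ∀ {p q : Vec M n}-> p ≈[ i ] q -> look p i ~ look p j -> look q i ~ look q j -> ∀ l -> Dec (l ~ i)-> look p l ~ look q l
  sub i j ij e a b l (no ne) = e l ne
  sub i j ij e a b .i (yes refl) = a & e j (ij ∘ sym)& sym b
  comm : ∀ i j {p q r : Vec M n}-> p ≈[ i ] q -> q ≈[ j ] r -> ∃[ s ] (p ≈[ j ] s × s ≈[ i ] r)
  comm i j {p}{q}{r} h k = p [ j ]≔ look r j , (\l ne -> sym (upd p j _ l ne)), \l ne -> go l ne (l Fin.≟ j)
   where
   go : ∀ l -> l # i -> Dec (l ~ j)-> look (p [ j ]≔ look r j) l ~ look r l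
   go l ne (yes refl) = upd-at p l _
   go l ne (no nj) = upd p j _ l nj & h l ne & k l nj

convL : Lab -> Lab
convL (pp ℓ) = pp (conv ℓ)
convL (zp κ) = pz κ
convL (pz κ) = zp κ
convL (zz b) = zz b

convL-convL : ∀ β -> convL (convL β)~ β
convL-convL (pp ℓ) = cong pp (cc ℓ)
convL-convL (zp κ) = refl
convL-convL (pz κ) = refl
convL-convL (zz b) = refl

module ConsSym (TS : Tiles)(K : ℕ)(mem : ℕ -> PL -> Bool) where
 open Tiles TS
 open Labels TS K mem
 open RU
 RU∘ : ∀ {a b c a' b' c'}-> a ~ a' -> b ~ b' -> c ~ c' -> RU a b c -> RU a' b' c'
 RU∘ refl refl refl h = h
 convInj : ∀ {a b}-> conv a ~ conv b -> a ~ b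
 convInj {a}{b} h = sym (cc a)& cong conv h & cc b
 conv-id : ∀ {a}-> conv a ~ idn -> a ~ idn
 conv-id h = convInj h
 convL-valid : ∀ β -> Valid β -> Valid (convL β)
 convL-valid (pp ℓ) v = conv-valid TS ℓ v
 convL-valid (zp κ) v = v
 convL-valid (pz κ) v = v
 convL-valid (zz b) v = v
 zokSym : ∀ {κ κ' ℓ}-> Zok κ κ' ℓ -> Zok κ' κ (conv ℓ)
 zokSym {κ}{κ'}{ℓ} h = zok (\a b e -> Zok.gg h b a (convInj e))
  (\R a b -> Zok.gn h R b a)(\R a b -> trans (cong (mem R)(cc ℓ))(Zok.ng h R b a))
  (\i -> sym (Zok.ii h (conv-id i)))
 swap2 : ∀ α β γ -> Cons α β γ -> Cons γ (convL β) α
 swap2 (pp α)(pp β)(pp γ) h = record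
  { r1 = r2; r2 = RU∘ refl (sym (cc β)) refl r1; r3 = r5; r4 = r6; r5 = RU∘ refl refl (sym (cc β)) r3
  ; r6 = RU∘ (sym (cc β)) refl refl r4
  ; i1 = \e -> trans (cong conv (i3 e))(cc α); i2 = \e -> sym (i2 (conv-id e)); i3 = \e -> cong conv (i1 e) }
  where open Pok h
 swap2 (pp ℓ)(pz κ')(pz κ) h = h
 swap2 (zp κ)(pp ℓ)(zp κ') h = zokSym h
 swap2 (pz κ)(zp κ')(pp ℓ) h = h
 swap2 (zz e)(zp κ)(zp κ') h = \k -> sym (h k)
 swap2 (zp κ)(pz κ')(zz e) h = \k -> sym (h k)
 swap2 (pz κ)(zz e)(pz κ') h = \k -> sym (h k)
 swap2 (zz a)(zz b)(zz c)(f , g , h) = (\k -> sym (h k)), (\k -> sym (g k)), (\k -> sym (f k))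
 rot : ∀ α β γ -> Cons α β γ -> Cons β (convL γ)(convL α)
 rot (pp α)(pp β)(pp γ) h = record
  { r1 = r4; r2 = RU∘ refl (sym (cc γ)) refl r3; r3 = r6; r4 = RU∘ refl (sym (cc α)) refl r5
  ; r5 = RU∘ (sym (cc α)) refl (sym (cc γ)) r1
  ; r6 = RU∘ (sym (cc γ)) refl (sym (cc α)) r2
  ; i1 = \e -> cong conv (sym (i2 e)); i2 = \e -> i3 (conv-id e); i3 = \e -> cong conv (sym (i1 (conv-id e))) }
  where open Pok h
 rot (pp ℓ)(pz κ')(pz κ) h = zokSym h
 rot (zp κ)(pp ℓ)(zp κ') h = h
 rot (pz κ)(zp κ')(pp ℓ) h = zokSym h
 rot (zz e)(zp κ)(zp κ') h = h
 rot (zp κ)(pz κ')(zz e) h = \k -> sym (h k)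
 rot (pz κ)(zz e)(pz κ') h = \k -> sym (h k)
 rot (zz a)(zz b)(zz c)(f , g , h) = (\k -> sym (g k)), (\k -> sym (h k)), f
 srcZ : Lab -> Bool
 srcZ (pp _) = false
 srcZ (zp _) = true
 srcZ (pz _) = false
 srcZ (zz _) = true
 ident : Bool -> Lab
 ident false = pp idn
 ident true = zz true
 open RuLemmas TS using (ru-conv; ru-id1)
 pok-id : ∀ α -> Pok idn α α
 pok-id α = record
  { r1 = mk (ru-id1 α α); r2 = mk (ru-conv α idn); r3 = mk (ru-id1 α α); r4 = mk (ru-conv α idn); r5 = mk refl; r6 = mk refl
  ; i1 = \_ -> refl; i2 = sym; i3 = \e -> e }
 cons-id : ∀ δ -> Cons (ident (srcZ δ)) δ δ
 cons-id (pp α) = pok-id α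
 cons-id (zp κ) = \_ -> refl
 cons-id (pz κ) = zok (\_ _ ())(\ { R refl () })(\ { R refl () })(\_ -> refl)
 cons-id (zz b) = (\_ -> refl), sym , sym

module Represent (em : EM)(TS : Tiles)(St : Structure TS (Codes.masks em TS))
 (n : ℕ) .(3≤n : 3 ≤ n) where
 open Tiles TS
 open Codes em TS
 open Triples em TS
 open Labels TS K mem
 open ConsSym TS K mem
 open Classical em
 open Structure St
 open Tuples M (\a b -> em 0ℓ) n
 open ComplexAlgebra em frame
 private module A = Alg algA
 lab-conv : ∀ a b -> lab b a ~ convL (lab a b)
 lab-conv a b = go (lab a b)(lab b a)(lab a a)(id⇐ a)(cons a b a)
  where
  isI : ∀ ℓ -> isId (pp ℓ) ! -> ℓ ~ idn
  isI idn e = refl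
  go : ∀ α β γ -> isId γ ! -> Cons α β γ -> β ~ convL α
  go (pp α)(pp β)(pp γ) e h = cong pp (Pok.i3 h (isI γ e))
  go (zp κ)(pz κ')(zz true) e h = cong pz (sym (h refl))
  go (pz κ)(zp κ')(pp ℓ) e h = cong zp (sym (Zok.ii h (isI ℓ e)))
  go (zz _)(zp _)(zp _)() h
  go (pp _)(pp _)(zz _) e ()
  go (zp _)(pp _)(pp _) e ()
  go (pz _)(pp _)(zz _) e ()
  go (zz a)(zz b)(zz true) e (_ , _ , h) = cong zz (sym (h refl))
 c0 c1 c2 : Fin n
 c0 = inject≤ zero 3≤n
 c1 = inject≤ 1F 3≤n
 c2 = inject≤ 2F 3≤n
 inj# : ∀ (i j : Fin 3)-> i # j -> inject≤ i 3≤n # inject≤ j 3≤n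
 inj# i j ne e = ne (Fin.inject≤-injective 3≤n 3≤n i j e)
 -- the atom realised by the first three coordinates
 at : Vec M n -> ℕ
 at s = numb (lab (look s c0)(look s c1))(lab (look s c1)(look s c2))(lab (look s c0)(look s c2))
 at< : ∀ s -> at s < total
 at< s = numb< _ _ _ (valid _ _)(valid _ _)(valid _ _)(cons (look s c0)(look s c1)(look s c2))
 at01 : ∀ s -> ℓ01 (atm (at s))~ encL (lab (look s c0)(look s c1))
 at01 s = numb-ℓ01 _ _ _ (valid _ _)(valid _ _)(valid _ _)(cons (look s c0)(look s c1)(look s c2))
 at12 : ∀ s -> ℓ12 (atm (at s))~ encL (lab (look s c1)(look s c2))
 at12 s = numb-ℓ12 _ _ _ (valid _ _)(valid _ _)(valid _ _)(cons (look s c0)(look s c1)(look s c2))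
 at02 : ∀ s -> ℓ02 (atm (at s))~ encL (lab (look s c0)(look s c2))
 at02 s = numb-ℓ02 _ _ _ (valid _ _)(valid _ _)(valid _ _)(cons (look s c0)(look s c1)(look s c2))
 set : A.Carrier -> Vec M n -> Bool
 set x s = has x (at s)
 at-cong : ∀ s t -> look s c0 ~ look t c0 -> look s c1 ~ look t c1 -> look s c2 ~ look t c2 -> at s ~ at t
 at-cong s t e f g rewrite e | f | g = refl
 below : ∀ (i : Fin n)(j : Fin 3)-> 3 ≤ ix i -> inject≤ j 3≤n # i
 below i j h refl = ℕ.<⇒≱ (Fin.toℕ<n j)(subst (3 ≤_)(Fin.toℕ-inject≤ j 3≤n) h)
 -- realising a given atom by changing one coordinate
 realise : ∀ (i : Fin 3) s j -> j < total -> edge (ix i)(atm (at s))~ edge (ix i)(atm j)->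
  ∃[ t ] (s ≈[ inject≤ i 3≤n ] t × at t ~ j)
 realise zero s j j< e = t , (\l ne -> sym (upd s c0 c l ne)), atom-ext _ j (at< t) j<
  (at01 t & cong encL (cong2 lab tc0 tc1 & lab-conv _ _ & cong convL (snd (snd wt))& convL-convL α)& sym e1)
  (at12 t & cong encL (cong2 lab tc1 tc2 & q)& sym e2)
  (at02 t & cong encL (cong2 lab tc0 tc2 & lab-conv _ _ & cong convL (fst (snd wt))& convL-convL γ)& sym e3)
  where
  open Atom (atom j j<) renaming (cons to k)
  q : lab (look s c1)(look s c2)~ β
  q = enc-inj _ _ (sym (at12 s)& e & e2)
  wt = meets (look s c1)(look s c2)(convL γ)(convL α)(convL-valid γ v3)(convL-valid α v1)
   (subst (\x -> Cons x (convL γ)(convL α))(sym q)(rot α β γ k))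
  c = fst wt
  t = s [ c0 ]≔ c
  tc0 : look t c0 ~ c
  tc0 = upd-at s c0 c
  tc1 : look t c1 ~ look s c1
  tc1 = upd s c0 c c1 (inj# _ _ \())
  tc2 : look t c2 ~ look s c2
  tc2 = upd s c0 c c2 (inj# _ _ \())
 realise 1F s j j< e = t , (\l ne -> sym (upd s c1 c l ne)), atom-ext _ j (at< t) j<
  (at01 t & cong encL (cong2 lab tc0 tc1 & snd (snd wt))& sym e1)
  (at12 t & cong encL (cong2 lab tc1 tc2 & lab-conv _ _ & cong convL (fst (snd wt))& convL-convL β)& sym e2)
  (at02 t & cong encL (cong2 lab tc0 tc2 & q)& sym e3)
  where
  open Atom (atom j j<) renaming (cons to k)
  q : lab (look s c0)(look s c2)~ γ
  q = enc-inj _ _ (sym (at02 s)& e & e3)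
  wt = meets (look s c0)(look s c2)(convL β) α (convL-valid β v2) v1
   (subst (\x -> Cons x (convL β) α)(sym q)(swap2 α β γ k))
  c = fst wt
  t = s [ c1 ]≔ c
  tc0 : look t c0 ~ look s c0
  tc0 = upd s c1 c c0 (inj# _ _ \())
  tc1 : look t c1 ~ c
  tc1 = upd-at s c1 c
  tc2 : look t c2 ~ look s c2
  tc2 = upd s c1 c c2 (inj# _ _ \())
 realise 2F s j j< e = t , (\l ne -> sym (upd s c2 c l ne)), atom-ext _ j (at< t) j<
  (at01 t & cong encL (cong2 lab tc0 tc1 & q)& sym e1)
  (at12 t & cong encL (cong2 lab tc1 tc2 & fst (snd wt))& sym e2)
  (at02 t & cong encL (cong2 lab tc0 tc2 & snd (snd wt))& sym e3)
  where
  open Atom (atom j j<) renaming (cons to k)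
  q : lab (look s c0)(look s c1)~ α
  q = enc-inj _ _ (sym (at01 s)& e & e1)
  wt = meets (look s c0)(look s c1) β γ v2 v3 (subst (\x -> Cons x β γ)(sym q) k)
  c = fst wt
  t = s [ c2 ]≔ c
  tc0 : look t c0 ~ look s c0
  tc0 = upd s c2 c c0 (inj# _ _ \())
  tc1 : look t c1 ~ look s c1
  tc1 = upd s c2 c c1 (inj# _ _ \())
  tc2 : look t c2 ~ c
  tc2 = upd-at s c2 c
 edge-same : ∀ (i : Fin 3) s t -> s ≈[ inject≤ i 3≤n ] t -> edge (ix i)(atm (at s))~ edge (ix i)(atm (at t))
 edge-same zero s t h = at12 s & cong encL (cong2 lab (h c1 (inj# _ _ \()))(h c2 (inj# _ _ \())))& sym (at12 t)
 edge-same 1F s t h = at02 s & cong encL (cong2 lab (h c0 (inj# _ _ \()))(h c2 (inj# _ _ \())))& sym (at02 t)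
 edge-same 2F s t h = at01 s & cong encL (cong2 lab (h c0 (inj# _ _ \()))(h c1 (inj# _ _ \())))& sym (at01 t)
 id-iff : ∀ a b l -> l ~ encL (lab a b)-> idLab l ~ tr (a ~ b)
 id-iff a b l refl = idLab-enc (lab a b)& bext (\h -> tr+ (id⇒ a b h))(\h -> subst (\x -> isId (lab a x) !)(tr- h)(id⇐ a))
 diag-iff : ∀ (i j : Fin 3) s -> onDiag (ix i)(ix j)(atm (at s))~ tr (look s (inject≤ i 3≤n)~ look s (inject≤ j 3≤n))
 diag-iff zero zero s = sym (tr+ refl)
 diag-iff zero 1F s = id-iff _ _ _ (at01 s)
 diag-iff zero 2F s = id-iff _ _ _ (at02 s)
 diag-iff 1F zero s = id-iff _ _ _ (at01 s)& tr-cong sym sym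
 diag-iff 1F 1F s = sym (tr+ refl)
 diag-iff 1F 2F s = id-iff _ _ _ (at12 s)
 diag-iff 2F zero s = id-iff _ _ _ (at02 s)& tr-cong sym sym
 diag-iff 2F 1F s = id-iff _ _ _ (at12 s)& tr-cong sym sym
 diag-iff 2F 2F s = sym (tr+ refl)
 any-realise : ∀ (i : Fin 3) x s -> has (A.cyl i x)(at s)~ tr (Cyl (inject≤ i 3≤n)(set x) s)
 any-realise i x s = has-cyl i x (at s)(at< s)& bext
  (\h -> let j , j< , q = anyN- total _ h; a , b = &- {has x j} q; t , e , f = realise i s j j< (==- b) in
   tr+ (t , e , trans (cong (has x) f) a))
  (\h -> let t , e , q = tr- h in anyN+ total _ (at t)(at< t)(&+ q (==+ (edge-same i s t e))))
 lab-self : ∀ a -> ∃[ b ] lab a a ~ ident b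
 lab-self a with lab a a | id⇐ a
 ... | pp idn | _ = false , refl
 ... | zz true | _ = true , refl
 default : Bool -> Bool -> Lab
 default false false = pp w
 default false true = pz 1
 default true false = zp 1
 default true true = zz false
 1≤K : 1 ≤ K
 1≤K = ≤-trans (sl zl) 6≤K
 default-src : ∀ a b -> srcZ (default a b)~ a
 default-src false false = refl
 default-src false true = refl
 default-src true false = refl
 default-src true true = refl
 default-valid : ∀ a b -> Valid (default a b)
 default-valid false false = tt
 default-valid false true = 1≤K
 default-valid true false = 1≤K
 default-valid true true = tt
 default-tgt : ∀ a b c -> Cons (default a b)(ident c)(default a b)-> c ~ b
 default-tgt false false false h = refl
 default-tgt false true true h = refl
 default-tgt true false false h = refl
 default-tgt true true true h = refl
 of-sort : ∀ b -> ∃[ x ] lab x x ~ ident b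
 of-sort b with lab-self point
 ... | a , e with meets point point (default a b)(default a b)(default-valid a b)(default-valid a b)
  (subst (\x -> Cons x (default a b)(default a b))(cong ident (default-src a b)& sym e)(cons-id (default a b)))
 ... | x , _ , f with lab-self x
 ... | c , g = x , trans g (cong ident (default-tgt a b c (subst₂ (\u v -> Cons u v u) f g (cons point x x))))
 module _ (x y z : M) where
  triple : Vec M n
  triple = (Vec.replicate n z [ c1 ]≔ y) [ c0 ]≔ x
  triple0 : look triple c0 ~ x
  triple0 = upd-at (Vec.replicate n z [ c1 ]≔ y) c0 x
  triple1 : look triple c1 ~ y
  triple1 = upd (Vec.replicate n z [ c1 ]≔ y) c0 x c1 (inj# _ _ \())& upd-at (Vec.replicate n z) c1 y
  triple2 : look triple c2 ~ z
  triple2 = upd (Vec.replicate n z [ c1 ]≔ y) c0 x c2 (inj# _ _ \())& upd (Vec.replicate n z) c1 y c2 (inj# _ _ \())& Vec.lookup-replicate c2 z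
 onto : ∀ j -> j < total -> ∃[ s ] at s ~ j
 onto j j< = s , atom-ext (at s) j (at< s) j<
  (at01 s & cong encL (cong2 lab (triple0 x y z)(triple1 x y z)& snd (snd hy))& sym e1)
  (at12 s & cong encL (cong2 lab (triple1 x y z)(triple2 x y z)& fst (snd hz))& sym e2)
  (at02 s & cong encL (cong2 lab (triple0 x y z)(triple2 x y z)& snd (snd hz))& sym e3)
  where
  open Atom (atom j j<) renaming (cons to k)
  hx : ∃[ x ] lab x x ~ ident (srcZ α)
  hx = of-sort (srcZ α)
  x = fst hx
  hy : ∃[ y ] (lab x y ~ α × lab x y ~ α)
  hy = let y , p , q = meets x x α α v1 v1 (subst (\u -> Cons u α α)(sym (snd hx))(cons-id α)) in y , q , q
  y = fst hy
  hz : ∃[ z ] (lab y z ~ β × lab x z ~ γ)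
  hz = meets x y β γ v2 v3 (subst (\u -> Cons u β γ)(sym (snd (snd hy))) k)
  z = fst hz
  s = triple x y z
 embedding : Embedding algA (Nr 3≤n cmCA)
 embedding = record
  { to = \x ->(set x , \ { refl -> refl }), neat x
  ; cong = \ { refl p -> refl }
  ; injective = \ {x}{y} h -> has-ext x y (\j j< -> let s , e = onto j j< in trans (cong (has x)(sym e))(h s & cong (has y) e))
  ; ∨-homo = \x y s -> has-join x y (at s)(at< s)
  ; ∧-homo = \x y s -> has-meet x y (at s)(at< s)
  ; ∼-homo = \x s -> has-comp x (at s)(at< s)
  ; ⊤-homo = \s -> has-top (at s)(at< s)
  ; ⊥-homo = \s -> has-bot (at s)(at< s)
  ; cyl-homo = \i x s -> any-realise i x s
  ; diag-homo = \i j s -> trans (has-diag i j (at s)(at< s))(diag-iff i j s) }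
  where
  neat : ∀ x -> Neat 3≤n cmCA (set x , \ { refl -> refl })
  neat x i h s = bext
   (\e -> let t , r , q = tr- e in trans (cong (has x)(at-cong s t (r c0 (below i zero h))(r c1 (below i 1F h))(r c2 (below i 2F h)))) q)
   (\e -> tr+ (s , (\_ _ -> refl), e))
 member : SNr 3≤n (AllCA n) algA
 member = cmCA , lift tt , embedding

-- Arithmetic of cylindric algebras.
module CALemmas {n : ℕ}(B : CA n 0ℓ 0ℓ) where
 open CA B public
 open Alg alg public hiding (refl; sym; trans; reflexive) renaming (_∨_ to _∪_; _∧_ to _∩_; ∼_ to −_; ⊤ to 𝟏; ⊥ to 𝟎; cyl to cy; diag to dg)
 open IsCA isCA public
 private
  booleanAlgebra : BooleanAlgebra 0ℓ 0ℓ
  booleanAlgebra = record { isBooleanAlgebra = isBooleanAlgebra }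
  module BA = BooleanAlgebra booleanAlgebra
  module BP = BAProperties booleanAlgebra
  module ≈ = Alg alg
 ~refl : ∀ {x}-> x ≈ x
 ~refl = ≈.refl
 ~sym : ∀ {x y}-> x ≈ y -> y ≈ x
 ~sym = ≈.sym
 ~trans : ∀ {x y z}-> x ≈ y -> y ≈ z -> x ≈ z
 ~trans = ≈.trans
 ⊑refl : ∀ {x}-> x ⊑ x
 ⊑refl = BP.∧-idem _
 ⊑trans : ∀ {x y z}-> x ⊑ y -> y ⊑ z -> x ⊑ z
 ⊑trans {x}{y}{z} p q = ~trans (∧-cong (~sym p) ~refl)(~trans (BA.∧-assoc x y z)(~trans (∧-cong ~refl q) p))
 ⊑≡ : ∀ {x y}-> x ≈ y -> x ⊑ y
 ⊑≡ p = ~trans (∧-cong ~refl (~sym p))(BP.∧-idem _)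
 antisym : ∀ {x y}-> x ⊑ y -> y ⊑ x -> x ≈ y
 antisym {x}{y} p q = ~trans (~sym p)(~trans (BA.∧-comm x y) q)
 &l : ∀ {x y}-> x ∩ y ⊑ x
 &l {x}{y} = ~trans (BA.∧-comm (x ∩ y) x)(~trans (~sym (BA.∧-assoc x x y))(∧-cong (BP.∧-idem x) ~refl))
 &r : ∀ {x y}-> x ∩ y ⊑ y
 &r {x}{y} = ~trans (BA.∧-assoc x y y)(∧-cong ~refl (BP.∧-idem y))
 glb : ∀ {x y z}-> x ⊑ y -> x ⊑ z -> x ⊑ y ∩ z
 glb {x}{y}{z} p q = ~trans (~sym (BA.∧-assoc x y z))(~trans (∧-cong p ~refl) q)
 ∧mono : ∀ {x y x' y'}-> x ⊑ x' -> y ⊑ y' -> x ∩ y ⊑ x' ∩ y'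
 ∧mono p q = glb (⊑trans &l p)(⊑trans &r q)
 ⊥⊑ : ∀ {x}-> 𝟎 ⊑ x
 ⊥⊑ = BP.∧-zeroˡ _
 ⊑⊤ : ∀ {x}-> x ⊑ 𝟏
 ⊑⊤ = BP.∧-identityʳ _
 ⊑⊥ : ∀ {x}-> x ⊑ 𝟎 -> x ≈ 𝟎
 ⊑⊥ p = antisym p ⊥⊑
 ∨l : ∀ {x y}-> x ⊑ x ∪ y
 ∨l {x}{y} = snd BA.absorptive x y
 ∨r : ∀ {x y}-> y ⊑ x ∪ y
 ∨r {x}{y} = ~trans (∧-cong ~refl (BA.∨-comm x y))(snd BA.absorptive y x)
 lub : ∀ {x y z}-> x ⊑ z -> y ⊑ z -> x ∪ y ⊑ z
 lub {x}{y}{z} p q = ~trans (BA.∧-distribʳ-∨ z x y)(∨-cong p q)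
 dist : ∀ {x y z}-> x ∩ (y ∪ z) ⊑ (x ∩ y) ∪ (x ∩ z)
 dist {x}{y}{z} = ⊑≡ (BA.∧-distribˡ-∨ x y z)
 split : ∀ {x y z}-> x ⊑ y ∪ z -> x ⊑ (x ∩ y) ∪ (x ∩ z)
 split p = ⊑trans (glb ⊑refl p) dist
 compl⊥ : ∀ {x}-> x ∩ − x ≈ 𝟎
 compl⊥ = BA.∧-complementʳ _
 compl⊤ : ∀ {x}-> 𝟏 ⊑ x ∪ − x
 compl⊤ = ⊑≡ (~sym (BA.∨-complementʳ _))
 dis⇒⊑ : ∀ {x y}-> x ∩ − y ≈ 𝟎 -> x ⊑ y
 dis⇒⊑ p = ⊑trans (split (⊑trans ⊑⊤ compl⊤))(lub &r (⊑trans (⊑≡ p) ⊥⊑))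
 clash : ∀ {x a b}-> x ⊑ a -> x ⊑ b -> a ∩ b ≈ 𝟎 -> x ≈ 𝟎
 clash p q e = ⊑⊥ (⊑trans (glb p q)(⊑≡ e))
 clash− : ∀ {x a}-> x ⊑ a -> x ⊑ − a -> x ≈ 𝟎
 clash− p q = clash p q compl⊥
 Fix : Fin n -> Carrier -> Set
 Fix i x = cy i x ≈ x
 cyl⊤ : ∀ i -> cy i 𝟏 ≈ 𝟏
 cyl⊤ i = antisym ⊑⊤ (cyl-⊑ i 𝟏)
 cyl-idem : ∀ i x -> Fix i (cy i x)
 cyl-idem i x = ~trans (cyl-cong i (~sym (BP.∧-identityˡ _)))(~trans (cyl-∧ i 𝟏 x)(~trans (∧-cong (cyl⊤ i) ~refl)(BP.∧-identityˡ _)))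
 cyl-fix : ∀ i {x y}-> Fix i y -> cy i (x ∩ y)≈ cy i x ∩ y
 cyl-fix i {x}{y} p = ~trans (cyl-cong i (∧-cong ~refl (~sym p)))(~trans (cyl-∧ i x y)(∧-cong ~refl p))
 cyl-fixˡ : ∀ i {x y}-> Fix i x -> cy i (x ∩ y)≈ x ∩ cy i y
 cyl-fixˡ i p = ~trans (cyl-cong i (BA.∧-comm _ _))(~trans (cyl-fix i p)(BA.∧-comm _ _))
 mono : ∀ i {x y}-> x ⊑ y -> cy i x ⊑ cy i y
 mono i {x}{y} p = ~trans (~sym (cyl-∧ i x y))(cyl-cong i (⊑trans p (cyl-⊑ i y)))
 fix-∧ : ∀ i {x y}-> Fix i x -> Fix i y -> Fix i (x ∩ y)
 fix-∧ i p q = ~trans (cyl-fix i q)(∧-cong p ~refl)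
 fix-− : ∀ i {x}-> Fix i x -> Fix i (− x)
 fix-− i {x} p = antisym (dis⇒⊑ (~trans (∧-cong ~refl (BP.¬-involutive x)) d))(cyl-⊑ i _)
  where
  d : cy i (− x)∩ x ≈ 𝟎
  d = ~trans (~sym (cyl-fix i p))(~trans (cyl-cong i (BA.∧-complementˡ x))(cyl-⊥ i))
 fix-cyl : ∀ i j {x}-> Fix i x -> Fix i (cy j x)
 fix-cyl i j p = ~trans (cyl-comm i j _)(cyl-cong j p)
 -- the least fixed element above
 least : ∀ i {x y}-> Fix i y -> x ⊑ y -> cy i x ⊑ y
 least i p q = ⊑trans (mono i q)(⊑≡ p)
 zero-cyl : ∀ i {x}-> x ≈ 𝟎 -> cy i x ≈ 𝟎
 zero-cyl i p = ~trans (cyl-cong i p)(cyl-⊥ i)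
 cyl-zero : ∀ i {x}-> cy i x ≈ 𝟎 -> x ≈ 𝟎
 cyl-zero i p = ⊑⊥ (⊑trans (cyl-⊑ i _)(⊑≡ p))
 private
  both : ∀ i j -> i # j -> cy i (dg j i ∩ dg i j)≈ 𝟏
  both i j ne = ~trans (~sym (diag-cyl j j i ne ne))(diag-⊤ j)
 diag⊑ : ∀ i j -> i # j -> dg i j ⊑ dg j i
 diag⊑ i j ne = dis⇒⊑ (cyl-zero i (~trans (~sym (~trans (∧-cong (~trans (cyl-cong i (BA.∧-comm _ _))(both i j ne)) ~refl)(BP.∧-identityˡ _)))(diag-sub i j (dg j i) ne)))
 diag-sym : ∀ i j -> i # j -> dg i j ≈ dg j i
 diag-sym i j ne = antisym (diag⊑ i j ne)(diag⊑ j i (ne ∘ sym))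
 cyl-diag : ∀ i j -> i # j -> cy i (dg i j)≈ 𝟏
 cyl-diag i j ne = antisym ⊑⊤ (⊑trans (⊑≡ (~sym (both i j ne)))(mono i &r))
 cyl-diag' : ∀ i j -> i # j -> cy i (dg j i)≈ 𝟏
 cyl-diag' i j ne = antisym ⊑⊤ (⊑trans (⊑≡ (~sym (both i j ne)))(mono i &l))
 fix-diag : ∀ k i j -> k # i -> k # j -> Fix k (dg i j)
 fix-diag k i j p q = ~trans (cyl-cong k (diag-cyl i j k p q))(~trans (cyl-idem k _)(~sym (diag-cyl i j k p q)))
 diag-trans : ∀ i j k -> j # i -> j # k -> dg i j ∩ dg j k ⊑ dg i k
 diag-trans i j k p q = ⊑trans (cyl-⊑ j _)(⊑≡ (~sym (diag-cyl i k j p q)))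
 diag-det : ∀ i j x -> i # j -> dg i j ∩ cy i (dg i j ∩ x) ⊑ x
 diag-det i j x ne = dis⇒⊑ (⊑⊥ (⊑trans (glb (⊑trans &l &r)(⊑trans (glb (⊑trans &l &l) &r)(cyl-⊑ i _)))(⊑≡ (diag-sub i j x ne))))
 -- an element not depending on i can be moved along a diagonal
 inst : ∀ i j {x}-> i # j -> Fix i x -> x ≈ cy i (dg i j ∩ x)
 inst i j ne p = ~sym (~trans (cyl-fix i p)(~trans (∧-cong (cyl-diag i j ne) ~refl)(BP.∧-identityˡ _)))
 ∧-comm = BA.∧-comm
 ∧-assoc = BA.∧-assoc
 ¬¬ : ∀ x -> − − x ≈ x
 ¬¬ = BP.¬-involutive
 fix-∨ : ∀ i {x y}-> Fix i x -> Fix i y -> Fix i (x ∪ y)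
 fix-∨ i {x}{y} p q = ~trans (cyl-cong i d)(~trans (fix-− i (fix-∧ i (fix-− i p)(fix-− i q)))(~sym d))
  where
  d : x ∪ y ≈ − (− x ∩ − y)
  d = ~trans (~sym (¬¬ _))(∼-cong (BP.deMorgan₂ x y))

-- A binary relation on the first two coordinates, and its copies on other pairs of coordinates.
module Relations {m : ℕ}(B : CA (6 + m) 0ℓ 0ℓ) where
 open CALemmas B public
 i0 i1 i2 : Fin (6 + m)
 i0 = zero
 i1 = suc zero
 i2 = suc 1F
 v : Fin 3 -> Fin (6 + m)
 v k = suc (suc (suc (k Fin.↑ˡ m)))
 v# : ∀ {k l}-> k # l -> v k # v l
 v# n e = n (Fin.↑ˡ-injective m _ _ (Fin.suc-injective (Fin.suc-injective (Fin.suc-injective e))))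
 v#0 : ∀ {k}-> v k # i0
 v#0 ()
 v#1 : ∀ {k}-> v k # i1
 v#1 ()
 v#2 : ∀ {k}-> v k # i2
 v#2 ()
 #s : ∀ {A : Set}{x y : A}-> x # y -> y # x
 #s n e = n (sym e)
 record Rel : Set where
  field
   r : Carrier
   rfix : ∀ k -> k # i0 -> k # i1 -> Fix k r
  q : Fin (6 + m)-> Carrier
  q j = cy i1 (dg i1 j ∩ r)
  e : Fin (6 + m)-> Fin (6 + m)-> Carrier
  e i j = cy i0 (dg i0 i ∩ q j)
  qfix : ∀ k j -> k # i0 -> k # j -> Fix k (q j)
  qfix k j n0 nj with k Fin.≟ i1
  ... | yes refl = cyl-idem _ _
  ... | no n1 = fix-cyl k i1 (fix-∧ k (fix-diag k i1 j n1 nj)(rfix k n0 n1))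
  qmove : ∀ j k -> j # i1 -> k # i1 -> j # k -> dg j k ∩ q j ⊑ q k
  qmove j k nj nk jk = ⊑trans (⊑≡ (~sym (cyl-fixˡ i1 (fix-diag i1 j k (#s nj)(#s nk)))))
   (mono i1 (glb (⊑trans (glb (⊑trans &r &l) &l)(diag-trans i1 j k nj jk))(⊑trans &r &r)))
  r->q : ∀ j -> dg i1 j ∩ r ⊑ q j
  r->q j = cyl-⊑ i1 _
  q->r : ∀ j -> i1 # j -> dg i1 j ∩ q j ⊑ r
  q->r j n = diag-det i1 j r n
  efix : ∀ k i j -> k # i -> k # j -> Fix k (e i j)
  efix k i j ni nj with k Fin.≟ i0
  ... | yes refl = cyl-idem _ _
  ... | no n0 = fix-cyl k i0 (fix-∧ k (fix-diag k i0 i n0 ni)(qfix k j n0 nj))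
  emove1 : ∀ i k j -> i # i0 -> k # i0 -> i # k -> dg i k ∩ e i j ⊑ e k j
  emove1 i k j ni nk ik = ⊑trans (⊑≡ (~sym (cyl-fixˡ i0 (fix-diag i0 i k (#s ni)(#s nk)))))
   (mono i0 (glb (⊑trans (glb (⊑trans &r &l) &l)(diag-trans i0 i k ni ik))(⊑trans &r &r)))
  emove2 : ∀ i j k -> j # i0 -> k # i0 -> j # i1 -> k # i1 -> j # k -> dg j k ∩ e i j ⊑ e i k
  emove2 i j k a b c d jk = ⊑trans (⊑≡ (~sym (cyl-fixˡ i0 (fix-diag i0 j k (#s a)(#s b)))))
   (mono i0 (glb (⊑trans &r &l)(⊑trans (∧mono ⊑refl &r)(qmove j k c d jk))))
  q->e : ∀ i j -> dg i0 i ∩ q j ⊑ e i j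
  q->e i j = cyl-⊑ i0 _
  e->q : ∀ i j -> i0 # i -> dg i0 i ∩ e i j ⊑ q j
  e->q i j n = diag-det i0 i (q j) n
 open Rel public
 neg-move : ∀ {d x y}-> d ∩ x ⊑ y -> d ∩ − y ⊑ − x
 neg-move {d}{x}{y} h = dis⇒⊑ (clash− {a = y}(⊑trans (glb (⊑trans &l &l)(⊑trans &r (⊑≡ (¬¬ x)))) h)(⊑trans &l &r))
 carry : ∀ i k {φ ψ}-> i # k -> Fix i ψ -> dg i k ∩ ψ ⊑ φ -> φ ≈ 𝟎 -> ψ ≈ 𝟎
 carry i k n f h z = ~trans (inst i k n f)(zero-cyl i (⊑⊥ (⊑trans h (⊑≡ z))))
 rename : ∀ i k {φ ψ}-> i # k -> Fix k φ -> Fix i ψ -> dg k i ∩ φ ⊑ ψ -> cy i φ ⊑ cy k ψ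
 rename i k n f g h = least i (fix-cyl i k g)(⊑trans (⊑≡ (inst k i (#s n) f))(mono k h))
 ors : (ℕ -> Carrier)-> ℕ -> Carrier
 ors f zero = 𝟎
 ors f (suc n) = f n ∪ ors f n
 ors-mono : ∀ {d f g} n ->(∀ t -> t < n -> d ∩ f t ⊑ g t)-> d ∩ ors f n ⊑ ors g n
 ors-mono zero h = ⊑trans &r ⊥⊑
 ors-mono (suc n) h = ⊑trans dist (lub (⊑trans (h n ≤-refl) ∨l)(⊑trans (ors-mono n (\t t< -> h t (m<n⇒m<1+n t<))) ∨r))
 fix-ors : ∀ i f n ->(∀ t -> t < n -> Fix i (f t))-> Fix i (ors f n)
 fix-ors i f zero h = cyl-⊥ i
 fix-ors i f (suc n) h = fix-∨ i (h n ≤-refl)(fix-ors i f n (\t t< -> h t (m<n⇒m<1+n t<)))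

-- Consequences of the laws of a system of relations.
record System (TS : Tiles){m : ℕ}(B : CA (6 + m) 0ℓ 0ℓ) : Set where
 open Tiles TS
 open Relations B
 field
  b : Carrier
  bfix : ∀ k -> Fix k b
  G P F W Tl : Rel
  Tt : ℕ -> Rel
  sucL : b ∩ r G ⊑ cy i2 (q G i2 ∩ e P i1 i2)
  inw : b ∩ (r G ∩ (q G i2 ∩ e W i1 i2))≈ 𝟎
  horL : ∀ t u -> t < N -> u < N -> hor t u ~ false -> b ∩ (r P ∩ (q (Tt t) i2 ∩ e (Tt u) i1 i2))≈ 𝟎
  hort : b ∩ (r P ∩ (q Tl i2 ∩ (− e Tl i1 i2 ∩ − e W i1 i2)))≈ 𝟎
  verL : ∀ t u -> t < N -> u < N -> ver t u ~ false -> b ∩ (r (Tt t)∩ (e P i1 i2 ∩ q (Tt u) i2))≈ 𝟎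
  vert : b ∩ (r Tl ∩ (e P i1 i2 ∩ (− q Tl i2 ∩ − q W i2)))≈ 𝟎
  pf : b ∩ (r P ∩ − r F)≈ 𝟎
  ff : b ∩ (r F ∩ (e P i1 i2 ∩ (− q F i2 ∩ − q W i2)))≈ 𝟎
  badL : ∀ t -> t < N -> bad t ! -> b ∩ (r (Tt start)∩ (e F i1 i2 ∩ q (Tt t) i2))≈ 𝟎
  til : b ∩ (r Tl ∩ − ors (\t -> r (Tt t)) N)≈ 𝟎
  st : ∀ t -> t < N -> t # start -> b ∩ (r (Tt start)∩ r (Tt t))≈ 𝟎
  stl : b ∩ (r (Tt start)∩ − r Tl)≈ 𝟎
  occ : ¬ (b ∩ (r G ∩ (q G i2 ∩ e (Tt start) i1 i2))≈ 𝟎)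

module Extraction (em : EM)(TS : Tiles){m : ℕ}(B : CA (6 + m) 0ℓ 0ℓ)(Sy : System TS B) where
 open Tiles TS
 open Relations B
 open System Sy
 -- ψ is obtained from φ by replacing the coordinate i by k
 record Mv (i k : Fin (6 + m))(ψ φ : Carrier) : Set where
  constructor mv
  field
   fx : Fix i ψ
   to : dg i k ∩ ψ ⊑ φ
   fr : dg i k ∩ φ ⊑ ψ
 open Mv
 carryM : ∀ {i k ψ φ}-> i # k -> Mv i k ψ φ -> φ ≈ 𝟎 -> ψ ≈ 𝟎
 carryM {i}{k} n h = carry i k n (fx h)(to h)
 infixr 7 _∩M_
 _∩M_ : ∀ {i k ψ φ ψ' φ'}-> Mv i k ψ φ -> Mv i k ψ' φ' -> Mv i k (ψ ∩ ψ')(φ ∩ φ')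
 _∩M_ {i} h g = mv (fix-∧ i (fx h)(fx g))(glb (⊑trans (∧mono ⊑refl &l)(to h))(⊑trans (∧mono ⊑refl &r)(to g)))
  (glb (⊑trans (∧mono ⊑refl &l)(fr h))(⊑trans (∧mono ⊑refl &r)(fr g)))
 −M : ∀ {i k ψ φ}-> Mv i k ψ φ -> Mv i k (− ψ)(− φ)
 −M {i} h = mv (fix-− i (fx h))(neg-move (fr h))(neg-move (to h))
 constM : ∀ {i k a}-> Fix i a -> Mv i k a a
 constM f = mv f &r &r
 cyM : ∀ {i k ψ φ} l -> l # i -> l # k -> Mv i k ψ φ -> Mv i k (cy l ψ)(cy l φ)
 cyM {i}{k} l a b h = mv (fix-cyl i l (fx h))
  (⊑trans (⊑≡ (~sym (cyl-fixˡ l (fix-diag l i k a b))))(mono l (to h)))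
  (⊑trans (⊑≡ (~sym (cyl-fixˡ l (fix-diag l i k a b))))(mono l (fr h)))
 orsM : ∀ {i k f g} n ->(∀ t -> t < n -> Mv i k (f t)(g t))-> Mv i k (ors f n)(ors g n)
 orsM {i} n h = mv (fix-ors i _ n (\t t< -> fx (h t t<)))(ors-mono n (\t t< -> to (h t t<)))(ors-mono n (\t t< -> fr (h t t<)))
 bM : ∀ {i k}-> Mv i k b b
 bM {i} = constM (bfix i)
 flip : ∀ {i k x y}-> i # k -> dg k i ∩ x ⊑ y -> dg i k ∩ x ⊑ y
 flip {i}{k} n h = ⊑trans (∧mono (⊑≡ (diag-sym i k n)) ⊑refl) h
 qM : ∀ R {i k}-> i # i0 -> i # i1 -> k # i1 -> i # k -> Mv i k (q R k)(q R i)
 qM R {i}{k} a b c n = mv (qfix R i k a n)(flip n (qmove R k i c b (#s n)))(qmove R i k b c n)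
 e1M : ∀ R {i k j}-> i # i0 -> k # i0 -> i # j -> i # k -> Mv i k (e R k j)(e R i j)
 e1M R {i}{k}{j} a b c n = mv (efix R i k j n c)(flip n (emove1 R k i j b a (#s n)))(emove1 R i k j a b n)
 e2M : ∀ R {i k a}-> i # i0 -> k # i0 -> i # i1 -> k # i1 -> i # a -> i # k -> Mv i k (e R a k)(e R a i)
 e2M R {i}{k}{a} x y z w' c n = mv (efix R i a k c n)(flip n (emove2 R a k i y x w' z (#s n)))(emove2 R a i k x y z w' n)
 rM : ∀ R {k}-> i1 # k -> Mv i1 k (q R k)(r R)
 rM R {k} n = mv (qfix R i1 k (\()) n)(q->r R k n)(r->q R k)
 q0M : ∀ R {k j}-> i0 # k -> i0 # j -> Mv i0 k (e R k j)(q R j)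
 q0M R {k}{j} n c = mv (efix R i0 k j n c)(e->q R k j n)(q->e R k j)
 c0 = \ {k}-> #s (v#0 {k})
 c1 = \ {k}-> #s (v#1 {k})
 c2 = \ {k}-> #s (v#2 {k})
 1#0 : i1 # i0
 1#0 ()
 2#0 : i2 # i0
 2#0 ()
 2#1 : i2 # i1
 2#1 ()
 0#1 : i0 # i1
 0#1 ()
 0#2 : i0 # i2
 0#2 ()
 1#2 : i1 # i2
 1#2 ()
 Gv : Fin 3 -> Carrier
 Gv k = q G (v k)
 succV : ∀ {k l}-> k # l -> b ∩ Gv k ⊑ cy (v l)(Gv l ∩ e P (v k)(v l))
 succV {k}{l} n = dis⇒⊑ (carryM {i1}{v k}(c1 {k})((bM ∩M rM G (c1 {k})) ∩M −M (cyM (v l) v#1 (v# (#s n))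
  (constM (qfix G i1 (v l) 1#0 (c1 {l})) ∩M e1M P 1#0 v#0 (c1 {l})(c1 {k})))) law)
  where
  law : (b ∩ r G)∩ − cy (v l)(Gv l ∩ e P i1 (v l))≈ 𝟎
  law = clash− (⊑trans &l (⊑trans sucL (rename i2 (v l)(c2 {l})
   (fix-∧ (v l)(qfix G (v l) i2 v#0 v#2)(efix P (v l) i1 i2 v#1 v#2))
   (fx (constM {i2}{v l}(fix-∧ i2 (qfix G i2 (v l) 2#0 (c2 {l}))(efix P i2 i1 (v l) 2#1 (c2 {l})))))
   (⊑trans (flip v#2 ⊑refl)(fr (qM G 2#0 2#1 (v#1 {l})(c2 {l}) ∩M e2M P 2#0 (v#0 {l}) 2#1 v#1 2#1 (c2 {l}))))))) &r
 inwV : ∀ {k l}-> k # l -> b ∩ (Gv k ∩ (Gv l ∩ e W (v k)(v l)))≈ 𝟎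
 inwV {k}{l} n = carryM (c1 {k})(bM ∩M rM G (c1 {k}) ∩M constM (qfix G i1 (v l) 1#0 (c1 {l})) ∩M e1M W 1#0 v#0 (c1 {l})(c1 {k}))
  (carryM (c2 {l})(bM ∩M constM (rfix G i2 2#0 2#1) ∩M qM G 2#0 2#1 v#1 (c2 {l}) ∩M e2M W 2#0 v#0 2#1 v#1 2#1 (c2 {l})) inw)
 inw2 : ∀ {l}-> b ∩ (q G i2 ∩ (Gv l ∩ e W i2 (v l)))≈ 𝟎
 inw2 {l} = carryM 1#2 (bM ∩M rM G 1#2 ∩M constM (qfix G i1 (v l) 1#0 (c1 {l})) ∩M e1M W 1#0 2#0 (c1 {l}) 1#2)
  (carryM (c2 {l})(bM ∩M constM (rfix G i2 2#0 2#1) ∩M qM G 2#0 2#1 v#1 (c2 {l}) ∩M e2M W 2#0 v#0 2#1 v#1 2#1 (c2 {l})) inw)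
 -- moving a law on (0,1), (0,2), (1,2) to (k,l), (k,a), (l,a)
 module At (k l a : Fin 3)(kl : k # l)(ka : k # a)(la : l # a) where
  record Mv3 (ψ φ : Carrier) : Set where
   constructor via
   field
    {χ ξ} : Carrier
    m2 : Mv i2 (v a) ψ χ
    m0 : Mv i0 (v k) χ ξ
    m1 : Mv i1 (v l) ξ φ
  carry3 : ∀ {ψ φ}-> Mv3 ψ φ -> φ ≈ 𝟎 -> ψ ≈ 𝟎
  carry3 (via x y z) h = carryM (c2 {a}) x (carryM (c0 {k}) y (carryM (c1 {l}) z h))
  infixr 7 _∩3_
  _∩3_ : ∀ {ψ φ ψ' φ'}-> Mv3 ψ φ -> Mv3 ψ' φ' -> Mv3 (ψ ∩ ψ')(φ ∩ φ')
  via x y z ∩3 via x' y' z' = via (x ∩M x')(y ∩M y')(z ∩M z')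
  −3 : ∀ {ψ φ}-> Mv3 ψ φ -> Mv3 (− ψ)(− φ)
  −3 (via x y z) = via (−M x)(−M y)(−M z)
  b3 : Mv3 b b
  b3 = via bM bM bM
  R01 : ∀ R -> Mv3 (e R (v k)(v l))(r R)
  R01 R = via (constM (efix R i2 (v k)(v l)(c2 {k})(c2 {l})))(q0M R (c0 {k})(c0 {l}))(rM R (c1 {l}))
  R02 : ∀ R -> Mv3 (e R (v k)(v a))(q R i2)
  R02 R = via (e2M R 2#0 v#0 2#1 v#1 (c2 {k})(c2 {a}))(q0M R (c0 {k}) 0#2)(constM (qfix R i1 i2 1#0 1#2))
  R12 : ∀ R -> Mv3 (e R (v l)(v a))(e R i1 i2)
  R12 R = via (e2M R 2#0 v#0 2#1 v#1 (c2 {l})(c2 {a}))(constM (efix R i0 (v l) i2 (c0 {l}) 0#2))(e1M R 1#0 v#0 1#2 (c1 {l}))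
  horV : ∀ t u -> t < N -> u < N -> hor t u ~ false -> b ∩ (e P (v k)(v l)∩ (e (Tt t)(v k)(v a)∩ e (Tt u)(v l)(v a)))≈ 𝟎
  horV t u t< u< h = carry3 (b3 ∩3 R01 P ∩3 R02 (Tt t) ∩3 R12 (Tt u))(horL t u t< u< h)
  hortV : b ∩ (e P (v k)(v l)∩ (e Tl (v k)(v a)∩ (− e Tl (v l)(v a)∩ − e W (v l)(v a))))≈ 𝟎
  hortV = carry3 (b3 ∩3 R01 P ∩3 R02 Tl ∩3 −3 (R12 Tl) ∩3 −3 (R12 W)) hort
  verV : ∀ t u -> t < N -> u < N -> ver t u ~ false -> b ∩ (e (Tt t)(v k)(v l)∩ (e P (v l)(v a)∩ e (Tt u)(v k)(v a)))≈ 𝟎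
  verV t u t< u< h = carry3 (b3 ∩3 R01 (Tt t) ∩3 R12 P ∩3 R02 (Tt u))(verL t u t< u< h)
  vertV : b ∩ (e Tl (v k)(v l)∩ (e P (v l)(v a)∩ (− e Tl (v k)(v a)∩ − e W (v k)(v a))))≈ 𝟎
  vertV = carry3 (b3 ∩3 R01 Tl ∩3 R12 P ∩3 −3 (R02 Tl) ∩3 −3 (R02 W)) vert
 module At2 (k l : Fin 3)(kl : k # l) where
  M1 : ∀ R -> Mv i1 (v l)(q R (v l))(r R)
  M1 R = rM R (c1 {l})
  M0 : ∀ R -> Mv i0 (v k)(e R (v k)(v l))(q R (v l))
  M0 R = q0M R (c0 {k})(c0 {l})
  pfV : b ∩ (e P (v k)(v l)∩ − e F (v k)(v l))≈ 𝟎
  pfV = carryM (c0 {k})(bM ∩M M0 P ∩M −M (M0 F))(carryM (c1 {l})(bM ∩M M1 P ∩M −M (M1 F)) pf)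
  tilV : b ∩ (e Tl (v k)(v l)∩ − ors (\t -> e (Tt t)(v k)(v l)) N)≈ 𝟎
  tilV = carryM (c0 {k})(bM ∩M M0 Tl ∩M −M (orsM N (\t _ -> M0 (Tt t))))
   (carryM (c1 {l})(bM ∩M M1 Tl ∩M −M (orsM N (\t _ -> M1 (Tt t)))) til)
  stV : ∀ t -> t < N -> t # start -> b ∩ (e (Tt start)(v k)(v l)∩ e (Tt t)(v k)(v l))≈ 𝟎
  stV t t< n = carryM (c0 {k})(bM ∩M M0 (Tt start) ∩M M0 (Tt t))(carryM (c1 {l})(bM ∩M M1 (Tt start) ∩M M1 (Tt t))(st t t< n))
  stlV : b ∩ (e (Tt start)(v k)(v l)∩ − e Tl (v k)(v l))≈ 𝟎
  stlV = carryM (c0 {k})(bM ∩M M0 (Tt start) ∩M −M (M0 Tl))(carryM (c1 {l})(bM ∩M M1 (Tt start) ∩M −M (M1 Tl)) stl)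
  ffV : b ∩ (e F i2 (v k)∩ (e P (v k)(v l)∩ (− e F i2 (v l)∩ − e W i2 (v l))))≈ 𝟎
  ffV = carryM 0#2 (bM ∩M q0M F 0#2 (c0 {k}) ∩M constM (efix P i0 (v k)(v l)(c0 {k})(c0 {l})) ∩M −M (q0M F 0#2 (c0 {l})) ∩M −M (q0M W 0#2 (c0 {l})))
   (carryM (c1 {k})(bM ∩M rM F (c1 {k}) ∩M e1M P 1#0 v#0 (c1 {l})(c1 {k}) ∩M −M (constM (qfix F i1 (v l) 1#0 (c1 {l}))) ∩M −M (constM (qfix W i1 (v l) 1#0 (c1 {l}))))
   (carryM (c2 {l})(bM ∩M constM (rfix F i2 2#0 2#1) ∩M e2M P 2#0 v#0 2#1 v#1 2#1 (c2 {l}) ∩M −M (qM F 2#0 2#1 v#1 (c2 {l})) ∩M −M (qM W 2#0 2#1 v#1 (c2 {l}))) ff))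
 badV : ∀ {l} t -> t < N -> bad t ! -> b ∩ (e (Tt start) i1 i2 ∩ (e F i2 (v l)∩ e (Tt t) i1 (v l)))≈ 𝟎
 badV {l} t t< h = carryM 0#1 (bM ∩M q0M (Tt start) 0#1 0#2 ∩M constM (efix F i0 i2 (v l) 0#2 (c0 {l})) ∩M q0M (Tt t) 0#1 (c0 {l}))
  (carryM 1#2 (bM ∩M rM (Tt start) 1#2 ∩M e1M F 1#0 2#0 (c1 {l}) 1#2 ∩M constM (qfix (Tt t) i1 (v l) 1#0 (c1 {l})))
  (carryM (c2 {l})(bM ∩M constM (rfix (Tt start) i2 2#0 2#1) ∩M e2M F 2#0 v#0 2#1 v#1 2#1 (c2 {l}) ∩M qM (Tt t) 2#0 2#1 v#1 (c2 {l}))(badL t t< h)))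
 -- The chains of points starting from the coordinates 1 and 2.
 infixr 5 _>>_
 _>>_ : ∀ {x y z}-> x ⊑ y -> y ⊑ z -> x ⊑ z
 _>>_ = ⊑trans
 pull : ∀ i {z φ}-> Fix i z -> z ⊑ cy i φ -> z ∩ φ ≈ 𝟎 -> z ≈ 𝟎
 pull i f h e = ⊑⊥ (glb ⊑refl h >> ⊑≡ (~trans (~sym (cyl-fixˡ i f))(zero-cyl i e)))
 below : ∀ {x y}-> x ⊑ y -> y ≈ 𝟎 -> x ≈ 𝟎
 below h e = ⊑⊥ (h >> ⊑≡ e)
 orsElim : ∀ {z f} n -> z ⊑ ors f n ->(∀ t -> t < n -> z ∩ f t ≈ 𝟎)-> z ≈ 𝟎
 orsElim zero h e = ⊑⊥ h
 orsElim {z}{f}(suc n) h e = ⊑⊥ (split h >> lub (⊑≡ (e n ≤-refl))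
  (⊑≡ (orsElim n &r \t t< -> below (glb (&l >> &l) &r)(e t (m<n⇒m<1+n t<)))))
 next : Fin 3 -> Fin 3
 next zero = suc zero
 next 1F = zero
 next 2F = zero
 next# : ∀ k -> next k # k
 next# zero ()
 next# 1F ()
 next# 2F ()
 third : ∀ (k l : Fin 3)-> Σ[ a ∈ Fin 3 ] (k # a × l # a)
 third zero zero = suc zero , (\()), (\())
 third zero 1F = suc 1F , (\()), (\())
 third zero 2F = suc zero , (\()), (\())
 third 1F zero = suc 1F , (\()), (\())
 third 1F 1F = zero , (\()), (\())
 third 1F 2F = zero , (\()), (\())
 third 2F zero = suc zero , (\()), (\())
 third 2F 1F = zero , (\()), (\())
 third 2F 2F = zero , (\()), (\())
 X : Fin (6 + m)-> ℕ -> Fin 3 -> Carrier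
 X c zero k = dg c (v k)∩ Gv k
 X c (suc i) k = Gv k ∩ cy (v (next k))(X c i (next k)∩ e P (v (next k))(v k))
 X⊑G : ∀ {c} i {k}-> X c i k ⊑ Gv k
 X⊑G zero = &r
 X⊑G (suc i) = &l
 Xfix : ∀ {c} i {k j}-> j # i0 -> j # c -> j # v k -> Fix j (X c i k)
 Xfix zero n0 nc nk = fix-∧ _ (fix-diag _ _ _ nc nk)(qfix G _ _ n0 nk)
 Xfix (suc i){k}{j} n0 nc nk = fix-∧ _ (qfix G _ _ n0 nk) inner
  where
  inner : Fix j (cy (v (next k))(X _ i (next k)∩ e P (v (next k))(v k)))
  inner with j Fin.≟ v (next k)
  ... | yes refl = cyl-idem _ _
  ... | no n = fix-cyl _ _ (fix-∧ _ (Xfix i n0 nc n)(efix P _ _ _ n nk))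
 module Chain (c : Fin (6 + m))(v#c : ∀ {k}-> v k # c) where
  alt⊑ : ∀ i {k a b}-> a # k -> b # k ->(a # b -> Mv (v a)(v b)(X c i b)(X c i a))->(a # b -> Mv (v b)(v a)(X c i a)(X c i b))->
   cy (v b)(X c i b ∩ e P (v b)(v k)) ⊑ cy (v a)(X c i a ∩ e P (v a)(v k))
  alt⊑ i {k}{a}{b'} ak bk h g with a Fin.≟ b'
  ... | yes refl = ⊑refl
  ... | no n = rename (v b')(v a)(v# (#s n))(fix-∧ _ (fx (h n))(efix P _ _ _ (v# n)(v# ak)))(fix-∧ _ (fx (g n))(efix P _ _ _ (v# (#s n))(v# bk)))
   (glb (∧mono ⊑refl &l >> to (h n))(∧mono ⊑refl &r >> flip (v# n)(emove1 P _ _ _ v#0 v#0 (v# (#s n)))))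
  XM : ∀ i {k l}-> k # l -> Mv (v k)(v l)(X c i l)(X c i k)
  alt : ∀ i {k a}-> a # k -> X c (suc i) k ≈ Gv k ∩ cy (v a)(X c i a ∩ e P (v a)(v k))
  alt i {k} n = ∧-cong ~refl (antisym (alt⊑ i n (next# k)(XM i)(\p -> XM i (#s p)))(alt⊑ i (next# k) n (XM i)(\p -> XM i (#s p))))
  XM zero {k}{l} n = mv (Xfix 0 v#0 v#c (v# n))
   (glb (glb (&r >> &l)(&l >> ⊑≡ (diag-sym _ _ (v# n))) >> diag-trans c (v l)(v k) v#c (v# (#s n)))(∧mono ⊑refl &r >> to g))
   (glb (glb (&r >> &l) &l >> diag-trans c (v k)(v l) v#c (v# n))(∧mono ⊑refl &r >> fr g))
   where g = qM G v#0 v#1 v#1 (v# n)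
  XM (suc i){k}{l} n with third k l
  ... | a , ka , la = mv (fix-resp (alt i (#s la))(fx g))(∧mono ⊑refl (⊑≡ (alt i (#s la))) >> to g >> ⊑≡ (~sym (alt i (#s ka))))
   (∧mono ⊑refl (⊑≡ (alt i (#s ka))) >> fr g >> ⊑≡ (~sym (alt i (#s la))))
   where
   fix-resp : ∀ {j x y}-> x ≈ y -> Fix j y -> Fix j x
   fix-resp p f = ~trans (cyl-cong _ p)(~trans f (~sym p))
   g : Mv (v k)(v l)(Gv l ∩ cy (v a)(X c i a ∩ e P (v a)(v l)))(Gv k ∩ cy (v a)(X c i a ∩ e P (v a)(v k)))
   g = qM G v#0 v#1 v#1 (v# n) ∩M cyM (v a)(v# (#s ka))(v# (#s la))
    (constM (Xfix i v#0 v#c (v# ka)) ∩M e2M P v#0 v#0 v#1 v#1 (v# ka)(v# n))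
 module X1 = Chain i1 v#1
 module X2 = Chain i2 v#2
 S0 : Carrier
 S0 = b ∩ (r G ∩ (q G i2 ∩ e (Tt start) i1 i2))
 S0fix : ∀ k -> Fix (v k) S0
 S0fix k = fix-∧ _ (bfix _)(fix-∧ _ (rfix G _ v#0 v#1)(fix-∧ _ (qfix G _ _ v#0 v#2)(efix (Tt start) _ _ _ v#1 v#2)))
 st⊑ : S0 ⊑ e (Tt start) i1 i2
 st⊑ = &r >> &r >> &r
 -- the situation with the i-th point of the first chain at k and the j-th point of the second at l
 XY : ℕ -> ℕ -> Fin 3 -> Fin 3 -> Carrier
 XY i j k l = S0 ∩ (X i1 i k ∩ X i2 j l)
 XYfix : ∀ i j {k l a}-> k # a -> l # a -> Fix (v a)(XY i j k l)
 XYfix i j {a = a} ka la = fix-∧ _ (S0fix a)(fix-∧ _ (Xfix i v#0 v#1 (v# (#s ka)))(Xfix j v#0 v#2 (v# (#s la))))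
 xy-b : ∀ {x}-> S0 ∩ x ⊑ b
 xy-b = &l >> &l
 noW : ∀ {i j k l}-> k # l -> XY i j k l ⊑ − e W (v k)(v l)
 noW {i}{j}{k}{l} n = dis⇒⊑ (below (glb (&l >> xy-b)(glb (&l >> &r >> &l >> X⊑G i)(glb (&l >> &r >> &r >> X⊑G j)(&r >> ⊑≡ (¬¬ _)))))
  (inwV n))
 -- a predecessor, with the coordinates of the situation
 back1 : ∀ {i j k l a}-> k # a -> l # a -> XY (suc i) j k l ⊑ cy (v a)(X i1 i a ∩ e P (v a)(v k))
 back1 {i}{j} ka la = &r >> &l >> ⊑≡ (X1.alt i (#s ka)) >> &r
 back2 : ∀ {i j k l a}-> k # a -> l # a -> XY i (suc j) k l ⊑ cy (v a)(X i2 j a ∩ e P (v a)(v l))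
 back2 {j = j} ka la = &r >> &r >> ⊑≡ (X2.alt j (#s la)) >> &r
 step1 : ∀ {i k a}-> k # a -> X i1 i k ∩ (Gv a ∩ e P (v k)(v a)) ⊑ X i1 (suc i) a
 step1 {i} ka = glb (&r >> &l)(glb &l (&r >> &r) >> cyl-⊑ _ _) >> ⊑≡ (~sym (X1.alt i ka))
 step2 : ∀ {i k a}-> k # a -> X i2 i k ∩ (Gv a ∩ e P (v k)(v a)) ⊑ X i2 (suc i) a
 step2 {i} ka = glb (&r >> &l)(glb &l (&r >> &r) >> cyl-⊑ _ _) >> ⊑≡ (~sym (X2.alt i ka))
 -- all the situations are possible
 possible : ∀ i j {k l}-> k # l -> ¬ (XY i j k l ≈ 𝟎)
 possible zero zero {k}{l} n h = occ (pull (v k)(S0fix k)(⊑⊤ >> ⊑≡ (~sym (cyl-diag _ _ v#1)))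
  (pull (v l)(fix-∧ _ (S0fix l)(fix-diag _ _ _ (v# (#s n)) v#1))(⊑⊤ >> ⊑≡ (~sym (cyl-diag _ _ v#2)))
   (below (glb (&l >> &l)(glb (glb d1 (glb d1 (&l >> &l >> &r >> &l) >> r->q G _))(glb d2 (glb d2 (&l >> &l >> &r >> &r >> &l) >> qmove G _ _ 2#1 v#1 c2)))) h)))
  where
  d1 : (S0 ∩ dg (v k) i1)∩ dg (v l) i2 ⊑ dg i1 (v k)
  d1 = &l >> &r >> ⊑≡ (diag-sym _ _ v#1)
  d2 : (S0 ∩ dg (v k) i1)∩ dg (v l) i2 ⊑ dg i2 (v l)
  d2 = &r >> ⊑≡ (diag-sym _ _ v#2)
 possible (suc i) j {k}{l} n h with third k l
 ... | a , ka , la = possible i j {a}{l}(#s la)(pull (v k)(XYfix i j (#s ka)(#s n))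
  (glb xy-b (&r >> &l >> X⊑G i) >> succV (#s ka))(below (glb (&l >> &l)(glb (glb (&l >> &r >> &l) &r >> step1 {i}(#s ka))(&l >> &r >> &r))) h))
 possible zero (suc j){k}{l} n h with third k l
 ... | a , ka , la = possible zero j {k}{a} ka (pull (v l)(XYfix zero j n (#s la))
  (glb xy-b (&r >> &r >> X⊑G j) >> succV (#s la))(below (glb (&l >> &l)(glb (&l >> &r >> &l)(glb (&l >> &r >> &r) &r >> step2 {j}(#s la)))) h))
 -- every situation carries a tile
 tiled : ∀ i j {k l}-> k # l -> XY i j k l ⊑ e Tl (v k)(v l)
 tiled zero zero {k}{l} n = glb xy-b stv >> dis⇒⊑ (below (glb (&l >> &l)(glb (&l >> &r) &r))(At2.stlV k l n))
  where
  stv : XY 0 0 k l ⊑ e (Tt start)(v k)(v l)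
  stv = glb (&r >> &r >> &l)(glb (&r >> &l >> &l)(&l >> st⊑) >> emove1 (Tt start) _ _ _ 1#0 v#0 c1) >> emove2 (Tt start) _ _ _ 2#0 v#0 2#1 v#1 c2
 tiled (suc i) j {k}{l} n with third k l
 ... | a , ka , la = dis⇒⊑ (pull (v a)(fix-∧ _ (XYfix (suc i) j ka la)(fix-− _ (efix Tl _ _ _ (v# (#s ka))(v# (#s la)))))
  (&l >> back1 {i}{j} ka la)(below (glb (&l >> &l >> xy-b)(glb (&r >> &r)(glb (glb (&l >> &l >> &l)(glb (&r >> &l)(&l >> &l >> &r >> &r)) >> tiled i j (#s la))
   (glb (&l >> &r)(&l >> &l >> noW {suc i}{j} n)))))(At.hortV a k l (#s ka)(#s la) n)))
 tiled zero (suc j){k}{l} n with third k l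
 ... | a , ka , la = dis⇒⊑ (pull (v a)(fix-∧ _ (XYfix 0 (suc j) ka la)(fix-− _ (efix Tl _ _ _ (v# (#s ka))(v# (#s la)))))
  (&l >> back2 {0}{j} ka la)(below (glb (&l >> &l >> xy-b)(glb (glb (&l >> &l >> &l)(glb (&l >> &l >> &r >> &l)(&r >> &l)) >> tiled zero j ka)(glb (&r >> &r)
   (glb (&l >> &r)(&l >> &l >> noW {0}{suc j} n)))))(At.vertV k a l ka n (#s la))))
 -- the tile t does not occur at (i , j)
 record Excl (i j t : ℕ) : Set where
  field none : ∀ {k l}-> k # l -> XY i j k l ∩ e (Tt t)(v k)(v l)≈ 𝟎
 open Excl
 byTile : ∀ {z} i j {k l}-> k # l -> z ⊑ XY i j k l ->(∀ t -> t < N -> Excl i j t ⊎ (z ∩ e (Tt t)(v k)(v l)≈ 𝟎))-> z ≈ 𝟎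
 byTile {z} i j {k}{l} n h g = orsElim N (h >> glb xy-b (tiled i j n) >> dis⇒⊑ (below (glb (&l >> &l)(glb (&l >> &r) &r))(At2.tilV k l n)))
  \t t< -> [ (\x -> below (∧mono h ⊑refl)(none x n)), id ]′ (g t t<)
 exc-right : ∀ i j u -> u < N ->(∀ t -> t < N -> Excl i j t ⊎ hor t u ~ false)-> Excl (suc i) j u
 exc-right i j u u< h .none {k}{l} n with third k l
 ... | a , ka , la = pull (v a)(fix-∧ _ (XYfix (suc i) j ka la)(efix (Tt u) _ _ _ (v# (#s ka))(v# (#s la))))(&l >> back1 {i}{j} ka la)
  (byTile i j {a}{l}(#s la)(glb (&l >> &l >> &l)(glb (&r >> &l)(&l >> &l >> &r >> &r)))
   \t t< -> [ inl , (\p -> inr (below (glb (&l >> &l >> &l >> xy-b)(glb (&l >> &r >> &r)(glb &r (&l >> &l >> &r))))(At.horV a k l (#s ka)(#s la) n t u t< u< p))) ]′ (h t t<))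
 exc-left : ∀ i j t -> t < N ->(∀ u -> u < N -> Excl (suc i) j u ⊎ hor t u ~ false)-> Excl i j t
 exc-left i j t t< h .none {k}{l} n with third k l
 ... | a , ka , la = pull (v a)(fix-∧ _ (XYfix i j ka la)(efix (Tt t) _ _ _ (v# (#s ka))(v# (#s la))))
  (glb (&l >> xy-b)(&l >> &r >> &l >> X⊑G i) >> succV ka)
  (byTile (suc i) j (#s la)(glb (&l >> &l >> &l)(glb (glb (&l >> &l >> &r >> &l) &r >> step1 {i} ka)(&l >> &l >> &r >> &r)))
   \u u< -> [ inl , (\p -> inr (below (glb (&l >> &l >> &l >> xy-b)(glb (&l >> &r >> &r)(glb (&l >> &l >> &r) &r)))(At.horV k a l ka n (#s la) t u t< u< p))) ]′ (h u u<))
 exc-up : ∀ i j u -> u < N ->(∀ t -> t < N -> Excl i j t ⊎ ver t u ~ false)-> Excl i (suc j) u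
 exc-up i j u u< h .none {k}{l} n with third k l
 ... | a , ka , la = pull (v a)(fix-∧ _ (XYfix i (suc j) ka la)(efix (Tt u) _ _ _ (v# (#s ka))(v# (#s la))))(&l >> back2 {i}{j} ka la)
  (byTile i j ka (glb (&l >> &l >> &l)(glb (&l >> &l >> &r >> &l)(&r >> &l)))
   \t t< -> [ inl , (\p -> inr (below (glb (&l >> &l >> &l >> xy-b)(glb &r (glb (&l >> &r >> &r)(&l >> &l >> &r))))(At.verV k a l ka n (#s la) t u t< u< p))) ]′ (h t t<))
 exc-start : ∀ t -> t < N -> t # start -> Excl 0 0 t
 exc-start t t< ne .none {k}{l} n = below (glb (&l >> xy-b)(glb (&l >> stv) &r))(At2.stV k l n t t< ne)
  where
  stv : XY 0 0 k l ⊑ e (Tt start)(v k)(v l)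
  stv = glb (&r >> &r >> &l)(glb (&r >> &l >> &l)(&l >> st⊑) >> emove1 (Tt start) _ _ _ 1#0 v#0 c1) >> emove2 (Tt start) _ _ _ 2#0 v#0 2#1 v#1 c2
 later : ∀ j {l}-> S0 ∩ X i2 (suc j) l ⊑ e F i2 (v l)
 later j {l} with third l l
 ... | a , la , _ = dis⇒⊑ (pull (v a)(fix-∧ _ (fix-∧ _ (S0fix a)(Xfix (suc j) v#0 v#2 (v# (#s la))))(fix-− _ (efix F _ _ _ v#2 (v# (#s la)))))
  (&l >> &r >> ⊑≡ (X2.alt j (#s la)) >> &r)(go j))
  where
  go : ∀ j ->((S0 ∩ X i2 (suc j) l)∩ − e F i2 (v l))∩ (X i2 j a ∩ e P (v a)(v l))≈ 𝟎
  go zero = clash− (glb (&r >> &l >> &l >> ⊑≡ (diag-sym _ _ c2))(glb (&l >> &l >> &l >> &l)(&r >> &r)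
   >> dis⇒⊑ (below (glb (&l >> &l)(glb (&l >> &r) &r))(At2.pfV a l (#s la)))) >> emove1 F _ _ _ v#0 2#0 v#2)(&l >> &r)
  go (suc j) = below (glb (&l >> &l >> &l >> &l)(glb (glb (&l >> &l >> &l)(&r >> &l) >> later j)(glb (&r >> &r)(glb (&l >> &r)(&l >> &l >> nw)))))
   (At2.ffV a l (#s la))
   where
   nw : S0 ∩ X i2 (suc (suc j)) l ⊑ − e W i2 (v l)
   nw = dis⇒⊑ (below (glb (&l >> &l >> &l)(glb (&l >> &l >> &r >> &r >> &l)(glb (&l >> &r >> X⊑G (suc (suc j)){l})(&r >> ⊑≡ (¬¬ _))))) inw2)
 exc-bad : ∀ j t -> t < N -> bad t ! -> Excl 0 (suc j) t
 exc-bad j t t< h .none {k}{l} n = below (glb (&l >> xy-b)(glb (&l >> &l >> st⊑)(glb (&l >> glb &l (&r >> &r) >> later j)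
  (glb (&l >> &r >> &l >> &l >> ⊑≡ (diag-sym _ _ c1)) &r >> emove1 (Tt t) _ _ _ v#0 1#0 v#1))))(badV t t< h)
 -- at every place some tile occurs
 exc-all : ∀ i j ->(∀ t -> t < N -> Excl i j t)-> Empty
 exc-all i j h = possible i j {zero}{suc zero}(\())(byTile i j (\()) ⊑refl \t t< -> inl (h t t<))
 -- in a finite algebra two points of the first chain carry a common tile
 exc-bounded : ∀ K (num : Carrier -> Fin K)->(∀ {x y}-> num x ~ num y -> x ≈ y)-> ∃[ i ] ∃[ i' ] (i < i' × ∀ j ->(∀ t -> t < N -> Excl i j t ⊎ Excl i' j t)-> Empty)
 exc-bounded K num inj with Fin.pigeonhole {K}{suc K} ≤-refl (\i -> num (X i1 (ix i) zero))
 ... | i , i' , lt , eq' = ix i , ix i' , lt , \j h -> possible (ix i) j {zero}{suc zero}(\())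
  (byTile (ix i) j (\()) ⊑refl \t t< -> [ inl , (\x -> inr (~trans (∧-cong (∧-cong ~refl (∧-cong same ~refl)) ~refl)(none x {zero}{suc zero}(\())))) ]′ (h t t<))
  where
  same : X i1 (ix i) zero ≈ X i1 (ix i') zero
  same = inj eq'

-- From excluded tiles to tiles that may occur.
module Occurrence (em : EM)(TS : Tiles)(Excl : ℕ -> ℕ -> ℕ -> Set)
 (exc-right : ∀ i j u -> u < Tiles.N TS ->(∀ t -> t < Tiles.N TS -> Excl i j t ⊎ Tiles.hor TS t u ~ false)-> Excl (suc i) j u)
 (exc-left : ∀ i j t -> t < Tiles.N TS ->(∀ u -> u < Tiles.N TS -> Excl (suc i) j u ⊎ Tiles.hor TS t u ~ false)-> Excl i j t)
 (exc-up : ∀ i j u -> u < Tiles.N TS ->(∀ t -> t < Tiles.N TS -> Excl i j t ⊎ Tiles.ver TS t u ~ false)-> Excl i (suc j) u)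
 (exc-start : ∀ t -> t < Tiles.N TS -> t # Tiles.start TS -> Excl 0 0 t)
 (exc-bad : ∀ j t -> t < Tiles.N TS -> Tiles.bad TS t ! -> Excl 0 (suc j) t)
 (exc-all : ∀ i j ->(∀ t -> t < Tiles.N TS -> Excl i j t)-> Empty) where
 open Tiles TS
 -- tiles that may occur at a place
 Occurs : ℕ -> ℕ -> ℕ -> Set
 Occurs i j t = t < N × ¬ Excl i j t
 private
  ex? : ∀ i j t -> Dec (Excl i j t)
  ex? i j t = em 0ℓ
  some : ∀ (Q : ℕ -> Set)->((∀ t -> t < N -> ¬ Q t)-> Empty)-> ∃[ t ] (t < N × Q t)
  some Q h with em 0ℓ {∃[ t ] (t < N × Q t)}
  ... | yes p = p
  ... | no n = efq (h \t t< q -> n (t , t< , q))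
  via : ∀ (p : ℕ -> Bool) i j ->((∀ t -> t < N -> Excl i j t ⊎ p t ~ false)-> Empty)-> ∃[ t ] (Occurs i j t × p t !)
  via p i j h with some (\t -> ¬ Excl i j t × p t !)(\g -> h (\t t< -> side (ex? i j t)(p t) refl (g t t<)))
   where
   side : ∀ {A : Set}{c}-> Dec A -> ∀ d -> c ~ d -> ¬ (¬ A × c !)-> A ⊎ c ~ false
   side (yes a) d e n = inl a
   side (no a) true e n = efq (n (a , e))
   side (no a) false e n = inr e
  ... | t , t< , x , q = t , (t< , x), q
 occ-right : ∀ {i j u}-> Occurs (suc i) j u -> ∃[ t ] (Occurs i j t × hor t u !)
 occ-right {i}{j}{u}(u< , n) = via (\t -> hor t u) i j (n ∘ exc-right i j u u<)
 occ-left : ∀ {i j t}-> Occurs i j t -> ∃[ u ] (Occurs (suc i) j u × hor t u !)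
 occ-left {i}{j}{t}(t< , n) = via (hor t)(suc i) j (n ∘ exc-left i j t t<)
 occ-up : ∀ {i j u}-> Occurs i (suc j) u -> ∃[ t ] (Occurs i j t × ver t u !)
 occ-up {i}{j}{u}(u< , n) = via (\t -> ver t u) i j (n ∘ exc-up i j u u<)
 occ-start : ∀ {t}-> Occurs 0 0 t -> t ~ start
 occ-start {t}(t< , n) with t ℕ.≟ start
 ... | yes e = e
 ... | no ne = efq (n (exc-start t t< ne))
 occ-bad : ∀ {j t}-> Occurs 0 (suc j) t -> bad t ~ false
 occ-bad {j}{t}(t< , n) with bad t in q
 ... | true = efq (n (exc-bad j t t< q))
 ... | false = refl
 occ-some : ∀ i j -> ∃[ t ] Occurs i j t
 occ-some i j with some (\t -> ¬ Excl i j t)(\h -> exc-all i j \t t< -> case ex? i j t of \ { (yes x)-> x; (no n)-> efq (h t t< n) })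
 ... | t , oc = t , oc
 occ-common : ∃[ i ] ∃[ i' ] (i < i' × ∀ j ->(∀ t -> t < N -> Excl i j t ⊎ Excl i' j t)-> Empty)->
  ∃[ i ] ∃[ i' ] (i < i' × ∀ j -> ∃[ t ] (Occurs i j t × Occurs i' j t))
 occ-common (i , i' , lt , h) = i , i' , lt , \j -> common j
  where
  common : ∀ j -> ∃[ t ] (Occurs i j t × Occurs i' j t)
  common j with some (\t -> ¬ Excl i j t × ¬ Excl i' j t)(\g -> h j (\t t< -> case ex? i j t of \
   { (yes x)-> inl x; (no x)-> case ex? i' j t of \ { (yes y)-> inr y; (no y)-> efq (g t t< (x , y)) } }))
  ... | t , t< , x , y = t , (t< , x), (t< , y)

-- Counter machines and their tilings.
allN : ℕ ->(ℕ -> Bool)-> Bool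
allN n Q = not (anyN n (\i -> not (Q i)))

allN- : ∀ {n Q}-> allN n Q ! -> ∀ i -> i < n -> Q i !
allN- {n}{Q} h i i< with Q i in e
... | true = refl
... | false = efq (not- h (anyN+ n _ i i< (cong not e)))

allN+ : ∀ {n Q}->(∀ i -> i < n -> Q i !)-> allN n Q !
allN+ {n}{Q} h = not+ \e -> let i , i< , q = anyN- n _ e in not- {Q i} q (h i i<)

b2n-== : ∀ z ->(b2n z == 1)~ z
b2n-== true = refl
b2n-== false = refl

bool-≡ : Bool -> Bool -> Bool
bool-≡ a b = b2n a == b2n b

bool-≡- : ∀ {a b}-> bool-≡ a b ! -> a ~ b
bool-≡- {true}{true} h = refl
bool-≡- {false}{false} h = refl

bool-≡+ : ∀ {a}-> bool-≡ a a !
bool-≡+ {true} = refl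
bool-≡+ {false} = refl

tick : ℕ -> ℕ -> ℕ
tick 0 x = x
tick 1 x = suc x
tick (suc (suc _)) x = ℕ.pred x

-- position i compared with the value v: below, at, above
cmp : ℕ -> ℕ -> ℕ
cmp zero (suc _) = 0
cmp zero zero = 1
cmp (suc _) zero = 2
cmp (suc i)(suc v) = cmp i v

cmp< : ∀ i v -> cmp i v < 3
cmp< zero zero = sl (sl zl)
cmp< zero (suc v) = sl zl
cmp< (suc i) zero = sl (sl (sl zl))
cmp< (suc i)(suc v) = cmp< i v

cmp-self : ∀ i -> cmp i i ~ 1
cmp-self zero = refl
cmp-self (suc i) = cmp-self i

cmp-above : ∀ {i v}-> v < i -> cmp i v ~ 2
cmp-above {suc i}{zero} h = refl
cmp-above {suc i}{suc v}(sl h) = cmp-above h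

horD : ℕ -> ℕ -> Bool
horD x y = if x == 0 then y << 2 else y == 2

verD : ℕ -> ℕ -> ℕ -> Bool
verD δ x y = if δ == 0 then x == y else
 (if δ == 1 then (if x << 2 then y == 0 else 0 << y) else (if x == 0 then y << 2 else y == 2))

horD-cmp : ∀ i v -> horD (cmp i v)(cmp (suc i) v) !
horD-cmp zero zero = refl
horD-cmp zero 1 = refl
horD-cmp zero (suc (suc v)) = refl
horD-cmp (suc i) zero = refl
horD-cmp (suc i)(suc v) = horD-cmp i v

verD-cmp : ∀ δ i v ->(∀ d -> δ ~ suc (suc d)-> v # 0)-> verD δ (cmp i v)(cmp i (tick δ v)) !
verD-cmp 0 i v h = ==+ {cmp i v} refl
verD-cmp 1 zero zero h = refl
verD-cmp 1 zero (suc v) h = refl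
verD-cmp 1 1 zero h = refl
verD-cmp 1 (suc (suc i)) zero h = refl
verD-cmp 1 (suc i)(suc v) h = verD-cmp 1 i v \d ()
verD-cmp (suc (suc d)) i zero h = efq (h d refl refl)
verD-cmp (suc (suc d)) i (suc v) h = dec i v
 where
 dec : ∀ i v -> verD (suc (suc d))(cmp i (suc v))(cmp i v) !
 dec zero zero = refl
 dec zero (suc v) = refl
 dec 1 zero = refl
 dec (suc (suc i)) zero = refl
 dec (suc i)(suc v) = dec i v

-- increments are determined from the left
inc0 : ∀ a y -> verD 1 (cmp 0 a) y ! -> y ~ 0
inc0 zero y h = ==- h
inc0 (suc a) y h = ==- h

inc-right : ∀ i a y -> horD (cmp i (suc a)) y ! -> verD 1 (cmp (suc i) a) y ! -> y ~ cmp (suc i)(suc a)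
inc-right zero zero 1 h g = refl
inc-right zero zero (suc (suc y))() g
inc-right zero 1 y h g = ==- g
inc-right zero (suc (suc a)) y h g = ==- g
inc-right 1 zero y h g = ==- h
inc-right (suc (suc i)) zero y h g = ==- h
inc-right (suc i)(suc a) y h g = inc-right i a y h g

-- decrements are determined from the right
dec0 : ∀ d a i y -> a < i -> verD (suc (suc d))(cmp i (suc a)) y ! -> y ~ cmp i a
dec0 d zero 1 y lt h = ==- h
dec0 d zero (suc (suc i)) y lt h = ==- h
dec0 d (suc a)(suc i) y (sl lt) h = dec0 d a i y lt h

dec-left : ∀ d i a y -> horD y (cmp (suc i) a) ! -> verD (suc (suc d))(cmp i (suc a)) y ! -> y ~ cmp i a
dec-left d zero zero 1 h g = refl
dec-left d zero zero (suc (suc y)) h ()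
dec-left d zero (suc a) zero h g = refl
dec-left d zero 1 (suc y)() g
dec-left d zero (suc (suc a))(suc y)() g
dec-left d 1 zero y h g = ==- g
dec-left d (suc (suc i)) zero y h g = ==- g
dec-left d (suc i)(suc a) y h g = dec-left d i a y h g

-- A machine in which a step from a state tests one register and changes every register by at most one.
-- The last register is R.
record Machine : Set where
 field
  Q1 R : ℕ -- one less than the number of states
  test : ℕ -> ℕ
  nxt : ℕ -> Bool -> ℕ
  dlt : ℕ -> Bool -> ℕ -> ℕ -- 0: keep, 1: increment, 2: decrement
  reject : ℕ
 Conf : Set
 Conf = ℕ × (ℕ -> ℕ)
 zeroTest : Conf -> Bool
 zeroTest (q , ρ) = ρ (test q) == 0
 step : Conf -> Conf
 step c@(q , ρ) = nxt q (zeroTest c), \r -> tick (dlt q (zeroTest c) r)(ρ r)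
 run : ℕ -> Conf
 run zero = 0 , \_ -> 0
 run (suc j) = step (run j)
 record Sound : Set where
  field
   nxt< : ∀ q z -> nxt q z < suc Q1
   nxt#0 : ∀ q z -> nxt q z # 0
   test≤ : ∀ q -> test q < suc R
   dec-ok : ∀ q z r d -> dlt q z r ~ suc (suc d)-> z ~ false × r ~ test q
 -- tile 0 is the blank tile
 enc : ℕ -> Bool ->(ℕ -> ℕ)-> ℕ
 enc q z d = suc (b2n z + (q + fd 2 (suc R) d * suc Q1) * 2)
 stT : ℕ -> ℕ
 stT t = ((t ∸ 1) / 2) % suc Q1
 zbT : ℕ -> Bool
 zbT t = ((t ∸ 1) % 2) == 1
 dT : ℕ -> ℕ -> ℕ
 dT r t = dig 2 r (((t ∸ 1) / 2) / suc Q1)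
 tiles : Tiles
 tiles = record
  { N = suc ((3 ^ suc R * suc Q1) * 2)
  ; hor = \t u -> if t == 0 then u == 0 else (not (u == 0) && ((stT t == stT u) && (bool-≡ (zbT t)(zbT u) && allN (suc R)(\r -> horD (dT r t)(dT r u)))))
  ; ver = \t u ->(u == 0) || (not (t == 0) && ((stT u == nxt (stT t)(zbT t)) && allN (suc R)(\r -> verD (dlt (stT t)(zbT t) r)(dT r t)(dT r u))))
  ; bad = \t ->(t == 0) || ((stT t == reject) || not (bool-≡ (zbT t)(dT (test (stT t)) t == 1)))
  ; start = enc 0 true (\_ -> 1) }

module Tiling (Ma : Machine)(so : Machine.Sound Ma) where
 open Machine Ma
 open Sound so
 open Tiles tiles
 module _ {q : ℕ}{z : Bool}{d : ℕ -> ℕ}(q< : q < suc Q1)(d< : ∀ r -> d r < 3) where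
  private
   t/2 : (enc q z d ∸ 1) / 2 ~ q + fd 2 (suc R) d * suc Q1
   t/2 = div-dm 1 (b2n z) _ (b2n< z)
  st-enc : stT (enc q z d)~ q
  st-enc = cong (_% suc Q1) t/2 & mod-dm Q1 q (fd 2 (suc R) d) q<
  zb-enc : zbT (enc q z d)~ z
  zb-enc = cong (_== 1)(mod-dm 1 (b2n z)(q + fd 2 (suc R) d * suc Q1)(b2n< z))& b2n-== z
  d-enc : ∀ r -> r < suc R -> dT r (enc q z d)~ d r
  d-enc r r< = cong (dig 2 r)(cong (_/ suc Q1) t/2 & div-dm Q1 q _ q<)& dig-fd 2 (suc R) d r d< r<
  enc< : enc q z d < N
  enc< = sl (begin-strict
   b2n z + (q + fd 2 (suc R) d * suc Q1) * 2 <⟨ +-monoˡ-< _ (b2n< z) ⟩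
   2 + (q + fd 2 (suc R) d * suc Q1) * 2 ≤⟨ *-monoˡ-≤ 2 (≤-trans (+-monoˡ-≤ _ q<)(*-monoˡ-≤ (suc Q1)(fd-< 2 (suc R) d d<))) ⟩
   (3 ^ suc R * suc Q1) * 2 ∎)
   where open ℕ.≤-Reasoning
 -- a tile other than the blank one is determined by its features
 tile-ext : ∀ t -> t < N -> t # 0 -> t ~ enc (stT t)(zbT t)(\r -> dT r t)
 tile-ext zero h n = efq (n refl)
 tile-ext (suc t)(sl h) n = cong suc (m≡m%n+[m/n]*n t 2 & cong2 (\x y -> x + y * 2) bit0
  (m≡m%n+[m/n]*n (t / 2)(suc Q1)& cong (\y ->(t / 2) % suc Q1 + y * suc Q1)(sym (fd-dig 2 (suc R) _ (m<n*o⇒m/o<n (m<n*o⇒m/o<n h))))))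
  where
  bit0 : t % 2 ~ b2n ((t % 2) == 1)
  bit0 with t % 2 | m%n<n t 2
  ... | 0 | _ = refl
  ... | 1 | _ = refl
  ... | suc (suc _) | sl (sl ())
 enc-cong : ∀ {q q' z z' d d'}-> q ~ q' -> z ~ z' ->(∀ r -> r < suc R -> d r ~ d' r)-> enc q z d ~ enc q' z' d'
 enc-cong {q}{z = z} refl refl h = cong (\x -> suc (b2n z + (q + x * suc Q1) * 2))(fd-cong 2 (suc R) _ _ h)
 st : ℕ -> ℕ
 st j = fst (run j)
 val : ℕ -> ℕ -> ℕ
 val j = snd (run j)
 zb : ℕ -> Bool
 zb j = zeroTest (run j)
 tAt : ℕ -> ℕ -> ℕ
 tAt i j = enc (st j)(zb j)(\r -> cmp i (val j r))
 st< : ∀ j -> st j < suc Q1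
 st< zero = sl zl
 st< (suc j) = nxt< _ _
 module _ (i j : ℕ) where
  private
   dj : ℕ -> ℕ
   dj r = cmp i (val j r)
  stA : stT (tAt i j)~ st j
  stA = st-enc {z = zb j}{d = dj}(st< j)(\r -> cmp< i (val j r))
  zbA : zbT (tAt i j)~ zb j
  zbA = zb-enc {z = zb j}{d = dj}(st< j)(\r -> cmp< i (val j r))
  dA : ∀ r -> r < suc R -> dT r (tAt i j)~ cmp i (val j r)
  dA = d-enc {z = zb j}{d = dj}(st< j)(\r -> cmp< i (val j r))
  tileAt< : tAt i j < N
  tileAt< = enc< {z = zb j}{d = dj}(st< j)(\r -> cmp< i (val j r))
 dec-pos : ∀ j r d -> dlt (st j)(zb j) r ~ suc (suc d)-> val j r # 0
 dec-pos j r d e v with dec-ok (st j)(zb j) r d e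
 ... | z , refl = case trans (sym z)(==+ v) of \()
 hor- : ∀ {t u}-> hor t u ! -> t # 0 -> u # 0 × stT t ~ stT u × zbT t ~ zbT u × (∀ r -> r < suc R -> horD (dT r t)(dT r u) !)
 hor- {zero} h n = efq (n refl)
 hor- {suc t}{u} h n with &- {not (u == 0)} h
 ... | a , h with &- {stT (suc t) == stT u} h
 ... | b , h with &- {bool-≡ (zbT (suc t))(zbT u)} h
 ... | c , d = (\e -> not- {u == 0} a (==+ e)), ==- b , bool-≡- c , allN- d
 hor+ : ∀ {t u}-> t # 0 -> u # 0 -> stT t ~ stT u -> zbT t ~ zbT u ->(∀ r -> r < suc R -> horD (dT r t)(dT r u) !)-> hor t u !
 hor+ {zero} n _ _ _ _ = efq (n refl)
 hor+ {suc t}{u} _ n a b c = &+ (not+ \e -> n (==- e))(&+ (==+ a)(&+ (subst (\x -> bool-≡ (zbT (suc t)) x !) b (bool-≡+ {zbT (suc t)}))(allN+ c)))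
 ver- : ∀ {t u}-> ver t u ! -> u # 0 -> stT u ~ nxt (stT t)(zbT t)× (∀ r -> r < suc R -> verD (dlt (stT t)(zbT t) r)(dT r t)(dT r u) !)
 ver- {t}{zero} h n = efq (n refl)
 ver- {t}{suc u} h n with &- {not (t == 0)} h
 ... | _ , h with &- {stT (suc u) == nxt (stT t)(zbT t)} h
 ... | a , b = ==- a , allN- b
 ver+ : ∀ {t u}-> t # 0 -> stT u ~ nxt (stT t)(zbT t)->(∀ r -> r < suc R -> verD (dlt (stT t)(zbT t) r)(dT r t)(dT r u) !)-> ver t u !
 ver+ {t}{zero} n a b = refl
 ver+ {t}{suc u} n a b = &+ (not+ \e -> n (==- e))(&+ (==+ a)(allN+ b))
 bad- : ∀ {t}-> bad t ~ false -> t # 0 × stT t # reject × zbT t ~ (dT (test (stT t)) t == 1)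
 bad- {t} h with t == 0 in a | stT t == reject in b | bool-≡ (zbT t)(dT (test (stT t)) t == 1) in c
 ... | false | false | true = (\e -> case trans (sym a)(==+ e) of \()), (\e -> case trans (sym b)(==+ e) of \()), bool-≡- c
 bad+ : ∀ {t}-> t # 0 -> stT t # reject -> zbT t ~ (dT (test (stT t)) t == 1)-> bad t ~ false
 bad+ {t} n m e rewrite sym e | bool-≡+ {zbT t} with t == 0 in a | stT t == reject in b
 ... | true | _ = efq (n (==- a))
 ... | false | true = efq (m (==- b))
 ... | false | false = refl
 honest-hor : ∀ i j -> hor (tAt i j)(tAt (suc i) j) !
 honest-hor i j = hor+ {tAt i j}{tAt (suc i) j}(\())(\())(stA i j & sym (stA (suc i) j))(zbA i j & sym (zbA (suc i) j))
  \r r< -> subst₂ (\x y -> horD x y !)(sym (dA i j r r<))(sym (dA (suc i) j r r<))(horD-cmp i (val j r))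
 honest-ver : ∀ i j -> ver (tAt i j)(tAt i (suc j)) !
 honest-ver i j = ver+ {tAt i j}{tAt i (suc j)}(\())(stA i (suc j)& cong2 nxt (sym (stA i j))(sym (zbA i j))) \r r< ->
  subst₂ (\x y -> verD (dlt (stT (tAt i j))(zbT (tAt i j)) r) x y !)(sym (dA i j r r<))(sym (dA i (suc j) r r<))
   (subst₂ (\x y -> verD (dlt x y r)(cmp i (val j r))(cmp i (val (suc j) r)) !)(sym (stA i j))(sym (zbA i j))(verD-cmp _ i (val j r)(dec-pos j r)))
 cmp0 : ∀ v ->(cmp 0 v == 1)~ (v == 0)
 cmp0 zero = refl
 cmp0 (suc v) = refl
 honest-bad : ∀ j -> st j # reject -> bad (tAt 0 j)~ false
 honest-bad j n = bad+ {tAt 0 j}(\())(n ∘ trans (sym (stA 0 j)))(zbA 0 j & sym (cmp0 (val j (test (st j))))& cong (_== 1)(sym (dA 0 j _ (test≤ _))& cong (\q -> dT (test q)(tAt 0 j))(sym (stA 0 j))))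
 start≡ : start ~ tAt 0 0
 start≡ = refl
 -- the rules of occurrence determine the tiles
 module Determined (Occ : ℕ -> ℕ -> ℕ -> Set)
  (occ< : ∀ {i j t}-> Occ i j t -> t < N)
  (right : ∀ {i j u}-> Occ (suc i) j u -> ∃[ t ] (Occ i j t × hor t u !))
  (left : ∀ {i j t}-> Occ i j t -> ∃[ u ] (Occ (suc i) j u × hor t u !))
  (up : ∀ {i j u}-> Occ i (suc j) u -> ∃[ t ] (Occ i j t × ver t u !))
  (atStart : ∀ {t}-> Occ 0 0 t -> t ~ start)
  (notBad : ∀ {j t}-> Occ 0 (suc j) t -> bad t ~ false) where
  module Step (j : ℕ)(prev : ∀ i t -> Occ i j t -> t ~ tAt i j) where
   nb : ∀ i {u}-> Occ i (suc j) u -> u # 0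
   nb zero {u} p = fst (bad- {u}(notBad p))
   nb (suc i){u} p with right p
   ... | t , q , h = fst (hor- {t}{u} h (nb i q))
   ups : ∀ i {u}-> Occ i (suc j) u -> stT u ~ st (suc j)× (∀ r -> r < suc R -> verD (dlt (st j)(zb j) r)(cmp i (val j r))(dT r u) !)
   ups i {u} p with up p
   ... | t , q , h with prev i t q
   ... | refl with ver- {tAt i j}{u} h (nb i p)
   ... | a , b = trans a (cong2 nxt (stA i j)(zbA i j)), \r r< -> subst₂ (\x y -> verD (dlt x y r)(cmp i (val j r))(dT r u) !)(stA i j)(zbA i j)
    (subst (\x -> verD (dlt (stT (tAt i j))(zbT (tAt i j)) r) x (dT r u) !)(dA i j r r<)(b r r<))
   sts : ∀ i {u}-> Occ i (suc j) u -> stT u ~ st (suc j)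
   sts i p = fst (ups i p)
   ds : ∀ r -> r < suc R -> ∀ i {u}-> Occ i (suc j) u -> dT r u ~ cmp i (tick (dlt (st j)(zb j) r)(val j r))
   ds r r< with dlt (st j)(zb j) r in e
   ... | 0 = \i p -> sym (==- (ver0 i p))
    where
    ver0 : ∀ i {u}-> Occ i (suc j) u -> verD 0 (cmp i (val j r))(dT r u) !
    ver0 i {u} p = subst (\δ -> verD δ (cmp i (val j r))(dT r u) !) e (snd (ups i p) r r<)
   ... | 1 = go
    where
    ver1 : ∀ i {u}-> Occ i (suc j) u -> verD 1 (cmp i (val j r))(dT r u) !
    ver1 i {u} p = subst (\δ -> verD δ (cmp i (val j r))(dT r u) !) e (snd (ups i p) r r<)
    go : ∀ i {u}-> Occ i (suc j) u -> dT r u ~ cmp i (suc (val j r))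
    go zero {u} p = inc0 (val j r) _ (ver1 0 p)
    go (suc i){u} p with right p
    ... | t , q , h = inc-right i (val j r) _ (subst (\x -> horD x (dT r u) !)(go i q)(snd (snd (snd (hor- {t}{u} h (nb i q)))) r r<))(ver1 (suc i) p)
   ... | suc (suc d) = \i p -> go (val j r) i (m≤n+m _ i) p
    where
    v = ℕ.pred (val j r)
    v≡ : val j r ~ suc v
    v≡ with val j r in f
    ... | zero = efq (dec-pos j r d e f)
    ... | suc _ = refl
    ver2 : ∀ i {u}-> Occ i (suc j) u -> verD (suc (suc d))(cmp i (suc v))(dT r u) !
    ver2 i {u} p = subst₂ (\δ x -> verD δ (cmp i x)(dT r u) !) e v≡ (snd (ups i p) r r<)
    go : ∀ k i -> val j r ≤ i + k -> ∀ {u}-> Occ i (suc j) u -> dT r u ~ cmp i v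
    go zero i le p = dec0 d v i _ (subst₂ _≤_ v≡ (+-identityʳ i) le)(ver2 i p)
    go (suc k) i le {t} p with left p
    ... | u , q , h = dec-left d i v _ (subst (\x -> horD (dT r t) x !)(go k (suc i)(subst (val j r ≤_)(+-suc i k) le) q)
     (snd (snd (snd (hor- {t}{u} h (nb i p)))) r r<))(ver2 i p)
   zbs : ∀ i {u}-> Occ i (suc j) u -> zbT u ~ zb (suc j)
   zbs zero {u} p = snd (snd (bad- {u}(notBad p)))& cong (_== 1)(cong (\q -> dT (test q) u)(sts 0 p)& ds _ (test≤ _) 0 p)& cmp0 (val (suc j)(test (st (suc j))))
   zbs (suc i){u} p with right p
   ... | t , q , h = sym (fst (snd (snd (hor- {t}{u} h (nb i q)))))& zbs i q
   next : ∀ i u -> Occ i (suc j) u -> u ~ tAt i (suc j)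
   next i u p = tile-ext u (occ< p)(nb i p)& enc-cong {d = \r -> dT r u}{\r -> cmp i (val (suc j) r)}(sts i p)(zbs i p)(\r r< -> ds r r< i p)
  exact0 : ∀ i t -> Occ i 0 t -> t ~ tAt i 0
  exact0 zero t p = atStart p & start≡
  exact0 (suc i) u p with right p
  ... | t , q , h with exact0 i t q
  ... | refl with hor- {tAt i 0}{u} h (\())
  ... | n , a , b , c = trans (tile-ext u (occ< p) n)(enc-cong {d = \r -> dT r u}{\r -> cmp (suc i) 0}(sym a & stA i 0)(sym b & zbA i 0)
   \r r< -> two i (subst (\x -> horD x (dT r u) !)(dA i 0 r r<)(c r r<)))
   where
   two : ∀ i {y}-> horD (cmp i 0) y ! -> y ~ 2
   two zero h = ==- h
   two (suc i) h = ==- h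
  exact : ∀ j i t -> Occ i j t -> t ~ tAt i j
  exact zero = exact0
  exact (suc j) i u p = Step.next j (exact j) i u p
  module _ (some : ∀ i j -> ∃[ t ] Occ i j t) where
   -- the rejecting state is not reached
   no-reject : ∀ j -> st (suc j)# reject
   no-reject j e with some 0 (suc j)
   ... | t , p with exact (suc j) 0 t p
   ... | refl = fst (snd (bad- {tAt 0 (suc j)}(notBad p)))(stA 0 (suc j)& e)
  -- distinct columns are told apart by a register counting the steps
  no-merge : (∀ j -> val j R ~ j)-> ¬ (∃[ i ] ∃[ i' ] (i < i' × ∀ j -> ∃[ t ] (Occ i j t × Occ i' j t)))
  no-merge clock (i , i' , lt , h) with h i
  ... | t , p , p' = case trans (sym (at i))(cong (dT R)(sym (exact i i t p)& exact i i' t p')& at i') of clash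
   where
   at : ∀ k -> dT R (tAt k i)~ cmp k i
   at k = dA k i R ≤-refl & cong (cmp k)(clock i)
   clash : cmp i i ~ cmp i' i -> Empty
   clash e = case trans (sym (cmp-self i))(e & cmp-above lt) of \()
 hd : ℕ -> ℕ
 hd zero = 0
 hd (suc _) = 2
 hd< : ∀ x -> hd x < 3
 hd< zero = sl zl
 hd< (suc x) = sl (sl (sl zl))
 horD-hd : ∀ x -> horD x (hd x) !
 horD-hd zero = refl
 horD-hd (suc x) = refl
 nextT : ℕ -> ℕ
 nextT zero = 0
 nextT (suc t) = enc (stT (suc t))(zbT (suc t))(\r -> hd (dT r (suc t)))
 private
  stT< : ∀ t -> stT t < suc Q1
  stT< t = m%n<n ((t ∸ 1) / 2)(suc Q1)
 module _ (t : ℕ) where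
  private
   d : ℕ -> ℕ
   d r = hd (dT r (suc t))
   z : Bool
   z = zbT (suc t)
   lt : stT (suc t)< suc Q1
   lt = stT< (suc t)
   d<3 : ∀ r -> d r < 3
   d<3 r = hd< (dT r (suc t))
  next< : nextT (suc t)< N
  next< = enc< {z = z}{d = d} lt d<3
  hor-suc : hor (suc t)(nextT (suc t)) !
  hor-suc = hor+ {suc t}{nextT (suc t)}(\())(\())(sym (st-enc {z = z}{d = d} lt d<3))(sym (zb-enc {z = z}{d = d} lt d<3))
   \r r< -> subst (\x -> horD (dT r (suc t)) x !)(sym (d-enc {z = z}{d = d} lt d<3 r r<))(horD-hd (dT r (suc t)))
  hd-suc : dT 0 (nextT (suc t))~ d 0
  hd-suc = d-enc {z = z}{d = d} lt d<3 0 (sl zl)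
 nextT< : ∀ t -> nextT t < N
 nextT< zero = sl zl
 nextT< (suc t) = next< t
 hor-next : ∀ t -> hor t (nextT t) !
 hor-next zero = refl
 hor-next (suc t) = hor-suc t
 nextT#start : ∀ t -> nextT t # start
 nextT#start (suc t) e = contra (dT 0 (suc t))(sym (hd-suc t)& cong (dT 0) e & dA 0 0 0 (sl zl))
  where
  contra : ∀ x -> hd x # 1
  contra zero ()
  contra (suc x)()
 start-only : ∀ a b -> tAt a b ~ start -> a ~ 0 × b ~ 0
 start-only a b e = go b (sym (stA a b)& cong stT e & stA 0 0) e
  where
  go : ∀ b -> st b ~ 0 -> tAt a b ~ start -> a ~ 0 × b ~ 0
  go (suc b) h e = efq (nxt#0 _ _ h)
  go zero h e = cmp1 a (sym (dA a 0 0 (sl zl))& cong (dT 0) e & dA 0 0 0 (sl zl)), refl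
   where
   cmp1 : ∀ a -> cmp a 0 ~ 1 -> a ~ 0
   cmp1 zero h = refl
 module Planes (never : ∀ j -> st j # reject) where
  honest : Tiles.Plane tiles start
  honest = record { cell = tAt; cell0 = refl; cell< = tileAt<; cellH = honest-hor; cellV = honest-ver; cellR = r }
   where
   r : ∀ a b b' -> tAt a b ~ start -> b < b' -> bad (tAt a b')~ false
   r a b b' e lt with start-only a b e
   ... | refl , refl = honest-bad b' (never b')
  plain : ∀ t -> t < N -> t # start -> Tiles.Plane tiles t
  plain t0 t< ne = record { cell = cell; cell0 = refl; cell< = c<; cellH = cH; cellV = cV; cellR = cR }
   where
   cell : ℕ -> ℕ -> ℕ
   cell zero zero = t0
   cell (suc a) zero = nextT (cell a zero)
   cell a (suc b) = 0
   c< : ∀ a b -> cell a b < N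
   c< zero zero = t<
   c< (suc a) zero = nextT< _
   c< zero (suc b) = sl zl
   c< (suc a)(suc b) = sl zl
   cH : ∀ a b -> hor (cell a b)(cell (suc a) b) !
   cH zero zero = hor-next t0
   cH (suc a) zero = hor-next (cell (suc a) zero)
   cH zero (suc b) = refl
   cH (suc a)(suc b) = refl
   cV : ∀ a b -> ver (cell a b)(cell a (suc b)) !
   cV zero b = refl
   cV (suc a) b = refl
   cR : ∀ a b b' -> cell a b ~ start -> b < b' -> bad (cell a b')~ false
   cR zero zero b' e lt = efq (ne e)
   cR (suc a) zero b' e lt = efq (nextT#start (cell a zero) e)
   cR zero (suc b) b' () lt
   cR (suc a)(suc b) b' () lt
  plane : ∀ t -> t < N -> Tiles.Plane tiles t
  plane t t< with t ℕ.≟ start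
  ... | yes refl = honest
  ... | no ne = plain t t< ne

-- Programs as numbers: the digits of C in base b + 1 are the program of the machine, which starts by loading b and C.
module Program (b C : ℕ) where
 fld : ℕ -> ℕ -> ℕ
 fld k p = dig b (p * 4 + k) C
 fld< : ∀ k p -> fld k p < suc b
 fld< k p = dig< b (p * 4 + k) C
 B : ℕ
 B = 3 + (b + C)
 target : ℕ -> ℕ -> Bool -> ℕ
 target op p z = if op == 0 then 1 else (if op == 4 then 2 else (if (op == 2) && z then B + fld 3 p else B + fld 2 p))
 change : ℕ -> Bool -> ℕ
 change op z = if op == 1 then 1 else (if (op == 2) && not z then 2 else 0)
 prog : Machine
 prog = record
  { Q1 = B + b
  ; R = suc b
  ; test = \q -> if q << B then 0 else fld 1 (q ∸ B)
  ; nxt = \q z -> if q == 0 then 3 else (if q << 3 then q else (if q << B then suc q else target (fld 0 (q ∸ B))(q ∸ B) z))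
  ; dlt = \q z r -> if r == suc b then (if q == 2 then 0 else 1) else (if q << 3 then 0 else (if q << B
   then (if q << 3 + b then b2n (r == 0) else b2n (r == 1))
   else (if r == fld 1 (q ∸ B) then change (fld 0 (q ∸ B)) z else 0)))
  ; reject = 1 }
 open Machine prog
 <B : ∀ {k}-> k ≤ b -> B + k < suc Q1
 <B h = sl (+-monoʳ-≤ B h)
 target-ok : ∀ op p z -> target op p z < suc Q1 × target op p z # 0
 target-ok op p z with op == 0 | op == 4 | (op == 2) && z
 ... | true | _ | _ = sl (sl zl), \()
 ... | false | true | _ = sl (sl (sl zl)), \()
 ... | false | false | true = <B (≤-pred (fld< 3 p)), \()
 ... | false | false | false = <B (≤-pred (fld< 2 p)), \()
 change-dec : ∀ op z d -> change op z ~ suc (suc d)-> z ~ false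
 change-dec op z d h with op == 1 | op == 2
 change-dec op false d h | false | true = refl
 change-dec op true d () | false | true
 change-dec op z d () | false | false
 change-dec op z d () | true | _
 sound : Machine.Sound prog
 sound = record { nxt< = \q z -> fst (nxs q z); nxt#0 = \q z -> snd (nxs q z); test≤ = ts; dec-ok = dc }
  where
  nxs : ∀ q z -> nxt q z < suc Q1 × nxt q z # 0
  nxs 0 z = sl (sl (sl (sl zl))), \()
  nxs 1 z = sl (sl zl), \()
  nxs 2 z = sl (sl (sl zl)), \()
  nxs (suc (suc (suc q))) z with suc (suc (suc q)) << B in e
  ... | true = sl (≤-trans (<<- e)(m≤m+n B b)), \()
  ... | false = target-ok (fld 0 (suc (suc (suc q)) ∸ B))(suc (suc (suc q)) ∸ B) z
  ts : ∀ q -> test q < suc R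
  ts q with q << B
  ... | true = sl zl
  ... | false = m<n⇒m<1+n (fld< 1 (q ∸ B))
  b2n-d : ∀ x {d}-> b2n x # suc (suc d)
  b2n-d true ()
  b2n-d false ()
  dc : ∀ q z r d -> dlt q z r ~ suc (suc d)-> z ~ false × r ~ test q
  dc q z r d h with r == suc b | q == 2 | q << 3 | q << B | q << 3 + b | r == fld 1 (q ∸ B) in e
  ... | true | true | _ | _ | _ | _ = case h of \()
  ... | true | false | _ | _ | _ | _ = case h of \()
  ... | false | _ | true | _ | _ | _ = case h of \()
  ... | false | _ | false | true | true | _ = efq (b2n-d (r == 0) h)
  ... | false | _ | false | true | false | _ = efq (b2n-d (r == 1) h)
  ... | false | _ | false | false | _ | true = change-dec (fld 0 (q ∸ B)) z d h , ==- e
  ... | false | _ | false | false | _ | false = case h of \()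
 open Tiling prog sound using (st; val; zb) public
 <<-no : ∀ a c ->(a + c << a)~ false
 <<-no zero c = refl
 <<-no (suc a) c = <<-no a c
 stay : ∀ q ->(q ~ 1 ⊎ q ~ 2)-> ∀ j k -> st j ~ q -> st (k + j)~ q
 stay q h j zero e = e
 stay .1 (inl refl) j (suc k) e rewrite stay 1 (inl refl) j k e = refl
 stay .2 (inr refl) j (suc k) e rewrite stay 2 (inr refl) j k e = refl
 clock : (∀ j -> st j # 2)-> ∀ j -> val j R ~ j
 clock h zero = refl
 clock h (suc j) rewrite ==+ {b}{b} refl with st j == 2 in e
 ... | true = efq (h j (==- e))
 ... | false = cong suc (clock h j)
 -- the register values stay below the number of steps
 val≤ : ∀ j r -> val j r ≤ j
 val≤ zero r = zl
 val≤ (suc j) r = tick≤ (dlt (st j)(zb j) r)(val≤ j r)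
  where
  tick≤ : ∀ δ {v}-> v ≤ j -> tick δ v ≤ suc j
  tick≤ 0 h = m≤n⇒m≤1+n h
  tick≤ 1 h = sl h
  tick≤ (suc (suc δ)) h = m≤n⇒m≤1+n (≤-trans pred[n]≤n h)
 still : ∀ j -> st j ~ 2 -> ∀ r -> val (suc j) r ~ val j r
 still j e r rewrite e with r == suc b
 ... | true = refl
 ... | false = refl
 At : ℕ -> ℕ ->(ℕ -> ℕ)-> Set
 At j p ρ = st j ~ B + p × (∀ r -> r ≤ b -> val j r ~ ρ r)
 private
  #ᵇ : ∀ {r}-> r ≤ b ->(r == suc b)~ false
  #ᵇ {r} h with r == suc b in e
  ... | false = refl
  ... | true = efq (<-irrefl (==- {r} e)(sl h))
 at-next : ∀ {j p ρ}-> At j p ρ -> fld 1 p ≤ b -> st (suc j)~ target (fld 0 p) p (ρ (fld 1 p) == 0)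
 at-next {j}{p}{ρ}(e , v) le rewrite e | <<-no B p | m+n∸m≡n B p | v (fld 1 p) le = refl
 at-val : ∀ {j p ρ}-> At j p ρ -> fld 1 p ≤ b -> ∀ r -> r ≤ b ->
  val (suc j) r ~ tick (if r == fld 1 p then change (fld 0 p)(ρ (fld 1 p) == 0) else 0)(ρ r)
 at-val {j}{p}{ρ}(e , v) le r r≤ rewrite e | #ᵇ r≤ | <<-no B p | m+n∸m≡n B p | v (fld 1 p) le | v r r≤ = refl
 loaded : ℕ -> ℕ -> ℕ -> ℕ
 loaded x y 0 = x
 loaded x y 1 = y
 loaded x y (suc (suc _)) = 0
 private
  <<-no' : ∀ {a c}-> c ≤ a ->(a << c)~ false
  <<-no' {a}{c} h with a << c in e
  ... | false = refl
  ... | true = efq (ℕ.<⇒≱ (<<- {a} e) h)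
 step-load : ∀ j k -> st j ~ 3 + k -> k < b + C -> st (suc j)~ 4 + k ×
  (∀ r -> r ≤ b -> val (suc j) r ~ tick (if k << b then b2n (r == 0) else b2n (r == 1))(val j r))
 step-load j k e lt = s , w'
  where
  s : st (suc j)~ 4 + k
  s rewrite e | <<+ lt = refl
  w' : ∀ r -> r ≤ b -> val (suc j) r ~ tick (if k << b then b2n (r == 0) else b2n (r == 1))(val j r)
  w' r r≤ rewrite e | #ᵇ r≤ | <<+ lt = refl
 load-b : ∀ k -> k ≤ b -> st (suc k)~ 3 + k × (∀ r -> r ≤ b -> val (suc k) r ~ loaded k 0 r)
 load-b zero h = refl , \ { 0 r≤ -> refl; 1 r≤ -> lem 1 r≤; (suc (suc r)) r≤ -> lem (suc (suc r)) r≤ }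
  where
  lem : ∀ r -> r ≤ b -> val 1 r ~ 0
  lem r r≤ rewrite #ᵇ r≤ = refl
 load-b (suc k) h = let e , v = load-b k (<⇒≤ h); e' , v' = step-load (suc k) k e (≤-trans h (m≤m+n b C)) in
  e' , \r r≤ -> trans (v' r r≤)(cong2 (\x y -> tick (if x then b2n (r == 0) else b2n (r == 1)) y)(<<+ h)(v r r≤)& go r)
  where
  go : ∀ r -> tick (b2n (r == 0))(loaded k 0 r)~ loaded (suc k) 0 r
  go 0 = refl
  go 1 = refl
  go (suc (suc r)) = refl
 load-C : ∀ k -> k ≤ C -> st (suc (k + b))~ 3 + (k + b)× (∀ r -> r ≤ b -> val (suc (k + b)) r ~ loaded b k r)
 load-C zero h = load-b b ≤-refl
 load-C (suc k) h = let e , v = load-C k (<⇒≤ h)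
                        e' , v' = step-load (suc (k + b))(k + b) e (subst (_≤ b + C)(+-comm b (suc k))(+-monoʳ-≤ b h)) in
  e' , \r r≤ -> trans (v' r r≤)(cong2 (\x y -> tick (if x then b2n (r == 0) else b2n (r == 1)) y)(<<-no' {k + b}{b}(m≤n+m b k))(v r r≤)& go r)
  where
  go : ∀ r -> tick (b2n (r == 1))(loaded b k r)~ loaded b (suc k) r
  go 0 = refl
  go 1 = refl
  go (suc (suc r)) = refl
 load : At (suc (C + b)) 0 (loaded b C)
 load with load-C C ≤-refl
 ... | e , v = trans e (cong (\x -> 3 + x)(+-comm C b)& sym (+-identityʳ B)), v

-- Primitive recursive functions of environments.
Env' : ℕ -> Set
Env' zero = Unit
Env' (suc n) = Env' n × ℕ

natrec : ℕ ->(ℕ -> ℕ -> ℕ)-> ℕ -> ℕ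
natrec z s zero = z
natrec z s (suc n) = s n (natrec z s n)

data Prim : (n : ℕ)->(Env' n -> ℕ)-> Set where
 p-zero : ∀ {n}-> Prim n (\_ -> 0)
 p-suc : ∀ {n f}-> Prim n f -> Prim n (\γ -> suc (f γ))
 p-top : ∀ {n}-> Prim (suc n) snd
 wk : ∀ {n f}-> Prim n f -> Prim (suc n)(\γ -> f (fst γ))
 p-drop : ∀ {n f}-> Prim (suc n) f -> Prim (2 + n)(\γ -> f (fst (fst γ), snd γ))
 p-let : ∀ {n f g}-> Prim (suc n) f -> Prim n g -> Prim n (\γ -> f (γ , g γ))
 p-rec : ∀ {n f g h}-> Prim n f -> Prim (2 + n) g -> Prim n h -> Prim n (\γ -> natrec (f γ)(\i a -> g ((γ , i), a))(h γ))
 p-ext : ∀ {n f g}->(∀ γ -> f γ ~ g γ)-> Prim n f -> Prim n g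

-- Structured programs: a loop decrements its register before each round.
data Cmd : Set where
 skip : Cmd
 incr : ℕ -> Cmd
 _⨟_ : Cmd -> Cmd -> Cmd
 loop : ℕ -> Cmd -> Cmd
infixr 5 _⨟_

data Instr : Set where
 inc' : ℕ -> ℕ -> Instr
 djz : ℕ -> ℕ -> ℕ -> Instr
 jmp : ℕ -> Instr
 acc rej : Instr

len : Cmd -> ℕ
len skip = 0
len (incr r) = 1
len (c ⨟ d) = len c + len d
len (loop r c) = suc (len c + 1)

gen : Cmd -> ℕ -> List Instr
gen skip a = []
gen (incr r) a = inc' r (suc a) ∷ []
gen (c ⨟ d) a = gen c a ++ gen d (a + len c)
gen (loop r c) a = djz r (suc a)(suc a + (len c + 1)) ∷ (gen c (suc a) ++ jmp a ∷ [])

Regs : Set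
Regs = ℕ -> ℕ

upd' : Regs -> ℕ -> ℕ -> Regs
upd' ρ r x s = if s == r then x else ρ s

upd'-at : ∀ ρ r x -> upd' ρ r x r ~ x
upd'-at ρ r x rewrite ==+ {r}{r} refl = refl

upd'-off : ∀ ρ r x s -> s # r -> upd' ρ r x s ~ ρ s
upd'-off ρ r x s n with s == r in e
... | true = efq (n (==- e))
... | false = refl

Holds : (ℕ -> Instr)-> ℕ -> List Instr -> Set
Holds code a [] = Unit
Holds code a (x ∷ xs) = code a ~ x × Holds code (suc a) xs

length-gen : ∀ c a -> List.length (gen c a)~ len c
length-gen skip a = refl
length-gen (incr r) a = refl
length-gen (c ⨟ d) a = List.length-++ (gen c a)& cong2 _+_ (length-gen c a)(length-gen d _)
length-gen (loop r c) a = cong suc (List.length-++ (gen c (suc a))& cong (\x -> x + 1)(length-gen c (suc a)))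

holds-split : ∀ {code} xs {a ys}-> Holds code a (xs ++ ys)-> Holds code a xs × Holds code (a + List.length xs) ys
holds-split {code} [] {a}{ys} h = tt , subst (\x -> Holds code x ys)(sym (+-identityʳ a)) h
holds-split {code}(x ∷ xs){a}{ys}(e , h) = let p , q = holds-split xs h in (e , p), subst (\z -> Holds code z ys)(sym (+-suc a (List.length xs))) q

-- runs of a program, with the number of steps
data Run (code : ℕ -> Instr) : ℕ -> ℕ -> Regs -> ℕ -> Regs -> Set where
 done : ∀ {p ρ}-> Run code 0 p ρ p ρ
 r-inc : ∀ {k p ρ r t p' ρ'}-> code p ~ inc' r t -> Run code k t (upd' ρ r (suc (ρ r))) p' ρ' -> Run code (suc k) p ρ p' ρ'
 r-zer : ∀ {k p ρ r t z p' ρ'}-> code p ~ djz r t z -> ρ r ~ 0 -> Run code k z ρ p' ρ' -> Run code (suc k) p ρ p' ρ'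
 r-dec : ∀ {k p ρ r t z x p' ρ'}-> code p ~ djz r t z -> ρ r ~ suc x -> Run code k t (upd' ρ r x) p' ρ' -> Run code (suc k) p ρ p' ρ'
 r-jmp : ∀ {k p ρ t p' ρ'}-> code p ~ jmp t -> Run code k t ρ p' ρ' -> Run code (suc k) p ρ p' ρ'

_▷_ : ∀ {code k l p ρ p' ρ' p'' ρ''}-> Run code k p ρ p' ρ' -> Run code l p' ρ' p'' ρ'' -> Run code (k + l) p ρ p'' ρ''
done ▷ s = s
r-inc e r ▷ s = r-inc e (r ▷ s)
r-zer e z r ▷ s = r-zer e z (r ▷ s)
r-dec e z r ▷ s = r-dec e z (r ▷ s)
r-jmp e r ▷ s = r-jmp e (r ▷ s)

record Exec (c : Cmd)(ρ ρ' : Regs) : Set where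
 constructor execute
 field at : ∀ code a -> Holds code a (gen c a)-> ∃[ k ] Run code k a ρ (a + len c) ρ'

exec-skip : ∀ {ρ}-> Exec skip ρ ρ
exec-skip {ρ} .Exec.at code a h = 0 , subst (\x -> Run code 0 a ρ x ρ)(sym (+-identityʳ a)) done

exec-inc : ∀ {ρ r}-> Exec (incr r) ρ (upd' ρ r (suc (ρ r)))
exec-inc {ρ}{r} .Exec.at code a (e , _) = 1 , r-inc e (subst (\x -> Run code 0 (suc a) ρ1 x ρ1)(+-comm 1 a) done)
 where ρ1 = upd' ρ r (suc (ρ r))

infixr 5 _⨟e_
_⨟e_ : ∀ {c d ρ ρ' ρ''}-> Exec c ρ ρ' -> Exec d ρ' ρ'' -> Exec (c ⨟ d) ρ ρ''
_⨟e_ {c}{d}{ρ}{ρ'' = ρ''} x y .Exec.at code a h with holds-split (gen c a) h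
... | p , q with Exec.at x code a p | Exec.at y code (a + len c)(subst (\l -> Holds code (a + l)(gen d (a + len c)))(length-gen c a) q)
... | k , r | l , s = k + l , subst (\z -> Run code (k + l) a ρ z ρ'')(+-assoc a (len c)(len d))(r ▷ s)

exec-loop : ∀ {r c}(I : ℕ -> Regs -> Set)->
 (∀ k ρ -> I (suc k) ρ -> ρ r ~ suc k -> ∃[ ρ' ] (Exec c (upd' ρ r k) ρ' × ρ' r ~ k × I k ρ'))->
 ∀ n ρ -> I n ρ -> ρ r ~ n -> ∃[ ρ' ] (Exec (loop r c) ρ ρ' × ρ' r ~ 0 × I 0 ρ')
exec-loop {r}{c} I body zero ρ i e = ρ , execute (\code a h -> 1 , r-zer (fst h) e (subst (\x -> Run code 0 (suc a + (len c + 1)) ρ x ρ)(sym (+-suc a (len c + 1))) done)), e , i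
exec-loop {r}{c} I body (suc n) ρ i e with body n ρ i e
... | ρ1 , x , e1 , i1 with exec-loop {r}{c} I body n ρ1 i1 e1
... | ρ2 , y , e2 , i2 = ρ2 , run , e2 , i2
 where
 run : Exec (loop r c) ρ ρ2
 run .Exec.at code a h@(e0 , h1) with holds-split (gen c (suc a)) h1
 ... | p , q with Exec.at x code (suc a) p | Exec.at y code a h
 ... | k , s | l , t = _ , r-dec e0 e (s ▷ r-jmp (fst (subst (\z -> Holds code (suc a + z)(jmp a ∷ []))(length-gen c (suc a)) q)) t)

-- adding a register to others, and emptying it
record Moved (ρ : Regs)(r : ℕ)(c : Cmd)(P : ℕ -> Set) : Set where
 field
  fin : Regs
  exec : Exec (loop r c) ρ fin
  zero' : fin r ~ 0
  plus : ∀ s -> P s -> s # r -> fin s ~ ρ s + ρ r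
  same : ∀ s -> ¬ P s -> s # r -> fin s ~ ρ s

move1 : ∀ ρ r ww -> ww # r -> Moved ρ r (incr ww)(_~ ww)
move1 ρ r ww ne with exec-loop {r}{incr ww}(\k σ -> σ ww + k ~ ρ ww + ρ r × (∀ s -> s # ww -> s # r -> σ s ~ ρ s))
 (\k σ (i , f) e -> _ , exec-inc {upd' σ r k}, trans (upd'-off (upd' σ r k) ww _ r (ne ∘ sym))(upd'-at σ r k) ,
  (trans (cong (\x -> x + k)(upd'-at (upd' σ r k) ww (suc (upd' σ r k ww))))(cong (\x -> suc (x + k))(upd'-off σ r k ww ne)& sym (+-suc (σ ww) k)& i) ,
   \s a b -> trans (upd'-off (upd' σ r k) ww _ s a)(upd'-off σ r k s b & f s a b)))
 (ρ r) ρ (refl , \s _ _ -> refl) refl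
... | ρ' , x , z , i , f = record { fin = ρ'; exec = x; zero' = z; plus = \ { s refl _ -> trans (sym (+-identityʳ _)) i }; same = \s n m -> f s n m }

move2 : ∀ ρ r ww o' -> ww # r -> o' # r -> ww # o' -> Moved ρ r (incr ww ⨟ incr o')(\s -> s ~ ww ⊎ s ~ o')
move2 ρ r ww o' n n' m = record { fin = fst L; exec = fst (snd L); zero' = fst (snd (snd L))
 ; plus = \ { s (inl refl) _ -> trans (sym (+-identityʳ _))(fst (fst i0)); s (inr refl) _ -> trans (sym (+-identityʳ _))(snd (fst i0)) }
 ; same = \s q w' -> snd i0 s (q ∘ inl)(q ∘ inr) w' }
 where
 Inv : ℕ -> Regs -> Set
 Inv k σ = (σ ww + k ~ ρ ww + ρ r × σ o' + k ~ ρ o' + ρ r)× (∀ s -> s # ww -> s # o' -> s # r -> σ s ~ ρ s)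
 body : ∀ k σ -> Inv (suc k) σ -> σ r ~ suc k ->
  ∃[ σ' ] (Exec (incr ww ⨟ incr o')(upd' σ r k) σ' × σ' r ~ k × Inv k σ')
 body k σ ((i , j), f) e = σ2 , exec-inc {σ0} ⨟e exec-inc {σ1}, trans (off' r (n' ∘ sym))(off r (n ∘ sym)& upd'-at σ r k) ,
  ((trans (cong (\x -> x + k)(off' ww m & upd'-at σ0 ww _))(cong (\x -> suc (x + k))(upd'-off σ r k ww n)& sym (+-suc (σ ww) k)& i) ,
   trans (cong (\x -> x + k)(upd'-at σ1 o' _))(cong (\x -> suc (x + k))(off o' (m ∘ sym)& upd'-off σ r k o' n')& sym (+-suc (σ o') k)& j)) ,
   \s a b c -> trans (off' s b)(off s a & upd'-off σ r k s c & f s a b c))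
  where
  σ0 = upd' σ r k
  σ1 = upd' σ0 ww (suc (σ0 ww))
  σ2 = upd' σ1 o' (suc (σ1 o'))
  off = upd'-off σ0 ww (suc (σ0 ww))
  off' = upd'-off σ1 o' (suc (σ1 o'))
 L = exec-loop {r}{incr ww ⨟ incr o'} Inv body (ρ r) ρ ((refl , refl), \s _ _ _ -> refl) refl
 i0 = snd (snd (snd L))

clear : ∀ ρ r -> ∃[ ρ' ] (Exec (loop r skip) ρ ρ' × ρ' r ~ 0 × (∀ s -> s # r -> ρ' s ~ ρ s))
clear ρ r = exec-loop {r}{skip}(\k σ -> ∀ s -> s # r -> σ s ~ ρ s)(\k σ i e -> upd' σ r k , exec-skip , upd'-at σ r k , \s n -> trans (upd'-off σ r k s n)(i s n))(ρ r) ρ (\s _ -> refl) refl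

-- The register of out gains the value, the other registers are kept; registers from base on are free.
Adds : Cmd -> Regs -> ℕ -> ℕ -> Set
Adds c ρ out x = ∃[ ρ' ] (Exec c ρ ρ' × ρ' out ~ ρ out + x × (∀ s -> s # out -> ρ' s ~ ρ s))

Reads : ∀ {n}-> Vec ℕ n -> ℕ -> ℕ -> Regs -> Env' n -> Set
Reads [] out base ρ γ = Unit
Reads (r ∷ v) out base ρ (γ , x) = (ρ r ~ x × r # out × r < base)× Reads v out base ρ γ

reads-mono : ∀ {n}(v : Vec ℕ n){out base out' base' ρ ρ' γ}->(∀ s -> s < base -> s # out -> s # out' × s < base' × ρ' s ~ ρ s)-> Reads v out base ρ γ -> Reads v out' base' ρ' γ
reads-mono [] h _ = tt
reads-mono (r ∷ v) h ((e , n , l), rs) = let a , b , c = h r l n in (trans c e , a , b), reads-mono v h rs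

Compiled : ∀ {n}->(Env' n -> ℕ)-> Set
Compiled {n} f = (v : Vec ℕ n)(out base : ℕ)-> Σ[ c ∈ Cmd ] (∀ ρ γ -> Reads v out base ρ γ -> out < base ->(∀ s -> base ≤ s -> ρ s ~ 0)-> Adds c ρ out (f γ))

compile : ∀ {n f}-> Prim n f -> Compiled f
compile p-zero v out base = skip , \ρ γ rs o< z -> ρ , exec-skip , sym (+-identityʳ _), \_ _ -> refl
compile (p-suc p) v out base with compile p v out base
... | c , h = (c ⨟ incr out), \ρ γ rs o< z -> let ρ' , x , e , f = h ρ γ rs o< z in
 _ , (x ⨟e exec-inc {ρ'}), trans (upd'-at ρ' out _)(cong suc e & sym (+-suc (ρ out) _)), \s n -> trans (upd'-off ρ' out _ s n)(f s n)
compile p-top (r ∷ v) out base = (loop r (incr out ⨟ incr base) ⨟ loop base (incr r)), \ { ρ (γ , x)((e , n , l), _) o< z ->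
 let module A = Moved (move2 ρ r out base (n ∘ sym)(\q -> <-irrefl (sym q) l)(\q -> <-irrefl q o<))
     module B = Moved (move1 A.fin base r (\q -> <-irrefl q l))
     bv : A.fin base ~ ρ r
     bv = trans (A.plus base (inr refl)(\q -> <-irrefl (sym q) l))(cong (\ww -> ww + ρ r)(z base ≤-refl))
 in B.fin , (A.exec ⨟e B.exec) ,
  trans (B.same out (n ∘ sym)(\q -> <-irrefl q o<))(A.plus out (inl refl)(n ∘ sym)& cong (\ww -> ρ out + ww) e) ,
  \s so -> keep ρ r out base A.fin B.fin (z base ≤-refl) A.zero' bv A.same B.zero' B.plus B.same (\q -> <-irrefl q l) s so }
 where
 keep : ∀ ρ r out base ρ1 ρ2 -> ρ base ~ 0 -> ρ1 r ~ 0 -> ρ1 base ~ ρ r ->(∀ s -> ¬ (s ~ out ⊎ s ~ base)-> s # r -> ρ1 s ~ ρ s)-> ρ2 base ~ 0 ->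
  (∀ s -> s ~ r -> s # base -> ρ2 s ~ ρ1 s + ρ1 base)->(∀ s -> s # r -> s # base -> ρ2 s ~ ρ1 s)-> r # base -> ∀ s -> s # out -> ρ2 s ~ ρ s
 keep ρ r out base ρ1 ρ2 z zr br same1 zb pl same2 rb s so with s ℕ.≟ base
 ... | yes refl = zb & sym z
 ... | no sb with s ℕ.≟ r
 ... | yes refl = pl s refl sb & cong2 _+_ zr br & refl
 ... | no sr = same2 s sr sb & (same1 s [ so , sb ]′ sr)
compile (wk p)(r ∷ v) out base with compile p v out base
... | c , h = c , \ρ γ rs o< z -> h ρ (fst γ)(snd rs) o< z
compile (p-drop p)(r ∷ r' ∷ v) out base with compile p (r ∷ v) out base
... | c , h = c , \ρ γ rs o< z -> h ρ _ (fst rs , snd (snd rs)) o< z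
compile (p-let p q) v out base with compile q v base (suc base) | compile p (base ∷ v) out (suc base)
... | c , h | d , g = (c ⨟ d ⨟ loop base skip), \ρ γ rs o< z ->
 let ρ1 , x1 , e1 , f1 = h ρ γ (reads-mono v (\s l n ->(\e -> <-irrefl e l), m<n⇒m<1+n l , refl) rs) ≤-refl (\s l -> z s (<⇒≤ l))
     ρ2 , x2 , e2 , f2 = g ρ1 (γ , _)((trans e1 (cong (\ww -> ww + _)(z base ≤-refl)), (\e -> <-irrefl (sym e) o<), ≤-refl) ,
      reads-mono v (\s l n -> n , m<n⇒m<1+n l , f1 s (\e -> <-irrefl e l)) rs)(m<n⇒m<1+n o<)
      (\s l -> trans (f1 s (\e -> <-irrefl (sym e) l))(z s (<⇒≤ l)))
     ρ3 , x3 , e3 , f3 = clear ρ2 base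
     o# = \(e : out ~ base)-> <-irrefl e o<
 in ρ3 , (x1 ⨟e x2 ⨟e x3), trans (f3 out o#)(e2 & cong (\ww -> ww + _)(f1 out o#)) ,
  \s so -> fin ρ ρ1 ρ2 ρ3 base out (z base ≤-refl) e3 f3 f2 f1 s so
 where
 fin : ∀ (ρ ρ1 ρ2 ρ3 : Regs) base out -> ρ base ~ 0 -> ρ3 base ~ 0 ->(∀ s -> s # base -> ρ3 s ~ ρ2 s)->(∀ s -> s # out -> ρ2 s ~ ρ1 s)->(∀ s -> s # base -> ρ1 s ~ ρ s)-> ∀ s -> s # out -> ρ3 s ~ ρ s
 fin ρ ρ1 ρ2 ρ3 base out z z3 f3 f2 f1 s so with s ℕ.≟ base
 ... | yes refl = z3 & sym z
 ... | no n = f3 s n & f2 s so & f1 s n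
compile (p-ext e p) v out base with compile p v out base
... | c , h = c , \ρ γ rs o< z -> let ρ' , x , q , f = h ρ γ rs o< z in ρ' , x , trans q (cong (\ww -> ρ out + ww)(e γ)), f
compile (p-rec {f = f}{g}{k} p q s) v out base = cmd , ok
 where
 -- scratch registers: the counter, the accumulator, its next value, the remaining rounds
 ic ac tc nc fr : ℕ
 ic = base
 ac = 1 + base
 tc = 2 + base
 nc = 3 + base
 fr = 4 + base
 cp = compile p v ac fr
 cs = compile s v nc fr
 cq = compile q (ac ∷ ic ∷ v) tc fr
 body cmd : Cmd
 body = fst cq ⨟ loop ac skip ⨟ loop tc (incr ac) ⨟ incr ic
 cmd = fst cp ⨟ fst cs ⨟ loop nc body ⨟ loop ac (incr out) ⨟ loop ic skip
 b# : ∀ j {s}-> s < base -> s # j + base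
 b# j l refl = ℕ.<⇒≱ l (m≤n+m base j)
 low : ∀ {s}-> s < base -> s < fr
 low l = ≤-trans l (m≤n+m base 4)
 +# : ∀ i j -> i # j -> i + base # j + base
 +# i j n e = n (+-cancelʳ-≡ base i j e)
 ≥# : ∀ i {s}-> i < 4 -> fr ≤ s -> s # i + base
 ≥# i i< l refl = ℕ.<⇒≱ (+-monoˡ-< base i<) l
 ok : ∀ ρ γ -> Reads v out base ρ γ -> out < base ->(∀ s -> base ≤ s -> ρ s ~ 0)-> Adds cmd ρ out (natrec (f γ)(\i a -> g ((γ , i), a))(k γ))
 ok ρ γ rs o< z = finish
  where
  val : ℕ -> ℕ
  val = natrec (f γ)(\i a -> g ((γ , i), a))
  n : ℕ
  n = k γ
  z' : ∀ j -> ρ (j + base)~ 0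
  z' j = z _ (m≤n+m base j)
  -- before the round with m rounds remaining
  Inv : ℕ -> Regs -> Set
  Inv m σ = (∃[ i ] (i + m ~ n × σ ic ~ i × σ ac ~ val i))× σ tc ~ 0 × (∀ s -> s < base -> σ s ~ ρ s)× (∀ s -> fr ≤ s -> σ s ~ 0)
  rd : ∀ {σ} ww ->(∀ s -> s < base -> σ s ~ ρ s)-> Reads v (ww + base) fr σ γ
  rd ww h = reads-mono v (\s l _ -> b# ww l , low l , h s l) rs
  round : ∀ m σ -> Inv (suc m) σ -> σ nc ~ suc m -> ∃[ σ' ] (Exec body (upd' σ nc m) σ' × σ' nc ~ m × Inv m σ')
  round m σ ((i , im , ei , ea), et , lo , hi) en = σ4 , (x1 ⨟e x2 ⨟e M.exec ⨟e exec-inc {M.fin}) ,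
   trans (u nc (+# 3 0 \()))(M.same nc (+# 3 1 \())(+# 3 2 \())& f2 nc (+# 3 1 \())& f1 nc (+# 3 2 \())& upd'-at σ nc m) ,
   (suc i , trans (sym (+-suc i m)) im , trans (upd'-at M.fin ic _)(cong suc (M.same ic (+# 0 1 \())(+# 0 2 \())& f2 ic (+# 0 1 \())& f1 ic (+# 0 2 \())& o0 ic (+# 0 3 \())& ei)) ,
    trans (u ac (+# 1 0 \()))(M.plus ac refl (+# 1 2 \())& cong2 _+_ e2 (f2 tc (+# 2 1 \())& e1 & cong (\ww -> ww + _)(o0 tc (+# 2 3 \())& et))& refl)) ,
   trans (u tc (+# 2 0 \())) M.zero' ,
   (\s l -> trans (u s (b# 0 l))(M.same s (b# 1 l)(b# 2 l)& f2 s (b# 1 l)& f1 s (b# 2 l)& o0 s (b# 3 l)& lo s l)) ,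
   (\s l -> trans (u s (≥# 0 (sl zl) l))(M.same s (≥# 1 (sl (sl zl)) l)(≥# 2 (sl (sl (sl zl))) l)& f2 s (≥# 1 (sl (sl zl)) l)& f1 s (≥# 2 (sl (sl (sl zl))) l)& o0 s (≥# 3 ≤-refl l)& hi s l))
   where
   σ0 = upd' σ nc m
   o0 : ∀ s -> s # nc -> σ0 s ~ σ s
   o0 = upd'-off σ nc m
   A = snd cq σ0 ((γ , i), val i)((trans (o0 ac (+# 1 3 \())) ea , +# 1 2 (\()), +-monoˡ-< base (sl (sl zl))), (trans (o0 ic (+# 0 3 \())) ei , +# 0 2 (\()), +-monoˡ-< base (sl zl)) ,
    rd 2 (\s l -> trans (o0 s (b# 3 l))(lo s l)))(+-monoˡ-< base (sl (sl (sl zl))))(\s l -> trans (o0 s (≥# 3 ≤-refl l))(hi s l))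
   σ1 = fst A
   x1 = fst (snd A)
   e1 = fst (snd (snd A))
   f1 = snd (snd (snd A))
   C = clear σ1 ac
   σ2 = fst C
   x2 = fst (snd C)
   e2 = fst (snd (snd C))
   f2 = snd (snd (snd C))
   module M = Moved (move1 σ2 tc ac (+# 1 2 \()))
   σ4 = upd' M.fin ic (suc (M.fin ic))
   u : ∀ s -> s # ic -> σ4 s ~ M.fin s
   u = upd'-off M.fin ic _
  finish : Adds cmd ρ out (val n)
  finish = fst L4 , (fst (snd L1) ⨟e fst (snd L2) ⨟e fst (snd L3) ⨟e M.exec ⨟e fst (snd L4)) ,
   trans (f4 out (b# 0 o<))(M.plus out refl (b# 1 o<)& cong2 _+_ (lo out o<)(acv i3)), frame
   where
   L1 = snd cp ρ γ (rd 1 (\s _ -> refl))(+-monoˡ-< base (sl (sl zl)))(\s l -> z s (≤-trans (m≤n+m base 4) l))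
   ρ1 = fst L1
   f1 = snd (snd (snd L1))
   L2 = snd cs ρ1 γ (rd 3 (\s l -> f1 s (b# 1 l)))(+-monoˡ-< base ≤-refl)(\s l -> trans (f1 s (≥# 1 (sl (sl zl)) l))(z s (≤-trans (m≤n+m base 4) l)))
   ρ2 = fst L2
   f2 = snd (snd (snd L2))
   inv0 : Inv n ρ2
   inv0 = (0 , refl , trans (f2 ic (+# 0 3 \()))(f1 ic (+# 0 1 \())& z' 0) ,
    trans (f2 ac (+# 1 3 \()))(fst (snd (snd L1))& cong (\ww -> ww + f γ)(z' 1))) ,
    trans (f2 tc (+# 2 3 \()))(f1 tc (+# 2 1 \())& z' 2), (\s l -> trans (f2 s (b# 3 l))(f1 s (b# 1 l))) ,
    (\s l -> trans (f2 s (≥# 3 ≤-refl l))(f1 s (≥# 1 (sl (sl zl)) l)& z s (≤-trans (m≤n+m base 4) l)))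
   L3 = exec-loop {nc}{body} Inv round n ρ2 inv0 (fst (snd (snd L2))& cong (\ww -> ww + n)(f1 nc (+# 3 1 \())& z' 3))
   ρ3 = fst L3
   i3 = fst (snd (snd (snd L3)))
   t3 = fst (snd (snd (snd (snd L3))))
   lo = fst (snd (snd (snd (snd (snd L3)))))
   hi = snd (snd (snd (snd (snd (snd L3)))))
   acv : ∃[ i ] (i + 0 ~ n × ρ3 ic ~ i × ρ3 ac ~ val i)-> ρ3 ac ~ val n
   acv (i , e , _ , h) = h & cong val (sym (+-identityʳ i)& e)
   module M = Moved (move1 ρ3 ac out (b# 1 o<))
   L4 = clear M.fin ic
   f4 = snd (snd (snd L4))
   frame : ∀ s -> s # out -> fst L4 s ~ ρ s
   frame s so =
    at? s ic (\ { refl -> trans (fst (snd (snd L4)))(sym (z' 0)) }) \a ->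
    at? s ac (\ { refl -> trans (f4 s a)(M.zero' & sym (z' 1)) }) \b ->
    at? s tc (\ { refl -> trans (f4 s a)(M.same s so b & t3 & sym (z' 2)) }) \c ->
    at? s nc (\ { refl -> trans (f4 s a)(M.same s so b & fst (snd (snd L3))& sym (z' 3)) }) \d ->
    trans (f4 s a)(M.same s so b & ([ lo s , (\l -> trans (hi s (above (above (above (above l a) b) c) d))(sym (z s l))) ]′ (<-≤-connex s base)))
    where
    at? : ∀ s x {P : Set}->(s ~ x -> P)->(s # x -> P)-> P
    at? s x y n with s ℕ.≟ x
    ... | yes e = y e
    ... | no e = n e
    above : ∀ {x}-> x ≤ s -> s # x -> suc x ≤ s
    above l n = ℕ.≤∧≢⇒< l (n ∘ sym)

-- Every primitive recursive search is performed by a machine that gets its own number as input.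
digit : Instr -> ℕ -> ℕ
digit (inc' r t) 0 = 1
digit (inc' r t) 1 = r
digit (inc' r t) 2 = t
digit (djz r t z) 0 = 2
digit (djz r t z) 1 = r
digit (djz r t z) 2 = t
digit (djz r t z) 3 = z
digit (jmp t) 0 = 3
digit (jmp t) 2 = t
digit acc 0 = 4
digit _ _ = 0

fetch : List Instr -> ℕ -> Instr
fetch [] p = rej
fetch (x ∷ xs) zero = x
fetch (x ∷ xs)(suc p) = fetch xs p

fetch< : ∀ xs p -> fetch xs p # rej -> p < List.length xs
fetch< [] p n = efq (n refl)
fetch< (x ∷ xs) zero n = sl zl
fetch< (x ∷ xs)(suc p) n = sl (fetch< xs p n)

size' : Instr -> ℕ
size' x = (digit x 0 + digit x 1)+ (digit x 2 + digit x 3)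

weight : List Instr -> ℕ
weight [] = 4
weight (x ∷ xs) = size' x + suc (weight xs)

digit≤ : ∀ x k -> digit x k ≤ size' x
digit≤ x 0 = ≤-trans (m≤m+n _ _)(m≤m+n _ _)
digit≤ x 1 = ≤-trans (m≤n+m _ (digit x 0))(m≤m+n _ _)
digit≤ x 2 = ≤-trans (m≤m+n _ _)(m≤n+m _ (digit x 0 + digit x 1))
digit≤ x 3 = ≤-trans (m≤n+m _ (digit x 2))(m≤n+m _ (digit x 0 + digit x 1))
digit≤ (inc' r t)(suc (suc (suc (suc k)))) = zl
digit≤ (djz r t z)(suc (suc (suc (suc k)))) = zl
digit≤ (jmp t)(suc (suc (suc (suc k)))) = zl
digit≤ acc (suc (suc (suc (suc k)))) = zl
digit≤ rej (suc (suc (suc (suc k)))) = zl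

weight-len : ∀ xs -> List.length xs ≤ weight xs
weight-len [] = zl
weight-len (x ∷ xs) = ≤-trans (sl (weight-len xs))(m≤n+m _ (size' x))

weight-digit : ∀ xs p k -> digit (fetch xs p) k ≤ weight xs
weight-digit [] p k = ≤-trans (digit≤ rej k) zl
weight-digit (x ∷ xs) zero k = ≤-trans (digit≤ x k)(m≤m+n _ _)
weight-digit (x ∷ xs)(suc p) k = ≤-trans (weight-digit xs p k)(≤-trans (n≤1+n _)(m≤n+m _ (size' x)))

holds-fetch : ∀ zs xs {a}-> a ~ List.length zs -> Holds (fetch (zs ++ xs)) a xs
holds-fetch zs [] e = tt
holds-fetch zs (x ∷ xs) refl = head zs , subst₂ (\l a -> Holds (fetch l) a xs)(List.++-assoc zs (x ∷ []) xs)
 (List.length-++ zs & +-comm _ 1)(holds-fetch (zs ++ x ∷ []) xs refl)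
 where
 head : ∀ zs -> fetch (zs ++ x ∷ xs)(List.length zs)~ x
 head [] = refl
 head (z ∷ zs) = head zs

module Encoded (xs : List Instr) where
 b C : ℕ
 b = weight xs
 C = fd b (suc b * 4)(\j -> digit (fetch xs (j / 4))(j % 4))
 open Program b C public
 fld-digit : ∀ k p -> k < 4 -> p ≤ b -> fld k p ~ digit (fetch xs p) k
 fld-digit k p k< p≤ = trans (dig-fd b (suc b * 4) _ (p * 4 + k)(\j -> sl (weight-digit xs (j / 4)(j % 4))) lt)
  (cong2 (\u g -> digit (fetch xs u) g)(cong (_/ 4)(+-comm (p * 4) k)& div-dm 3 k p k<)(cong (_% 4)(+-comm (p * 4) k)& mod-dm 3 k p k<))
  where
  lt : p * 4 + k < suc b * 4
  lt = <-≤-trans (+-monoʳ-< (p * 4) k<)(≤-trans (≤-reflexive (+-comm (p * 4) 4))(*-monoˡ-≤ 4 (sl p≤)))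
 code : ℕ -> Instr
 code = fetch xs
 module _ {j p ρ}(at : At j p ρ)(p≤ : p ≤ b){x : Instr}(e : code p ~ x) where
  private
   f : ∀ k -> k < 4 -> fld k p ~ digit x k
   f k k< = fld-digit k p k< p≤ & cong (\y -> digit y k) e
   f0 = f 0 (sl zl)
   f1 = f 1 (sl (sl zl))
   f2 = f 2 (sl (sl (sl zl)))
   f3 = f 3 ≤-refl
  next-st : st (suc j)~ (if digit x 0 == 0 then 1 else (if digit x 0 == 4 then 2 else (if (digit x 0 == 2) && (ρ (digit x 1) == 0) then B + digit x 3 else B + digit x 2)))
  next-st = trans (at-next {j}{p}{ρ} at (≤-pred (fld< 1 p))) eq'
   where
   eq' : target (fld 0 p) p (ρ (fld 1 p) == 0)~ _
   eq' rewrite f0 | f1 | f2 | f3 = refl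
  next-val : ∀ r -> r ≤ b -> val (suc j) r ~ tick (if r == digit x 1 then change (digit x 0)(ρ (digit x 1) == 0) else 0)(ρ r)
  next-val r r≤ = at-val {j}{p}{ρ} at (≤-pred (fld< 1 p)) r r≤ & cong2 (\u g -> tick (if r == u then change g (ρ u == 0) else 0)(ρ r)) f1 f0
 code≤ : ∀ {p x}-> code p ~ x -> x # rej -> p ≤ b
 code≤ {p} e n = ≤-trans (<⇒≤ (fetch< xs p (\q -> n (sym e & q))))(weight-len xs)
 private
  upd-tick : ∀ (ρ : Regs) r δ y s -> tick δ (ρ r)~ y -> tick (if s == r then δ else 0)(ρ s)~ upd' ρ r y s
  upd-tick ρ r δ y s h with s == r in e
  ... | true = cong (\z -> tick δ (ρ z))(==- {s}{r} e)& h
  ... | false = refl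
 simulate : ∀ {k p ρ p' ρ'}-> Run code k p ρ p' ρ' -> ∀ j -> At j p ρ -> At (k + j) p' ρ'
 simulate done j at = at
 simulate {suc k}{p}{ρ}{p'}{ρ'}(r-inc {r = r} e run) j at = subst (\i -> At i p' ρ')(+-suc k j)(simulate run (suc j)
  (next-st {j}{p}{ρ} at (code≤ e \()) e , \s s≤ -> trans (next-val {j}{p}{ρ} at (code≤ e \()) e s s≤)(upd-tick ρ r 1 _ s refl)))
 simulate {suc k}{p}{ρ}{p'}{ρ'}(r-zer {r = r}{z = z} e q run) j at = subst (\i -> At i p' ρ')(+-suc k j)(simulate run (suc j)
  (trans (next-st {j}{p}{ρ} at (code≤ e \()) e)(cong (\y -> if y == 0 then B + z else B + _) q) ,
   \s s≤ -> trans (next-val {j}{p}{ρ} at (code≤ e \()) e s s≤)(cong (\y -> tick (if s == r then change 2 (y == 0) else 0)(ρ s)) q & same s)))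
  where
  same : ∀ s -> tick (if s == r then 0 else 0)(ρ s)~ ρ s
  same s with s == r
  ... | true = refl
  ... | false = refl
 simulate {suc k}{p}{ρ}{p'}{ρ'}(r-dec {r = r}{t = t}{x = x} e q run) j at = subst (\i -> At i p' ρ')(+-suc k j)(simulate run (suc j)
  (trans (next-st {j}{p}{ρ} at (code≤ e \()) e)(cong (\y -> if y == 0 then B + _ else B + t) q) ,
   \s s≤ -> trans (next-val {j}{p}{ρ} at (code≤ e \()) e s s≤)(cong (\y -> tick (if s == r then change 2 (y == 0) else 0)(ρ s)) q & upd-tick ρ r 2 x s (cong ℕ.pred q))))
 simulate {suc k}{p}{ρ}{p'}{ρ'}(r-jmp e run) j at = subst (\i -> At i p' ρ')(+-suc k j)(simulate run (suc j)
  (next-st {j}{p}{ρ} at (code≤ e \()) e , \s s≤ -> trans (next-val {j}{p}{ρ} at (code≤ e \()) e s s≤)(same s)))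
  where
  same : ∀ s -> tick (if s == 0 then 0 else 0)(ρ s)~ ρ s
  same zero = refl
  same (suc s) = refl

module Search (d : ℕ -> ℕ -> ℕ -> ℕ)(pd : Prim 3 (\ { (((_ , b), C), s)-> d b C s })) where
 private
  comp' = compile pd (2 ∷ 1 ∷ 0 ∷ []) 3 4
  cd = fst comp'
  L = len cd
  tail : List Instr
  tail = djz 3 (L + 1)(L + 4) ∷ djz 3 (L + 2)(L + 3) ∷ acc ∷ rej ∷ inc' 2 0 ∷ []
 open Encoded (gen cd 0 ++ tail) public
 private
  tail-at : Holds code L tail
  tail-at = holds-fetch (gen cd 0) tail (sym (length-gen cd 0))
  c0 : code L ~ djz 3 (L + 1)(L + 4)
  c0 = fst tail-at
  c1 : code (L + 1)~ djz 3 (L + 2)(L + 3)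
  c1 = subst (\x -> code x ~ djz 3 (L + 2)(L + 3))(+-comm 1 L)(fst (snd tail-at))
  c2 : code (L + 2)~ acc
  c2 = subst (\x -> code x ~ acc)(+-comm 2 L)(fst (snd (snd tail-at)))
  c3 : code (L + 3)~ rej
  c3 = subst (\x -> code x ~ rej)(+-comm 3 L)(fst (snd (snd (snd tail-at))))
  c4 : code (L + 4)~ inc' 2 0
  c4 = subst (\x -> code x ~ inc' 2 0)(+-comm 4 L)(fst (snd (snd (snd (snd tail-at)))))
  prefix-at : ∀ xs {a} ys zs -> a ~ List.length zs -> Holds (fetch (zs ++ (xs ++ ys))) a xs
  prefix-at [] ys zs e = tt
  prefix-at (x ∷ xs) ys zs e = let h , t = holds-fetch zs (x ∷ xs ++ ys) e in h ,
   subst₂ (\l a -> Holds (fetch l) a xs)(List.++-assoc zs (x ∷ [])(xs ++ ys))(List.length-++ zs & +-comm _ 1 & cong suc (sym e))(prefix-at xs ys (zs ++ x ∷ []) refl)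
  record Head (s : ℕ)(ρ : Regs) : Set where
   field
    h0 : ρ 0 ~ b
    h1 : ρ 1 ~ C
    h2 : ρ 2 ~ s
    h3 : ∀ r -> 3 ≤ r -> ρ r ~ 0
  evaluate : ∀ {s ρ}-> Head s ρ -> ∃[ k ] ∃[ ρ' ] (Run code k 0 ρ L ρ' × ρ' 3 ~ d b C s × (∀ r -> r # 3 -> ρ' r ~ ρ r))
  evaluate {s}{ρ} h = let ρ' , x , e , f = snd comp' ρ (((tt , b), C), s)
                           ((h2 , (\()), sl (sl (sl zl))), (h1 , (\()), sl (sl zl)), (h0 , (\()), sl zl), tt) ≤-refl (\r l -> h3 r (<⇒≤ l))
                          k , run = Exec.at x code 0 (prefix-at (gen cd 0) tail [] refl)
   in k , ρ' , run , trans e (cong (\g -> g + d b C s)(h3 3 ≤-refl)), f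
   where open Head h
  heads : ∀ s ->(∀ s' -> s' < s -> d b C s' ~ 0)-> ∃[ j ] ∃[ ρ ] (s ≤ j × At j 0 ρ × Head s ρ)
  heads zero h = suc (C + b), loaded b C , zl , load , record { h0 = refl; h1 = refl; h2 = refl; h3 = \ { (suc (suc (suc r))) _ -> refl; 0 (); 1 (sl ()); 2 (sl (sl ())) } }
  heads (suc s) h with heads s (\s' l -> h s' (m<n⇒m<1+n l))
  ... | j , ρ , le , at , hd with evaluate hd
  ... | k , ρ' , run , e , f = (k + 2)+ j , upd' ρ' 2 (suc (ρ' 2)), ≤-trans (sl le)(+-monoˡ-≤ j {1}{k + 2}(≤-trans (sl zl)(m≤n+m 2 k))) ,
   simulate (run ▷ r-zer c0 (e & h s ≤-refl)(r-inc c4 done)) j at ,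
   record { h0 = (f 0 \())& h0; h1 = (f 1 \())& h1; h2 = cong suc ((f 2 \())& h2)
    ; h3 = \ { 3 _ -> trans e (h s ≤-refl); (suc (suc (suc (suc r)))) _ -> trans (f _ \())(h3 _ (sl (sl (sl zl)))); 0 (); 1 (sl ()); 2 (sl (sl ())) } }
   where open Head hd
 diverges : (∀ s -> d b C s ~ 0)-> ∀ j q -> q ~ 1 ⊎ q ~ 2 -> st j # q
 diverges h j0 q two e with heads j0 (\s _ -> h s)
 ... | j , ρ , le , at , _ = away two (sym (stay q two j0 (j ∸ j0) e)& cong st (m∸n+n≡m le)& fst at)
  where
  away : ∀ {q}-> q ~ 1 ⊎ q ~ 2 -> q # B + 0
  away (inl refl)()
  away (inr refl)()
 rejects : ∀ s ->(∀ s' -> s' < s -> d b C s' ~ 0)-> d b C s ~ 1 -> ∃[ j ] st (suc j)~ 1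
 rejects s h d≡ with heads s h
 ... | j , ρ , le , at , hd with evaluate hd
 ... | k , ρ' , run , e , f = let at' = simulate (run ▷ r-dec c0 (e & d≡)(r-zer c1 refl done)) j at in
  (k + 2)+ j , next-st {(k + 2)+ j}{L + 3}{upd' ρ' 3 0} at' (≤-trans (≤-trans (<⇒≤ (+-monoʳ-< L (sl (sl (sl (sl zl))))))(<⇒≤ (fetch< (gen cd 0 ++ tail)(L + 4)(\q -> case trans (sym c4) q of \()))))(weight-len (gen cd 0 ++ tail))) c3
 accepts : ∀ s x ->(∀ s' -> s' < s -> d b C s' ~ 0)-> d b C s ~ suc (suc x)-> ∃[ j ] st j ~ 2
 accepts s x h d≡ with heads s h
 ... | j , ρ , le , at , hd with evaluate hd
 ... | k , ρ' , run , e , f = let at' = simulate (run ▷ r-dec c0 (e & d≡)(r-dec c1 refl done)) j at in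
  suc ((k + 2)+ j), next-st {(k + 2)+ j}{L + 2}{upd' (upd' ρ' 3 (suc x)) 3 x} at' (code≤ c2 \()) c2

-- the program with the digits of C in base b + 1, started with b and C, searches for a positive value of d
record Searches (d : ℕ -> ℕ -> ℕ -> ℕ)(b C : ℕ) : Set where
 open Program b C
 field
  diverges : (∀ s -> d b C s ~ 0)-> ∀ j q -> q ~ 1 ⊎ q ~ 2 -> st j # q
  rejects : ∀ s ->(∀ s' -> s' < s -> d b C s' ~ 0)-> d b C s ~ 1 -> ∃[ j ] st (suc j)~ 1
  accepts : ∀ s x ->(∀ s' -> s' < s -> d b C s' ~ 0)-> d b C s ~ suc (suc x)-> ∃[ j ] st j ~ 2

abstract
 searcher : ∀ d -> Prim 3 (\ { (((_ , b), C), s)-> d b C s })-> ∃[ b ] ∃[ C ] Searches d b C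
 searcher d pd = S.b , S.C , record { diverges = S.diverges; rejects = S.rejects; accepts = S.accepts }
  where module S = Search d pd

-- Primitive recursive arithmetic.
record PB (n : ℕ)(p : Env' n -> Bool) : Set where
 constructor asB
 field nat : Prim n (\γ -> b2n (p γ))
open PB public

infixl 7 _p/_ _p%_
infixr 3 _p⇛_

pk : ∀ {n}(c : ℕ)-> Prim n (\_ -> c)
pk zero = p-zero
pk (suc c) = p-suc (pk c)

x0 : ∀ {n}-> Prim (1 + n) snd
x0 = p-top
x1 : ∀ {n}-> Prim (2 + n)(\γ -> snd (fst γ))
x1 = wk p-top

module _ {n : ℕ}{f g : Env' n -> ℕ} where
 infixl 6 _p+_ _p∸_
 _p+_ : Prim n f -> Prim n g -> Prim n (\γ -> f γ + g γ)
 p p+ q = p-ext (\γ -> e (f γ)(g γ))(p-rec q (p-suc x0) p)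
  where
  e : ∀ x y -> natrec y (\_ a -> suc a) x ~ x + y
  e zero y = refl
  e (suc x) y = cong suc (e x y)
 _p∸_ : Prim n f -> Prim n g -> Prim n (\γ -> f γ ∸ g γ)
 p p∸ q = p-ext (\γ -> e (f γ)(g γ))(p-rec p (p-ext pr (p-rec p-zero x1 x0)) q)
  where
  pr : ∀ γ -> natrec 0 (\i _ -> i)(snd γ)~ ℕ.pred (snd γ)
  pr (γ , zero) = refl
  pr (γ , suc x) = refl
  e : ∀ x y -> natrec x (\_ a -> ℕ.pred a) y ~ x ∸ y
  e x zero = refl
  e x (suc y) = cong ℕ.pred (e x y)& pred[m∸n]≡m∸[1+n] x y & refl

module _ {n : ℕ}{f g : Env' n -> ℕ} where
 infixl 7 _p*_
 _p*_ : Prim n f -> Prim n g -> Prim n (\γ -> f γ * g γ)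
 p p* q = p-ext (\γ -> e (f γ)(g γ))(p-rec p-zero (wk (wk q) p+ x0) p)
  where
  e : ∀ x y -> natrec 0 (\_ a -> y + a) x ~ x * y
  e zero y = refl
  e (suc x) y = cong (\z -> y + z)(e x y)
 p-if : ∀ {c}-> PB n c -> Prim n f -> Prim n g -> Prim n (\γ -> if c γ then f γ else g γ)
 p-if {c} r p q = p-ext (\γ -> e (c γ)(f γ)(g γ))(p-rec q (wk (wk p))(nat r))
  where
  e : ∀ c x y -> natrec y (\_ _ -> x)(b2n c)~ (if c then x else y)
  e true x y = refl
  e false x y = refl

p-pow : ∀ {n f g}-> Prim n f -> Prim n g -> Prim n (\γ -> f γ ^ g γ)
p-pow {n}{f}{g} p q = p-ext (\γ -> e (f γ)(g γ))(p-rec (pk 1)(wk (wk p) p* x0) q)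
 where
 e : ∀ x y -> natrec 1 (\_ a -> x * a) y ~ x ^ y
 e x zero = refl
 e x (suc y) = cong (\z -> x * z)(e x y)

p-wkB : ∀ {n c}-> PB n c -> PB (suc n)(\γ -> c (fst γ))
p-wkB p .nat = wk (nat p)

p-zero? : ∀ {n f}-> Prim n f -> PB n (\γ -> f γ == 0)
p-zero? {n}{f} p .nat = p-ext (\γ -> e (f γ))(p-rec (pk 1) p-zero p)
 where
 e : ∀ x -> natrec 1 (\_ _ -> 0) x ~ b2n (x == 0)
 e zero = refl
 e (suc x) = refl

p-not : ∀ {n c}-> PB n c -> PB n (\γ -> not (c γ))
p-not {c = c} p .nat = p-ext (\γ -> e (c γ))(nat (p-zero? (nat p)))
 where
 e : ∀ x -> b2n (b2n x == 0)~ b2n (not x)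
 e true = refl
 e false = refl

p-ifB : ∀ {n c d e}-> PB n c -> PB n d -> PB n e -> PB n (\γ -> if c γ then d γ else e γ)
p-ifB {c = c}{d}{e} p q r .nat = p-ext (\γ -> h (c γ)(d γ)(e γ))(p-if p (nat q)(nat r))
 where
 h : ∀ c d e ->(if c then b2n d else b2n e)~ b2n (if c then d else e)
 h true d e = refl
 h false d e = refl

module _ {n : ℕ}{c d : Env' n -> Bool} where
 infixr 5 _p&&_ _p||_
 _p&&_ : PB n c -> PB n d -> PB n (\γ -> c γ && d γ)
 (p p&& q) .nat = p-ext (\γ -> h (c γ)(d γ))(nat p p* nat q)
  where
  h : ∀ c d -> b2n c * b2n d ~ b2n (c && d)
  h true d = +-identityʳ _
  h false d = refl
 _p||_ : PB n c -> PB n d -> PB n (\γ -> c γ || d γ)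
 (p p|| q) .nat = p-ext (\γ -> h (c γ)(d γ))(p-if p (pk 1)(nat q))
  where
  h : ∀ c d ->(if c then 1 else b2n d)~ b2n (c || d)
  h true d = refl
  h false d = refl

_p⇛_ : ∀ {n c d}-> PB n c -> PB n d -> PB n (\γ -> c γ ⇛ d γ)
p p⇛ q = p-not p p|| q

module _ {n : ℕ}{f g : Env' n -> ℕ} where
 infix 4 _p==_ _p<<_
 _p==_ : Prim n f -> Prim n g -> PB n (\γ -> f γ == g γ)
 (p p== q) .nat = p-ext (\γ -> cong b2n (h (f γ)(g γ)))(nat (p-zero? ((p p∸ q) p+ (q p∸ p))))
  where
  h : ∀ x y ->((x ∸ y)+ (y ∸ x) == 0)~ (x == y)
  h zero zero = refl
  h zero (suc y) = refl
  h (suc x) zero = refl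
  h (suc x)(suc y) = h x y
 _p<<_ : Prim n f -> Prim n g -> PB n (\γ -> f γ << g γ)
 (p p<< q) .nat = p-ext (\γ -> cong b2n (h (f γ)(g γ)))(nat (p-not (p-zero? (q p∸ p))))
  where
  h : ∀ x y -> not (y ∸ x == 0)~ (x << y)
  h zero zero = refl
  h zero (suc y) = refl
  h (suc x) zero = refl
  h (suc x)(suc y) = h x y

module _ (b : ℕ) where
 private
  step : ∀ x ->(suc x % suc b ~ (if x % suc b == b then 0 else suc (x % suc b)))× (suc x / suc b ~ b2n (x % suc b == b)+ x / suc b)
  step x with x % suc b == b in e
  ... | true = trans (cong (_% suc b) eq')(mod-dm b 0 (suc (x / suc b))(sl zl)), trans (cong (_/ suc b) eq')(div-dm b 0 (suc (x / suc b))(sl zl))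
   where
   eq' : suc x ~ 0 + suc (x / suc b) * suc b
   eq' = cong suc (m≡m%n+[m/n]*n x (suc b))& cong (\z -> suc z + x / suc b * suc b)(==- e)
  ... | false = trans (cong (_% suc b) eq')(mod-dm b (suc (x % suc b))(x / suc b) lt), trans (cong (_/ suc b) eq')(div-dm b (suc (x % suc b))(x / suc b) lt)
   where
   eq' : suc x ~ suc (x % suc b)+ x / suc b * suc b
   eq' = cong suc (m≡m%n+[m/n]*n x (suc b))
   lt : suc (x % suc b)< suc b
   lt = ℕ.≤∧≢⇒< (m%n<n x (suc b))(\q -> case trans (sym e)(==+ (ℕ.suc-injective q)) of \())
 mod-rec : ∀ x -> natrec 0 (\_ a -> if a == b then 0 else suc a) x ~ x % suc b
 mod-rec zero = refl
 mod-rec (suc x) = cong (\a -> if a == b then 0 else suc a)(mod-rec x)& sym (fst (step x))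
 div-rec : ∀ x -> natrec 0 (\i a -> b2n (i % suc b == b)+ a) x ~ x / suc b
 div-rec zero = refl
 div-rec (suc x) = cong (\a -> b2n (x % suc b == b)+ a)(div-rec x)& sym (snd (step x))

_p%_ : ∀ {n f b}-> Prim n f -> Prim n b -> Prim n (\γ -> f γ % suc (b γ))
_p%_ {f = f}{b} p q = p-ext (\γ -> mod-rec (b γ)(f γ))(p-rec p-zero (p-if (x0 p== wk (wk q))(pk 0)(p-suc x0)) p)

_p/_ : ∀ {n f b}-> Prim n f -> Prim n b -> Prim n (\γ -> f γ / suc (b γ))
_p/_ {f = f}{b} p q = p-ext (\γ -> div-rec (b γ)(f γ))(p-rec p-zero (nat ((x1 p% wk (wk q)) p== wk (wk q)) p+ x0) p)

p-dig : ∀ {n b j x}-> Prim n b -> Prim n j -> Prim n x -> Prim n (\γ -> dig (b γ)(j γ)(x γ))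
p-dig {b = b}{j}{x} p q r = p-ext (\γ -> e (b γ)(j γ)(x γ))(p-rec r (x0 p/ wk (wk p)) q) p% p
 where
 e : ∀ b j x -> natrec x (\_ a -> a / suc b) j ~ shr b j x
 e b zero x = refl
 e b (suc j) x = cong (_/ suc b)(e b j x)

p-any : ∀ {n N}{Q : Env' n -> ℕ -> Bool}-> Prim n N -> PB (suc n)(\γ -> Q (fst γ)(snd γ))-> PB n (\γ -> anyN (N γ)(Q γ))
p-any {N = N}{Q} p q .nat = p-ext (\γ -> e (N γ)(Q γ))(p-rec p-zero (p-if (p-wkB q)(pk 1) x0) p)
 where
 e : ∀ n Q -> natrec 0 (\i a -> if Q i then 1 else a) n ~ b2n (anyN n Q)
 e zero Q = refl
 e (suc n) Q with Q n
 ... | true = refl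
 ... | false = e n Q

p-all : ∀ {n N}{Q : Env' n -> ℕ -> Bool}-> Prim n N -> PB (suc n)(\γ -> Q (fst γ)(snd γ))-> PB n (\γ -> allN (N γ)(Q γ))
p-all p q = p-not (p-any p (p-not q))

p-cnt : ∀ {n N}{Q : Env' n -> ℕ -> Bool}-> Prim n N -> PB (suc n)(\γ -> Q (fst γ)(snd γ))-> Prim n (\γ -> cnt (Q γ)(N γ))
p-cnt {N = N}{Q} p q = p-ext (\γ -> e (N γ)(Q γ))(p-rec p-zero (x0 p+ wk (nat q)) p)
 where
 e : ∀ n Q -> natrec 0 (\i a -> a + b2n (Q i)) n ~ cnt Q n
 e zero Q = refl
 e (suc n) Q = cong (\a -> a + b2n (Q n))(e n Q)

p-find : ∀ {n N}{Q : Env' n -> ℕ -> Bool}-> Prim n N -> PB (suc n)(\γ -> Q (fst γ)(snd γ))-> Prim n (\γ -> findN (Q γ)(N γ))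
p-find {N = N}{Q} p q = p-ext (\γ -> e (N γ)(Q γ))(p-rec p-zero (p-if (p-wkB q) x1 x0) p)
 where
 e : ∀ n Q -> natrec 0 (\i a -> if Q i then i else a) n ~ findN Q n
 e zero Q = refl
 e (suc n) Q with Q n
 ... | true = refl
 ... | false = e n Q

p-fd : ∀ {n b N}{F : Env' n -> ℕ -> ℕ}-> Prim n b -> Prim n N -> Prim (suc n)(\γ -> F (fst γ)(snd γ))-> Prim n (\γ -> fd (b γ)(N γ)(F γ))
p-fd {b = b}{N}{F} p q r = p-ext (\γ -> e (b γ)(N γ)(F γ))(p-rec p-zero (x0 p+ wk r p* p-pow (p-suc (wk (wk p))) x1) q)
 where
 snoc : ∀ b n f -> fd b (suc n) f ~ fd b n f + f n * suc b ^ n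
 snoc b zero f = +-identityʳ _ & sym (*-identityʳ (f 0))
 snoc b (suc n) f = trans (cong (\z -> f 0 + z * suc b)(snoc b n (f ∘ suc)))(solve 5 (\x y z s u -> x :+ (y :+ z :* u) :* s := (x :+ y :* s) :+ z :* (s :* u)) refl (f 0)(fd b n (f ∘ suc))(f (suc n))(suc b)(suc b ^ n))
  where open +-*-Solver
 e : ∀ b n f -> natrec 0 (\i a -> a + f i * suc b ^ i) n ~ fd b n f
 e b zero f = refl
 e b (suc n) f = cong (\a -> a + f n * suc b ^ n)(e b n f)& sym (snoc b n f)

p-bits : ∀ {n N}{Q : Env' n -> ℕ -> Bool}-> Prim n N -> PB (suc n)(\γ -> Q (fst γ)(snd γ))-> Prim n (\γ -> bits (N γ)(Q γ))
p-bits p q = p-fd (pk 1) p (nat q)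

p-bit : ∀ {n x j}-> Prim n x -> Prim n j -> PB n (\γ -> bit (x γ)(j γ))
p-bit p q = p-dig (pk 1) q p p== pk 1

p-pair : ∀ {n f g}-> Prim n f -> Prim n g -> Prim n (\γ -> ⟪ f γ , g γ ⟫)
p-pair {f = f}{g} p q = p-ext (\γ -> e (f γ + g γ))(p-rec p-zero (p-suc x1 p+ x0)(p p+ q)) p+ q
 where
 e : ∀ x -> natrec 0 (\i a -> suc i + a) x ~ triangle x
 e zero = refl
 e (suc x) = cong (\a -> suc x + a)(e x)

listN : ℕ ->(ℕ -> ℕ)-> List ℕ
listN zero f = []
listN (suc n) f = f 0 ∷ listN n (f ∘ suc)

p-list : ∀ {n N}{F : Env' n -> ℕ -> ℕ}-> Prim n N -> Prim (suc n)(\γ -> F (fst γ)(snd γ))-> Prim n (\γ -> codeList (listN (N γ)(F γ)))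
p-list {N = N}{F} p q = p-ext (\γ -> trans (e (N γ)(N γ)(F γ) ≤-refl)(cong codeList (l-cong (N γ)(\k -> cong (F γ)(cong (\i -> k + i)(n∸n≡0 (N γ))& +-identityʳ k)))))
 (p-rec p-zero (p-suc (p-pair (p-let (p-drop (p-drop q))(wk (wk p) p∸ p-suc x1)) x0)) p)
 where
 l-cong : ∀ n {f g}->(∀ k -> f k ~ g k)-> listN n f ~ listN n g
 l-cong zero h = refl
 l-cong (suc n) h = cong2 _∷_ (h 0)(l-cong n (h ∘ suc))
 e : ∀ N n f -> n ≤ N -> natrec 0 (\i a -> suc ⟪ f (N ∸ suc i), a ⟫) n ~ codeList (listN n (\k -> f (k + (N ∸ n))))
 e N zero f h = refl
 e N (suc n) f h = cong (\a -> suc ⟪ f (N ∸ suc n), a ⟫)(e N n f (<⇒≤ h)& cong codeList (l-cong n \k -> cong f (cong (\i -> k + i)(sym (ℕ.suc-pred (N ∸ n){{ℕ.>-nonZero (m<n⇒0<n∸m h)}}))& cong (\i -> k + suc i)(pred[m∸n]≡m∸[1+n] N n)& +-suc k _)))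

-- The table of the algebra of a program is primitive recursive in the program.
p-≡B : ∀ {n c d}-> PB n c -> PB n d -> PB n (\γ -> bool-≡ (c γ)(d γ))
p-≡B p q = nat p p== nat q

module TilesPrim {n : ℕ}{b C : Env' n -> ℕ}(pb : Prim n b)(pC : Prim n C) where
 private
  module T γ = Tiles (Machine.tiles (Program.prog (b γ)(C γ)))
  module Pr γ = Program (b γ)(C γ)
  module Ma γ = Machine (Pr.prog γ)
 p-fld : ∀ k {p}-> Prim n p -> Prim n (\γ -> Pr.fld γ k (p γ))
 p-fld k p = p-dig pb (p p* pk 4 p+ pk k) pC
 pB : Prim n Pr.B
 pB = p-suc (p-suc (p-suc (pb p+ pC)))
 p-test : ∀ {q}-> Prim n q -> Prim n (\γ -> Ma.test γ (q γ))
 p-test {q} p = p-if (p p<< pB)(pk 0)(p-fld 1 (p p∸ pB))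
 p-target : ∀ {oo p z}-> Prim n oo -> Prim n p -> PB n z -> Prim n (\γ -> Pr.target γ (oo γ)(p γ)(z γ))
 p-target po pp' pz' = p-if (po p== pk 0)(pk 1)(p-if (po p== pk 4)(pk 2)
  (p-if ((po p== pk 2) p&& pz')(pB p+ p-fld 3 pp')(pB p+ p-fld 2 pp')))
 p-change : ∀ {oo z}-> Prim n oo -> PB n z -> Prim n (\γ -> Pr.change γ (oo γ)(z γ))
 p-change po pz' = p-if (po p== pk 1)(pk 1)(p-if
  ((po p== pk 2) p&& p-not pz')(pk 2)(pk 0))
 p-nxt : ∀ {q z}-> Prim n q -> PB n z -> Prim n (\γ -> Ma.nxt γ (q γ)(z γ))
 p-nxt {q}{z} p r = p-if (p p== pk 0)(pk 3)(p-if (p p<< pk 3) p (p-if (p p<< pB)(p-suc p)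
  (p-target (p-fld 0 (p p∸ pB))(p p∸ pB) r)))
 p-dlt : ∀ {q z r}-> Prim n q -> PB n z -> Prim n r -> Prim n (\γ -> Ma.dlt γ (q γ)(z γ)(r γ))
 p-dlt {q}{z}{r} p s t = p-if (t p== p-suc pb)(p-if (p p== pk 2)(pk 0)(pk 1))
  (p-if (p p<< pk 3)(pk 0)(p-if (p p<< pB)
   (p-if (p p<< p-suc (p-suc (p-suc pb)))(nat (t p== pk 0))(nat (t p== pk 1)))
   (p-if (t p== p-fld 1 (p p∸ pB))(p-change (p-fld 0 (p p∸ pB)) s)(pk 0))))
 private
  pQ : Prim n Ma.Q1
  pQ = pB p+ pb
  pR : Prim n (\γ -> suc (Ma.R γ))
  pR = p-suc (p-suc pb)
 p-st : ∀ {t}-> Prim n t -> Prim n (\γ -> Ma.stT γ (t γ))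
 p-st p = ((p p∸ pk 1) p/ pk 1) p% pQ
 p-zb : ∀ {t}-> Prim n t -> PB n (\γ -> Ma.zbT γ (t γ))
 p-zb p = ((p p∸ pk 1) p% pk 1) p== pk 1
 p-dT : ∀ {r t}-> Prim n r -> Prim n t -> Prim n (\γ -> Ma.dT γ (r γ)(t γ))
 p-dT p q = p-dig (pk 2) p (((q p∸ pk 1) p/ pk 1) p/ pQ)
 pN : Prim n T.N
 pN = p-suc ((p-pow (pk 3) pR p* p-suc pQ) p* pk 2)
 p-start : Prim n T.start
 p-start = p-suc (pk 1 p+ ((pk 0 p+ (p-fd {F = \_ _ -> 1}(pk 2) pR (pk 1) p* p-suc pQ)) p* pk 2))
 p-bad : ∀ {t}-> Prim n t -> PB n (\γ -> T.bad γ (t γ))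
 p-bad {t} p = (p p== pk 0) p|| (p-st p p== pk 1) p|| p-not (p-≡B (p-zb p)(p-dT (p-test (p-st p)) p p== pk 1))

p-horD : ∀ {n x y}-> Prim n x -> Prim n y -> PB n (\γ -> horD (x γ)(y γ))
p-horD {x = x}{y} p q = p-ifB (p p== pk 0)(q p<< pk 2)(q p== pk 2)

p-verD : ∀ {n δ x y}-> Prim n δ -> Prim n x -> Prim n y -> PB n (\γ -> verD (δ γ)(x γ)(y γ))
p-verD {δ = δ}{x}{y} r p q = p-ifB (r p== pk 0)(p p== q)
 (p-ifB (r p== pk 1)(p-ifB (p p<< pk 2)(q p== pk 0)(pk 0 p<< q))
  (p-ifB (p p== pk 0)(q p<< pk 2)(q p== pk 2)))

tilesOf : ℕ -> ℕ -> Tiles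
tilesOf b C = Machine.tiles (Program.prog b C)

module _ {n : ℕ}{b C t u : Env' n -> ℕ}(pb : Prim n b)(pC : Prim n C)(pt : Prim n t)(pu : Prim n u) where
 private
  open TilesPrim pb pC
  module W = TilesPrim (wk pb)(wk pC)
  pR : Prim n (\γ -> suc (suc (b γ)))
  pR = p-suc (p-suc pb)
 p-hor : PB n (\γ -> Tiles.hor (tilesOf (b γ)(C γ))(t γ)(u γ))
 p-hor = p-ifB (pt p== pk 0)(pu p== pk 0)(p-not (pu p== pk 0) p&& (p-st pt p== p-st pu) p&& p-≡B (p-zb pt)(p-zb pu) p&&
  p-all pR (p-horD (W.p-dT x0 (wk pt))(W.p-dT x0 (wk pu))))
 p-ver : PB n (\γ -> Tiles.ver (tilesOf (b γ)(C γ))(t γ)(u γ))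
 p-ver = (pu p== pk 0) p|| (p-not (pt p== pk 0) p&& (p-st pu p== p-nxt (p-st pt)(p-zb pt)) p&&
  p-all pR (p-verD (W.p-dlt (W.p-st (wk pt))(W.p-zb (wk pt)) x0)(W.p-dT x0 (wk pt))(W.p-dT x0 (wk pu))))

p-cvk : ∀ {n k}-> Prim n k -> Prim n (\γ -> cvk (k γ))
p-cvk p = p-if (p p== pk 1)(pk 2)(p-if (p p== pk 2)(pk 1) p)

p-cvv : ∀ {n k v}-> Prim n k -> Prim n v -> Prim n (\γ -> cvv (k γ)(v γ))
p-cvv p q = p-if (p p== pk 0)(p-if (q p== pk 3)(pk 4)(p-if (q p== pk 4)(pk 3)(p-if (q p== pk 5)(pk 6)(p-if (q p== pk 6)(pk 5) q)))) q

module LabelsPrim (em : EM) where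
 private
  module Nu b C = Numeric (tilesOf b C)
  module Co b C = Codes em (tilesOf b C)
  module Tr b C = Triples em (tilesOf b C)
 module _ {n : ℕ}{b C : Env' n -> ℕ}(pb : Prim n b)(pC : Prim n C) where
  private
   open TilesPrim pb pC using (pN; p-start; p-bad)
   isK : ∀ k' v' {k v}-> Prim n k -> Prim n v -> PB n (\γ ->(k γ == k') && (v γ == v'))
   isK k' v' p q = (p p== pk k') p&& (q p== pk v')
  p-ruN : ∀ {k1 v1 k2 v2 k3 v3}-> Prim n k1 -> Prim n v1 -> Prim n k2 -> Prim n v2 -> Prim n k3 -> Prim n v3 ->
   PB n (\γ -> Nu.ruN (b γ)(C γ)(k1 γ)(v1 γ)(k2 γ)(v2 γ)(k3 γ)(v3 γ))
  p-ruN k1 v1 k2 v2 k3 v3 =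
   (isK 0 3 k2 v2 p&& (isK 0 3 k1 v1 p|| isK 0 5 k1 v1) p⇛ (isK 0 2 k3 v3 p|| isK 0 5 k3 v3)) p&&
   (((isK 0 3 k2 v2 p&& (k1 p== pk 1)) p⇛ (isK 0 2 k3 v3 p|| ((k3 p== pk 1) p&& p-ver pb pC v1 v3))) p&&
   (((isK 0 3 k2 v2 p&& (k1 p== pk 2)) p⇛ (isK 0 2 k3 v3 p|| ((k3 p== pk 2) p&& p-hor pb pC v1 v3))) p&&
    (((isK 0 3 k2 v2 p|| isK 0 5 k2 v2) p&& ((k1 p== pk 1) p&& (k3 p== pk 1))) p⇛ p-not ((v1 p== p-start) p&& p-bad v3))))
  p-memN : ∀ {R k v}-> Prim n R -> Prim n k -> Prim n v -> PB n (\γ -> Co.memN (b γ)(C γ)(R γ)(k γ)(v γ))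
  p-memN R k v = p-ifB ((k p== pk 0) p&& (v p<< pk 3))(p-not (v p== pk 0))
   (p-bit R (p-if (k p== pk 1)(pk 4 p+ pk 2 p* v)(p-if (k p== pk 2)(pk 5 p+ pk 2 p* v)(v p∸ pk 3))))
  p-zokF : ∀ {κ κ' k v}-> Prim n κ -> Prim n κ' -> Prim n k -> Prim n v -> PB n (\γ -> Co.zokF (b γ)(C γ)(κ γ)(κ' γ)(k γ)(v γ))
  p-zokF κ κ' k v =
   (((κ p== pk 0) p&& (κ' p== pk 0)) p⇛ p-not (isK 0 2 k v)) p&&
   (((p-not (κ p== pk 0) p&& (κ' p== pk 0)) p⇛ p-memN (κ p∸ pk 1) k v) p&&
   ((((κ p== pk 0) p&& p-not (κ' p== pk 0)) p⇛ p-memN (κ' p∸ pk 1)(p-cvk k)(p-cvv k v)) p&&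
    (isK 0 0 k v p⇛ (κ p== κ'))))
  private
   p-idF : ∀ {k1 v1 k2 v2 k3 v3}-> Prim n k1 -> Prim n v1 -> Prim n k2 -> Prim n v2 -> Prim n k3 -> Prim n v3 ->
    PB n (\γ -> Co.idF (b γ)(C γ)(k1 γ)(v1 γ)(k2 γ)(v2 γ)(k3 γ)(v3 γ))
   p-idF k1 v1 k2 v2 k3 v3 = isK 0 0 k1 v1 p⇛ ((k2 p== k3) p&& (v2 p== v3))
  p-pokF : ∀ {k1 v1 k2 v2 k3 v3}-> Prim n k1 -> Prim n v1 -> Prim n k2 -> Prim n v2 -> Prim n k3 -> Prim n v3 ->
   PB n (\γ -> Co.pokF (b γ)(C γ)(k1 γ)(v1 γ)(k2 γ)(v2 γ)(k3 γ)(v3 γ))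
  p-pokF k1 v1 k2 v2 k3 v3 =
   p-ruN k1 v1 k2 v2 k3 v3 p&&
   (p-ruN k3 v3 (p-cvk k2)(p-cvv k2 v2) k1 v1 p&&
   (p-ruN (p-cvk k1)(p-cvv k1 v1) k3 v3 k2 v2 p&&
   (p-ruN k2 v2 (p-cvk k3)(p-cvv k3 v3)(p-cvk k1)(p-cvv k1 v1) p&&
   (p-ruN (p-cvk k3)(p-cvv k3 v3) k1 v1 (p-cvk k2)(p-cvv k2 v2) p&&
   (p-ruN (p-cvk k2)(p-cvv k2 v2)(p-cvk k1)(p-cvv k1 v1)(p-cvk k3)(p-cvv k3 v3) p&&
   (p-idF k1 v1 k2 v2 k3 v3 p&& (p-idF k2 v2 k1 v1 k3 v3 p&& p-idF k3 v3 k2 v2 (p-cvk k1)(p-cvv k1 v1))))))))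
  private
   p-eqz : ∀ {x y z : Env' n -> ℕ}-> Prim n x -> Prim n y -> Prim n z -> PB n (\γ ->(x γ == 1) ⇛ (y γ == z γ))
   p-eqz x y z = (x p== pk 1) p⇛ (y p== z)
  p-consF : ∀ {s k1 v1 k2 v2 k3 v3}-> Prim n s -> Prim n k1 -> Prim n v1 -> Prim n k2 -> Prim n v2 -> Prim n k3 -> Prim n v3 ->
   PB n (\γ -> Co.consF (b γ)(C γ)(s γ)(k1 γ)(v1 γ)(k2 γ)(v2 γ)(k3 γ)(v3 γ))
  p-consF s k1 v1 k2 v2 k3 v3 =
   p-ifB (s p== pk 0)(p-pokF k1 v1 k2 v2 k3 v3)
   (p-ifB (s p== pk 28)(p-zokF v3 v2 k1 v1)
   (p-ifB (s p== pk 111)(p-zokF v1 v3 k2 v2)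
   (p-ifB (s p== pk 162)(p-zokF v1 v2 k3 v3)
   (p-ifB (s p== pk 201)(p-eqz v1 v2 v3)
   (p-ifB (s p== pk 137)(p-eqz v3 v1 v2)
   (p-ifB (s p== pk 178)(p-eqz v2 v1 v3)
   (p-ifB (s p== pk 215)(p-eqz v1 v2 v3 p&& (p-eqz v2 v1 v3 p&& p-eqz v3 v1 v2))(asB p-zero))))))))
  private
   pK : Prim n (\γ -> Co.K (b γ)(C γ))
   pK = p-pow (pk 2)(pk 4 p+ pk 2 p* pN)
   p-base : Prim n (\γ -> Tr.base-1 (b γ)(C γ))
   p-base = p-ext (\γ -> sym (Tr.base-1≡ (b γ)(C γ)))(pk 5 p+ pK p* pk 6)
   p-kd : ∀ {l}-> Prim n l -> Prim n (\γ -> l γ % 6)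
   p-kd p = p p% pk 5
   p-vl : ∀ {l}-> Prim n l -> Prim n (\γ -> l γ / 6)
   p-vl p = p p/ pk 5
   p-okLab : ∀ {l}-> Prim n l -> PB n (\γ -> Tr.okLab (b γ)(C γ)(l γ))
   p-okLab p = p-ifB (p-kd p p== pk 0)(p-vl p p<< pk 7)(p-ifB (p-kd p p<< pk 3)(p-vl p p<< pN)
    (p-ifB (p-kd p p<< pk 5)(p-vl p p<< p-suc pK)(p-vl p p<< pk 2)))
   p-cat : ∀ {k}-> Prim n k -> Prim n (\γ -> Co.cat (b γ)(C γ)(k γ))
   p-cat p = p-if (p p<< pk 3)(pk 0) p
   p-ok3 : ∀ {x y z}-> Prim n x -> Prim n y -> Prim n z -> PB n (\γ -> Tr.okTriple (b γ)(C γ)(x γ)(y γ)(z γ))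
   p-ok3 x y z = (p-okLab x p&& (p-okLab y p&& p-okLab z)) p&&
    p-consF (p-cat (p-kd x) p* pk 36 p+ p-cat (p-kd y) p* pk 6 p+ p-cat (p-kd z))(p-kd x)(p-vl x)(p-kd y)(p-vl y)(p-kd z)(p-vl z)
  p-ℓ : ∀ j {c}-> Prim n c -> Prim n (\γ -> dig (Tr.base-1 (b γ)(C γ)) j (c γ))
  p-ℓ j p = p-dig p-base (pk j) p
  p-okAtom : ∀ {c}-> Prim n c -> PB n (\γ -> Tr.okAtom (b γ)(C γ)(c γ))
  p-okAtom p = p-ok3 (p-ℓ 0 p)(p-ℓ 1 p)(p-ℓ 2 p)
  p-bound : Prim n (\γ -> Tr.bound (b γ)(C γ))
  p-bound = p-pow (p-suc p-base)(pk 3)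
  p-edge : ∀ {i c}-> Prim n i -> Prim n c -> Prim n (\γ -> Tr.edge (b γ)(C γ)(i γ)(c γ))
  p-edge p q = p-if (p p== pk 0)(p-ℓ 1 q)(p-if (p p== pk 1)(p-ℓ 2 q)(p-ℓ 0 q))
  private
   p-idLab : ∀ {l}-> Prim n l -> PB n (\γ -> Tr.idLab (b γ)(C γ)(l γ))
   p-idLab p = isK 0 0 (p-kd p)(p-vl p) p|| ((p-kd p p== pk 5) p&& (p-vl p p== pk 1))
  p-onDiag : ∀ {i j c}-> Prim n i -> Prim n j -> Prim n c -> PB n (\γ -> Tr.onDiag (b γ)(C γ)(i γ)(j γ)(c γ))
  p-onDiag p q r = p-ifB (p p== q)(asB (pk 1))(p-idLab (p-if ((p p+ q) p== pk 1)(p-ℓ 0 r)(p-if ((p p+ q) p== pk 2)(p-ℓ 2 r)(p-ℓ 1 r))))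
 module _ {n : ℕ}{b C : Env' n -> ℕ}(pb : Prim n b)(pC : Prim n C) where
  p-total : Prim n (\γ -> Tr.total (b γ)(C γ))
  p-total = p-ext (\γ -> sym (Tr.total≡ (b γ)(C γ)))(p-cnt (p-bound pb pC)(p-okAtom (wk pb)(wk pC) x0))
  p-atomNo : ∀ {j}-> Prim n j -> Prim n (\γ -> Tr.atm (b γ)(C γ)(j γ))
  p-atomNo p = p-ext (\γ -> sym (Tr.atomNo≡ (b γ)(C γ) _))(p-find (p-bound pb pC)(p-okAtom (wk pb)(wk pC) x0 p&& (p-cnt x0 (p-okAtom (wk (wk pb))(wk (wk pC)) x0) p== wk p)))
 module _ {n : ℕ}{b C x y : Env' n -> ℕ}(pb : Prim n b)(pC : Prim n C)(px : Prim n x)(py : Prim n y) where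
  private
   pb' = wk pb
   pC' = wk pC
  p-join : Prim n (\γ -> Tr.joinN (b γ)(C γ)(x γ)(y γ))
  p-join = p-bits (p-total pb pC)(p-bit (wk px) x0 p|| p-bit (wk py) x0)
  p-meet : Prim n (\γ -> Tr.meetN (b γ)(C γ)(x γ)(y γ))
  p-meet = p-bits (p-total pb pC)(p-bit (wk px) x0 p&& p-bit (wk py) x0)
  p-comp : Prim n (\γ -> Tr.compN (b γ)(C γ)(x γ))
  p-comp = p-bits (p-total pb pC)(p-not (p-bit (wk px) x0))
  p-cyl : Prim n (\γ -> Tr.cylN (b γ)(C γ)(x γ)(y γ))
  p-cyl = p-bits (p-total pb pC)(p-any (p-total pb' pC')(p-bit (wk (wk py)) x0 p&&
   (p-edge (wk pb')(wk pC')(wk (wk px))(p-atomNo (wk pb')(wk pC') x1) p== p-edge (wk pb')(wk pC')(wk (wk px))(p-atomNo (wk pb')(wk pC') x0))))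
  p-top' : Prim n (\γ -> Tr.topN (b γ)(C γ))
  p-top' = p-bits (p-total pb pC)(asB (pk 1))
  p-bot : Prim n (\γ -> Tr.botN (b γ)(C γ))
  p-bot = p-bits (p-total pb pC)(asB p-zero)
  p-diag : Prim n (\γ -> Tr.diagN (b γ)(C γ)(x γ)(y γ))
  p-diag = p-bits (p-total pb pC)(p-onDiag pb' pC' (wk px)(wk py)(p-atomNo pb' pC' x0))

-- Codes of tables.
listN-cong : ∀ n {f g}->(∀ k -> k < n -> f k ~ g k)-> listN n f ~ listN n g
listN-cong zero h = refl
listN-cong (suc n) h = cong2 _∷_ (h 0 (sl zl))(listN-cong n (\k k< -> h (suc k)(sl k<)))

listN-++ : ∀ m n f -> listN (m + n) f ~ listN m f ++ listN n (\i -> f (m + i))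
listN-++ zero n f = refl
listN-++ (suc m) n f = cong (f 0 ∷_)(listN-++ m n (f ∘ suc))

row : ∀ {m S}(f : Fin m -> Fin S)(g : ℕ -> ℕ)->(∀ i -> ix (f i)~ g (ix i))-> toList (Vec.map ix (tabulate f))~ listN m g
row {zero} f g h = refl
row {suc m} f g h = cong2 _∷_ (h zero)(row (f ∘ suc)(g ∘ suc)(h ∘ suc))

rows : ∀ m k {S}(f : Fin m -> Fin (suc k)-> Fin S)(g : ℕ -> ℕ -> ℕ)->(∀ i j -> ix (f i j)~ g (ix i)(ix j))->
 toList (Vec.map ix (concat (tabulate \i -> tabulate (f i))))~ listN (m * suc k)(\i -> g (i / suc k)(i % suc k))
rows zero k f g h = refl
rows (suc m) k f g h = trans (cong toList (Vec.map-++ ix (tabulate (f zero)) rest))(Vec.toList-++ (Vec.map ix (tabulate (f zero)))(Vec.map ix rest)& cong2 _++_ first (rows m k (f ∘ suc)(\i -> g (suc i))(\i j -> h (suc i) j)& (listN-cong (m * suc k){\i -> g (suc (i / suc k))(i % suc k)}{\i -> G (suc k + i)} \i _ -> sym (cong2 g (quot i)(remd i))))& sym (listN-++ (suc k)(m * suc k) G))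
 where
 rest = concat (tabulate \i -> tabulate (f (suc i)))
 G : ℕ -> ℕ
 G i = g (i / suc k)(i % suc k)
 first : toList (Vec.map ix (tabulate (f zero)))~ listN (suc k) G
 first = row (f zero)(g 0)(h zero)& (listN-cong (suc k){g 0}{G} \i i< -> cong2 g (sym (m<n⇒m/n≡0 i<))(sym (m<n⇒m%n≡m i<)))
 eq' : ∀ i -> suc k + i ~ i % suc k + suc (i / suc k) * suc k
 eq' i = trans (cong (\x -> suc k + x)(m≡m%n+[m/n]*n i (suc k)))(solve 3 (\a r q -> a :+ (r :+ q) := r :+ (a :+ q)) refl (suc k)(i % suc k)(i / suc k * suc k))
  where open +-*-Solver
 quot : ∀ i ->(suc k + i) / suc k ~ suc (i / suc k)
 quot i = cong (_/ suc k)(eq' i)& div-dm k (i % suc k)(suc (i / suc k))(m%n<n i (suc k))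
 remd : ∀ i ->(suc k + i) % suc k ~ i % suc k
 remd i = cong (_% suc k)(eq' i)& mod-dm k (i % suc k)(suc (i / suc k))(m%n<n i (suc k))

entries : ∀ {h s}-> Vec (Fin s) h -> List ℕ
entries xs = toList (Vec.map ix xs)

abstract
 pack : ℕ -> List ℕ -> List ℕ -> List ℕ -> ℕ -> ℕ -> List ℕ -> List ℕ -> ℕ
 pack s j m c t b y d = codeList (s ∷ codeList j ∷ codeList m ∷ codeList c ∷ t ∷ b ∷ codeList y ∷ codeList d ∷ [])
 pack-def : ∀ s j m c t b y d -> pack s j m c t b y d ~ codeList (s ∷ codeList j ∷ codeList m ∷ codeList c ∷ t ∷ b ∷ codeList y ∷ codeList d ∷ [])
 pack-def s j m c t b y d = refl
 code-pack : ∀ (T : Table 3)-> let open Table T in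
  Table.code T ~ pack size (entries (concat joinT))(entries (concat meetT))(entries complT)(ix topT)(ix botT)(entries (concat cylT))(entries (concat diagT))
 code-pack T = refl

pack-cong : ∀ {s j j' m m' c c' t t' b b' y y' d d'}-> j ~ j' -> m ~ m' -> c ~ c' -> t ~ t' -> b ~ b' -> y ~ y' -> d ~ d' -> pack s j m c t b y d ~ pack s j' m' c' t' b' y' d'
pack-cong refl refl refl refl refl refl refl = refl

module _ (O : Ops) where
 open Ops O
 table-code : Table.code table ~ pack (suc sz)(listN ((suc sz) * (suc sz))(\i -> join (i / (suc sz))(i % (suc sz)) % (suc sz)))(listN ((suc sz) * (suc sz))(\i -> meet (i / (suc sz))(i % (suc sz)) % (suc sz)))
  (listN (suc sz)(\i -> comp' i % (suc sz)))(top % (suc sz))(bot % (suc sz))(listN (3 * (suc sz))(\i -> cyl' (i / (suc sz))(i % (suc sz)) % (suc sz)))(listN 9 (\i -> diag' (i / 3)(i % 3) % (suc sz)))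
 table-code = code-pack table & pack-cong
  (rows (suc sz) sz (\x y -> fin (join (ix x)(ix y)))(\x y -> join x y % (suc sz))(\i j -> toℕ-fin (join (ix i)(ix j))))
  (rows (suc sz) sz (\x y -> fin (meet (ix x)(ix y)))(\x y -> meet x y % (suc sz))(\i j -> toℕ-fin (meet (ix i)(ix j))))
  (row (\x -> fin (comp' (ix x)))(\x -> comp' x % (suc sz))(\i -> toℕ-fin (comp' (ix i))))(toℕ-fin top)(toℕ-fin bot)
  (rows 3 sz (\i x -> fin (cyl' (ix i)(ix x)))(\x y -> cyl' x y % (suc sz))(\i j -> toℕ-fin (cyl' (ix i)(ix j))))
  (rows 3 2 (\i j -> fin (diag' (ix i)(ix j)))(\x y -> diag' x y % (suc sz))(\i j -> toℕ-fin (diag' (ix i)(ix j))))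

-- Copies of a table on permuted elements; a permutation is the number with its values as digits.
conj-ops : Ops -> ℕ -> ℕ -> Ops
conj-ops O p p' = record { sz = sz; join = \x y -> π (join (π- x)(π- y)); meet = \x y -> π (meet (π- x)(π- y)); comp' = \x -> π (comp' (π- x))
 ; top = π top; bot = π bot; cyl' = \i x -> π (cyl' i (π- x)); diag' = \i j -> π (diag' i j) }
 where
 open Ops O
 π π- : ℕ -> ℕ
 π x = dig sz x p
 π- x = dig sz x p'

isPerm : Ops -> ℕ -> ℕ -> Bool
isPerm O p p' = allN (suc sz)(\x ->(dig sz (dig sz x p) p' == x) && (dig sz (dig sz x p') p == x))
 where open Ops O

module _ {n : ℕ}{O : Env' n -> Ops}
 (psz : Prim n (\γ -> Ops.sz (O γ)))(pt : Prim n (\γ -> Ops.top (O γ)))(pbo : Prim n (\γ -> Ops.bot (O γ)))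
 (pj : Prim (suc n)(\γ -> Ops.join (O (fst γ))(snd γ / suc (Ops.sz (O (fst γ))))(snd γ % suc (Ops.sz (O (fst γ))))))
 (pm : Prim (suc n)(\γ -> Ops.meet (O (fst γ))(snd γ / suc (Ops.sz (O (fst γ))))(snd γ % suc (Ops.sz (O (fst γ))))))
 (pc : Prim (suc n)(\γ -> Ops.comp' (O (fst γ))(snd γ)))
 (py : Prim (suc n)(\γ -> Ops.cyl' (O (fst γ))(snd γ / suc (Ops.sz (O (fst γ))))(snd γ % suc (Ops.sz (O (fst γ))))))
 (pd : Prim (suc n)(\γ -> Ops.diag' (O (fst γ))(snd γ / 3)(snd γ % 3))) where
 p-code : Prim n (\γ -> Table.code (Ops.table (O γ)))
 p-code = p-ext (\γ -> sym (table-code (O γ)& pack-def _ _ _ _ _ _ _ _))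
  (p-suc (p-pair (p-suc psz)(p-suc (p-pair (p-list (p-suc psz p* p-suc psz)(pj p% wk psz))(p-suc (p-pair (p-list (p-suc psz p* p-suc psz)(pm p% wk psz))
  (p-suc (p-pair (p-list (p-suc psz)(pc p% wk psz))(p-suc (p-pair (pt p% psz)(p-suc (p-pair (pbo p% psz)
  (p-suc (p-pair (p-list (pk 3 p* p-suc psz)(py p% wk psz))(p-suc (p-pair (p-list (pk 9)(pd p% wk psz)) p-zero))))))))))))))))

-- Permuted tables are the tables of isomorphic algebras.
record Closed (O : Ops) : Set where
 open Ops O
 field
  join< : ∀ x y -> join x y < suc sz
  meet< : ∀ x y -> meet x y < suc sz
  comp< : ∀ x -> comp' x < suc sz
  top< : top < suc sz
  bot< : bot < suc sz
  cyl< : ∀ i x -> cyl' i x < suc sz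
  diag< : ∀ i j -> diag' i j < suc sz

_∘E_ : ∀ {n a ℓa b ℓb c ℓc}{A : Alg n a ℓa}{B : Alg n b ℓb}{C : Alg n c ℓc}-> Embedding B C -> Embedding A B -> Embedding A C
_∘E_ {B = B}{C} g f = record
 { to = \x -> G.to (F.to x); cong = \p -> G.cong (F.cong p); injective = \p -> F.injective (G.injective p)
 ; ∨-homo = \x y -> C.trans (G.cong (F.∨-homo x y))(G.∨-homo _ _); ∧-homo = \x y -> C.trans (G.cong (F.∧-homo x y))(G.∧-homo _ _)
 ; ∼-homo = \x -> C.trans (G.cong (F.∼-homo x))(G.∼-homo _); ⊤-homo = C.trans (G.cong F.⊤-homo) G.⊤-homo; ⊥-homo = C.trans (G.cong F.⊥-homo) G.⊥-homo
 ; cyl-homo = \i x -> C.trans (G.cong (F.cyl-homo i x))(G.cyl-homo i _); diag-homo = \i j -> C.trans (G.cong (F.diag-homo i j))(G.diag-homo i j) }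
 where
 module F = Embedding f
 module G = Embedding g
 module C = Alg C

module Permuted (O : Ops)(cl : Closed O) where
 open Ops O
 open Closed cl
 A : Alg 3 0ℓ 0ℓ
 A = Table.alg table
 private module A = Alg A
 small : ∀ {x}-> x < suc sz -> x % suc sz ~ x
 small = m<n⇒m%n≡m
 fin-toℕ : ∀ x -> fin (ix x)~ x
 fin-toℕ x = Fin.toℕ-injective (toℕ-fin' (ix x)(Fin.toℕ<n x))
 module _ (p p' : ℕ) where
  private
   O' = conj-ops O p p'
   module O' = Ops O'
   A' = Table.alg O'.table
   module A' = Alg A'
   π π- : ℕ -> ℕ
   π x = dig sz x p
   π- x = dig sz x p'
  perm-embedding : isPerm O p p' ! -> Embedding A A'
  perm-embedding h = record
   { to = to; cong = cong to
   ; injective = \ {x}{y} e -> Fin.toℕ-injective (sym (inv x)& cong π- (sym (val x)& cong ix e & val y)& inv y)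
   ; ∨-homo = \x y -> by (x A.∨ y)(cong π (join≡ x y & small (join< _ _))& sym (O'.join≡ (to x)(to y)& red (join (π- (ix (to x)))(π- (ix (to y))))& cong2 (\u k -> π (join u k))(back x)(back y)))
   ; ∧-homo = \x y -> by (x A.∧ y)(cong π (meet≡ x y & small (meet< _ _))& sym (O'.meet≡ (to x)(to y)& red (meet (π- (ix (to x)))(π- (ix (to y))))& cong2 (\u k -> π (meet u k))(back x)(back y)))
   ; ∼-homo = \x -> by (A.∼ x)(cong π (comp≡ x & small (comp< _))& sym (O'.comp≡ (to x)& red (comp' (π- (ix (to x))))& cong (\u -> π (comp' u))(back x)))
   ; ⊤-homo = by A.⊤ (cong π (toℕ-fin top & small top<)& sym (O'.toℕ-fin (π top)& red top))
   ; ⊥-homo = by A.⊥ (cong π (toℕ-fin bot & small bot<)& sym (O'.toℕ-fin (π bot)& red bot))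
   ; cyl-homo = \i x -> by (A.cyl i x)(cong π (cyl≡ i x & small (cyl< _ _))& sym (O'.cyl≡ i (to x)& red (cyl' (ix i)(π- (ix (to x))))& cong (\u -> π (cyl' (ix i) u))(back x)))
   ; diag-homo = \i j -> by (A.diag i j)(cong π (diag≡ i j & small (diag< _ _))& sym (O'.diag≡ i j & red (diag' (ix i)(ix j)))) }
   where
   to : Fin (suc sz)-> Fin (suc sz)
   to x = fin (π (ix x))
   val : ∀ x -> ix (to x)~ π (ix x)
   val x = toℕ-fin' (π (ix x))(dig< sz (ix x) p)
   inv : ∀ x -> π- (π (ix x))~ ix x
   inv x = ==- (fst (&- {π- (π (ix x)) == ix x}(allN- {suc sz} h (ix x)(Fin.toℕ<n x))))
   back : ∀ x -> π- (ix (to x))~ ix x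
   back x = cong π- (val x)& inv x
   red : ∀ z -> π z % suc sz ~ π z
   red z = small (dig< sz z p)
   by : ∀ x {y}-> π (ix x)~ ix y -> to x ~ y
   by x e = Fin.toℕ-injective (val x & e)
 -- every table of an isomorphic algebra is a permuted table
 private
  vec≡ : ∀ {n}{X : Set}(v : Vec X n)(f : Fin n -> X)->(∀ i -> look v i ~ f i)-> v ~ tabulate f
  vec≡ v f h = sym (Vec.tabulate∘lookup v)& Vec.tabulate-cong h
  mat≡ : ∀ {m n}{X : Set}(v : Vec (Vec X n) m)(f : Fin m -> Fin n -> X)->(∀ i j -> look (look v i) j ~ f i j)-> v ~ tabulate \i -> tabulate (f i)
  mat≡ v f h = vec≡ v _ (\i -> vec≡ (look v i)(f i)(h i))
 main : ∀ T -> Table.size T ~ suc sz ->(e : Embedding A (Table.alg T))->(∀ y -> ∃[ x ] Embedding.to e x ~ y)->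
  ∃[ p ] ∃[ p' ] (isPerm O p p' ! × Table.code T ~ Table.code (Ops.table (conj-ops O p p')))
 main T@(record { size = .(suc sz); joinT = jT; meetT = mT; complT = cT; topT = tT; botT = bT; cylT = yT; diagT = dT }) refl e onto =
  p , p' , allN+ {suc sz}(\i i< -> &+ {dig sz (dig sz i p) p' == i}(==+ (π⁻π i i<))(==+ (ππ- i i<))) ,
  trans (code-pack T)(pack-cong
   (cong (entries ∘ concat)(mat≡ jT _ \x y -> val {jT}{A._∨_}{join}(\_ -> E.∨-homo _ _) x y (join≡ (from x)(from y))(join< _ _)))
   (cong (entries ∘ concat)(mat≡ mT _ \x y -> val {mT}{A._∧_}{meet}(\_ -> E.∧-homo _ _) x y (meet≡ (from x)(from y))(meet< _ _)))
   (cong entries (vec≡ cT _ \x -> trans (cong (look cT)(sym (from-to x)))(sym (E.∼-homo _)& img _ _ (comp≡ _)(comp< _)(cong comp' (f- x)))))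
   (cong ix (sym E.⊤-homo & img _ _ (toℕ-fin top) top< refl))
   (cong ix (sym E.⊥-homo & img _ _ (toℕ-fin bot) bot< refl))
   (cong (entries ∘ concat)(mat≡ yT _ \i x -> trans (cong (look (look yT i))(sym (from-to x)))(sym (E.cyl-homo i _)& img _ _ (cyl≡ i _)(cyl< _ _)(cong (cyl' (ix i))(f- x)))))
   (cong (entries ∘ concat)(mat≡ dT _ \i j -> trans (sym (E.diag-homo i j))(img _ _ (diag≡ i j)(diag< _ _) refl)))& sym (code-pack (Ops.table (conj-ops O p p'))))
  where
  module E = Embedding e
  from : Fin (suc sz)-> Fin (suc sz)
  from y = fst (onto y)
  from-to : ∀ y -> E.to (from y)~ y
  from-to y = snd (onto y)
  to-from : ∀ x -> from (E.to x)~ x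
  to-from x = E.injective (from-to (E.to x))
  P P' : ℕ -> ℕ
  P i = ix (E.to (fin i))
  P' i = ix (from (fin i))
  p p' : ℕ
  p = fd sz (suc sz) P
  p' = fd sz (suc sz) P'
  dp : ∀ i -> i < suc sz -> dig sz i p ~ P i
  dp i i< = dig-fd sz (suc sz) P i (\j -> Fin.toℕ<n (E.to (fin j))) i<
  dp' : ∀ i -> i < suc sz -> dig sz i p' ~ P' i
  dp' i i< = dig-fd sz (suc sz) P' i (\j -> Fin.toℕ<n (from (fin j))) i<
  f- : ∀ x -> ix (from x)~ dig sz (ix x) p'
  f- x = sym (dp' (ix x)(Fin.toℕ<n x)& cong (ix ∘ from)(fin-toℕ x))
  π⁻π : ∀ i -> i < suc sz -> dig sz (dig sz i p) p' ~ i
  π⁻π i i< = cong (\x -> dig sz x p')(dp i i<)& sym (f- (E.to (fin i)))& cong ix (to-from (fin i))& toℕ-fin' i i<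
  ππ- : ∀ i -> i < suc sz -> dig sz (dig sz i p') p ~ i
  ππ- i i< = cong (\x -> dig sz x p)(dp' i i<)& dp (P' i)(Fin.toℕ<n (from (fin i)))& cong (ix ∘ E.to)(fin-toℕ (from (fin i)))& cong ix (from-to (fin i))& toℕ-fin' i i<
  -- the image of an element with a given number
  img : ∀ (x : Fin (suc sz)) z {u}-> ix x ~ u % suc sz -> u < suc sz -> u ~ z -> E.to x ~ fin (dig sz z p)
  img x z {u} q u< refl = Fin.toℕ-injective (sym (toℕ-fin' (dig sz u p)(dig< sz u p)& dp u u< & cong (ix ∘ E.to)(Fin.toℕ-injective (toℕ-fin' u u< & sym (q & small u<)))))
  val : ∀ {M : Vec (Vec (Fin (suc sz))(suc sz))(suc sz)}{f : Fin (suc sz)-> Fin (suc sz)-> Fin (suc sz)}{g : ℕ -> ℕ -> ℕ}->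
   (Unit -> ∀ {x y}-> E.to (f x y)~ look (look M (E.to x))(E.to y))-> ∀ x y -> ix (f (from x)(from y))~ g (ix (from x))(ix (from y)) % suc sz ->
   g (ix (from x))(ix (from y))< suc sz -> look (look M x) y ~ fin (dig sz (g (dig sz (ix x) p')(dig sz (ix y) p')) p)
  val {M}{f}{g} h x y q l = cong2 (\u k -> look (look M u) k)(sym (from-to x))(sym (from-to y))& sym (h tt)& img _ _ q l (cong2 g (f- x)(f- y))
 iso-perm : ∀ T -> A ≅ Table.alg T -> ∃[ p ] ∃[ p' ] (isPerm O p p' ! × Table.code T ~ Table.code (Ops.table (conj-ops O p p')))
 iso-perm T (e , onto) = main T size≡ e onto
  where
  module E = Embedding e
  size≡ : Table.size T ~ suc sz
  size≡ = ≤-antisym (Fin.injective⇒≤ {f = \y -> fst (onto y)}(\ {x}{y} h -> trans (sym (snd (onto x)))(cong E.to h & snd (onto y))))(Fin.injective⇒≤ {f = E.to} E.injective)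

-- Evaluation of partial recursive functions with bounded search: 0 is no value, 1 + y the value y.
mutual
 ev : ∀ {k}-> PR k -> ℕ -> Vec ℕ k -> ℕ
 ev zer s xs = 1
 ev succ s (x ∷ []) = suc (suc x)
 ev (proj i) s xs = suc (look xs i)
 ev (comp f gs) s xs = if allPos (evs gs s xs) then ev f s (Vec.map ℕ.pred (evs gs s xs)) else 0
 ev (prec f g) s (x ∷ xs) = natrec (ev f s xs)(\i a -> if a == 0 then 0 else ev g s (i ∷ ℕ.pred a ∷ xs)) x
 ev (mu f) s xs = ℕ.pred (natrec 0 (\i a -> scan (ev f s (i ∷ xs)) i a) s)
 evs : ∀ {j k}-> Vec (PR k) j -> ℕ -> Vec ℕ k -> Vec ℕ j
 evs [] s xs = []
 evs (g ∷ gs) s xs = ev g s xs ∷ evs gs s xs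
 allPos : ∀ {j}-> Vec ℕ j -> Bool
 allPos [] = true
 allPos (x ∷ xs) = not (x == 0) && allPos xs
 -- 0: still searching, 1: an undefined value was met, 2 + y: the search ended at y
 scan : ℕ -> ℕ -> ℕ -> ℕ
 scan r i a = if a == 0 then (if r == 0 then 1 else (if r == 1 then suc (suc i) else 0)) else a

private
 prec-sound : ∀ {k}(f : PR k)(g : PR (2 + k)) s xs x y ->
  (∀ {y}-> ev f s xs ~ suc y -> f [ xs ]⇓ y)->(∀ i r {y}-> ev g s (i ∷ r ∷ xs)~ suc y -> g [ i ∷ r ∷ xs ]⇓ y)->
  ev (prec f g) s (x ∷ xs)~ suc y -> prec f g [ x ∷ xs ]⇓ y
 prec-sound f g s xs zero y hf hg e = prec0⇓ (hf e)
 prec-sound f g s xs (suc x) y hf hg e with ev (prec f g) s (x ∷ xs) in q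
 ... | suc r = precs⇓ (prec-sound f g s xs x r hf hg q)(hg x r e)
 mu-sound : ∀ {k}(f : PR (1 + k)) s xs ->(∀ i {y}-> ev f s (i ∷ xs)~ suc y -> f [ i ∷ xs ]⇓ y)-> ∀ n -> let a = natrec 0 (\i a -> scan (ev f s (i ∷ xs)) i a) n in
  (a ~ 0 -> ∀ z -> z < n -> ∃[ v ] (f [ z ∷ xs ]⇓ suc v))× (∀ y -> a ~ suc (suc y)-> mu f [ xs ]⇓ y)
 mu-sound f s xs h zero = (\_ z ()), (\y ())
 mu-sound f s xs h (suc n) with natrec 0 (\i a -> scan (ev f s (i ∷ xs)) i a) n | mu-sound f s xs h n
 ... | suc a | p , q = (\()), q
 ... | zero | p , q with ev f s (n ∷ xs) in e
 ... | zero = (\()), (\y ())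
 ... | suc zero = (\()), (\ { y refl -> mu⇓ (h n e)(p refl) })
 ... | suc (suc v) = (\_ z z< -> [ p refl z , (\ { refl -> v , h n e }) ]′ (m≤n⇒m<n∨m≡n (≤-pred z<))), (\y ())

mutual
 ev-sound : ∀ {k}(p : PR k) s xs {y}-> ev p s xs ~ suc y -> p [ xs ]⇓ y
 ev-sound zer s [] refl = zer⇓
 ev-sound succ s (x ∷ []) refl = succ⇓
 ev-sound (proj i) s xs refl = proj⇓
 ev-sound (comp f gs) s xs e with allPos (evs gs s xs) in q
 ... | true = comp⇓ (evs-sound gs s xs q)(ev-sound f s _ e)
 ev-sound (prec f g) s (x ∷ xs) e = prec-sound f g s xs x _ (\q -> ev-sound f s xs q)(\i r q -> ev-sound g s (i ∷ r ∷ xs) q) e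
 ev-sound (mu f) s xs {y} e with natrec 0 (\i a -> scan (ev f s (i ∷ xs)) i a) s | mu-sound f s xs (\i q -> ev-sound f s (i ∷ xs) q) s
 ev-sound (mu f) s xs {y} refl | suc .(suc y) | _ , h = h y refl
 evs-sound : ∀ {j k}(gs : Vec (PR k) j) s xs -> allPos (evs gs s xs) ! -> gs [ xs ]⇓* Vec.map ℕ.pred (evs gs s xs)
 evs-sound [] s xs h = []
 evs-sound (g ∷ gs) s xs h with ev g s xs in e
 ... | suc y = ev-sound g s xs e ∷ evs-sound gs s xs h

-- f has its value at all sufficiently large bounds
Eventually : (ℕ -> Set)-> Set
Eventually Q = ∃[ s0 ] (∀ s -> s0 ≤ s -> Q s)

both : ∀ {P Q : ℕ -> Set}-> Eventually P -> Eventually Q -> Eventually (\s -> P s × Q s)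
both (s , p)(t , q) = s + t , \r h -> p r (≤-trans (m≤m+n s t) h), q r (≤-trans (m≤n+m t s) h)

all-below : ∀ {P : ℕ -> ℕ -> Set} y ->(∀ z -> z < y -> Eventually (P z))-> Eventually (\s -> ∀ z -> z < y -> P z s)
all-below zero h = 0 , \s _ z ()
all-below (suc y) h with both (h y ≤-refl)(all-below y (\z l -> h z (m<n⇒m<1+n l)))
... | s0 , g = s0 , \s l z z< -> [ snd (g s l) z , (\ { refl -> fst (g s l) }) ]′ (m≤n⇒m<n∨m≡n (≤-pred z<))

mutual
 ev-complete : ∀ {k}{p : PR k}{xs y}-> p [ xs ]⇓ y -> Eventually (\s -> ev p s xs ~ suc y)
 ev-complete zer⇓ = 0 , \_ _ -> refl
 ev-complete succ⇓ = 0 , \_ _ -> refl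
 ev-complete proj⇓ = 0 , \_ _ -> refl
 ev-complete {xs = xs}(comp⇓ {f = f}{gs} gd fd') with both (evs-complete gd)(ev-complete fd')
 ... | s0 , h = s0 , \s l -> go s (fst (h s l))(snd (h s l))
  where
  all-suc : ∀ {j}(ys : Vec ℕ j)-> allPos (Vec.map suc ys) !
  all-suc [] = refl
  all-suc (y ∷ ys) = all-suc ys
  map-pred : ∀ {j}(ys : Vec ℕ j)-> Vec.map ℕ.pred (Vec.map suc ys)~ ys
  map-pred [] = refl
  map-pred (y ∷ ys) = cong (y ∷_)(map-pred ys)
  go : ∀ s {ys y}-> evs gs s xs ~ Vec.map suc ys -> ev f s ys ~ suc y -> ev (comp f gs) s xs ~ suc y
  go s {ys} e d rewrite e | all-suc ys | map-pred ys = d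
 ev-complete (prec0⇓ d) = ev-complete d
 ev-complete {xs = suc x ∷ xs}(precs⇓ {f = f}{g}{r = r} d e) with both (ev-complete d)(ev-complete e)
 ... | s0 , h = s0 , \s l -> trans (cong (\a -> if a == 0 then 0 else ev g s (x ∷ ℕ.pred a ∷ xs))(fst (h s l)))(snd (h s l))
 ev-complete {xs = xs}(mu⇓ {f = f}{y = y} d h) with both (both (ev-complete d)(all-below y (\z l -> mu-below d h z l)))(suc y , \s l -> l)
 ... | s0 , g = s0 , \s l -> let (a , b), c = g s l in cong ℕ.pred (after s a b s c)
  where
  acc' : ℕ -> ℕ -> ℕ
  acc' s n = natrec 0 (\i a -> scan (ev f s (i ∷ xs)) i a) n
  before : ∀ s ->(∀ z -> z < y -> ∃[ v ] (ev f s (z ∷ xs)~ suc (suc v)))-> ∀ n -> n ≤ y -> acc' s n ~ 0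
  before s h zero l = refl
  before s h (suc n) l rewrite before s h n (<⇒≤ l) | snd (h n l) = refl
  after : ∀ s -> ev f s (y ∷ xs)~ 1 ->(∀ z -> z < y -> ∃[ v ] (ev f s (z ∷ xs)~ suc (suc v)))-> ∀ n -> y < n -> acc' s n ~ suc (suc y)
  after s e h (suc n) l with m≤n⇒m<n∨m≡n (≤-pred l)
  ... | inl l' rewrite after s e h n l' = refl
  ... | inr refl rewrite before s h y ≤-refl | e = refl
 mu-below : ∀ {k}{f : PR (1 + k)}{xs y}-> f [ y ∷ xs ]⇓ 0 ->(h : ∀ z -> z < y -> ∃[ v ] (f [ z ∷ xs ]⇓ suc v))-> ∀ z -> z < y -> Eventually (\s -> ∃[ v ] (ev f s (z ∷ xs)~ suc (suc v)))
 mu-below d h z l with h z l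
 ... | v , e with ev-complete e
 ... | s0 , g = s0 , \s l -> v , g s l
 evs-complete : ∀ {j k}{gs : Vec (PR k) j}{xs ys}-> gs [ xs ]⇓* ys -> Eventually (\s -> evs gs s xs ~ Vec.map suc ys)
 evs-complete [] = 0 , \_ _ -> refl
 evs-complete (d ∷ ds) with both (ev-complete d)(evs-complete ds)
 ... | s0 , h = s0 , \s l -> cong2 _∷_ (fst (h s l))(snd (h s l))

PV : ℕ -> ℕ -> Set
PV n k = Vec (Σ[ f ∈ (Env' n -> ℕ) ] Prim n f) k

at : ∀ {n k}-> PV n k -> Env' n -> Vec ℕ k
at v γ = Vec.map (\a -> fst a γ) v

wkV : ∀ {n k}-> PV n k -> PV (suc n) k
wkV = Vec.map (\a ->(\γ -> fst a (fst γ)), wk (snd a))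

wkV≡ : ∀ {n k}(v : PV n k) γ -> at (wkV v) γ ~ at v (fst γ)
wkV≡ v γ = sym (Vec.map-∘ _ _ v)

p-pred : ∀ {n f}-> Prim n f -> Prim n (\γ -> ℕ.pred (f γ))
p-pred p = p p∸ pk 1

mutual
 p-ev : ∀ {n k}(f : PR k)(v : PV n k){s}-> Prim n s -> Prim n (\γ -> ev f (s γ)(at v γ))
 p-ev zer v ps = pk 1
 p-ev succ ((_ , p) ∷ []) ps = p-suc (p-suc p)
 p-ev (proj i) v ps = p-suc (p-ext (\γ -> sym (Vec.lookup-map i _ v))(snd (look v i)))
 p-ev (comp f gs) v {s} ps = p-if (p-pos (p-evs gs v ps)(\γ -> evs≡ gs v ps γ))
  (p-ext (\γ -> cong (ev f (s γ))(pred≡ (p-evs gs v ps)(evs gs (s γ)(at v γ)) γ (evs≡ gs v ps γ)))(p-ev f (predV (p-evs gs v ps)) ps))(pk 0)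
 p-ev (prec f g)((x , px) ∷ v){s} ps = p-rec (p-ev f v ps)(p-if (x0 p== pk 0)(pk 0)
  (p-ext (\γ -> cong (\u -> ev g (s (fst (fst γ)))(_ ∷ _ ∷ u))(wkV≡ (wkV v) γ & wkV≡ v (fst γ)))(p-ev g ((_ , x1) ∷ (_ , p-pred x0) ∷ wkV (wkV v))(wk (wk ps))))) px
 p-ev (mu f) v {s} ps = p-pred (p-rec p-zero (p-if (x0 p== pk 0)(p-if (r p== pk 0)(pk 1)(p-if (r p== pk 1)(p-suc (p-suc x1))(pk 0))) x0) ps)
  where
  r : Prim _ (\γ -> ev f (s (fst (fst γ)))(snd (fst γ) ∷ at v (fst (fst γ))))
  r = p-ext (\γ -> cong (\u -> ev f (s (fst (fst γ)))(_ ∷ u))(wkV≡ (wkV v) γ & wkV≡ v (fst γ)))(p-ev f ((_ , x1) ∷ wkV (wkV v))(wk (wk ps)))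
 p-evs : ∀ {n j k}(gs : Vec (PR k) j)(v : PV n k){s}-> Prim n s -> PV n j
 p-evs [] v ps = []
 p-evs (g ∷ gs) v ps = (_ , p-ev g v ps) ∷ p-evs gs v ps
 evs≡ : ∀ {n j k}(gs : Vec (PR k) j)(v : PV n k){s}(ps : Prim n s) γ -> at (p-evs gs v ps) γ ~ evs gs (s γ)(at v γ)
 evs≡ [] v ps γ = refl
 evs≡ (g ∷ gs) v ps γ = cong (_ ∷_)(evs≡ gs v ps γ)
 predV : ∀ {n j}-> PV n j -> PV n j
 predV = Vec.map (\a -> _ , p-pred (snd a))
 pred≡ : ∀ {n j}(v : PV n j) ys γ -> at v γ ~ ys -> at (predV v) γ ~ Vec.map ℕ.pred ys
 pred≡ v ys γ refl = sym (Vec.map-∘ _ _ v)& Vec.map-∘ _ _ v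
 p-pos : ∀ {n j}{F : Env' n -> Vec ℕ j}(v : PV n j)->(∀ γ -> at v γ ~ F γ)-> PB n (\γ -> allPos (F γ))
 p-pos v h .nat = p-ext (\γ -> cong (b2n ∘ allPos)(h γ))(go v)
  where
  go : ∀ {n j}(v : PV n j)-> Prim n (\γ -> b2n (allPos (at v γ)))
  go [] = pk 1
  go ((_ , p) ∷ v) = nat (p-not (p p== pk 0) p&& asB {p = \γ -> allPos (at v γ)}(go v))

-- The equation saying that the laws have no model.
T3' : Set
T3' = Term 3 ℕ

-- a relation variable on the coordinates (0,1), (0,2) and (1,2)
R01 R02 R12 : ℕ -> T3'
R01 k = cyl 2F (var k)
R02 k = cyl 1F (diag 1F 2F ∧ R01 k)
R12 k = cyl zero (diag zero 1F ∧ R02 k)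

vG vP vF vW vL : ℕ
vG = 0
vP = 1
vF = 2
vW = 3
vL = 4

vT : ℕ -> ℕ
vT t = 5 + t

⋁ : ℕ ->(ℕ -> T3')-> T3'
⋁ zero f = ⊥
⋁ (suc n) f = f n ∨ ⋁ n f

when : Bool -> T3' -> T3'
when c t = if c then t else ⊥

module LawTerms (TS : Tiles) where
 open Tiles TS
 v-suc v-inw v-hor v-hort v-ver v-vert v-pf v-ff v-bad v-til v-st v-stl : T3'
 v-suc = R01 vG ∧ (∼ cyl 2F (R02 vG ∧ R12 vP))
 v-inw = R01 vG ∧ (R02 vG ∧ R12 vW)
 v-hor = ⋁ N \t -> ⋁ N \u -> when (not (hor t u))(R01 vP ∧ (R02 (vT t) ∧ R12 (vT u)))
 v-hort = R01 vP ∧ (R02 vL ∧ ((∼ R12 vL) ∧ (∼ R12 vW)))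
 v-ver = ⋁ N \t -> ⋁ N \u -> when (not (ver t u))(R01 (vT t) ∧ (R12 vP ∧ R02 (vT u)))
 v-vert = R01 vL ∧ (R12 vP ∧ ((∼ R02 vL) ∧ (∼ R02 vW)))
 v-pf = R01 vP ∧ (∼ R01 vF)
 v-ff = R01 vF ∧ (R12 vP ∧ ((∼ R02 vF) ∧ (∼ R02 vW)))
 v-bad = ⋁ N \t -> when (bad t)(R01 (vT start) ∧ (R12 vF ∧ R02 (vT t)))
 v-til = R01 vL ∧ (∼ ⋁ N (\t -> R01 (vT t)))
 v-st = ⋁ N \t -> when (not (t == start))(R01 (vT start) ∧ R01 (vT t))
 v-stl = R01 (vT start) ∧ (∼ R01 vL)
 violation : T3'
 violation = v-suc ∨ (v-inw ∨ (v-hor ∨ (v-hort ∨ (v-ver ∨ (v-vert ∨ (v-pf ∨ (v-ff ∨ (v-bad ∨ (v-til ∨ (v-st ∨ v-stl))))))))))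
 lawful : T3'
 lawful = ∼ cyl zero (cyl 1F (cyl 2F violation))
 corner : T3'
 corner = R01 vG ∧ (R02 vG ∧ R12 (vT start))
 equation : Equation 3
 equation = (lawful ∧ corner), ⊥

-- A set of triples with truth values of terms at which the relation variables denote relations on edges satisfying the laws.
record Lawful (TS : Tiles) : Set1 where
 open Tiles TS
 open LawTerms TS
 field
  S E : Set
  sem : T3' -> S -> Bool
  p01 p02 p12 : S -> E
  rl : ℕ -> E -> Bool
  sem-∨ : ∀ t u s -> sem (t ∨ u) s ~ sem t s || sem u s
  sem-∧ : ∀ t u s -> sem (t ∧ u) s ~ sem t s && sem u s
  sem-∼ : ∀ t s -> sem (∼ t) s ~ not (sem t s)
  sem-⊥ : ∀ s -> sem ⊥ s ~ false
  sem01 : ∀ k s -> sem (R01 k) s ~ rl k (p01 s)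
  sem02 : ∀ k s -> sem (R02 k) s ~ rl k (p02 s)
  sem12 : ∀ k s -> sem (R12 k) s ~ rl k (p12 s)
 infix 4 _∋_
 _∋_ : ℕ -> E -> Set
 k ∋ e = rl k e !
 field
  l-suc : ∀ s -> vG ∋ p01 s -> sem (cyl 2F (R02 vG ∧ R12 vP)) s !
  l-inw : ∀ s -> vG ∋ p01 s -> vG ∋ p02 s -> ¬ vW ∋ p12 s
  l-hor : ∀ s t u -> vP ∋ p01 s -> vT t ∋ p02 s -> vT u ∋ p12 s -> hor t u !
  l-hort : ∀ s -> vP ∋ p01 s -> vL ∋ p02 s -> vL ∋ p12 s ⊎ vW ∋ p12 s
  l-ver : ∀ s t u -> vT t ∋ p01 s -> vP ∋ p12 s -> vT u ∋ p02 s -> ver t u !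
  l-vert : ∀ s -> vL ∋ p01 s -> vP ∋ p12 s -> vL ∋ p02 s ⊎ vW ∋ p02 s
  l-pf : ∀ s -> vP ∋ p01 s -> vF ∋ p01 s
  l-ff : ∀ s -> vF ∋ p01 s -> vP ∋ p12 s -> vF ∋ p02 s ⊎ vW ∋ p02 s
  l-bad : ∀ s t -> vT start ∋ p01 s -> vF ∋ p12 s -> vT t ∋ p02 s -> bad t ~ false
  l-til : ∀ s -> vL ∋ p01 s -> ∃[ t ] (t < N × vT t ∋ p01 s)
  l-st : ∀ s t -> vT start ∋ p01 s -> vT t ∋ p01 s -> t ~ start
  l-stl : ∀ s -> vT start ∋ p01 s -> vL ∋ p01 s
 record Never (t : T3') : Set where
  constructor nev
  field never : ∀ s -> sem t s ! -> Empty
 open Never public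
 private
  r01 : ∀ k {s}-> sem (R01 k) s ! -> k ∋ p01 s
  r01 k h = sym (sem01 k _)& h
  r02 : ∀ k {s}-> sem (R02 k) s ! -> k ∋ p02 s
  r02 k h = sym (sem02 k _)& h
  r12 : ∀ k {s}-> sem (R12 k) s ! -> k ∋ p12 s
  r12 k h = sym (sem12 k _)& h
  and : ∀ t u {s}-> sem (t ∧ u) s ! -> sem t s ! × sem u s !
  and t u {s} h = &- (sym (sem-∧ t u s)& h)
  neg' : ∀ t {s}-> sem (∼ t) s ! -> ¬ sem t s !
  neg' t {s} h = not- (sym (sem-∼ t s)& h)
  never-∨ : ∀ {t u}-> Never t -> Never u -> Never (t ∨ u)
  never-∨ {t}{u} f g = nev \s h -> [ never f s , never g s ]′ (or- (sem t s)(sym (sem-∨ t u s)& h))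
   where
   or- : ∀ a {b}-> a || b ! -> a ! ⊎ b !
   or- true h = inl h
   or- false h = inr h
  never-⊥ : Never ⊥
  never-⊥ = nev \s h -> case trans (sym h)(sem-⊥ s) of \()
  never-⋁ : ∀ n {f}->(∀ t -> Never (f t))-> Never (⋁ n f)
  never-⋁ zero h = never-⊥
  never-⋁ (suc n) h = never-∨ (h n)(never-⋁ n h)
  never-when : ∀ {c t}->(c ! -> Never t)-> Never (when c t)
  never-when {true} f = f refl
  never-when {false} f = never-⊥
  ⋁-in : ∀ f s n t -> t < n -> sem (f t) s ! -> sem (⋁ n f) s !
  ⋁-in f s (suc n) t l h = trans (sem-∨ (f n)(⋁ n f) s)(go (m≤n⇒m<n∨m≡n (≤-pred l)))
   where
   go : t < n ⊎ t ~ n -> sem (f n) s || sem (⋁ n f) s !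
   go (inl l') = cong (sem (f n) s ||_)(⋁-in f s n t l' h)& Bool.∨-zeroʳ _
   go (inr e) = cong (_|| sem (⋁ n f) s)(subst (\n -> sem (f n) s !) e h)
  -- a law whose conclusion is one of two relations
  fork : ∀ {t u k l : T3'}{s}{A B C D : Set}->(A -> B -> C ⊎ D)->(sem t s ! -> A)->(sem u s ! -> B)->(C -> sem k s !)->(D -> sem l s !)->
   ¬ sem (t ∧ (u ∧ ((∼ k) ∧ (∼ l)))) s !
  fork {t}{u}{k}{l} f a b c d h = let p , x = and t (u ∧ ((∼ k) ∧ (∼ l))) h; q , y = and u ((∼ k) ∧ (∼ l)) x; n , m = and (∼ k)(∼ l) y in
   [ neg' k n ∘ c , neg' l m ∘ d ]′ (f (a p)(b q))
  three : ∀ {t u v : T3'}{s}{A : Set}->(sem t s ! -> sem u s ! -> sem v s ! -> A)-> sem (t ∧ (u ∧ v)) s ! -> A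
  three {t}{u}{v} f h = let p , x = and t (u ∧ v) h; q , r = and u v x in f p q r
 never-violation : Never violation
 never-violation =
  never-∨ (nev \s h -> let g , x = and (R01 vG)(∼ cyl 2F (R02 vG ∧ R12 vP)) h in neg' (cyl 2F (R02 vG ∧ R12 vP)) x (l-suc s (r01 vG g)))
  (never-∨ (nev \s -> three \p q r -> l-inw s (r01 vG p)(r02 vG q)(r12 vW r))
  (never-∨ (never-⋁ N \t -> never-⋁ N \u -> never-when \f -> nev \s -> three \p q r -> not- f (l-hor s t u (r01 vP p)(r02 (vT t) q)(r12 (vT u) r)))
  (never-∨ (nev \s -> fork (l-hort s)(r01 vP)(r02 vL)(trans (sem12 vL s))(trans (sem12 vW s)))
  (never-∨ (never-⋁ N \t -> never-⋁ N \u -> never-when \f -> nev \s -> three \p q r -> not- f (l-ver s t u (r01 (vT t) p)(r12 vP q)(r02 (vT u) r)))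
  (never-∨ (nev \s -> fork (l-vert s)(r01 vL)(r12 vP)(trans (sem02 vL s))(trans (sem02 vW s)))
  (never-∨ (nev \s h -> let p , x = and (R01 vP)(∼ R01 vF) h in neg' (R01 vF) x (sem01 vF s & l-pf s (r01 vP p)))
  (never-∨ (nev \s -> fork (l-ff s)(r01 vF)(r12 vP)(trans (sem02 vF s))(trans (sem02 vW s)))
  (never-∨ (never-⋁ N \t -> never-when \f -> nev \s -> three \p q r -> case trans (sym f)(l-bad s t (r01 (vT start) p)(r12 vF q)(r02 (vT t) r)) of \())
  (never-∨ (nev \s h -> let p , x = and (R01 vL)(∼ ⋁ N (\t -> R01 (vT t))) h; t , t< , q = l-til s (r01 vL p) in
   neg' (⋁ N (\t -> R01 (vT t))) x (⋁-in (\t -> R01 (vT t)) s N t t< (sem01 (vT t) s & q)))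
  (never-∨ (never-⋁ N \t -> never-when \f -> nev \s h -> let p , q = and (R01 (vT start))(R01 (vT t)) h in not- f (==+ (l-st s t (r01 (vT start) p)(r01 (vT t) q))))
  (nev \s h -> let p , x = and (R01 (vT start))(∼ R01 vL) h in neg' (R01 vL) x (sem01 vL s & l-stl s (r01 (vT start) p)))))))))))))

-- Homomorphisms into neat reducts.
record Hom (A : Alg 3 0ℓ 0ℓ){m : ℕ}(B : CA (6 + m) 0ℓ 0ℓ) : Set where
 private module A = Alg A
 open CALemmas B
 emb : Fin 3 -> Fin (6 + m)
 emb i = inject≤ i (m≤m+n 3 (3 + m))
 field
  to : A.Carrier -> Carrier
  neat : ∀ x k -> 3 ≤ ix k -> Fix k (to x)
  to-∧ : ∀ x y -> to (x A.∧ y)≈ to x ∩ to y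
  to-∨ : ∀ x y -> to (x A.∨ y)≈ to x ∪ to y
  to-∼ : ∀ x -> to (A.∼ x)≈ − to x
  to-⊤ : to A.⊤ ≈ 𝟏
  to-⊥ : to A.⊥ ≈ 𝟎
  to-cy : ∀ i x -> to (A.cyl i x)≈ cy (emb i)(to x)
  to-dg : ∀ i j -> to (A.diag i j)≈ dg (emb i)(emb j)

-- Values of the relation variables at which the equation fails form a system of relations.
module FromEquation (TS : Tiles){A : Alg 3 0ℓ 0ℓ}{m : ℕ}{B : CA (6 + m) 0ℓ 0ℓ}(h : Hom A B)(ρ : ℕ -> Alg.Carrier A) where
 open Tiles TS
 open LawTerms TS
 open Hom h
 open Relations B
 val : T3' -> Carrier
 val t = to (eval A ρ t)
 rel' : ℕ -> Rel
 rel' k = record { r = val (R01 k); rfix = fix }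
  where
  fix : ∀ j -> j # i0 -> j # i1 -> Fix j (val (R01 k))
  fix zero a b = efq (a refl)
  fix 1F a b = efq (b refl)
  fix 2F a b = ~trans (cyl-cong i2 (to-cy 2F (ρ k)))(~trans (cyl-idem i2 _)(~sym (to-cy 2F (ρ k))))
  fix (suc (suc (suc j))) a b = neat _ (suc (suc (suc j)))(sl (sl (sl zl)))
 record Im (x : Carrier)(t : T3') : Set where
  constructor im
  field ~val : x ≈ val t
 open Im
 im-r : ∀ k -> Im (r (rel' k))(R01 k)
 im-r k = im ~refl
 im-q : ∀ k -> Im (q (rel' k) i2)(R02 k)
 im-q k = im (~trans (cyl-cong i1 (~trans (∧-cong (~sym (to-dg 1F 2F)) ~refl)(~sym (to-∧ _ _))))(~sym (to-cy 1F _)))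
 im-e : ∀ k -> Im (e (rel' k) i1 i2)(R12 k)
 im-e k = im (~trans (cyl-cong i0 (~trans (∧-cong (~sym (to-dg zero 1F))(~val (im-q k)))(~sym (to-∧ _ _))))(~sym (to-cy zero _)))
 infixr 7 _im∩_
 _im∩_ : ∀ {x y s t}-> Im x s -> Im y t -> Im (x ∩ y)(s ∧ t)
 im p im∩ im q = im (~trans (∧-cong p q)(~sym (to-∧ _ _)))
 im− : ∀ {x t}-> Im x t -> Im (− x)(∼ t)
 im− (im p) = im (~trans (∼-cong p)(~sym (to-∼ _)))
 im-ors : ∀ {f : ℕ -> Carrier}{g} n ->(∀ t -> Im (f t)(g t))-> Im (ors f n)(⋁ n g)
 im-ors zero h = im (~sym to-⊥)
 im-ors (suc n) h = im (~trans (∨-cong (~val (h n))(~val (im-ors n h)))(~sym (to-∨ _ _)))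
 infix 4 _≼_
 record _≼_ (s t : T3') : Set where
  constructor le
  field ⊑val : val s ⊑ val t
 open _≼_
 infixr 5 _≫_
 _≫_ : ∀ {s t u}-> s ≼ t -> t ≼ u -> s ≼ u
 le p ≫ le q = le (⊑trans p q)
 in-l : ∀ {s t}-> s ≼ s ∨ t
 in-l = le (⊑trans ∨l (⊑≡ (~sym (to-∨ _ _))))
 in-r : ∀ {s t}-> t ≼ s ∨ t
 in-r = le (⊑trans ∨r (⊑≡ (~sym (to-∨ _ _))))
 in-⋁ : ∀ n (f : ℕ -> T3') t -> t < n -> f t ≼ ⋁ n f
 in-⋁ (suc n) f t l with t ℕ.≟ n
 ... | yes refl = in-l
 ... | no ne = in-⋁ n f t (ℕ.≤∧≢⇒< (≤-pred l) ne) ≫ in-r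
 in-when : ∀ {c t}-> c ! -> t ≼ when c t
 in-when refl = le ⊑refl
 private
  V : Carrier
  V = cy i0 (cy i1 (cy i2 (val violation)))
  lawful≈ : val lawful ≈ − V
  lawful≈ = ~trans (to-∼ _)(∼-cong (~trans (to-cy zero _)(cyl-cong i0 (~trans (to-cy 1F _)(cyl-cong i1 (to-cy 2F _))))))
  V-fix : ∀ k -> Fix k V
  V-fix zero = cyl-idem i0 _
  V-fix 1F = fix-cyl i1 i0 (cyl-idem i1 _)
  V-fix 2F = fix-cyl i2 i0 (fix-cyl i2 i1 (cyl-idem i2 _))
  V-fix (suc (suc (suc k))) = fix-cyl _ i0 (fix-cyl _ i1 (fix-cyl _ i2 (neat (eval A ρ violation)(suc (suc (suc k)))(sl (sl (sl zl))))))
  law : ∀ {x v}-> Im x v -> v ≼ violation -> val lawful ∩ x ≈ 𝟎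
  law (im p)(le q) = clash− (⊑trans &r (⊑trans (⊑≡ p)(⊑trans q (⊑trans (cyl-⊑ i2 _)(⊑trans (cyl-⊑ i1 _)(cyl-⊑ i0 _))))))(⊑trans &l (⊑≡ lawful≈))
  true-when : ∀ {c}-> c ~ false -> not c !
  true-when refl = refl
 system : ¬ (val (fst equation)≈ 𝟎)-> System TS B
 system nz = record
  { b = val lawful; bfix = \k -> ~trans (cyl-cong k lawful≈)(~trans (fix-− k (V-fix k))(~sym lawful≈))
  ; G = rel' vG; P = rel' vP; F = rel' vF; W = rel' vW; Tl = rel' vL; Tt = \t -> rel' (vT t)
  ; sucL = dis⇒⊑ (~trans (∧-assoc _ _ _)(law (im-r vG im∩ im− (im-c (im-q vG im∩ im-e vP))) in-l))
  ; inw = law (im-r vG im∩ im-q vG im∩ im-e vW)(in-l ≫ in-r)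
  ; horL = \t u t< u< f -> law (im-r vP im∩ im-q (vT t) im∩ im-e (vT u))(in-when (true-when f) ≫ in-⋁ N _ u u< ≫ in-⋁ N (\t -> ⋁ N \u -> when (not (hor t u))(R01 vP ∧ (R02 (vT t) ∧ R12 (vT u)))) t t< ≫ in-l ≫ in-r ≫ in-r)
  ; hort = law (im-r vP im∩ im-q vL im∩ im− (im-e vL) im∩ im− (im-e vW))(in-l ≫ in-r ≫ in-r ≫ in-r)
  ; verL = \t u t< u< f -> law (im-r (vT t) im∩ im-e vP im∩ im-q (vT u))(in-when (true-when f) ≫ in-⋁ N _ u u< ≫ in-⋁ N (\t -> ⋁ N \u -> when (not (ver t u))(R01 (vT t) ∧ (R12 vP ∧ R02 (vT u)))) t t< ≫ in-l ≫ in-r ≫ in-r ≫ in-r ≫ in-r)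
  ; vert = law (im-r vL im∩ im-e vP im∩ im− (im-q vL) im∩ im− (im-q vW))(in-l ≫ in-r ≫ in-r ≫ in-r ≫ in-r ≫ in-r)
  ; pf = law (im-r vP im∩ im− (im-r vF))(in-l ≫ in-r ≫ in-r ≫ in-r ≫ in-r ≫ in-r ≫ in-r)
  ; ff = law (im-r vF im∩ im-e vP im∩ im− (im-q vF) im∩ im− (im-q vW))(in-l ≫ in-r ≫ in-r ≫ in-r ≫ in-r ≫ in-r ≫ in-r ≫ in-r)
  ; badL = \t t< f -> law (im-r (vT start) im∩ im-e vF im∩ im-q (vT t))(in-when f ≫ in-⋁ N (\t -> when (bad t)(R01 (vT start) ∧ (R12 vF ∧ R02 (vT t)))) t t< ≫ in-l ≫ in-r ≫ in-r ≫ in-r ≫ in-r ≫ in-r ≫ in-r ≫ in-r ≫ in-r)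
  ; til = law (im-r vL im∩ im− (im-ors N (\t -> im-r (vT t))))(in-l ≫ in-r ≫ in-r ≫ in-r ≫ in-r ≫ in-r ≫ in-r ≫ in-r ≫ in-r ≫ in-r)
  ; st = \t t< ne -> law (im-r (vT start) im∩ im-r (vT t))(in-when (not+ (ne ∘ ==-)) ≫ in-⋁ N (\t -> when (not (t == start))(R01 (vT start) ∧ R01 (vT t))) t t<
   ≫ in-l ≫ in-r ≫ in-r ≫ in-r ≫ in-r ≫ in-r ≫ in-r ≫ in-r ≫ in-r ≫ in-r ≫ in-r)
  ; stl = law (im-r (vT start) im∩ im− (im-r vL))(in-r ≫ in-r ≫ in-r ≫ in-r ≫ in-r ≫ in-r ≫ in-r ≫ in-r ≫ in-r ≫ in-r ≫ in-r)
  ; occ = \z -> nz (~trans (to-∧ _ _)(~trans (∧-cong ~refl (~sym (~val (im-r vG im∩ im-q vG im∩ im-e (vT start))))) z)) }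
  where
  im-c : ∀ {x t}-> Im x t -> Im (cy i2 x)(cyl 2F t)
  im-c (im p) = im (~trans (cyl-cong i2 p)(~sym (to-cy 2F _)))

module Negative (em : EM)(TS : Tiles)(start< : Tiles.start TS < Tiles.N TS) where
 open Tiles TS
 open Codes em TS
 open Triples em TS
 open Labels TS K mem
 open ConsSym TS K mem
 private module A = Alg algA
 r01 r12 r02 : (ℕ -> Bool)-> A.Carrier
 r01 P = elt (\j -> P (ℓ01 (atm j)))
 r12 P = elt (\j -> P (ℓ12 (atm j)))
 r02 P = elt (\j -> P (ℓ02 (atm j)))
 is : Lab -> ℕ -> Bool
 is β l = l == encL β
 isG isP isF isW isT : ℕ -> Bool
 isG = is (zp 0)
 isP = is (pp nx)
 isF l = is (pp nx) l || is (pp ft) l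
 isW = is (pp w)
 isT l = anyN N (\t -> is (pp (tl t)) l)
 isTt : ℕ -> ℕ -> Bool
 isTt t = is (pp (tl t))
 cornerEl : A.Carrier
 cornerEl = elt (\j -> isG (ℓ01 (atm j)) && (isG (ℓ02 (atm j)) && isTt start (ℓ12 (atm j))))
 private
  true-ext : ∀ {a b}->(a ! -> b !)->(b ! -> a !)-> a ~ b
  true-ext {true}{true} f g = refl
  true-ext {true}{false} f g = sym (f refl)
  true-ext {false}{true} f g = g refl
  true-ext {false}{false} f g = refl
  enc≡ : ∀ {l β}-> is β l ! -> l ~ encL β
  enc≡ = ==-
  mkAtom : ∀ α β γ -> Valid α -> Valid β -> Valid γ -> Cons α β γ -> ∃[ j ] (j < total × ℓ01 (atm j)~ encL α × ℓ12 (atm j)~ encL β × ℓ02 (atm j)~ encL γ)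
  mkAtom α β γ a b c h = numb α β γ , numb< α β γ a b c h , numb-ℓ01 α β γ a b c h , numb-ℓ12 α β γ a b c h , numb-ℓ02 α β γ a b c h
  ident-valid : ∀ x -> Valid (ident x)
  ident-valid true = tt
  ident-valid false = tt
  ident-id : ∀ x -> idLab (encL (ident x)) !
  ident-id true = idLab-enc (zz true)
  ident-id false = idLab-enc (pp idn)
  conv-ident : ∀ x -> convL (ident x)~ ident x
  conv-ident true = refl
  conv-ident false = refl
  cons-idʳ : ∀ γ -> ∃[ x ] Cons γ (ident x) γ
  cons-idʳ γ = srcZ (convL γ), subst₂ (\y z -> Cons y z y)(convL-convL γ)(cong convL (conv-ident _)& conv-ident _)
   (rot (convL γ)(convL (convL γ))(convL (ident _))(rot (ident _)(convL γ)(convL γ)(cons-id (convL γ))))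
  id-mid : ∀ α β γ -> isId β ! -> Cons α β γ -> α ~ γ
  id-mid (pp a)(pp idn)(pp c) e h = cong pp (Pok.i2 h refl)
  id-mid (zp κ)(pp idn)(zp κ') e h = cong zp (Zok.ii h refl)
  id-mid (pz κ)(zz true)(pz κ') e h = cong pz (h refl)
  id-mid (zz a)(zz true)(zz c) e (_ , h , _) = cong zz (h refl)
  id-first : ∀ α β γ -> isId α ! -> Cons α β γ -> β ~ γ
  id-first (pp idn)(pp b)(pp c) e h = cong pp (Pok.i1 h refl)
  id-first (pp idn)(pz κ)(pz κ') e h = cong pz (sym (Zok.ii h refl))
  id-first (zz true)(zp κ)(zp κ') e h = cong zp (h refl)
  id-first (zz true)(zz b)(zz c) e (h , _) = cong zz (h refl)
  isId- : ∀ {l β}-> l ~ encL β -> idLab l ! -> isId β !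
  isId- {β = β} refl h = sym (idLab-enc β)& h
 same-mid : ∀ j -> j < total -> idLab (ℓ12 (atm j)) ! -> ℓ01 (atm j)~ ℓ02 (atm j)
 same-mid j l h = let open Atom (atom j l) in trans e1 (cong encL (id-mid α β γ (isId- {β = β} e2 h) cons)& sym e3)
 same-first : ∀ j -> j < total -> idLab (ℓ01 (atm j)) ! -> ℓ12 (atm j)~ ℓ02 (atm j)
 same-first j l h = let open Atom (atom j l) in trans e2 (cong encL (id-first α β γ (isId- {β = α} e1 h) cons)& sym e3)
 cyl- : ∀ i x j -> j < total -> has (A.cyl i x) j ! -> ∃[ j' ] (j' < total × has x j' ! × edge (ix i)(atm j)~ edge (ix i)(atm j'))
 cyl- i x j l h = let j' , l' , q = anyN- total (\j' -> has x j' && (edge (ix i)(atm j) == edge (ix i)(atm j')))(sym (has-cyl i x j l)& h)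
                      a , b = &- {has x j'} q in j' , l' , a , ==- b
 single : ℕ -> A.Carrier
 single j = elt (\i -> i == j)
 pick : A.Carrier -> ℕ
 pick a = findN (has a) total
 nonzero- : ∀ x -> x # A.⊥ -> ∃[ j ] (j < total × has x j !)
 nonzero- x n with em 0ℓ {∃[ j ] (j < total × has x j !)}
 ... | yes p = p
 ... | no q = efq (n (has-ext x A.⊥ \j l -> trans (off (\h -> q (j , l , h)))(sym (has-bot j l))))
  where
  off : ∀ {c}->(c ! -> Empty)-> c ~ false
  off {true} h = efq (h refl)
  off {false} h = refl
 below- : ∀ x y -> x A.⊑ y -> ∀ j -> j < total -> has x j ! -> has y j !
 below- x y h j l e = snd (&- {has x j}(sym (has-meet x y j l)& cong (\z -> has z j) h & e))
 below+ : ∀ x y ->(∀ j -> j < total -> has x j ! -> has y j !)-> x A.⊑ y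
 below+ x y h = has-ext _ x \j l -> trans (has-meet x y j l)(absorb (h j l))
  where
  absorb : ∀ {a b}->(a ! -> b !)-> a && b ~ a
  absorb {true} g = g refl
  absorb {false} g = refl
 single-at : ∀ j -> j < total -> has (single j) j !
 single-at j l = has-elt _ j l & ==+ {j} refl
 single-only : ∀ j i -> i < total -> has (single j) i ! -> i ~ j
 single-only j i l h = ==- (sym (has-elt _ i l)& h)
 pick-single : ∀ j -> j < total -> pick (single j)~ j
 pick-single j l = let h , l' = findN-sat (has (single j)) total j l (single-at j l) in single-only j _ l' h
 single-atom : ∀ j -> j < total -> A.IsAtom (single j)
 single-atom j l = record
  { nonzero = \e -> case trans (sym (single-at j l))(cong (\x -> has x j) e & has-bot j l) of \()
  ; minimal = \x h n -> has-ext x (single j) \i li -> true-ext (below- x (single j) h i li)(\e -> let k , lk , q = nonzero- x n in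
   subst (\z -> has x z !)(single-only j k lk (below- x (single j) h k lk q)& sym (single-only j i li e)) q) }
 atom-single : ∀ a -> A.IsAtom a -> pick a < total × a ~ single (pick a)
 atom-single a ia = let j , l , h = nonzero- a (A.IsAtom.nonzero ia)
                        p , l' = findN-sat (has a) total j l h
  in l' , sym (A.IsAtom.minimal ia (single (pick a))(below+ _ a \i li e -> subst (\z -> has a z !)(sym (single-only (pick a) i li e)) p)
   (A.IsAtom.nonzero (single-atom (pick a) l')))
 cyl-r01 : ∀ P -> A.cyl 2F (r01 P)~ r01 P
 cyl-r01 P = has-ext _ _ \j j< -> trans (has-cyl 2F (r01 P) j j<)(true-ext
  (\h -> let i , i< , q = anyN- total _ h; a , b = &- {has (r01 P) i} q in
   subst (\x -> P x !)(sym (==- b))(sym (has-elt _ i i<)& a))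
  (\h -> anyN+ total _ j j< (&+ (has-elt _ j j< & h)(==+ {ℓ01 (atm j)} refl)))& sym (has-elt _ j j<))
 private
  cylQ : Fin 3 -> A.Carrier -> ℕ -> ℕ -> Bool
  cylQ i x j j' = has x j' && (edge (ix i)(atm j) == edge (ix i)(atm j'))
  shift1 : ∀ x P ->(∀ i -> i < total -> has x i ~ idLab (ℓ12 (atm i)) && P (ℓ01 (atm i)))-> A.cyl 1F x ~ r02 P
  shift1 x P hx = has-ext _ _ \j j< -> trans (has-cyl 1F x j j<)(true-ext (fwd j)(bwd j j<)& sym (has-elt (\j -> P (ℓ02 (atm j))) j j<))
   where
   fwd : ∀ j -> anyN total (cylQ 1F x j) ! -> P (ℓ02 (atm j)) !
   fwd j h = let i , i< , q = anyN- total (cylQ 1F x j) h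
                 a , b = &- {has x i} q
                 d , p = &- {idLab (ℓ12 (atm i))}(sym (hx i i<)& a)
                 open Atom (atom i i<)
                 α≡γ = id-mid α β γ (isId- {β = β} e2 d) cons
    in subst (\x -> P x !)(e1 & cong encL α≡γ & sym e3 & sym (==- b)) p
   bwd : ∀ j -> j < total -> P (ℓ02 (atm j)) ! -> anyN total (cylQ 1F x j) !
   bwd j j< h = let open Atom (atom j j<)
                    y , k = cons-idʳ γ
                    i , i< , a , b , c = mkAtom γ (ident y) γ v3 (ident-valid y) v3 k
    in anyN+ total (cylQ 1F x j) i i< (&+ {has x i}(hx i i< & &+ (cong idLab b & ident-id y)
     (subst (\y -> P y !)(e3 & sym a) h))(==+ (e3 & sym c)))
  shift0 : ∀ x P ->(∀ i -> i < total -> has x i ~ idLab (ℓ01 (atm i)) && P (ℓ02 (atm i)))-> A.cyl zero x ~ r12 P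
  shift0 x P hx = has-ext _ _ \j j< -> trans (has-cyl zero x j j<)(true-ext (fwd j)(bwd j j<)& sym (has-elt (\j -> P (ℓ12 (atm j))) j j<))
   where
   fwd : ∀ j -> anyN total (cylQ zero x j) ! -> P (ℓ12 (atm j)) !
   fwd j h = let i , i< , q = anyN- total (cylQ zero x j) h
                 a , b = &- {has x i} q
                 d , p = &- {idLab (ℓ01 (atm i))}(sym (hx i i<)& a)
                 open Atom (atom i i<)
                 β≡γ = id-first α β γ (isId- {β = α} e1 d) cons
    in subst (\x -> P x !)(e3 & cong encL (sym β≡γ)& sym e2 & sym (==- b)) p
   bwd : ∀ j -> j < total -> P (ℓ12 (atm j)) ! -> anyN total (cylQ zero x j) !
   bwd j j< h = let open Atom (atom j j<)
                    i , i< , a , b , c = mkAtom (ident (srcZ β)) β β (ident-valid (srcZ β)) v2 v2 (cons-id β)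
    in anyN+ total (cylQ zero x j) i i< (&+ {has x i}(hx i i< & &+ (cong idLab a & ident-id (srcZ β))
     (subst (\y -> P y !)(e2 & sym c) h))(==+ (e2 & sym b)))
 shift-r02 : ∀ P -> A.cyl 1F (A.diag 1F 2F A.∧ r01 P)~ r02 P
 shift-r02 P = shift1 _ P \i i< -> trans (has-meet (A.diag 1F 2F)(r01 P) i i<)(cong2 _&&_ (has-diag 1F 2F i i<)(has-elt (\j -> P (ℓ01 (atm j))) i i<))
 shift-r12 : ∀ P -> A.cyl zero (A.diag zero 1F A.∧ r02 P)~ r12 P
 shift-r12 P = shift0 _ P \i i< -> trans (has-meet (A.diag zero 1F)(r02 P) i i<)(cong2 _&&_ (has-diag zero 1F i i<)(has-elt (\j -> P (ℓ02 (atm j))) i i<))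
 cyl+ : ∀ i x j j' -> j < total -> j' < total -> edge (ix i)(atm j)~ edge (ix i)(atm j')-> has x j' ! -> has (A.cyl i x) j !
 cyl+ i x j j' l l' e h = has-cyl i x j l & anyN+ total (cylQ i x j) j' l' (&+ {has x j'} h (==+ {edge (ix i)(atm j)} e))
 private
  is-enc : ∀ {α β}-> is β (encL α) ! -> α ~ β
  is-enc {α}{β} h = enc-inj α β (==- h)
  is-self : ∀ β -> is β (encL β) !
  is-self β = ==+ {encL β} refl
  isT- : ∀ {α}-> isT (encL α) ! -> ∃[ t ] (t < N × α ~ pp (tl t))
  isT- {α} h = let t , t< , q = anyN- N (\t -> is (pp (tl t))(encL α)) h in t , t< , is-enc {α}{pp (tl t)} q
  isT+ : ∀ {t}-> t < N -> isT (encL (pp (tl t))) !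
  isT+ {t} t< = anyN+ N (\u -> is (pp (tl u))(encL (pp (tl t)))) t t< (is-self (pp (tl t)))
  isF- : ∀ {α}-> isF (encL α) ! -> α ~ pp nx ⊎ α ~ pp ft
  isF- {α} h with is (pp nx)(encL α) in e
  ... | true = inl (is-enc {α}{pp nx} e)
  ... | false = inr (is-enc {α}{pp ft} h)
  law : (F : ℕ -> ℕ -> ℕ -> Set)->(∀ α β γ -> Valid α -> Valid β -> Valid γ -> Cons α β γ -> F (encL α)(encL β)(encL γ))->
   ∀ j -> j < total -> F (ℓ01 (atm j))(ℓ12 (atm j))(ℓ02 (atm j))
  law F h j j< = let open Atom (atom j j<) in
   subst₂ (\x y -> F x y (ℓ02 (atm j)))(sym e1)(sym e2)(subst (F (encL α)(encL β))(sym e3)(h α β γ v1 v2 v3 cons))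
  ver-tile : ∀ t γ -> Valid γ -> Cons (pp (tl t))(pp nx) γ ->(∃[ u ] (u < N × γ ~ pp (tl u)))⊎ γ ~ pp w
  ver-tile t (pp ℓ) v k = go ℓ v (fst (&- {verOk t ℓ}(RU.un (Pok.r1 k))))
   where
   go : ∀ ℓ -> VPL ℓ -> verOk t ℓ ! ->(∃[ u ] (u < N × pp ℓ ~ pp (tl u)))⊎ pp ℓ ~ pp w
   go (tl u) v h = inl (u , v , refl)
   go w v h = inr refl
  hor-tile : ∀ t β -> Valid β -> Cons (pp nx) β (pp (tl t))->(∃[ u ] (u < N × β ~ pp (tl u)× hor t u !))⊎ β ~ pp w
  hor-tile t (pp ℓ) v k = go ℓ v (RU.un (Pok.r5 k))
   where
   go : ∀ ℓ -> VPL ℓ -> horOk t (conv ℓ) ! ->(∃[ u ] (u < N × pp ℓ ~ pp (tl u)× hor t u !))⊎ pp ℓ ~ pp w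
   go (tl u) v h = inl (u , v , refl , h)
   go w v h = inr refl
  ft-next : ∀ α γ ->(α ~ pp nx ⊎ α ~ pp ft)-> Cons α (pp nx) γ -> γ ~ pp ft ⊎ γ ~ pp w
  ft-next α (pp ℓ)(inl refl) k = go ℓ (RU.un (Pok.r1 k))
   where
   go : ∀ ℓ -> isft ℓ ! -> pp ℓ ~ pp ft ⊎ pp ℓ ~ pp w
   go ft h = inl refl
   go w h = inr refl
  ft-next α (pp ℓ)(inr refl) k = go ℓ (RU.un (Pok.r1 k))
   where
   go : ∀ ℓ -> isft ℓ ! -> pp ℓ ~ pp ft ⊎ pp ℓ ~ pp w
   go ft h = inl refl
   go w h = inr refl
  run-ok : ∀ t -> runOk start (tl t) ! -> bad t ~ false
  run-ok t r rewrite ==-refl start with bad t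
  ... | false = refl
 -- The relations of the edges of the atoms satisfy the laws.
 rl : ℕ -> ℕ -> Bool
 rl 0 = isG
 rl 1 = isP
 rl 2 = isF
 rl 3 = isW
 rl 4 = isT
 rl (suc (suc (suc (suc (suc t))))) = isTt t
 open LawTerms TS
 ρ : ℕ -> A.Carrier
 ρ k = r01 (rl k)
 private
  evN : T3' -> A.Carrier
  evN = eval algA ρ
  ev02 : ∀ k -> evN (R02 k)~ r02 (rl k)
  ev02 k = cong (\x -> A.cyl 1F (A.diag 1F 2F A.∧ x))(cyl-r01 (rl k))& shift-r02 (rl k)
  ev12 : ∀ k -> evN (R12 k)~ r12 (rl k)
  ev12 k = cong (\x -> A.cyl zero (A.diag zero 1F A.∧ x))(ev02 k)& shift-r12 (rl k)
  atN : ∀ {x f}-> x ~ elt f -> ∀ j -> j < total -> has x j ~ f j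
  atN {f = f} e j l = cong (\x -> has x j) e & has-elt f j l
  enc : ∀ {α} β -> is β (encL α) ! -> α ~ β
  enc {α} β = is-enc {α}{β}
  tile-or-w : ∀ {γ}->(∃[ u ] (u < N × γ ~ pp (tl u)))⊎ γ ~ pp w -> isT (encL γ) ! ⊎ isW (encL γ) !
  tile-or-w (inl (u , u< , refl)) = inl (isT+ u<)
  tile-or-w (inr refl) = inr (is-self (pp w))
  inw' : ∀ α β γ -> Cons α β γ -> isG (encL α) ! -> isG (encL γ) ! -> ¬ isW (encL β) !
  inw' α β γ k a c d with enc {α}(zp 0) a | enc {γ}(zp 0) c | enc {β}(pp w) d
  ... | refl | refl | refl = Zok.gg k refl refl refl
  hor' : ∀ t u α β γ -> Valid β -> Cons α β γ -> isP (encL α) ! -> isTt t (encL γ) ! -> isTt u (encL β) ! -> hor t u !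
  hor' t u α β γ v k a c d with enc {α}(pp nx) a | enc {γ}(pp (tl t)) c | enc {β}(pp (tl u)) d
  ... | refl | refl | refl with hor-tile t (pp (tl u)) v k
  ... | inl (.u , _ , refl , g) = g
  hort' : ∀ α β γ -> Valid β -> Cons α β γ -> isP (encL α) ! -> isT (encL γ) ! -> isT (encL β) ! ⊎ isW (encL β) !
  hort' α β γ v k a c with enc {α}(pp nx) a | isT- {γ} c
  ... | refl | t , _ , refl = tile-or-w ([ (\(u , l , e , _)-> inl (u , l , e)), inr ]′ (hor-tile t β v k))
  ver' : ∀ t u α β γ -> Cons α β γ -> isTt t (encL α) ! -> isP (encL β) ! -> isTt u (encL γ) ! -> ver t u !
  ver' t u α β γ k a c d with enc {α}(pp (tl t)) a | enc {β}(pp nx) c | enc {γ}(pp (tl u)) d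
  ... | refl | refl | refl = fst (&- {ver t u}(RU.un (Pok.r1 k)))
  vert' : ∀ α β γ -> Valid γ -> Cons α β γ -> isT (encL α) ! -> isP (encL β) ! -> isT (encL γ) ! ⊎ isW (encL γ) !
  vert' α β γ v k a c with isT- {α} a | enc {β}(pp nx) c
  ... | t , _ , refl | refl = tile-or-w (ver-tile t γ v k)
  ff' : ∀ α β γ -> Cons α β γ -> isF (encL α) ! -> isP (encL β) ! -> isF (encL γ) ! ⊎ isW (encL γ) !
  ff' α β γ k a c with enc {β}(pp nx) c
  ... | refl with ft-next α γ (isF- {α} a) k
  ... | inl refl = inl refl
  ... | inr refl = inr (is-self (pp w))
  bad' : ∀ t α β γ -> Cons α β γ -> isTt start (encL α) ! -> isF (encL β) ! -> isTt t (encL γ) ! -> bad t ~ false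
  bad' t α β γ k a c d with enc {α}(pp (tl start)) a | isF- {β} c | enc {γ}(pp (tl t)) d
  ... | refl | inl refl | refl = run-ok t (snd (&- {ver start t}(RU.un (Pok.r1 k))))
  ... | refl | inr refl | refl = run-ok t (RU.un (Pok.r1 k))
 laws : Lawful TS
 laws = record
  { S = Σ[ j ∈ ℕ ] j < total; E = ℕ; sem = \t (j , _)-> has (evN t) j
  ; p01 = \(j , _)-> ℓ01 (atm j); p02 = \(j , _)-> ℓ02 (atm j); p12 = \(j , _)-> ℓ12 (atm j); rl = rl
  ; sem-∨ = \t u (j , l)-> has-join (evN t)(evN u) j l; sem-∧ = \t u (j , l)-> has-meet (evN t)(evN u) j l
  ; sem-∼ = \t (j , l)-> has-comp (evN t) j l; sem-⊥ = \(j , l)-> has-bot j l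
  ; sem01 = \k (j , l)-> atN (cyl-r01 (rl k)) j l; sem02 = \k (j , l)-> atN (ev02 k) j l; sem12 = \k (j , l)-> atN (ev12 k) j l
  ; l-suc = \(j , l) h -> let i , i< , a , b , c = mkAtom (zp 0)(pp nx)(zp 0) zl tt zl (zok (\_ _ ())(\_ ())(\_ _ ())(\())) in
   cyl+ 2F (evN (R02 vG ∧ R12 vP)) j i l i< (enc≡ {ℓ01 (atm j)}{zp 0} h & sym a)
    (has-meet (evN (R02 vG))(evN (R12 vP)) i i< & &+ (atN (ev02 vG) i i< & cong isG c & is-self (zp 0))(atN (ev12 vP) i i< & cong isP b & is-self (pp nx)))
  ; l-inw = \(j , l)-> law (\a b c -> isG a ! -> isG c ! -> ¬ isW b !)(\α β γ _ _ _ -> inw' α β γ) j l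
  ; l-hor = \(j , l) t u -> law (\a b c -> isP a ! -> isTt t c ! -> isTt u b ! -> hor t u !)(\α β γ _ v _ -> hor' t u α β γ v) j l
  ; l-hort = \(j , l)-> law (\a b c -> isP a ! -> isT c ! -> isT b ! ⊎ isW b !)(\α β γ _ v _ -> hort' α β γ v) j l
  ; l-ver = \(j , l) t u -> law (\a b c -> isTt t a ! -> isP b ! -> isTt u c ! -> ver t u !)(\α β γ _ _ _ -> ver' t u α β γ) j l
  ; l-vert = \(j , l)-> law (\a b c -> isT a ! -> isP b ! -> isT c ! ⊎ isW c !)(\α β γ _ _ v -> vert' α β γ v) j l
  ; l-pf = \(j , _) h -> cong (_|| is (pp ft)(ℓ01 (atm j))) h
  ; l-ff = \(j , l)-> law (\a b c -> isF a ! -> isP b ! -> isF c ! ⊎ isW c !)(\α β γ _ _ _ -> ff' α β γ) j l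
  ; l-bad = \(j , l) t -> law (\a b c -> isTt start a ! -> isF b ! -> isTt t c ! -> bad t ~ false)(\α β γ _ _ _ -> bad' t α β γ) j l
  ; l-til = \(j , l) h -> anyN- N (\t -> isTt t (ℓ01 (atm j))) h
  ; l-st = \(j , l) t p q -> case enc-inj (pp (tl t))(pp (tl start))(sym (==- {ℓ01 (atm j)} q)& ==- {ℓ01 (atm j)} p) of \ { refl -> refl }
  ; l-stl = \(j , l) h -> anyN+ N (\t -> isTt t (ℓ01 (atm j))) start start< h }
 ev-corner : evN (fst equation)~ cornerEl
 ev-corner = has-ext _ _ \j l -> trans (has-meet (evN lawful)(evN corner) j l)(cong2 _&&_ (valid j l)(edges j l)& sym (has-elt _ j l))
  where
  valid : ∀ j -> j < total -> has (evN lawful) j !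
  valid j l = has-comp _ j l & (not+ \h -> let j1 , l1 , h1 , _ = cyl- zero _ j l h; j2 , l2 , h2 , _ = cyl- 1F _ j1 l1 h1; j3 , l3 , h3 , _ = cyl- 2F _ j2 l2 h2 in
   Lawful.never (Lawful.never-violation laws)(j3 , l3) h3)
  edges : ∀ j -> j < total -> has (evN corner) j ~ isG (ℓ01 (atm j)) && (isG (ℓ02 (atm j)) && isTt start (ℓ12 (atm j)))
  edges j l = has-meet (evN (R01 vG)) _ j l & cong2 _&&_ (atN (cyl-r01 isG) j l)
   (has-meet (evN (R02 vG))(evN (R12 (vT start))) j l & cong2 _&&_ (atN (ev02 vG) j l)(atN (ev12 (vT start)) j l))
 module FromHom {m : ℕ}{B : CA (6 + m) 0ℓ 0ℓ}(h : Hom algA B) where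
  open Hom h
  open Relations B
  to≡ : ∀ {x y}-> x ~ y -> to x ≈ to y
  to≡ refl = ~refl
  system : ¬ (to cornerEl ≈ 𝟎)-> System TS B
  system nz = FromEquation.system TS h ρ (\z -> nz (~trans (to≡ (sym ev-corner)) z))
  collapse : A.cyl 2F (A.cyl 1F (A.cyl zero cornerEl))~ A.⊤ -> to cornerEl ≈ 𝟎 -> 𝟏 ≈ 𝟎
  collapse top z = ~trans (~sym to-⊤)(~trans (to≡ (sym top))(~trans (to-cy 2F _)(zero-cyl _
   (~trans (to-cy 1F _)(zero-cyl _ (~trans (to-cy zero cornerEl)(zero-cyl _ z)))))))
 corner#⊥ : cornerEl # A.⊥
 corner#⊥ e = let i , i< , a , b , c = mkAtom (zp 0)(pp (tl start))(zp 0) zl start< zl (zok (\_ _ ())(\_ ())(\_ _ ())(\())) in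
  case trans (sym (has-elt _ i i< & &+ (cong isG a & is-self (zp 0))(&+ (cong isG c & is-self (zp 0))(cong (isTt start) b & is-self (pp (tl start))))))(cong (\x -> has x i) e & has-bot i i<) of \()
 -- from any atom the corner is reached by changing the coordinates 2, 1 and 0
 corner-top : A.cyl 2F (A.cyl 1F (A.cyl zero cornerEl))~ A.⊤
 corner-top = has-ext _ _ \j j< -> trans (reach j j<)(sym (has-top j j<))
  where
  apex = mkAtom (zp 0)(pp (tl start))(zp 0) zl start< zl (zok (\_ _ ())(\_ ())(\_ _ ())(\()))
  lk : Lab -> Lab
  lk (pp _) = pp w
  lk (zp _) = zp 0
  lk (pz _) = pp w
  lk (zz _) = zp 0
  mid : Lab -> Lab
  mid (pp _) = pp w
  mid (zp _) = pp o
  mid (pz _) = zp 1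
  mid (zz _) = zp 0
  open RuLemmas TS
  pok-w : ∀ α -> Pok α w w
  pok-w α = record { r1 = mk refl; r2 = mk refl; r3 = mk refl; r4 = mk refl; r5 = mk (ru-w3 w α); r6 = mk (ru-w3 w (conv α))
   ; i1 = \_ -> refl; i2 = \(); i3 = \() }
  pok-s : Pok w (tl start) w
  pok-s = record { r1 = mk refl; r2 = mk refl; r3 = mk refl; r4 = mk refl; r5 = mk refl; r6 = mk refl; i1 = \(); i2 = \(); i3 = \() }
  lk-valid : ∀ α -> Valid (lk α)
  lk-valid (pp _) = tt
  lk-valid (zp _) = zl
  lk-valid (pz _) = tt
  lk-valid (zz _) = zl
  mid-valid : ∀ α -> Valid (mid α)
  mid-valid (pp _) = tt
  mid-valid (zp _) = tt
  mid-valid (pz _) = ≤-trans (sl zl) 6≤K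
  mid-valid (zz _) = zl
  mid-cons : ∀ α -> Cons α (mid α)(lk α)
  mid-cons (pp α) = pok-w α
  mid-cons (zp κ) = zok (\_ _ ())(\R _ _ -> refl)(\R _ ())(\())
  mid-cons (pz κ) = zok (\_ ())(\R _ ())(\R _ _ -> refl)(\())
  mid-cons (zz a) = \_ -> refl
  lk-cons : ∀ α -> Cons (lk α)(pp (tl start))(lk α)
  lk-cons (pp _) = pok-s
  lk-cons (zp _) = zok (\_ _ ())(\_ ())(\_ _ ())(\())
  lk-cons (pz _) = pok-s
  lk-cons (zz _) = zok (\_ _ ())(\_ ())(\_ _ ())(\())
  reach : ∀ j -> j < total -> has (A.cyl 2F (A.cyl 1F (A.cyl zero cornerEl))) j !
  reach j j< =
   let open Atom (atom j j<)
       j0 , l0 , a0 , b0 , c0 = apex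
       j1 , l1 , a1 , b1 , c1 = mkAtom α (mid α)(lk α) v1 (mid-valid α)(lk-valid α)(mid-cons α)
       j2 , l2 , a2 , b2 , c2 = mkAtom (lk α)(pp (tl start))(lk α)(lk-valid α) start< (lk-valid α)(lk-cons α)
   in cyl+ 2F _ j j1 j< l1 (e1 & sym a1)(cyl+ 1F _ j1 j2 l1 l2 (c1 & sym c2)(cyl+ zero cornerEl j2 j0 l2 l0 (b2 & sym b0)
    (has-elt _ j0 l0 & &+ (cong isG a0 & is-self (zp 0))(&+ (cong isG c0 & is-self (zp 0))(cong (isTt start) b0 & is-self (pp (tl start)))))))

-- An algebra with injectively numbered elements, up to a bound.
record Bounded {n : ℕ}(A : Alg n 0ℓ 0ℓ) : Set where
 open Alg A
 field
  size : ℕ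
  num : Carrier -> Fin size
  num-inj : ∀ {x y}-> num x ~ num y -> x ≈ y

-- Algebras of rejecting programs and of programs that never stop.
module Verdict (em : EM)(b C : ℕ) where
 open Program b C
 TS : Tiles
 TS = tilesOf b C
 open Tiles TS
 open Triples em TS public using (algA; tableA)
 private
  module Ti = Tiling prog sound
 start< : start < N
 start< = Ti.tileAt< 0 0
 module _ {m : ℕ}{B : CA (6 + m) 0ℓ 0ℓ}(Sy : System TS B) where
  private
   module X = Extraction em TS B Sy
   module O = Occurrence em TS X.Excl X.exc-right X.exc-left X.exc-up X.exc-start X.exc-bad X.exc-all
   module D = Ti.Determined O.Occurs fst O.occ-right O.occ-left O.occ-up O.occ-start O.occ-bad
  not-rejecting : ∀ j -> st (suc j)# 1
  not-rejecting = D.no-reject O.occ-some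
  not-bounded : Bounded (CA.alg B)->(∀ j -> st j # 2)-> Empty
  not-bounded bd h = D.no-merge (clock h)(O.occ-common (X.exc-bounded (Bounded.size bd)(Bounded.num bd)(Bounded.num-inj bd)))
 module _ (n : ℕ) .(3≤n : 3 ≤ n)(never : ∀ j -> st j # 1) where
  abstract
   represented : SNr 3≤n (AllCA n) algA
   represented = Represent.member em TS (Model.structure em TS (Ti.Planes.plane never)(Codes.masks em TS)) n 3≤n
 neat-hom : ∀ {m}{A : Alg 3 0ℓ 0ℓ}(B : CA (6 + m) 0ℓ 0ℓ)-> Embedding A (Nr (m≤m+n 3 (3 + m)) B)-> Hom A B
 neat-hom B e = record { to = \x -> fst (E.to x); neat = \x -> snd (E.to x); to-∧ = E.∧-homo; to-∨ = E.∨-homo; to-∼ = E.∼-homo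
  ; to-⊤ = E.⊤-homo; to-⊥ = E.⊥-homo; to-cy = E.cyl-homo; to-dg = E.diag-homo }
  where module E = Embedding e
 module Ne = Negative em TS start<
 hom-system : ∀ {m}{B : CA (6 + m) 0ℓ 0ℓ}(h : Hom algA B)-> ¬ (Alg._≈_ (CA.alg B)(Hom.to h Ne.cornerEl)(Alg.⊥ (CA.alg B)))-> System TS B
 hom-system h = Ne.FromHom.system h
 rejected : ∀ m -> ∃[ j ] st (suc j)~ 1 -> ¬ SNr (m≤m+n 3 (3 + m))(AllCA (6 + m)) algA
 rejected m (j , r)(B , _ , e) = not-rejecting {m}{B}(hom-system (neat-hom B e)(\z -> Ne.corner#⊥ (Embedding.injective e
  (Alg.trans (CA.alg B) z (Alg.sym (CA.alg B)(Embedding.⊥-homo e)))))) j r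
 diag-top : ∀ {m}{B : CA (6 + m) 0ℓ 0ℓ}-> Embedding algA (Nr (m≤m+n 3 (3 + m)) B)-> ∀ i -> zero # i -> Alg.cyl algA i (Alg.diag algA zero i)~ Alg.⊤ algA
 diag-top {m}{B} e i ne = Embedding.injective e (L.~trans (L.~trans (Hom.to-cy k i (Alg.diag algA zero i))(L.cyl-cong (Hom.emb k i)(Hom.to-dg k zero i)))
  (L.~trans (L.cyl-diag' (Hom.emb k i)(Hom.emb k zero)(\q -> ne (sym (Fin.inject≤-injective (m≤m+n 3 (3 + m))(m≤m+n 3 (3 + m)) i zero q))))(L.~sym (Hom.to-⊤ k))))
  where
  module L = CALemmas B
  k = neat-hom B e

-- Sets of points with numbers below N are numbered by the numbers below 2 ^ N.
module Numbered (em : EM){C X : Set}(v : C -> X -> Bool)(N : ℕ)(code : X -> ℕ)(code< : ∀ x -> code x < N)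
 (code-inj : ∀ c {x y}-> code x ~ code y -> v c x ~ v c y) where
 open Classical em
 number : C -> Fin (2 ^ N)
 number c = fromℕ< (bits< N (\i -> tr (∃[ x ] (code x ~ i × v c x !))))
 number-inj : ∀ {c d}-> number c ~ number d -> ∀ x -> v c x ~ v d x
 number-inj {c}{d} h x = bext (go c d h)(go d c (sym h))
  where
  go : ∀ c d -> number c ~ number d -> v c x ! -> v d x !
  go c d h e = let y , p , q = tr- (sym (bit-bits N _ (code x)(code< x))& cong (\z -> bit z (code x))(sym same)& bit-bits N _ (code x)(code< x)& tr+ (x , refl , e))
   in trans (code-inj d (sym p)) q
   where
   same : bits N (\i -> tr (∃[ x ] (code x ~ i × v c x !)))~ bits N (\i -> tr (∃[ x ] (code x ~ i × v d x !)))
   same = sym (Fin.toℕ-fromℕ< (bits< N _))& cong ix h & Fin.toℕ-fromℕ< (bits< N _)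

-- The algebra of first order formulas on the clique tuples of a flat representation.
module FlatAlgebra (em : EM){A : Alg 3 0ℓ 0ℓ}(R : RelRep A)(m : ℕ)(fl : Flat R (6 + m)) where
 open RelRep R
 open Classical em
 private
  n = 6 + m
  module A = Alg A
  module E = Embedding rep
 Sat' : FO A.Carrier 3 n -> Vec M n -> Set
 Sat' = CliqueSat R
 Tuple : Set
 Tuple = Σ (Vec M n) CliqueTuple
 v : FO A.Carrier 3 n -> Tuple -> Bool
 v φ (x , _) = tr (Sat' φ x)
 or : FO A.Carrier 3 n -> FO A.Carrier 3 n -> FO A.Carrier 3 n
 or φ ψ = neg (conj (neg φ)(neg ψ))
 -- equivalence from equivalent satisfaction
 same : ∀ {φ ψ}->(∀ x -> CliqueTuple x ->(Sat' φ x -> Sat' ψ x)× (Sat' ψ x -> Sat' φ x))-> ∀ x -> v φ x ~ v ψ x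
 same h (x , u) = tr-cong (fst (h x u))(snd (h x u))
 private
  dne : ∀ {P : Set}-> ¬ ¬ P -> P
  dne {P} h with em 0ℓ {P}
  ... | yes p = p
  ... | no np = efq (h np)
  &&-tr : ∀ {P Q : Set}-> tr (P × Q)~ tr P && tr Q
  &&-tr {P}{Q} = bext (\h -> &+ (tr+ (fst (tr- h)))(tr+ (snd (tr- h))))(\h -> let a , b = &- {tr P} h in tr+ (tr- a , tr- b))
  not-tr : ∀ {P : Set}-> tr (¬ P)~ not (tr P)
  not-tr {P} = bext (\h -> not+ \e -> tr- h (tr- e))(\h -> tr+ \p -> not- {tr P} h (tr+ p))
  or-tr : ∀ {P Q : Set}-> tr (¬ (¬ P × ¬ Q))~ tr P || tr Q
  or-tr {P}{Q} = trans not-tr (cong not (&&-tr & cong2 _&&_ not-tr not-tr)& dm (tr P)(tr Q))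
   where
   dm : ∀ a b -> not (not a && not b)~ a || b
   dm true b = refl
   dm false true = refl
   dm false false = refl
  i0 : Fin n
  i0 = zero
  module P = Pointwise v or conj neg (eq i0 i0)(neg (eq i0 i0))(\a b x -> or-tr)(\a b x -> &&-tr)(\a x -> not-tr)(\x -> tr+ refl)(\x -> trans not-tr (cong not (tr+ refl)))
 private
  vec-ext : ∀ {k}(s t : Vec M k)->(∀ j -> look s j ~ look t j)-> s ~ t
  vec-ext s t h = sym (Vec.tabulate∘lookup s)& Vec.tabulate-cong h & Vec.tabulate∘lookup t
  copy : ∀ (x : Vec M n)-> CliqueTuple x -> ∀ i k -> ∃[ y ] (CliqueTuple y × AgreeOff k x y × look y k ~ look x i)
  copy x u i k = x [ k ]≔ look x i , (\s h -> u s (VecAll.map inside h)), (\j ne -> Vec.lookup∘updateAt′ j k ne x), Vec.lookup∘updateAt k x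
   where
   inside : ∀ {a}-> a VecM.∈ (x [ k ]≔ look x i)-> a VecM.∈ x
   inside {a} p with VecAny.index p Fin.≟ k | VecAnyP.lookup-index p
   ... | yes e | q = subst (VecM._∈ x)(sym (q & cong (look (x [ k ]≔ look x i)) e & Vec.lookup∘updateAt k x))(VecMP.∈-lookup i x)
   ... | no ne | q = subst (VecM._∈ x)(sym (q & Vec.lookup∘updateAt′ (VecAny.index p) k ne x))(VecMP.∈-lookup (VecAny.index p) x)
 foAlg : Alg n 0ℓ 0ℓ
 foAlg = record
  { Carrier = FO A.Carrier 3 n; _≈_ = P._≋_; isEquivalence = record { refl = \x -> refl; sym = \h x -> sym (h x); trans = \h k x -> trans (h x)(k x) }
  ; _∨_ = or; _∧_ = conj; ∼_ = neg; ⊤ = eq i0 i0; ⊥ = neg (eq i0 i0); cyl = ex; diag = eq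
  ; ∨-cong = \ {a}{a'}{b}{b'}-> IsBooleanAlgebra.∨-cong P.boolean {a}{a'}{b}{b'}
  ; ∧-cong = \ {a}{a'}{b}{b'}-> IsBooleanAlgebra.∧-cong P.boolean {a}{a'}{b}{b'}
  ; ∼-cong = \ {a}{b}-> IsBooleanAlgebra.¬-cong P.boolean {a}{b}
  ; cyl-cong = \i {φ}{ψ} h -> same {ex i φ}{ex i ψ} \x u ->
   (\(y , g , a , s)-> y , g , a , tr- (sym (h (y , g))& tr+ s)), (\(y , g , a , s)-> y , g , a , tr- (h (y , g)& tr+ s)) }
 foCA : CA n 0ℓ 0ℓ
 foCA = record { alg = foAlg; isCA = record
  { isBooleanAlgebra = P.boolean
  ; cyl-⊥ = \i -> same {ex i (neg (eq i0 i0))}{neg (eq i0 i0)} \x u ->(\(y , g , a , s)-> efq (s refl)), (\s -> efq (s refl))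
  ; cyl-⊑ = \i φ -> same {conj φ (ex i φ)}{φ} \x u -> fst , (\s -> s , x , u , (\j _ -> refl), s)
  ; cyl-∧ = \i φ ψ -> same {ex i (conj φ (ex i ψ))}{conj (ex i φ)(ex i ψ)} \x u ->
   (\(y , g , a , s , z , w' , a' , t)->(y , g , a , s), (z , w' , (\j ne -> trans (a' j ne)(a j ne)), t)) ,
   (\((y , g , a , s), (z , w' , a' , t))-> y , g , a , s , z , w' , (\j ne -> trans (a' j ne)(sym (a j ne))), t)
  ; cyl-comm = \i j φ -> same {ex i (ex j φ)}{ex j (ex i φ)} \x u -> Equivalence.to (snd fl φ x u i j), Equivalence.from (snd fl φ x u i j)
  ; diag-⊤ = \i -> same {eq i i}{eq i0 i0} \x u ->(\_ -> refl), (\_ -> refl)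
  ; diag-cyl = \i j k ki kj -> same {eq i j}{ex k (conj (eq i k)(eq k j))} \x u ->
   (\e -> let y , g , a , b = copy x u i k in y , g , a , trans (a i (ki ∘ sym))(sym b), trans b (e & sym (a j (kj ∘ sym)))) ,
   (\(y , g , a , s , t)-> trans (sym (a i (ki ∘ sym)))(s & t & a j (kj ∘ sym)))
  ; diag-sub = \i j φ ij -> same {conj (ex i (conj (eq i j) φ))(ex i (conj (eq i j)(neg φ)))}{neg (eq i0 i0)} \x u ->
   (\((y , g , a , s , t), (z , w' , a' , s' , t'))-> efq (t' (subst (Sat' φ)(vec-ext y z (\l -> eqs i j ij {x}{y}{z} a s a' s' l (l Fin.≟ i))) t))), (\s -> efq (s refl)) } }
  where
  eqs : ∀ i j -> i # j -> ∀ {x y z : Vec M n}-> AgreeOff i x y -> look y i ~ look y j -> AgreeOff i x z -> look z i ~ look z j -> ∀ l -> Dec (l ~ i)-> look y l ~ look z l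
  eqs i j ij a s a' s' l (no ne) = a l ne & sym (a' l ne)
  eqs i j ij a s a' s' .i (yes refl) = s & a j (ij ∘ sym)& sym (a' j (ij ∘ sym))& sym s'
 private
  idx : Vec (Fin n) 3
  idx = zero ∷ suc zero ∷ suc 1F ∷ []
  first : Vec M n -> Vec M 3
  first x = Vec.map (look x) idx
  inV : ∀ x -> CliqueTuple x -> V (first x)
  inV x u = u (first x)(VecMP.∈-lookup zero x VecAll.∷ VecMP.∈-lookup 1F x VecAll.∷ VecMP.∈-lookup 2F x VecAll.∷ VecAll.[])
  emb : Fin 3 -> Fin n
  emb i = inject≤ i (m≤m+n 3 (3 + m))
  first-at : ∀ x i -> look (first x) i ~ look x (emb i)
  first-at x zero = refl
  first-at x 1F = refl
  first-at x 2F = refl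
  first-agree : ∀ {x y : Vec M n}->(∀ i -> look y (emb i)~ look x (emb i))-> first y ~ first x
  first-agree {x}{y} h = vec-ext _ _ \i -> trans (first-at y i)(h i & sym (first-at x i))
  emb-inj : ∀ {i j}-> i # j -> emb i # emb j
  emb-inj n e = n (Fin.inject≤-injective _ _ _ _ e)
  idx-upd : ∀ i (y : Vec M n)-> Vec.map (look y)(idx [ i ]≔ emb i)~ first y
  idx-upd zero y = refl
  idx-upd 1F y = refl
  idx-upd 2F y = refl
  idx-at : ∀ j -> look idx j ~ emb j
  idx-at zero = refl
  idx-at 1F = refl
  idx-at 2F = refl
 hom : Hom A foCA
 hom = record
  { to = \a -> rel a idx
  ; neat = \a k le -> same {ex k (rel a idx)}{rel a idx} \x u ->(\(y , g , ag , s)-> subst (_⊨ a)(first-agree {x}{y}(\i -> ag (emb i)(low i k le))) s), (\s -> x , u , (\_ _ -> refl), s)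
  ; to-∧ = \a b -> same {rel (a A.∧ b) idx}{conj (rel a idx)(rel b idx)} \x u -> fst (E.∧-homo a b), snd (E.∧-homo a b)
  ; to-∨ = \a b -> same {rel (a A.∨ b) idx}{or (rel a idx)(rel b idx)} \x u ->
   (\s (p , q)-> [ p , q ]′ (fst (E.∨-homo a b) s)) ,
   (\s -> snd (E.∨-homo a b)(dne \k -> s ((\p -> k (inl p)), (\q -> k (inr q)))))
  ; to-∼ = \a -> same {rel (A.∼ a) idx}{neg (rel a idx)} \x u ->(\s -> snd (fst (E.∼-homo a) s)), (\s -> snd (E.∼-homo a)(inV x u , s))
  ; to-⊤ = same {rel A.⊤ idx}{eq i0 i0} \x u ->(\_ -> refl), (\_ -> snd E.⊤-homo (inV x u))
  ; to-⊥ = same {rel A.⊥ idx}{neg (eq i0 i0)} \x u ->(\s -> efq (fst E.⊥-homo s)), (\s -> efq (s refl))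
  ; to-cy = \i a -> same {rel (A.cyl i a) idx}{ex (emb i)(rel a idx)} \x u ->
   (\s -> let y , g , ag , t = fst fl x u a i idx (emb i)(\j ne e -> emb-inj (ne ∘ sym)(e & idx-at j)) s in y , g , ag , subst (_⊨ a)(idx-upd i y) t) ,
   (\(y , g , ag , s)-> snd (E.cyl-homo i a)(inV x u , first y , s , \j ne -> trans (first-at y j)(ag (emb j)(emb-inj ne)& sym (first-at x j))))
  ; to-dg = \i j -> same {rel (A.diag i j) idx}{eq (emb i)(emb j)} \x u ->
   (\s -> trans (sym (first-at x i))(snd (fst (E.diag-homo i j) s)& first-at x j)) ,
   (\e -> snd (E.diag-homo i j)(inV x u , trans (first-at x i)(e & sym (first-at x j)))) }
  where
  low : ∀ i k -> 3 ≤ ix k -> emb i # k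
  low i k le refl = ℕ.<⇒≱ (Fin.toℕ<n i)(subst (3 ≤_)(Fin.toℕ-inject≤ i _) le)
 constant : (A.cyl 1F (A.diag zero 1F)) A.≈ A.⊤ ->(A.cyl 2F (A.diag zero 2F)) A.≈ A.⊤ -> ¬ (A.⊤ A.≈ A.⊥)-> Tuple
 constant h1 h2 nt = Vec.replicate n p , \s h -> subst V (sym (vec-ext s _ \j -> trans (inside (VecAllP.lookup⁺ h j))(sym (Vec.lookup-replicate j p)))) vp
  where
  nonempty : ∃[ s ] V s
  nonempty with em 0ℓ {∃[ s ] V s}
  ... | yes q = q
  ... | no q = efq (nt (E.injective ((\s -> efq (q (_ , fst E.⊤-homo s))), (\s -> efq (fst E.⊥-homo s)))))
  p : M
  p = look (fst nonempty) zero
  move : ∀ k (kz : zero # k)-> A.cyl k (A.diag zero k) A.≈ A.⊤ -> ∀ s -> V s -> ∃[ t ] (V t × look t zero ~ look t k × (∀ j -> j # k -> look t j ~ look s j))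
  move k kz h s vs = let _ , t , d , ag = fst (E.cyl-homo k _)(snd (E.cong h)(snd E.⊤-homo vs))
                         vt , e = fst (E.diag-homo zero k) d in t , vt , e , ag
  vp : V (Vec.replicate 3 p)
  vp = let s , vs = nonempty
           t , vt , e , ag = move 1F (\()) h1 s vs
           r , vr , e' , ag' = move 2F (\()) h2 t vt
           r0 = trans (ag' zero (\()))(ag zero (\()))
   in subst V (vec-ext r _ \ { zero -> r0; 1F -> trans (ag' 1F (\()))(sym e & ag zero (\())); 2F -> trans (sym e') r0 }) vr
  inside : ∀ {a}-> a VecM.∈ Vec.replicate n p -> a ~ p
  inside q = VecAnyP.lookup-index q & Vec.lookup-replicate (VecAny.index q) p
 -- over a finite set the algebra is finite
 bounded : Finite (≡.setoid M)-> Bounded foAlg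
 bounded (k , inv) = record { size = 2 ^ (suc k ^ n); num = Nu.number; num-inj = \ {φ}{ψ}-> Nu.number-inj {φ}{ψ} }
  where
  num : M -> Fin k
  num = Inverse.to inv
  num-inj' : ∀ {x y}-> num x ~ num y -> x ~ y
  num-inj' e = sym (Inverse.inverseʳ inv refl)& Inverse.inverseʳ inv e
  code : ∀ {l}-> Vec M l -> ℕ
  code [] = 0
  code (x ∷ xs) = ix (num x)+ code xs * suc k
  lt : ∀ x -> ix (num x)< suc k
  lt x = m<n⇒m<1+n (Fin.toℕ<n (num x))
  code< : ∀ {l}(xs : Vec M l)-> code xs < suc k ^ l
  code< [] = sl zl
  code< {suc l}(x ∷ xs) = subst (code (x ∷ xs) <_)(*-comm (suc k ^ l)(suc k))(≤-trans (+-monoˡ-< (code xs * suc k)(lt x))(*-monoˡ-≤ (suc k)(code< xs)))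
  code-inj : ∀ {l}(xs ys : Vec M l)-> code xs ~ code ys -> xs ~ ys
  code-inj [] [] e = refl
  code-inj (x ∷ xs)(y ∷ ys) e = cong2 _∷_
   (num-inj' (Fin.toℕ-injective (sym (mod-dm k _ (code xs)(lt x))& cong (_% suc k) e & mod-dm k _ (code ys)(lt y))))
   (code-inj xs ys (sym (div-dm k (ix (num x)) _ (lt x))& cong (_/ suc k) e & div-dm k (ix (num y)) _ (lt y)))
  module Nu = Numbered em v (suc k ^ n)(\x -> code (fst x))(\x -> code< (fst x))(\φ {x}{y} e -> cong (\z -> tr (Sat' φ z))(code-inj (fst x)(fst y) e))

-- The complex algebra of a hyperbasis.
module HyperAlgebra (em : EM)(TS : Tiles)(start< : Tiles.start TS < Tiles.N TS)(m : ℕ)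
 {Λ : Set}(H : Pred (Hypernetwork (Triples.algA em TS)(6 + m) Λ) 0ℓ)(hb : IsHyperbasis (Triples.algA em TS)(6 + m)(m≤m+n 3 (3 + m)) H) where
 open Triples em TS hiding (atom)
 open Negative em TS start<
 open Classical em
 open IsHyperbasis hb
 private
  n = 6 + m
  module A = Alg algA
  Net = Hypernetwork algA n Λ
  record Ag (S : Pred (Fin n) 0ℓ)(M N : Net) : Set where
   constructor ag
   field agree : Agree algA n S M N
 open Hypernetwork
 private
  atB : Net -> Vec (Fin n) 3 -> ℕ
  atB N x = pick (atom N x)
  at< : ∀ N x -> atB N x < total
  at< N x = fst (atom-single (atom N x)(isAtom N x))
  atom≡ : ∀ N x -> atom N x ~ single (atB N x)
  atom≡ N x = snd (atom-single (atom N x)(isAtom N x))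
  below-iff : ∀ N x a -> atom N x A.⊑ a -> has a (atB N x) !
  below-iff N x a h = below- (atom N x) a h (atB N x)(at< N x)(subst (\z -> has z (atB N x) !)(sym (atom≡ N x))(single-at _ (at< N x)))
  iff-below : ∀ N x a -> has a (atB N x) ! -> atom N x A.⊑ a
  iff-below N x a h = below+ (atom N x) a \j l e -> subst (\z -> has a z !)(sym (single-only _ j l (subst (\z -> has z j !)(atom≡ N x) e))) h
  cyl-edge : ∀ N δ i d -> edge (ix i)(atm (atB N (δ [ i ]≔ d)))~ edge (ix i)(atm (atB N δ))
  cyl-edge N δ i d = let j , l , h , e = cyl- i (atom N δ) _ (at< N _)(below-iff N _ _ (atom-cyl N δ i d)) in
   trans e (cong (edge (ix i) ∘ atm)(single-only _ j l (subst (\z -> has z j !)(atom≡ N δ) h)))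
  diag-at : ∀ N δ i j -> onDiag (ix i)(ix j)(atm (atB N (δ [ i ]≔ look δ j))) !
  diag-at N δ i j = sym (has-diag i j _ (at< N _))& below-iff N _ _ (atom-diag N δ i j)
  lb : Net -> Fin n -> Fin n -> ℕ
  lb N x y = ℓ01 (atm (atB N (x ∷ y ∷ y ∷ [])))
  l01 : ∀ N x y z -> ℓ01 (atm (atB N (x ∷ y ∷ z ∷ [])))~ lb N x y
  l01 N x y z = cyl-edge N (x ∷ y ∷ y ∷ []) 2F z
  l02 : ∀ N x y z -> ℓ02 (atm (atB N (x ∷ z ∷ y ∷ [])))~ lb N x y
  l02 N x y z = cyl-edge N (x ∷ y ∷ y ∷ []) 1F z & sym (same-mid _ (at< N _)(diag-at N (x ∷ y ∷ y ∷ []) 1F 2F))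
  l12 : ∀ N x y z -> ℓ12 (atm (atB N (z ∷ x ∷ y ∷ [])))~ lb N x y
  l12 N x y z = cyl-edge N (x ∷ x ∷ y ∷ []) zero z & same-first _ (at< N _)(diag-at N (x ∷ x ∷ y ∷ []) zero 1F)& l02 N x y x
  Id : Net -> Fin n -> Fin n -> Set
  Id N x y = idLab (lb N x y) !
  Id⇒ : ∀ N x y z -> Id N x y -> atom N (x ∷ y ∷ z ∷ []) A.⊑ A.diag zero 1F
  Id⇒ N x y z h = iff-below N _ _ (has-diag zero 1F _ (at< N _)& cong idLab (l01 N x y z)& h)
  id-refl : ∀ N x -> Id N x x
  id-refl N x = diag-at N (x ∷ x ∷ x ∷ []) zero 1F
  id-sym : ∀ N x y -> Id N x y -> Id N y x
  id-sym N x y h = subst (\l -> idLab l !)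
   (sym (l02 N x x y)& sym (same-first _ (at< N _)(cong idLab (l01 N x y x)& h))& l12 N y x x)(id-refl N x)
  id-trans : ∀ N x y z -> Id N x y -> Id N y z -> Id N x z
  id-trans N x y z h k = subst (\l -> idLab l !)
   (sym (l12 N y z x)& same-first _ (at< N _)(cong idLab (l01 N x y z)& h)& l02 N x z y) k
  ag-atom : ∀ {S M N}-> Ag S M N -> ∀ x -> VecAll.All (\i -> ¬ S i) x -> atB M x ~ atB N x
  ag-atom (ag (h , _)) x a = cong pick (h x a)
  ag-lb : ∀ {S M N}-> Ag S M N -> ∀ x y -> ¬ S x -> ¬ S y -> lb M x y ~ lb N x y
  ag-lb g x y a b = cong (ℓ01 ∘ atm)(ag-atom g _ (a VecAll.∷ b VecAll.∷ b VecAll.∷ VecAll.[]))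
  ag-sym : ∀ {S M N}-> Ag S M N -> Ag S N M
  ag-sym (ag (h , k)) = ag ((\x a -> sym (h x a)), (\p q x a -> sym (k p q x a)))
  ag-trans : ∀ {S L M N}-> Ag S L M -> Ag S M N -> Ag S L N
  ag-trans (ag (h , k))(ag (h' , k')) = ag ((\x a -> trans (h x a)(h' x a)), (\p q x a -> trans (k p q x a)(k' p q x a)))
  ag-mono : ∀ {S S' M N}->(∀ {i}-> S i -> S' i)-> Ag S M N -> Ag S' M N
  ag-mono f (ag (h , k)) = ag ((\x a -> h x (VecAll.map (\n s -> n (f s)) a)), (\p q x a -> k p q x (VecAll.map (\n s -> n (f s)) a)))
  Only : Fin n -> Pred (Fin n) 0ℓ
  Only i j = i ~ j
  None : Pred (Fin n) 0ℓ
  None _ = Empty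
  merge : Fin n -> Fin n -> Fin n -> Fin n
  merge i j x with x Fin.≟ i
  ... | yes _ = j
  ... | no _ = x
  merge-off : ∀ i j -> i # j -> ∀ x -> ¬ (Only i (merge i j x))
  merge-off i j ne x e with x Fin.≟ i
  ... | yes _ = ne e
  ... | no nx' = nx' (sym e)
  merge-id : ∀ N i j -> Id N i j -> ∀ x -> Id N x (merge i j x)
  merge-id N i j h x with x Fin.≟ i
  ... | yes refl = h
  ... | no _ = id-refl N x
  identified : ∀ N i j -> Id N i j -> ∀ {l}(x : Vec (Fin n) l)-> Identified N x (Vec.map (merge i j) x)
  identified N i j h x p = zero ∷ [] , Id⇒ N (look x p)(look (Vec.map (merge i j) x) p) zero (subst (Id N (look x p))(sym (Vec.lookup-map p (merge i j) x))(merge-id N i j h (look x p)))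
  determined : ∀ i j -> i # j -> ∀ M N -> Ag (Only i) M N -> Id M i j -> Id N i j -> Ag None M N
  determined i j ne M N (ag (h , k)) a b = ag
   ((\x _ -> trans (atom-resp M x _ (identified M i j a x))(h _ (off x)& sym (atom-resp N x _ (identified N i j b x)))) ,
   (\p q x _ -> trans (label-resp M p q x _ (identified M i j a x))(k p q _ (off x)& sym (label-resp N p q x _ (identified N i j b x)))))
   where
   off : ∀ {l}(x : Vec (Fin n) l)-> VecAll.All (\y -> ¬ Only i y)(Vec.map (merge i j) x)
   off x = VecAllP.lookup⁻ \p -> subst (\z -> ¬ Only i z)(sym (Vec.lookup-map p (merge i j) x))(merge-off i j ne (look x p))
  emb : Fin 3 -> Fin n
  emb i = inject≤ i (m≤m+n 3 (3 + m))
  idx : Vec (Fin n) 3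
  idx = tabulate emb
  identify : ∀ i j k -> k # i -> k # j -> ∀ M -> H M -> Id M i j -> ∃[ N ] (H N × Ag (Only k) M N × Id N i k × Id N k j)
  identify i j k ki kj M hM h =
   let N , hN , g , e = cylinders M hM (i ∷ i ∷ j ∷ []) 1F (atom M (i ∷ i ∷ j ∷ []))(isAtom M _)
        (iff-below M _ _ (cyl+ 1F _ _ _ (at< M _)(at< M _) refl (below-iff M _ _ (below+ _ _ (\_ _ q -> q))))) k
        (\ { zero _ -> ki; 1F ne -> efq (ne refl); 2F _ -> kj })
       e' = cong (atm ∘ pick) e
   in N , hN , ag-sym (ag g) ,
    trans (cong idLab (sym (l01 N i k j)& cong ℓ01 e' & l01 M i i j))(id-refl M i) ,
    trans (cong idLab (sym (l12 N k j i)& cong ℓ12 e' & l12 M i j i)) h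
 frame' : Frame n
 frame' = record
  { Pt = Σ Net H; _∼_ = \p q -> Ag None (fst p)(fst q); E = \i p q -> Ag (Only i)(fst p)(fst q); D = \i j p -> Id (fst p) i j
  ; ∼-E = \i g -> ag-mono efq g; ∼-D = \i j {p}{q} g h -> trans (cong idLab (sym (ag-lb {None}{fst p}{fst q} g i j id id))) h; ∼-sym = ag-sym
  ; E-refl = \i p -> ag ((\x _ -> refl), (\_ _ x _ -> refl)); E-sym = \i -> ag-sym; E-trans = \i -> ag-trans
  ; E-comm = \i j {p}{q}{r} g k -> let L , hL , a , b = amalgam (fst p)(fst r)(snd p)(snd r) j i
                                        (Ag.agree (ag-trans (ag-mono (\ { refl -> inr refl }) g)(ag-mono (\ { refl -> inl refl }) k))) in (L , hL), ag a , ag b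
  ; D-refl = \i p -> id-refl (fst p) i
  ; D-cyl⇒ = \i j k ki kj p h -> let N , hN , g , a , b = identify i j k ki kj (fst p)(snd p) h in (N , hN), g , a , b
  ; D-cyl⇐ = \i j k ki kj p q g a b -> trans (cong idLab (ag-lb {Only k}{fst p}{fst q} g i j ki kj))(id-trans (fst q) i k j a b)
  ; D-sub = \i j ij {p}{q} g a b -> determined i j ij (fst p)(fst q) g a b }
 open ComplexAlgebra em frame' public using (cmCA; cm)
 open ComplexAlgebra em frame' using (Elt)
 private
  val : A.Carrier -> Σ Net H -> Bool
  val a p = has a (atB (fst p) idx)
  elem : A.Carrier -> Elt
  elem a = val a , \ {p}{q} g -> cong (has a)(ag-atom {None}{fst p}{fst q} g idx (id VecAll.∷ id VecAll.∷ id VecAll.∷ VecAll.[]))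
  emb# : ∀ {i j}-> i # j -> emb i # emb j
  emb# ne e = ne (Fin.inject≤-injective _ _ _ _ e)
  same-edge : ∀ i {M N}-> Ag (Only (emb i)) M N -> edge (ix i)(atm (atB M idx))~ edge (ix i)(atm (atB N idx))
  same-edge zero {M}{N} g = l12 M _ _ _ & ag-lb {_}{M}{N} g _ _ (emb# \())(emb# \())& sym (l12 N _ _ _)
  same-edge 1F {M}{N} g = l02 M _ _ _ & ag-lb {_}{M}{N} g _ _ (emb# \())(emb# \())& sym (l02 N _ _ _)
  same-edge 2F {M}{N} g = l01 M _ _ _ & ag-lb {_}{M}{N} g _ _ (emb# \())(emb# \())& sym (l01 N _ _ _)
  idx-upd : ∀ i -> idx [ i ]≔ emb i ~ idx
  idx-upd zero = refl
  idx-upd 1F = refl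
  idx-upd 2F = refl
  diag-val : ∀ i j N -> onDiag (ix i)(ix j)(atm (atB N idx))~ tr (Id N (emb i)(emb j))
  diag-val zero zero N = sym (tr+ (id-refl N _))
  diag-val 1F 1F N = sym (tr+ (id-refl N _))
  diag-val 2F 2F N = sym (tr+ (id-refl N _))
  diag-val zero 1F N = cong idLab (l01 N _ _ _)& bext tr+ tr-
  diag-val 1F zero N = cong idLab (l01 N _ _ _)& bext (\h -> tr+ (id-sym N _ _ h))(\h -> id-sym N _ _ (tr- h))
  diag-val zero 2F N = cong idLab (l02 N _ _ _)& bext tr+ tr-
  diag-val 2F zero N = cong idLab (l02 N _ _ _)& bext (\h -> tr+ (id-sym N _ _ h))(\h -> id-sym N _ _ (tr- h))
  diag-val 1F 2F N = cong idLab (l12 N _ _ _)& bext tr+ tr-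
  diag-val 2F 1F N = cong idLab (l12 N _ _ _)& bext (\h -> tr+ (id-sym N _ _ h))(\h -> id-sym N _ _ (tr- h))
 hom : Hom algA cmCA
 hom = record
  { to = elem
  ; neat = \a k le p -> bext
   (\h -> let (N , hN), g , e = tr- h in trans (cong (has a)(ag-atom {Only k}{fst p}{N} g idx (low zero k le VecAll.∷ low 1F k le VecAll.∷ low 2F k le VecAll.∷ VecAll.[]))) e)
   (\e -> tr+ (p , ag ((\x _ -> refl), (\_ _ x _ -> refl)), e))
  ; to-∧ = \a b p -> has-meet a b _ (at< (fst p) idx)
  ; to-∨ = \a b p -> has-join a b _ (at< (fst p) idx)
  ; to-∼ = \a p -> has-comp a _ (at< (fst p) idx)
  ; to-⊤ = \p -> has-top _ (at< (fst p) idx)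
  ; to-⊥ = \p -> has-bot _ (at< (fst p) idx)
  ; to-cy = \i a (M , hM)-> bext
   (\h -> let j , l , e , q = cyl- i a _ (at< M idx) h
              N , hN , g , f = cylinders M hM idx i (single j)(single-atom j l)(iff-below M idx _ (cyl+ i (single j) _ j (at< M idx) l q (single-at j l)))(emb i)
               (\k ne e -> emb# (ne ∘ sym)(e & Vec.lookup∘tabulate emb k))
    in tr+ ((N , hN), ag-sym (ag g), trans (cong (has a)(cong (atB N)(sym (idx-upd i))& cong pick f & pick-single j l)) e))
   (\h -> let (N , hN), g , e = tr- h in cyl+ i a _ _ (at< M idx)(at< N idx)(same-edge i {M}{N} g) e)
  ; to-dg = \i j (M , hM)-> trans (has-diag i j _ (at< M idx))(diag-val i j M) }
  where
  low : ∀ i k -> 3 ≤ ix k -> ¬ (k ~ emb i)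
  low i k le refl = ℕ.<⇒≱ (Fin.toℕ<n i)(subst (3 ≤_)(Fin.toℕ-inject≤ i _) le)
 nonzero' : ¬ (Alg._≈_ cm (elem cornerEl)(Alg.⊥ cm))
 nonzero' h = let j , l , e = nonzero- cornerEl corner#⊥
                  N , hN , f = atoms (single j)(single-atom j l)
  in case trans (sym e)(cong (has cornerEl)(sym (cong pick f & pick-single j l))& h (N , hN)) of \()
 bounded : FiniteSet algA n H -> Bounded cm
 bounded (Ns , h) = record { size = 2 ^ List.length Ns; num = Nu.number; num-inj = \ {x}{y}-> Nu.number-inj {x}{y} }
  where
  code : Σ Net H -> ℕ
  code (N , hN) = ix (Any.index (h N hN))
  via : ∀ p -> Ag None (fst p)(List.lookup Ns (Any.index (h (fst p)(snd p))))
  via (N , hN) = ag (AnyP.lookup-index (h N hN))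
  module Nu = Numbered em {Elt}{Σ Net H} fst (List.length Ns) code (\p -> Fin.toℕ<n (Any.index (h (fst p)(snd p))))
   (\c {p}{q} e -> snd c {p}{q}(ag-trans (via p)(ag-sym (subst (\i -> Ag None (fst q)(List.lookup Ns i))(sym (Fin.toℕ-injective e))(via q)))))

-- Finite algebras with only infinite flat representations.
least : ∀ (d : ℕ -> ℕ) s -> d s # 0 -> ∃[ t ] (d t # 0 × ∀ s' -> s' < t -> d s' ~ 0)
least d s n = go s 0 (\s' ())(subst (\z -> d z # 0)(sym (+-identityʳ s)) n)
 where
 go : ∀ k t ->(∀ s' -> s' < t -> d s' ~ 0)-> d (k + t)# 0 -> ∃[ t ] (d t # 0 × ∀ s' -> s' < t -> d s' ~ 0)
 go zero t h n = t , n , h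
 go (suc k) t h n with d t ℕ.≟ 0
 ... | no q = t , q , h
 ... | yes q = go k (suc t)(\s' l -> [ h s' , (\ { refl -> q }) ]′ (m≤n⇒m<n∨m≡n (≤-pred l)))(subst (\z -> d z # 0)(sym (+-suc k t)) n)

module Algebras (em : EM) where
 opsOf : ℕ -> ℕ -> Ops
 opsOf b C = Triples.ops em (tilesOf b C)
 open LabelsPrim em
 p-sz : ∀ {n b C}-> Prim n b -> Prim n C -> Prim n (\γ -> Ops.sz (opsOf (b γ)(C γ)))
 p-sz pb pC = p-pow (pk 2)(p-total pb pC) p∸ pk 1
 closed : ∀ b C -> Closed (opsOf b C)
 closed b C = record { join< = \x y -> lt (\j -> bit x j || bit y j); meet< = \x y -> lt (\j -> bit x j && bit y j); comp< = \x -> lt (\j -> not (bit x j)); top< = lt (\j -> true); bot< = lt (\j -> false)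
  ; cyl< = \i x -> lt (\j -> anyN total (\j' -> bit x j' && (edge i (atm j) == edge i (atm j')))); diag< = \i j -> lt (\k -> onDiag i j (atm k)) }
  where
  open Triples em (tilesOf b C)
  lt : ∀ f -> bits total f < suc (2 ^ total ∸ 1)
  lt f = subst (bits total f <_)(sym size≡)(bits< total f)
 module _ {n : ℕ}{b C p p' : Env' n -> ℕ}(pb : Prim n b)(pC : Prim n C)(pp' : Prim n p)(pq : Prim n p') where
  p-permCode : Prim n (\γ -> Table.code (Ops.table (conj-ops (opsOf (b γ)(C γ))(p γ)(p' γ))))
  p-permCode = p-code {O = \γ -> conj-ops (opsOf (b γ)(C γ))(p γ)(p' γ)}(p-sz pb pC)(p-dig (p-sz pb pC)(p-top' pb pC pb pC) pp')(p-dig (p-sz pb pC)(p-bot pb pC pb pC) pp')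
   (π (p-join wb wC (π- quo)(π- rem)))(π (p-meet wb wC (π- quo)(π- rem)))(π (p-comp wb wC (π- x0) x0))
   (π (p-cyl wb wC quo (π- rem)))(π (p-diag wb wC (x0 p/ pk 2)(x0 p% pk 2)))
   where
   wb = wk pb
   wC = wk pC
   π : ∀ {f}-> Prim (suc n) f -> Prim (suc n)(\γ -> dig (Ops.sz (opsOf (b (fst γ))(C (fst γ))))(f γ)(p (fst γ)))
   π h = p-dig (p-sz wb wC) h (wk pp')
   π- : ∀ {f}-> Prim (suc n) f -> Prim (suc n)(\γ -> dig (Ops.sz (opsOf (b (fst γ))(C (fst γ))))(f γ)(p' (fst γ)))
   π- h = p-dig (p-sz wb wC) h (wk pq)
   quo : Prim (suc n)(\γ -> snd γ / suc (Ops.sz (opsOf (b (fst γ))(C (fst γ)))))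
   quo = x0 p/ p-sz wb wC
   rem : Prim (suc n)(\γ -> snd γ % suc (Ops.sz (opsOf (b (fst γ))(C (fst γ)))))
   rem = x0 p% p-sz wb wC
  p-isPerm : PB n (\γ -> isPerm (opsOf (b γ)(C γ))(p γ)(p' γ))
  p-isPerm = p-all (p-suc (p-sz pb pC))((p-dig s (p-dig s x0 (wk pp'))(wk pq) p== x0) p&& (p-dig s (p-dig s x0 (wk pq))(wk pp') p== x0))
   where s = p-sz (wk pb)(wk pC)
 -- a program that never stops gives an algebra without finite models of its laws
 module Endless (b C m : ℕ)(h : ∀ j q -> q ~ 1 ⊎ q ~ 2 -> Program.st b C j # q) where
  open Verdict em b C public
  private
   n = 6 + m
   module A = Alg algA
  member : SNr (m≤m+n 3 (3 + m))(AllCA n) algA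
  member = represented n (m≤m+n 3 (3 + m))(\j -> h j 1 (inl refl))
  finite : FiniteAlg algA
  finite = _ , record { to = \x -> x; from = \x -> x; to-cong = \e -> e; from-cong = \e -> e; inverse = (\e -> e), (\e -> e) }
  no-model : ∀ {B : CA n 0ℓ 0ℓ}(k : Hom algA B)-> ¬ (Alg._≈_ (CA.alg B)(Hom.to k Ne.cornerEl)(Alg.⊥ (CA.alg B)))-> ¬ Bounded (CA.alg B)
  no-model {B} k nz bd = not-bounded {m}{B}(hom-system k nz) bd (\j -> h j 2 (inr refl))
  no-hyperbasis : ¬ HasFiniteHyperbasis algA n (m≤m+n 3 (3 + m))
  no-hyperbasis (Λ , H , _ , hb , fin) = no-model {X.cmCA} X.hom X.nonzero' (X.bounded fin)
   where module X = HyperAlgebra em TS start< m H hb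
  only-infinite : OnlyInfiniteFlatReps n algA
  only-infinite R fl fin = no-model {X.foCA} X.hom nz (X.bounded fin)
   where
   module X = FlatAlgebra em R m fl
   module T = Triples em TS
   point : X.Tuple
   point = X.constant (diag-top {m}{fst member}(snd (snd member)) 1F \())(diag-top {m}{fst member}(snd (snd member)) 2F \()) \q ->
    let j , l , _ = Ne.nonzero- Ne.cornerEl Ne.corner#⊥ in case trans (sym (T.has-top j l))(cong (\x -> T.has x j) q & T.has-bot j l) of \()
   module K = Hom X.hom
   module F = CALemmas X.foCA
   nz : ¬ (K.to Ne.cornerEl F.≈ F.𝟎)
   nz z = Classical.tr- em (sym (Ne.FromHom.collapse X.hom Ne.corner-top z point)& Classical.tr+ em refl) refl
 -- the set of isomorphism types is not recursively enumerable
 module NotRE (m : ℕ)(re : REIsoTypes (\A -> FiniteAlg A × SNr (m≤m+n 3 (3 + m))(AllCA (6 + m)) A × OnlyInfiniteFlatReps (6 + m) A)) where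
  f = fst re
  hit : ℕ -> ℕ -> ℕ -> ℕ -> ℕ -> Bool
  hit b C s p p' = isPerm (opsOf b C) p p' && not (ev f s (Table.code (Ops.table (conj-ops (opsOf b C) p p')) ∷ []) == 0)
  d : ℕ -> ℕ -> ℕ -> ℕ
  d b C s = b2n (anyN s (\p -> anyN s (hit b C s p)))
  pd : Prim 3 (\ { (((_ , b), C), s)-> d b C s })
  pd = nat (p-any x0 (p-any x1 (p-isPerm vb vC x1 x0 p&& p-not (p-ev f ((_ , p-permCode vb vC x1 x0) ∷ [])(wk (wk x0)) p== pk 0))))
   where
   vb = wk (wk (wk (wk x0)))
   vC = wk (wk (wk x0))
  refute-hit : ∀ b C -> Searches d b C -> ∀ t -> d b C t # 0 ->(∀ s -> s < t -> d b C s ~ 0)-> Empty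
  refute-hit b C sr t n' h = rejected m (Searches.rejects sr t h (one n')) sn
   where
   open Verdict em b C
   one : ∀ {c}-> b2n c # 0 -> b2n c ~ 1
   one {true} q = refl
   one {false} q = efq (q refl)
   tru : ∀ {c}-> b2n c # 0 -> c !
   tru {true} q = refl
   tru {false} q = efq (q refl)
   found : ∃[ p ] ∃[ p' ] (isPerm (opsOf b C) p p' ! × Halts f (Table.code (Ops.table (conj-ops (opsOf b C) p p'))))
   found = let p , _ , x = anyN- t (\p -> anyN t (hit b C t p))(tru n')
               p' , _ , y = anyN- t (hit b C t p) x
               a , q = &- {isPerm (opsOf b C) p p'} y
               r , e = pos (\z -> not- q (==+ z))
    in p , p' , a , r , ev-sound f t _ e
    where
    pos : ∀ {x}-> x # 0 -> ∃[ r ] (x ~ suc r)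
    pos {zero} q = efq (q refl)
    pos {suc r} q = r , refl
   sn : SNr (m≤m+n 3 (3 + m))(AllCA (6 + m)) algA
   sn = let p , p' , a , hl = found
            _ , (B , l , e), _ = fst (snd re)(Ops.table (conj-ops (opsOf b C) p p')) hl
    in B , l , (e ∘E Permuted.perm-embedding (opsOf b C)(closed b C) p p' a)
  hits : ∀ b C p p' c s0 r -> isPerm (opsOf b C) p p' ! -> c ~ Table.code (Ops.table (conj-ops (opsOf b C) p p'))->(∀ s -> s0 ≤ s -> ev f s (c ∷ [])~ suc r)->
   d b C (suc (s0 + (p + p')))# 0
  hits b C p p' c s0 r a refl h e = case trans (sym (cong b2n hit')) e of \()
   where
   s = suc (s0 + (p + p'))
   hit' : anyN s (\p -> anyN s (hit b C s p)) !
   hit' = anyN+ s (\p -> anyN s (hit b C s p)) p (sl (≤-trans (m≤m+n p p')(m≤n+m _ s0)))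
    (anyN+ s (hit b C s p) p' (sl (≤-trans (m≤n+m p' p)(m≤n+m _ s0)))(&+ a (cong (\x -> not (x == 0))(h s (m≤n⇒m≤1+n (m≤m+n _ _))))))
  refute-none : ∀ b C -> Searches d b C ->(∀ s -> d b C s ~ 0)-> Empty
  refute-none b C sr none =
   let T , (r , hl), iso = snd (snd re) algA (finite , member , only-infinite)
       p , p' , a , e = Permuted.iso-perm (opsOf b C)(closed b C) T iso
       s0 , h = ev-complete hl
   in hits b C p p' (Table.code T) s0 r a e h (none _)
   where open Endless b C m (Searches.diverges sr none)
  absurd : Empty
  absurd = let b , C , sr = searcher d pd in decide b C sr (em 0ℓ)
   where
   zero? : ∀ x -> x ~ 0 ⊎ x # 0
   zero? zero = inl refl
   zero? (suc x) = inr \()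
   decide : ∀ b C -> Searches d b C -> Dec (∃[ s ] (d b C s # 0))-> Empty
   decide b C sr (yes (s , n)) = let t , n' , h = least (d b C) s n in refute-hit b C sr t n' h
   decide b C sr (no none) = refute-none b C sr (\s -> [ id , (\q -> efq (none (s , q))) ]′ (zero? (d b C s)))

-- Truth of higher order sentences in finite algebras, on the numbers of the objects of each type.
module Truth (O : Ops)(cl : Closed O) where
 open Ops O
 open Closed cl
 A : Alg 3 0ℓ 0ℓ
 A = Table.alg table
 private module A = Alg A
 -- one less than the number of objects of a type, and the number of tuples
 K : Ty -> ℕ
 L : List Ty -> ℕ
 K ind = sz
 K (rel ts) = 2 ^ L ts ∸ 1
 L [] = 1
 L (t ∷ ts) = L ts * suc (K t)
 private
  D : Ty -> Set
  D t = Setoid.Carrier (Dom A t)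
  Ds : List Ty -> Set
  Ds ts = Setoid.Carrier (Doms A ts)
 enc : ∀ t -> D t -> ℕ
 encs : ∀ ts -> Ds ts -> ℕ
 dec : ∀ t -> ℕ -> D t
 decs : ∀ ts -> ℕ -> Ds ts
 enc-cong : ∀ t {d e}-> Setoid._≈_ (Dom A t) d e -> enc t d ~ enc t e
 encs-cong : ∀ ts {d e}-> Setoid._≈_ (Doms A ts) d e -> encs ts d ~ encs ts e
 enc ind x = ix x
 enc (rel ts) f = bits (L ts)(\i -> f ⟨$⟩ decs ts i)
 encs [] _ = 0
 encs (t ∷ ts)(d , ds) = enc t d + encs ts ds * suc (K t)
 dec ind i = fin i
 dec (rel ts) i = record { to = \ds -> bit i (encs ts ds); cong = \e -> cong (bit i)(encs-cong ts e) }
 decs [] i = tt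
 decs (t ∷ ts) i = dec t (i % suc (K t)), decs ts (i / suc (K t))
 enc-cong ind refl = refl
 enc-cong (rel ts) h = fd-cong 1 (L ts) _ _ (\i _ -> cong b2n (h (decs ts i)))
 encs-cong [] h = refl
 encs-cong (t ∷ ts)(h , hs) = cong2 (\x y -> x + y * suc (K t))(enc-cong t h)(encs-cong ts hs)
 private
  pow≡ : ∀ n -> suc (2 ^ n ∸ 1)~ 2 ^ n
  pow≡ n = +-comm 1 (2 ^ n ∸ 1)& m∸n+n≡m (m^n>0 2 n)
 enc< : ∀ t d -> enc t d < suc (K t)
 enc< ind x = Fin.toℕ<n x
 enc< (rel ts) f = subst (enc (rel ts) f <_)(sym (pow≡ (L ts)))(bits< (L ts)(\i -> f ⟨$⟩ decs ts i))
 encs< : ∀ ts ds -> encs ts ds < L ts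
 encs< [] _ = sl zl
 encs< (t ∷ ts)(d , ds) = <-≤-trans (+-monoˡ-< (encs ts ds * suc (K t))(enc< t d))(*-monoˡ-≤ (suc (K t))(encs< ts ds))
 dec-enc : ∀ t d -> Setoid._≈_ (Dom A t)(dec t (enc t d)) d
 decs-encs : ∀ ts ds -> Setoid._≈_ (Doms A ts)(decs ts (encs ts ds)) ds
 dec-enc ind x = Fin.toℕ-injective (toℕ-fin' (ix x)(Fin.toℕ<n x))
 dec-enc (rel ts) f ds = bit-bits (L ts)(\i -> f ⟨$⟩ decs ts i)(encs ts ds)(encs< ts ds)& Func.cong f (decs-encs ts ds)
 decs-encs [] _ = refl
 decs-encs (t ∷ ts)(d , ds) =
  subst (\i -> Setoid._≈_ (Dom A t)(dec t i) d)(sym (mod-dm (K t)(enc t d)(encs ts ds)(enc< t d)))(dec-enc t d) ,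
  subst (\i -> Setoid._≈_ (Doms A ts)(decs ts i) ds)(sym (div-dm (K t)(enc t d)(encs ts ds)(enc< t d)))(decs-encs ts ds)
 enc-dec : ∀ t i -> i < suc (K t)-> enc t (dec t i)~ i
 encs-decs : ∀ ts i -> i < L ts -> encs ts (decs ts i)~ i
 enc-dec ind i h = toℕ-fin' i h
 enc-dec (rel ts) i h = bit-ext (L ts) _ i (bits< (L ts)(\j -> bit i (encs ts (decs ts j))))(subst (i <_)(pow≡ (L ts)) h)
  \j j< -> trans (bit-bits (L ts)(\j -> bit i (encs ts (decs ts j))) j j<)(cong (bit i)(encs-decs ts j j<))
 encs-decs [] zero h = refl
 encs-decs [] (suc i)(sl ())
 encs-decs (t ∷ ts) i h = cong2 (\x y -> x + y * suc (K t))(enc-dec t _ (m%n<n i (suc (K t))))(encs-decs ts _ (m<n*o⇒m/o<n h))& sym (m≡m%n+[m/n]*n i (suc (K t)))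
 Codes' : List Ty -> Set
 Codes' = All (\_ -> ℕ)
 evalN : ∀ {X : Set}->(X -> ℕ)-> Term 3 X -> ℕ
 evalN η (var x) = η x
 evalN η (s ∨ t) = join (evalN η s)(evalN η t)
 evalN η (s ∧ t) = meet (evalN η s)(evalN η t)
 evalN η (∼ t) = comp' (evalN η t)
 evalN η ⊤ = top
 evalN η ⊥ = bot
 evalN η (cyl i t) = cyl' (ix i)(evalN η t)
 evalN η (diag i j) = diag' (ix i)(ix j)
 argN : ∀ {Γ t}-> Codes' Γ -> Arg 3 Γ t -> ℕ
 argN η (ind s) = evalN (All.lookup η) s
 argN η (rel x) = All.lookup η x
 argsN : ∀ {Γ ts}-> Codes' Γ -> All (Arg 3 Γ) ts -> ℕ
 argsN η [] = 0
 argsN η (_∷_ {x = t} a as) = argN η a + argsN η as * suc (K t)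
 satN : ∀ {r Γ}-> Codes' Γ -> HO 3 r Γ -> Bool
 satN η (eq s t) = evalN (All.lookup η) s == evalN (All.lookup η) t
 satN η (app x as) = bit (All.lookup η x)(argsN η as)
 satN η (neg φ) = not (satN η φ)
 satN η (conj φ ψ) = satN η φ && satN η ψ
 satN η (ex t _ φ) = anyN (suc (K t))(\i -> satN (i ∷ η) φ)
 codes : ∀ {Γ}-> Env A Γ -> Codes' Γ
 codes [] = []
 codes (_∷_ {x = t} d ρ) = enc t d ∷ codes ρ
 lookup-codes : ∀ {Γ t}(ρ : Env A Γ)(x : t ∈ Γ)-> All.lookup (codes ρ) x ~ enc t (All.lookup ρ x)
 lookup-codes (d ∷ ρ)(here refl) = refl
 lookup-codes (d ∷ ρ)(there x) = lookup-codes ρ x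
 private
  small : ∀ {x}-> x < suc sz -> x % suc sz ~ x
  small = m<n⇒m%n≡m
 eval-code : ∀ {X : Set}(ρ : X -> A.Carrier)(η : X -> ℕ)->(∀ x -> η x ~ ix (ρ x))-> ∀ t -> evalN η t ~ ix (eval A ρ t)
 eval-code ρ η h (var x) = h x
 eval-code ρ η h (s ∨ t) = cong2 join (eval-code ρ η h s)(eval-code ρ η h t)& sym (join≡ _ _ & small (join< _ _))
 eval-code ρ η h (s ∧ t) = cong2 meet (eval-code ρ η h s)(eval-code ρ η h t)& sym (meet≡ _ _ & small (meet< _ _))
 eval-code ρ η h (∼ t) = cong comp' (eval-code ρ η h t)& sym (comp≡ _ & small (comp< _))
 eval-code ρ η h ⊤ = sym (toℕ-fin top & small top<)
 eval-code ρ η h ⊥ = sym (toℕ-fin bot & small bot<)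
 eval-code ρ η h (cyl i t) = cong (cyl' (ix i))(eval-code ρ η h t)& sym (cyl≡ i _ & small (cyl< _ _))
 eval-code ρ η h (diag i j) = sym (diag≡ i j & small (diag< _ _))
 arg-code : ∀ {Γ t}(ρ : Env A Γ)(a : Arg 3 Γ t)-> argN (codes ρ) a ~ enc t (evalArg A ρ a)
 arg-code ρ (ind s) = eval-code (All.lookup ρ)(All.lookup (codes ρ))(lookup-codes ρ) s
 arg-code ρ (rel x) = lookup-codes ρ x
 args-code : ∀ {Γ ts}(ρ : Env A Γ)(as : All (Arg 3 Γ) ts)-> argsN (codes ρ) as ~ encs ts (evalArgs A ρ as)
 args-code ρ [] = refl
 args-code ρ (_∷_ {x = t} a as) = cong2 (\x y -> x + y * suc (K t))(arg-code ρ a)(args-code ρ as)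
 sat⇒ : ∀ {r Γ}(φ : HO 3 r Γ)(ρ : Env A Γ)-> Sat A ρ φ -> satN (codes ρ) φ !
 sat⇐ : ∀ {r Γ}(φ : HO 3 r Γ)(ρ : Env A Γ)-> satN (codes ρ) φ ! -> Sat A ρ φ
 app-code : ∀ {Γ ts}(ρ : Env A Γ)(x : rel ts ∈ Γ)(as : All (Arg 3 Γ) ts)-> bit (All.lookup (codes ρ) x)(argsN (codes ρ) as)~ All.lookup ρ x ⟨$⟩ evalArgs A ρ as
 app-code {ts = ts} ρ x as = cong2 bit (lookup-codes ρ x)(args-code ρ as)& dec-enc (rel ts)(All.lookup ρ x)(evalArgs A ρ as)
 sat⇒ (eq s t) ρ h = ==+ (eval-code _ _ (lookup-codes ρ) s & cong ix h & sym (eval-code _ _ (lookup-codes ρ) t))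
 sat⇒ (app x as) ρ h = app-code ρ x as & h
 sat⇒ (neg φ) ρ h = not+ (\e -> h (sat⇐ φ ρ e))
 sat⇒ (conj φ ψ) ρ (h , k) = &+ (sat⇒ φ ρ h)(sat⇒ ψ ρ k)
 sat⇒ (ex t _ φ) ρ (d , h) = anyN+ (suc (K t))(\i -> satN (i ∷ codes ρ) φ)(enc t d)(enc< t d)(sat⇒ φ (d ∷ ρ) h)
 sat⇐ (eq s t) ρ h = Fin.toℕ-injective (sym (eval-code _ _ (lookup-codes ρ) s)& ==- h & eval-code _ _ (lookup-codes ρ) t)
 sat⇐ (app x as) ρ h = sym (app-code ρ x as)& h
 sat⇐ (neg φ) ρ h s = not- h (sat⇒ φ ρ s)
 sat⇐ (conj φ ψ) ρ h = let a , b = &- {satN (codes ρ) φ} h in sat⇐ φ ρ a , sat⇐ ψ ρ b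
 sat⇐ (ex t _ φ) ρ h = let i , i< , q = anyN- (suc (K t))(\i -> satN (i ∷ codes ρ) φ) h in
  dec t i , sat⇐ φ (dec t i ∷ ρ)(subst (\c -> satN (c ∷ codes ρ) φ !)(sym (enc-dec t i i<)) q)

-- truth in the algebra of a program is primitive recursive
module TruthPrim (em : EM) where
 open Algebras em
 open LabelsPrim em
 private
  module Tr b C = Truth (opsOf b C)(closed b C)
 PE : ℕ -> List Ty -> Set
 PE n Γ = All (\_ -> Σ[ f ∈ (Env' n -> ℕ) ] Prim n f) Γ
 atS : ∀ {n Γ}-> PE n Γ -> Env' n -> All (\_ -> ℕ) Γ
 atS [] γ = []
 atS (p ∷ ps) γ = fst p γ ∷ atS ps γ
 wkE : ∀ {n Γ}-> PE n Γ -> PE (suc n) Γ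
 wkE [] = []
 wkE (p ∷ ps) = ((\γ -> fst p (fst γ)), wk (snd p)) ∷ wkE ps
 wkE≡ : ∀ {n Γ}(ps : PE n Γ) γ -> atS (wkE ps) γ ~ atS ps (fst γ)
 wkE≡ [] γ = refl
 wkE≡ (p ∷ ps) γ = cong (_ ∷_)(wkE≡ ps γ)
 p-lookup : ∀ {n Γ t}(ps : PE n Γ)(x : t ∈ Γ)-> Prim n (\γ -> All.lookup (atS ps γ) x)
 p-lookup (p ∷ ps)(here refl) = snd p
 p-lookup (p ∷ ps)(there x) = p-lookup ps x
 module _ {n : ℕ}{b C : Env' n -> ℕ}(pb : Prim n b)(pC : Prim n C) where
  p-K : ∀ t -> Prim n (\γ -> Tr.K (b γ)(C γ) t)
  p-L : ∀ ts -> Prim n (\γ -> Tr.L (b γ)(C γ) ts)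
  p-K ind = p-sz pb pC
  p-K (rel ts) = p-pow (pk 2)(p-L ts) p∸ pk 1
  p-L [] = pk 1
  p-L (t ∷ ts) = p-L ts p* p-suc (p-K t)
  p-eval : ∀ {X : Set}{η : X -> Env' n -> ℕ}->(∀ x -> Prim n (η x))-> ∀ t -> Prim n (\γ -> Tr.evalN (b γ)(C γ)(\x -> η x γ) t)
  p-eval p (var x) = p x
  p-eval p (s ∨ t) = p-join pb pC (p-eval p s)(p-eval p t)
  p-eval p (s ∧ t) = p-meet pb pC (p-eval p s)(p-eval p t)
  p-eval p (∼ t) = p-comp pb pC (p-eval p t)(p-eval p t)
  p-eval p ⊤ = p-top' pb pC pb pC
  p-eval p ⊥ = p-bot pb pC pb pC
  p-eval p (cyl i t) = p-cyl pb pC (pk (ix i))(p-eval p t)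
  p-eval p (diag i j) = p-diag pb pC (pk (ix i))(pk (ix j))
  p-arg : ∀ {Γ t}(ps : PE n Γ)(a : Arg 3 Γ t)-> Prim n (\γ -> Tr.argN (b γ)(C γ)(atS ps γ) a)
  p-arg ps (ind s) = p-eval {η = \x γ -> All.lookup (atS ps γ) x}(p-lookup ps) s
  p-arg ps (rel x) = p-lookup ps x
  p-args : ∀ {Γ ts}(ps : PE n Γ)(as : All (Arg 3 Γ) ts)-> Prim n (\γ -> Tr.argsN (b γ)(C γ)(atS ps γ) as)
  p-args ps [] = pk 0
  p-args ps (_∷_ {x = t} a as) = p-arg ps a p+ p-args ps as p* p-suc (p-K t)
 p-sat : ∀ {n r Γ}{b C : Env' n -> ℕ}(pb : Prim n b)(pC : Prim n C)(ps : PE n Γ)(φ : HO 3 r Γ)-> PB n (\γ -> Tr.satN (b γ)(C γ)(atS ps γ) φ)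
 p-sat pb pC ps (eq s t) = p-eval pb pC {η = \x γ -> All.lookup (atS ps γ) x}(p-lookup ps) s p== p-eval pb pC {η = \x γ -> All.lookup (atS ps γ) x}(p-lookup ps) t
 p-sat pb pC ps (app x as) = p-bit (p-lookup ps x)(p-args pb pC ps as)
 p-sat pb pC ps (neg φ) = p-not (p-sat pb pC ps φ)
 p-sat pb pC ps (conj φ ψ) = p-sat pb pC ps φ p&& p-sat pb pC ps ψ
 p-sat {b = b}{C} pb pC ps (ex t _ φ) = p-any (p-suc (p-K pb pC t))
  (asB (p-ext (\γ -> cong (\η -> b2n (Tr.satN (b (fst γ))(C (fst γ))(snd γ ∷ η) φ))(wkE≡ ps γ))(nat (p-sat (wk pb)(wk pC)((_ , x0) ∷ wkE ps) φ))))
 -- no finite list of sentences axiomatizes the class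
 module NotAxiomatizable (m r : ℕ)(ax : FinitelyAxiomatizable {3} r (SNr (m≤m+n 3 (3 + m))(AllCA (6 + m)))) where
  allN' : ℕ -> ℕ -> List (Sentence 3 r)-> Bool
  allN' b C [] = true
  allN' b C (φ ∷ Φ) = Tr.satN b C [] φ && allN' b C Φ
  p-all' : ∀ {n}{b C : Env' n -> ℕ}-> Prim n b -> Prim n C -> ∀ Φ -> PB n (\γ -> allN' (b γ)(C γ) Φ)
  p-all' pb pC [] = asB (pk 1)
  p-all' pb pC (φ ∷ Φ) = p-sat pb pC [] φ p&& p-all' pb pC Φ
  d : ℕ -> ℕ -> ℕ -> ℕ
  d b C s = b2n (allN' b C (fst ax))
  all⇒ : ∀ b C Φ -> All (Sat (Tr.A b C) []) Φ -> allN' b C Φ !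
  all⇒ b C [] [] = refl
  all⇒ b C (φ ∷ Φ)(h ∷ hs) = &+ (Tr.sat⇒ b C φ [] h)(all⇒ b C Φ hs)
  all⇐ : ∀ b C Φ -> allN' b C Φ ! -> All (Sat (Tr.A b C) []) Φ
  all⇐ b C [] h = []
  all⇐ b C (φ ∷ Φ) h = let a , k = &- {Tr.satN b C [] φ} h in Tr.sat⇐ b C φ [] a ∷ all⇐ b C Φ k
  absurd : Empty
  absurd = let b , C , sr = searcher d (nat (p-all' (wk (wk x0)) x1 (fst ax))) in decide b C sr (allN' b C (fst ax)) refl
   where
   decide : ∀ b C -> Searches d b C -> ∀ v -> allN' b C (fst ax)~ v -> Empty
   decide b C sr true e = Verdict.rejected em b C m (Searches.rejects sr 0 (\s ())(cong b2n e))(Equivalence.from (snd ax (Tr.A b C))(all⇐ b C (fst ax) e))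
   decide b C sr false e = case trans (sym e)(all⇒ b C (fst ax)(Equivalence.to (snd ax (Tr.A b C))(Endless.member b C m (Searches.diverges sr (\s -> cong b2n e))))) of \()

-- Its code is primitive recursive in the program. The pairing is sealed, to be kept from being computed.
abstract
 pr : ℕ -> ℕ -> ℕ
 pr x y = ⟪ x , y ⟫
 pr≡ : ∀ x y -> pr x y ~ ⟪ x , y ⟫
 pr≡ x y = refl
 p-pr : ∀ {n f g}-> Prim n f -> Prim n g -> Prim n (\γ -> pr (f γ)(g γ))
 p-pr = p-pair

cT : T3' -> ℕ
cT (var x) = pr 0 x
cT (s ∨ t) = pr 1 (pr (cT s)(cT t))
cT (s ∧ t) = pr 2 (pr (cT s)(cT t))
cT (∼ t) = pr 3 (cT t)
cT ⊤ = pr 4 0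
cT ⊥ = pr 5 0
cT (cyl i t) = pr 6 (pr (ix i)(cT t))
cT (diag i j) = pr 7 (pr (ix i)(ix j))

private
 pr-cong : ∀ {x x' y y'}-> x ~ x' -> y ~ y' -> pr x y ~ ⟪ x' , y' ⟫
 pr-cong refl refl = pr≡ _ _

cT≡ : ∀ t -> cT t ~ codeTerm t
cT≡ (var x) = pr≡ 0 x
cT≡ (s ∨ t) = pr-cong {1} refl (pr-cong (cT≡ s)(cT≡ t))
cT≡ (s ∧ t) = pr-cong {2} refl (pr-cong (cT≡ s)(cT≡ t))
cT≡ (∼ t) = pr-cong {3} refl (cT≡ t)
cT≡ ⊤ = pr≡ 4 0
cT≡ ⊥ = pr≡ 5 0
cT≡ (cyl i t) = pr-cong {6} refl (pr-cong {ix i} refl (cT≡ t))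
cT≡ (diag i j) = pr-cong {7} refl (pr≡ (ix i)(ix j))

abstract
 eqCode : Equation 3 -> ℕ
 eqCode = codeEquation
 eqCode≡ : ∀ e -> eqCode e ~ codeEquation e
 eqCode≡ e = refl
 eqCode-pr : ∀ s t -> pr (cT s)(cT t)~ eqCode (s , t)
 eqCode-pr s t = pr-cong (cT≡ s)(cT≡ t)

-- primitive recursive families of terms
record PrimT (n : ℕ)(t : Env' n -> T3') : Set where
 constructor asT
 field num : Prim n (\γ -> cT (t γ))
open PrimT

c-cyl : ∀ {n} i {t : Env' n -> T3'}-> PrimT n t -> PrimT n (\γ -> cyl i (t γ))
c-cyl i p .num = p-pr (pk 6)(p-pr (pk (ix i))(num p))
c-diag : ∀ {n} i j -> PrimT n (\γ -> diag i j)
c-diag i j .num = p-pr (pk 7)(p-pr (pk (ix i))(pk (ix j)))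
c-var : ∀ {n}{k : Env' n -> ℕ}-> Prim n k -> PrimT n (\γ -> var (k γ))
c-var p .num = p-pr (pk 0) p

module _ {n : ℕ}{s t : Env' n -> T3'} where
 c-∨ : PrimT n s -> PrimT n t -> PrimT n (\γ -> s γ ∨ t γ)
 c-∨ p q .num = p-pr (pk 1)(p-pr (num p)(num q))
 c-∧ : PrimT n s -> PrimT n t -> PrimT n (\γ -> s γ ∧ t γ)
 c-∧ p q .num = p-pr (pk 2)(p-pr (num p)(num q))

module _ {n : ℕ} where
 c-∼ : ∀ {t : Env' n -> T3'}-> PrimT n t -> PrimT n (\γ -> ∼ t γ)
 c-∼ p .num = p-pr (pk 3)(num p)
 c-⊥ : PrimT n (\γ -> ⊥)
 c-⊥ .num = p-pr (pk 5)(pk 0)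
 c-when : ∀ {c}{t : Env' n -> T3'}-> PB n c -> PrimT n t -> PrimT n (\γ -> when (c γ)(t γ))
 c-when {c}{t} p q .num = p-ext (\γ -> e (c γ)(t γ))(p-if p (num q)(num c-⊥))
  where
  e : ∀ c t ->(if c then cT t else cT ⊥)~ cT (when c t)
  e true t = refl
  e false t = refl
 c-R01 : ∀ {k}-> Prim n k -> PrimT n (\γ -> R01 (k γ))
 c-R01 p = c-cyl 2F (c-var p)
 c-R02 : ∀ {k}-> Prim n k -> PrimT n (\γ -> R02 (k γ))
 c-R02 p = c-cyl 1F (c-∧ (c-diag 1F 2F)(c-R01 p))
 c-R12 : ∀ {k}-> Prim n k -> PrimT n (\γ -> R12 (k γ))
 c-R12 p = c-cyl zero (c-∧ (c-diag zero 1F)(c-R02 p))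

c-⋁ : ∀ {n N}{f : Env' n -> ℕ -> T3'}-> Prim n N -> PrimT (suc n)(\γ -> f (fst γ)(snd γ))-> PrimT n (\γ -> ⋁ (N γ)(f γ))
c-⋁ {N = N}{f} p q .num = p-ext (\γ -> e (N γ)(f γ))(p-rec (num c-⊥)(p-pr (pk 1)(p-pr (wk (num q)) x0)) p)
 where
 e : ∀ n f -> natrec (cT ⊥)(\i a -> pr 1 (pr (cT (f i)) a)) n ~ cT (⋁ n f)
 e zero f = refl
 e (suc n) f = cong (\a -> pr 1 (pr (cT (f n)) a))(e n f)

module _ {n : ℕ}{b C : Env' n -> ℕ}(pb : Prim n b)(pC : Prim n C) where
 private
  open TilesPrim pb pC using (pN; p-start)
  module W = TilesPrim (wk pb)(wk pC)
  module L γ = LawTerms (tilesOf (b γ)(C γ))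
  k5 : ∀ {n f}-> Prim n f -> Prim n (\γ -> vT (f γ))
  k5 p = p-suc (p-suc (p-suc (p-suc (p-suc p))))
  kG = \ {n}-> pk {n} vG
  kP = \ {n}-> pk {n} vP
  kF = \ {n}-> pk {n} vF
  kW = \ {n}-> pk {n} vW
  kL = \ {n}-> pk {n} vL
  two : ∀ {g : ℕ -> ℕ -> ℕ -> ℕ -> Bool}{h : ℕ -> ℕ -> T3'}-> PB (2 + n)(\γ -> g (b (fst (fst γ)))(C (fst (fst γ)))(snd (fst γ))(snd γ))->
   PrimT (2 + n)(\γ -> h (snd (fst γ))(snd γ))->
   PrimT n (\γ -> ⋁ (Tiles.N (tilesOf (b γ)(C γ))) \t -> ⋁ (Tiles.N (tilesOf (b γ)(C γ))) \u -> when (not (g (b γ)(C γ) t u))(h t u))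
  two p q = c-⋁ pN (c-⋁ W.pN (c-when (p-not p) q))
 c-violation : PrimT n L.violation
 c-violation =
  c-∨ (c-∧ (c-R01 kG)(c-∼ (c-cyl 2F (c-∧ (c-R02 kG)(c-R12 kP)))))
  (c-∨ (c-∧ (c-R01 kG)(c-∧ (c-R02 kG)(c-R12 kW)))
  (c-∨ (two {\b C -> Tiles.hor (tilesOf b C)}(p-hor (wk (wk pb))(wk (wk pC)) x1 x0)(c-∧ (c-R01 kP)(c-∧ (c-R02 (k5 x1))(c-R12 (k5 x0)))))
  (c-∨ (c-∧ (c-R01 kP)(c-∧ (c-R02 kL)(c-∧ (c-∼ (c-R12 kL))(c-∼ (c-R12 kW)))))
  (c-∨ (two {\b C -> Tiles.ver (tilesOf b C)}(p-ver (wk (wk pb))(wk (wk pC)) x1 x0)(c-∧ (c-R01 (k5 x1))(c-∧ (c-R12 kP)(c-R02 (k5 x0)))))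
  (c-∨ (c-∧ (c-R01 kL)(c-∧ (c-R12 kP)(c-∧ (c-∼ (c-R02 kL))(c-∼ (c-R02 kW)))))
  (c-∨ (c-∧ (c-R01 kP)(c-∼ (c-R01 kF)))
  (c-∨ (c-∧ (c-R01 kF)(c-∧ (c-R12 kP)(c-∧ (c-∼ (c-R02 kF))(c-∼ (c-R02 kW)))))
  (c-∨ (c-⋁ pN (c-when (W.p-bad x0)(c-∧ (c-R01 (k5 (wk p-start)))(c-∧ (c-R12 kF)(c-R02 (k5 x0))))))
  (c-∨ (c-∧ (c-R01 kL)(c-∼ (c-⋁ pN (c-R01 (k5 x0)))))
  (c-∨ (c-⋁ pN (c-when (p-not (x0 p== wk p-start))(c-∧ (c-R01 (k5 (wk p-start)))(c-R01 (k5 x0)))))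
   (c-∧ (c-R01 (k5 p-start))(c-∼ (c-R01 kL)))))))))))))
 c-equation : Prim n (\γ -> eqCode (L.equation γ))
 c-equation = p-ext (\γ -> eqCode-pr (L.lawful γ ∧ L.corner γ) ⊥)
  (p-pr (num (c-∧ (c-∼ (c-cyl zero (c-cyl 1F (c-cyl 2F c-violation))))(c-∧ (c-R01 kG)(c-∧ (c-R02 kG)(c-R12 (k5 p-start))))))(num c-⊥))

-- A finite model of the laws for an accepting program.
module _ (k : ℕ) where
 code : ∀ {l}-> Vec (Fin (suc k)) l -> ℕ
 code [] = 0
 code (x ∷ xs) = ix x + code xs * suc k
 uncode : ∀ l -> ℕ -> Vec (Fin (suc k)) l
 uncode zero i = []
 uncode (suc l) i = fromℕ< (m%n<n i (suc k)) ∷ uncode l (i / suc k)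
 code< : ∀ {l}(xs : Vec (Fin (suc k)) l)-> code xs < suc k ^ l
 code< [] = sl zl
 code< {suc l}(x ∷ xs) = subst (code (x ∷ xs) <_)(*-comm (suc k ^ l)(suc k))(≤-trans (+-monoˡ-< (code xs * suc k)(Fin.toℕ<n x))(*-monoˡ-≤ (suc k)(code< xs)))
 code-uncode : ∀ l i -> i < suc k ^ l -> code (uncode l i)~ i
 code-uncode zero i h = sym (n<1⇒n≡0 h)
 code-uncode (suc l) i h = cong2 (\x y -> x + y * suc k)(Fin.toℕ-fromℕ< _)(code-uncode l (i / suc k)(m<n*o⇒m/o<n (subst (i <_)(*-comm (suc k)(suc k ^ l)) h)))& sym (m≡m%n+[m/n]*n i (suc k))
 uncode-code : ∀ {l}(xs : Vec (Fin (suc k)) l)-> uncode l (code xs)~ xs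
 uncode-code [] = refl
 uncode-code {suc l}(x ∷ xs) = cong2 _∷_ (Fin.toℕ-injective (Fin.toℕ-fromℕ< _ & mod-dm k (ix x)(code xs)(Fin.toℕ<n x)))
  (cong (uncode l)(div-dm k (ix x)(code xs)(Fin.toℕ<n x))& uncode-code xs)
 -- the full set algebra on a finite set is finite
 finite-cm : (em : EM)(n : ℕ)-> FiniteAlg (ComplexAlgebra.cm em (Tuples.frame (Fin (suc k)) Fin._≟_ n))
 finite-cm em n = 2 ^ N , record
  { to = to; from = \i ->(\s -> bit (ix i)(code s)), (\ { refl -> refl })
  ; to-cong = \ {X}{Y} h -> Fin.toℕ-injective (Fin.toℕ-fromℕ< _ & fd-cong 1 N _ _ (\i _ -> cong b2n (h (uncode n i)))& sym (Fin.toℕ-fromℕ< _))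
  ; from-cong = \ { refl p -> refl }
  ; inverse = (\ {i}{X} h -> Fin.toℕ-injective (bit-ext N _ _ (Fin.toℕ<n (to X))(Fin.toℕ<n i) \j j< ->
   trans (cong (\z -> bit z j)(Fin.toℕ-fromℕ< _))(bit-bits N (\i -> fst X (uncode n i)) j j< & h (uncode n j)& cong (bit (ix i))(code-uncode n j j<)))) ,
   (\ { {X} refl s -> trans (cong (\z -> bit z (code s))(Fin.toℕ-fromℕ< _))(bit-bits N (\i -> fst X (uncode n i))(code s)(code< s)& cong (fst X)(uncode-code s)) }) }
  where
  N = suc k ^ n
  to : ComplexAlgebra.Elt em (Tuples.frame (Fin (suc k)) Fin._≟_ n)-> Fin (2 ^ N)
  to X = fromℕ< (bits< N (\i -> fst X (uncode n i)))

-- successor on {0,…,H}, constant at H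
next : ℕ -> ℕ -> ℕ
next H i = if i << H then suc i else i

at-H : ∀ {H i}-> i ≤ H ->(i << H)~ false -> i ~ H
at-H {H}{i} h e = [ (\l -> case trans (sym (<<+ l)) e of \()), id ]′ (m≤n⇒m<n∨m≡n h)

next≤ : ∀ {H i}-> i ≤ H -> next H i ≤ H
next≤ {H}{i} h with i << H in e
... | true = <<- e
... | false = h

-- a tiling of the quarter plane whose rows and columns are constant from H on
record Closing (TS : Tiles) : Set where
 open Tiles TS
 field
  H : ℕ
  tAt : ℕ -> ℕ -> ℕ
  tileAt< : ∀ i j -> tAt i j < N
  hor-next : ∀ i j -> i ≤ H -> j ≤ H -> hor (tAt i j)(tAt (next H i) j) !
  ver-next : ∀ i j -> j ≤ H -> ver (tAt i j)(tAt i (next H j)) !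
  origin : tAt 0 0 ~ start
  only : ∀ i j -> tAt i j ~ start -> i ~ 0 × j ~ 0
  good : ∀ j -> bad (tAt 0 j)~ false

module Accepting (b C J : ℕ)(accept : Program.st b C J ~ 2) where
 open Program b C
 open Tiling prog sound hiding (st; val; zb)
 TS : Tiles
 TS = tilesOf b C
 open Tiles TS
 -- the tiling closes up at H
 H : ℕ
 H = suc J
 private
  val<H : ∀ j r -> j ≤ H -> val j r < H
  val<H j r h = go (m≤n⇒m<n∨m≡n h)
   where
   go : j < H ⊎ j ~ H -> val j r < H
   go (inl l) = sl (≤-trans (val≤ j r)(≤-pred l))
   go (inr e) = sl (subst (_≤ J)(sym (cong (\j -> val j r) e & still J accept r))(val≤ J r))
  st-H : st H ~ 2
  st-H = stay 2 (inr refl) J 1 accept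
  no-1 : ∀ j -> st j # 1
  no-1 j e = case trans (sym (stay 1 (inl refl) j J e))(cong st (+-comm J j)& stay 2 (inr refl) J j accept) of \()
 private
  hor-to : ∀ x {t u}-> t ~ u -> hor x t ! -> hor x u !
  hor-to x refl h = h
  ver-to : ∀ x {t u}-> t ~ u -> ver x t ! -> ver x u !
  ver-to x refl h = h
 hor-next' : ∀ i j -> i ≤ H -> j ≤ H -> hor (tAt i j)(tAt (next H i) j) !
 hor-next' i j hi hj with i << H in e
 ... | true = honest-hor i j
 ... | false = hor-to (tAt i j) same (honest-hor i j)
  where
  lt : ∀ r -> val j r < i
  lt r = subst (val j r <_)(sym (at-H hi e))(val<H j r hj)
  same : tAt (suc i) j ~ tAt i j
  same = enc-cong {st j}{st j}{zb j}{zb j}{\r -> cmp (suc i)(val j r)}{\r -> cmp i (val j r)} refl refl (\r _ ->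
   trans (cmp-above (m<n⇒m<1+n (lt r)))(sym (cmp-above (lt r))))
 ver-next' : ∀ i j -> j ≤ H -> ver (tAt i j)(tAt i (next H j)) !
 ver-next' i j hj with j << H in e
 ... | true = honest-ver i j
 ... | false = ver-to (tAt i j) same (honest-ver i j)
  where
  stj : st j ~ 2
  stj = cong st (at-H hj e)& st-H
  st' : st (suc j)~ 2
  st' = stay 2 (inr refl) j 1 stj
  same : tAt i (suc j)~ tAt i j
  same = enc-cong {st (suc j)}{st j}{zb (suc j)}{zb j}{\r -> cmp i (val (suc j) r)}{\r -> cmp i (val j r)}
   (st' & sym stj)(cong (\q -> val (suc j)(Machine.test prog q) == 0) st' & cong (_== 0)(still j stj _)& sym (cong (\q -> val j (Machine.test prog q) == 0) stj))
   (\r _ -> cong (cmp i)(still j stj r))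
 closing : Closing TS
 closing = record { H = H; tAt = tAt; tileAt< = tileAt<; hor-next = hor-next'; ver-next = ver-next'
  ; origin = refl; only = start-only; good = \j -> honest-bad j (no-1 j) }

idEmbedding : ∀ {n}(A : Alg n 0ℓ 0ℓ)-> Embedding A A
idEmbedding A = record { to = id; cong = id; injective = id; ∨-homo = \_ _ -> ~refl; ∧-homo = \_ _ -> ~refl; ∼-homo = \_ -> ~refl
 ; ⊤-homo = ~refl; ⊥-homo = ~refl; cyl-homo = \_ _ -> ~refl; diag-homo = \_ _ -> ~refl }
 where open Alg A using () renaming (refl to ~refl)

refutes : (𝒱 : Pred (Alg 3 0ℓ 0ℓ) (lsuc 0ℓ))(e : Equation 3)(A : Alg 3 0ℓ 0ℓ)-> 𝒱 A -> ∀ ρ -> ¬ Alg._≈_ A (eval A ρ (fst e))(eval A ρ (snd e))-> ¬ EqTheory 𝒱 e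
refutes 𝒱 e A a ρ f v = f (v A a ρ)

module Countermodel (em : EM)(TS : Tiles)(cl : Closing TS)(m : ℕ) where
 open Classical em
 open Tiles TS
 open LawTerms TS
 open Closing cl
 -- the points: one world, and two chains of points
 data Role : Set where
  rz : Role
  rx ry : (i : ℕ)-> i ≤ H -> Role
 bump : Role -> Role
 bump rz = rz
 bump (rx i h) = rx (next H i)(next≤ h)
 bump (ry j h) = ry (next H j)(next≤ h)
 role : ℕ -> Role
 role 0 = rz
 role 1 = rx 0 zl
 role 2 = ry 0 zl
 role (suc (suc (suc n))) = bump (role (suc n))
 rl : ℕ -> Role -> Role -> Bool
 rl 0 rz (rx _ _) = true
 rl 0 rz (ry _ _) = true
 rl 1 (rx i _)(rx i' _) = i' == next H i
 rl 1 (ry j _)(ry j' _) = j' == next H j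
 rl 2 (rx i _)(rx i' _) = true
 rl 2 (ry j _)(ry j' _) = (j << j') || ((j == H) && (j' == H))
 rl 4 (rx _ _)(ry _ _) = true
 rl (suc (suc (suc (suc (suc t)))))(rx i _)(ry j _) = t == tAt i j
 rl _ _ _ = false
 K n : ℕ
 K = 3 + 2 * H
 n = 6 + m
 M : Set
 M = Fin K
 open Tuples M Fin._≟_ n
 open ComplexAlgebra em frame
 A : Alg 3 0ℓ 0ℓ
 A = Nr (m≤m+n 3 (3 + m)) cmCA
 ro : M -> Role
 ro a = role (ix a)
 private
  c0 c1 c2 : Fin n
  c0 = zero
  c1 = suc zero
  c2 = suc 1F
 ρ : ℕ -> Alg.Carrier A
 ρ k = (X , \ { refl -> refl }), \ { zero (); 1F (sl ()); 2F (sl (sl ())); (suc (suc (suc i))) _ s -> bext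
  (\h -> let q , e , x = tr- h in trans (cong2 (\u v -> rl k (ro u)(ro v))(e c0 (\()))(e c1 (\()))) x)(\h -> tr+ (s , (\_ _ -> refl), h)) }
  where
  X : Vec M n -> Bool
  X s = rl k (ro (look s c0))(ro (look s c1))
 sem : T3' -> Vec M n -> Bool
 sem t s = fst (fst (eval A ρ t)) s
 module _ (k : ℕ) where
  sem01 : ∀ s -> sem (R01 k) s ~ rl k (ro (look s c0))(ro (look s c1))
  sem01 s = bext (\h -> let q , e , x = tr- h in trans (cong2 (\u v -> rl k (ro u)(ro v))(e c0 (\()))(e c1 (\()))) x)(\h -> tr+ (s , (\_ _ -> refl), h))
  sem02 : ∀ s -> sem (R02 k) s ~ rl k (ro (look s c0))(ro (look s c2))
  sem02 s = bext
   (\h -> let q , e , x = tr- h; d , y = &- {tr (look q c1 ~ look q c2)} x in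
    trans (cong2 (\u v -> rl k (ro u)(ro v))(e c0 (\()))(e c2 (\())& sym (tr- d)))(sym (sem01 q)& y))
   (\h -> let q = s [ c1 ]≔ look s c2; q1 = upd-at s c1 (look s c2) in
    tr+ (q , (\l ne -> sym (upd s c1 (look s c2) l ne)), &+ (tr+ (q1 & sym (upd s c1 (look s c2) c2 (\()))))
     (sem01 q & cong2 (\u v -> rl k (ro u)(ro v))(upd s c1 (look s c2) c0 (\())) q1 & h)))
  sem12 : ∀ s -> sem (R12 k) s ~ rl k (ro (look s c1))(ro (look s c2))
  sem12 s = bext
   (\h -> let q , e , x = tr- h; d , y = &- {tr (look q c0 ~ look q c1)} x in
    trans (cong2 (\u v -> rl k (ro u)(ro v))(e c1 (\())& sym (tr- d))(e c2 (\())))(sym (sem02 q)& y))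
   (\h -> let b' = look s c1; q = s [ c0 ]≔ b'; q0 = upd-at s c0 b' in
    tr+ (q , (\l ne -> sym (upd s c0 b' l ne)), &+ (tr+ (q0 & sym (upd s c0 b' c1 (\()))))
     (sem02 q & cong2 (\u v -> rl k (ro u)(ro v)) q0 (upd s c0 b' c2 (\()))& h)))
 private
  l-succ : ∀ x y -> rl vG x y ! -> ∃[ w' ] (rl vG x w' ! × rl vP y w' ! × w' ~ bump y)
  l-succ rz (rx i h) e = rx (next H i)(next≤ h), refl , ==-refl (next H i), refl
  l-succ rz (ry j h) e = ry (next H j)(next≤ h), refl , ==-refl (next H j), refl
  l-hor : ∀ x y c t u -> rl vP x y ! -> rl (vT t) x c ! -> rl (vT u) y c ! -> hor t u !
  l-hor (rx i h)(rx i' h')(ry j g) t u p q r with ==- {i'} p | ==- {t} q | ==- {u} r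
  ... | refl | refl | refl = hor-next i j h g
  l-hort : ∀ x y c -> rl vP x y ! -> rl vL x c ! -> rl vL y c !
  l-hort (rx i h)(rx i' h')(ry j g) p q = refl
  l-ver : ∀ x y c t u -> rl (vT t) x y ! -> rl vP y c ! -> rl (vT u) x c ! -> ver t u !
  l-ver (rx i h)(ry j g)(ry j' g') t u p q r with ==- {j'} q | ==- {t} p | ==- {u} r
  ... | refl | refl | refl = ver-next i j g
  l-vert : ∀ x y c -> rl vL x y ! -> rl vP y c ! -> rl vL x c !
  l-vert (rx i h)(ry j g)(ry j' g') p q = refl
  l-pf : ∀ x y -> rl vP x y ! -> rl vF x y !
  l-pf (rx i h)(rx i' h') p = refl
  l-pf (ry j h)(ry j' h') p with ==- {j'} p
  ... | refl with j << H in e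
  ... | true = cong (_|| ((j == H) && (suc j == H)))(<<+ (n<1+n j))& refl
  ... | false = cong2 _||_ (refl {x = j << j})(&+ (==+ (at-H h e))(==+ (at-H h e)))& Bool.∨-zeroʳ _
  l-ff : ∀ x y c -> rl vF x y ! -> rl vP y c ! -> rl vF x c !
  l-ff (rx i h)(rx i' h')(rx i'' h'') p q = refl
  l-ff (ry j h)(ry j' h')(ry j'' h'') p q with ==- {j''} q
  ... | refl with j << j' in e | j' << H in e'
  ... | true | true = cong (_|| ((j == H) && (suc j' == H)))(<<+ (m<n⇒m<1+n (<<- {j} e)))
  ... | true | false = cong (_|| ((j == H) && (j' == H))) e
  ... | false | true = case trans (sym (<<-irr (==- {j'}(snd (&- {j == H} p))))) e' of \()
   where
   <<-irr : ∀ {i}-> i ~ H ->(i << H)~ false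
   <<-irr {i} refl with H << H in q
   ... | false = refl
   ... | true = efq (<-irrefl refl (<<- {H} q))
  ... | false | false = cong (_|| ((j == H) && (j' == H))) e & p
  l-bad : ∀ x y c t -> rl (vT start) x y ! -> rl vF y c ! -> rl (vT t) x c ! -> bad t ~ false
  l-bad (rx i h)(ry j g)(ry j' g') t p q r with only i j (sym (==- {start} p)) | ==- {t} r
  ... | refl , refl | refl = good j'
  l-til : ∀ x y -> rl vL x y ! -> ∃[ t ] (t < N × rl (vT t) x y !)
  l-til (rx i h)(ry j g) e = tAt i j , tileAt< i j , ==-refl (tAt i j)
  l-st : ∀ x y t -> rl (vT start) x y ! -> rl (vT t) x y ! -> t ~ start
  l-st (rx i h)(ry j g) t p q = ==- {t} q & sym (==- {start} p)
  l-stl : ∀ x y -> rl (vT start) x y ! -> rl vL x y !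
  l-stl (rx i h)(ry j g) p = refl
  w-empty : ∀ x y -> rl vW x y ! -> Empty
  w-empty rz y ()
  w-empty (rx _ _) y ()
  w-empty (ry _ _) y ()
  -- every successor is the role of a point
  next-H : next H H ~ H
  next-H with H << H in e
  ... | true = efq (<-irrefl refl (<<- {H} e))
  ... | false = refl
  next-< : ∀ {i}-> i < H -> next H i ~ suc i
  next-< {i} l = cong (\c -> if c then suc i else i)(<<+ l)
  rx≡ : ∀ {i j}(e : i ~ j){h : i ≤ H}{h' : j ≤ H}-> rx i h ~ rx j h'
  rx≡ refl = cong (rx _)(≤-irrelevant _ _)
  ry≡ : ∀ {i j}(e : i ~ j){h : i ≤ H}{h' : j ≤ H}-> ry i h ~ ry j h'
  ry≡ refl = cong (ry _)(≤-irrelevant _ _)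
  role-x : ∀ i (h : i ≤ H)-> role (1 + i * 2)~ rx i h
  role-x zero h = rx≡ refl
  role-x (suc i) h = cong bump (role-x i (<⇒≤ h))& rx≡ (next-< h)
  role-y : ∀ i (h : i ≤ H)-> role (2 + i * 2)~ ry i h
  role-y zero h = ry≡ refl
  role-y (suc i) h = cong bump (role-y i (<⇒≤ h))& ry≡ (next-< h)
  last-bump : ∀ v -> v < K -> ¬ (2 + v < K)-> bump (role v)~ role v
  last-bump v l g = go (m≤n⇒m<n∨m≡n (≤-pred (≤-pred (ℕ.≮⇒≥ g))))
   where
   go : 1 + 2 * H < v ⊎ 1 + 2 * H ~ v -> bump (role v)~ role v
   go (inr e) = trans (cong bump r)(rx≡ next-H & sym r)
    where
    r = cong role (sym e & cong suc (*-comm 2 H))& role-x H ≤-refl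
   go (inl a) = trans (cong bump r)(ry≡ next-H & sym r)
    where
    r = cong role (≤-antisym (≤-pred l) a & cong (\x -> suc (suc x))(*-comm 2 H))& role-y H ≤-refl
  bump-point : ∀ (a : M)-> ∃[ c ] (ro c ~ bump (ro a))
  bump-point zero = zero , refl
  bump-point (suc a) with (2 + ix (suc a)) ℕ.<? K
  ... | yes l = fromℕ< l , cong role (Fin.toℕ-fromℕ< l)
  ... | no g = suc a , sym (last-bump (ix (suc a))(Fin.toℕ<n (suc a)) g)
 laws : Lawful TS
 laws = record
  { S = Vec M n; E = Role × Role; sem = sem; rl = \k (x , y)-> rl k x y
  ; p01 = \s -> ro (look s c0), ro (look s c1); p02 = \s -> ro (look s c0), ro (look s c2); p12 = \s -> ro (look s c1), ro (look s c2)
  ; sem-∨ = \_ _ _ -> refl; sem-∧ = \_ _ _ -> refl; sem-∼ = \_ _ -> refl; sem-⊥ = \_ -> refl; sem01 = sem01; sem02 = sem02; sem12 = sem12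
  ; l-suc = \s h -> let w' , p , q , e = l-succ (ro (look s c0))(ro (look s c1)) h
                        c , ec = bump-point (look s c1)
                        s' = s [ c2 ]≔ c
                        rc = trans (cong ro (upd-at s c2 c))(ec & sym e)
                        s0 = upd s c2 c c0 (\())
                        s1 = upd s c2 c c1 (\())
   in tr+ (s' , (\l ne -> sym (upd s c2 c l ne)) ,
    &+ (sem02 vG s' & cong2 (rl vG)(cong ro s0) rc & p)(sem12 vP s' & cong2 (rl vP)(cong ro s1) rc & q))
  ; l-inw = \s _ _ -> w-empty (ro (look s c1))(ro (look s c2))
  ; l-hor = \s t u -> l-hor (ro (look s c0))(ro (look s c1))(ro (look s c2)) t u; l-hort = \s p q -> inl (l-hort (ro (look s c0))(ro (look s c1))(ro (look s c2)) p q)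
  ; l-ver = \s t u -> l-ver (ro (look s c0))(ro (look s c1))(ro (look s c2)) t u; l-vert = \s p q -> inl (l-vert (ro (look s c0))(ro (look s c1))(ro (look s c2)) p q)
  ; l-pf = \s -> l-pf (ro (look s c0))(ro (look s c1)); l-ff = \s p q -> inl (l-ff (ro (look s c0))(ro (look s c1))(ro (look s c2)) p q)
  ; l-bad = \s t -> l-bad (ro (look s c0))(ro (look s c1))(ro (look s c2)) t; l-til = \s -> l-til (ro (look s c0))(ro (look s c1)); l-st = \s t -> l-st (ro (look s c0))(ro (look s c1)) t; l-stl = \s -> l-stl (ro (look s c0))(ro (look s c1)) }
 private
  not-true : ∀ {x}->(x ! -> Empty)-> not x !
  not-true {true} f = efq (f refl)
  not-true {false} f = refl
 fails : ¬ (Alg._≈_ A (eval A ρ (fst equation))(eval A ρ (snd equation)))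
 fails h = case trans (sym (h σ))(&+ law (&+ (sem01 vG σ)(&+ (sem02 vG σ)(sem12 (vT start) σ & cong (start ==_) origin & ==-refl start)))) of \()
  where
  σ : Vec M n
  σ = zero ∷ suc zero ∷ suc 1F ∷ Vec.replicate _ zero
  law : sem lawful σ !
  down : ∀ i t s -> sem (cyl i t) s ! -> ∃[ q ] sem t q !
  down i t s h = let q , _ , k = tr- {Σ (Vec M n) \q -> _ × sem t q !} h in q , k
  law = not-true \h -> let a , x = down zero (cyl 1F (cyl 2F violation)) σ h; b , y = down 1F (cyl 2F violation) a x; c , z = down 2F violation b y in Lawful.never (Lawful.never-violation laws) c z
 invalid : ∀ 𝒦 ->(∀ {B}-> FiniteCA n B -> 𝒦 B)-> ¬ EqTheory (SNr (m≤m+n 3 (3 + m)) 𝒦) equation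
 invalid 𝒦 f = refutes (SNr (m≤m+n 3 (3 + m)) 𝒦) equation A (cmCA , f (lift (finite-cm (2 + 2 * H) em n)), idEmbedding A) ρ fails

-- The equational theories are undecidable.
module EquationalTheory (em : EM)(m : ℕ)(𝒦 : Pred (CA (6 + m) 0ℓ 0ℓ)(lsuc 0ℓ))(fin⊆ : ∀ {B}-> FiniteCA (6 + m) B -> 𝒦 B)
 (dec : DecidableEqTheory (SNr (m≤m+n 3 (3 + m)) 𝒦)) where
 private
  f = fst dec
  𝒱 = SNr (m≤m+n 3 (3 + m)) 𝒦
  equ : ℕ -> ℕ -> Equation 3
  equ b C = LawTerms.equation (tilesOf b C)
  -- the outcome, plus one, of s steps of deciding the equation of a program
  d : ℕ -> ℕ -> ℕ -> ℕ
  d b C s = ev f s (eqCode (equ b C) ∷ [])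
  pd : Prim 3 (\ { (((_ , b), C), s)-> d b C s })
  pd = p-ev f ((_ , c-equation (wk (wk x0))(wk x0)) ∷ []) x0
  -- the least positive value is the outcome
  outcome : ∀ b C y -> f [ codeEquation (equ b C) ∷ [] ]⇓ y -> ∃[ t ] (d b C t ~ suc y × ∀ s -> s < t -> d b C s ~ 0)
  outcome b C y h = let s0 , late = ev-complete {p = f}{eqCode (equ b C) ∷ []} h'
                        t , n , below = least (d b C) s0 (\z -> case trans (sym (late s0 ≤-refl)) z of \())
                        x , e = pos n
                        s1 , late1 = ev-complete (ev-sound f t _ e)
   in t , trans e (sym (late1 (s0 + s1)(m≤n+m s1 s0))& late (s0 + s1)(m≤m+n s0 s1)), below
   where
   h' : f [ eqCode (equ b C) ∷ [] ]⇓ y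
   h' = subst (\c -> f [ c ∷ [] ]⇓ y)(sym (eqCode≡ (equ b C))) h
   pos : ∀ {x}-> x # 0 -> ∃[ r ] (x ~ suc r)
   pos {zero} q = efq (q refl)
   pos {suc r} q = r , refl
  accepted : ∀ b C J -> Program.st b C J ~ 2 -> ¬ EqTheory 𝒱 (equ b C)
  accepted b C J a = Countermodel.invalid em (tilesOf b C)(Accepting.closing b C J a) m 𝒦 fin⊆
  rejected-valid : ∀ b C j -> Program.st b C (suc j)~ 1 -> EqTheory 𝒱 (equ b C)
  rejected-valid b C j r A (B , _ , e) ρ = decide (em 0ℓ)
   where
   open Verdict em b C
   module S = FromEquation (tilesOf b C){A}{m}{B}(neat-hom B e) ρ
   decide : Dec (Alg._≈_ A (eval A ρ (fst (equ b C)))(Alg.⊥ A))-> Alg._≈_ A (eval A ρ (fst (equ b C)))(Alg.⊥ A)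
   decide (yes p) = p
   decide (no n) = efq (not-rejecting {m}{B}(S.system (\z -> n (Embedding.injective e
    (Alg.trans (CA.alg B) z (Alg.sym (CA.alg B)(Embedding.⊥-homo e)))))) j r)
  decide : ∀ b C -> Searches d b C -> Dec (EqTheory 𝒱 (equ b C))-> Empty
  decide b C sr (yes v) = let t , e , h = outcome b C 1 (fst (snd dec (equ b C)) v); J , a = Searches.accepts sr t 0 h e in accepted b C J a v
  decide b C sr (no n) = let t , e , h = outcome b C 0 (snd (snd dec (equ b C)) n); j , r = Searches.rejects sr t h e in n (rejected-valid b C j r)
 absurd : Empty
 absurd = let b , C , sr = searcher d pd in decide b C sr (em _)

corollary7p9 :
    (∀ ℓ → ExcludedMiddle ℓ) →
    (n : ℕ) (6≤n : 6 ≤ n) →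
    let 3≤n = ≤-trans (m≤m+n 3 3) 6≤n
        SNr₃CA = SNr 3≤n (AllCA n)
        SNr₃CA∩Fin = SNr 3≤n (FiniteCA n)
    in ¬ REIsoTypes (λ A → FiniteAlg A × SNr₃CA A × OnlyInfiniteFlatReps n A)
     × ¬ DecidableEqTheory SNr₃CA
     × ¬ DecidableEqTheory SNr₃CA∩Fin
     × (∀ m → ¬ FinitelyAxiomatizable m SNr₃CA)
     × (∃[ A ] (FiniteAlg A × SNr₃CA A × ¬ HasFiniteHyperbasis A n 3≤n))
corollary7p9 em n 6≤n with ℕ.m≤n⇒∃[o]m+o≡n 6≤n
... | m , refl =
 Algebras.NotRE.absurd em m
 , EquationalTheory.absurd em m _ (\_ -> lift tt)
 , EquationalTheory.absurd em m _ id
 , (\r ax -> TruthPrim.NotAxiomatizable.absurd em m r ax)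
 -- the search for a positive value of the zero function never stops
 , let b , C , sr = searcher (\_ _ _ -> 0) p-zero
       module X = Algebras.Endless em b C m (Searches.diverges sr (\_ -> refl))
  in X.algA , X.finite , X.member , X.no-hyperbasis
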